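{- For every $\alpha>0$ there exists a constant $\beta>0$ such that every cubic bridgeless graph with $n$ vertices has at least $\alpha n-\beta$ perfect matchings.
   Context: Graphs are finite and may have parallel edges (multigraphs); a cubic graph is one in which every vertex has degree three. Perfect matchings are counted as sets of edges (parallel edges are distinct edges). -}

module Defs where

open import Data.Nat using (ℕ; zero; suc)
open import Data.Fin using (Fin; _≟_)
open import Data.Fin.Subset using (Subset; _∈_)
open import Data.Fin.Subset.Properties using (_∈?_)
open import Data.Fin.Properties using (all?)
open import Data.List using (List; []; _∷_; _++_; map; filter; length; allFin)
open import Data.Vec using (Vec; []; _∷_)
open import Data.Bool using (Bool; true; false)
open import Data.Product using (_×_; _,_; proj₁; proj₂)
open import Data.Sum using (_⊎_)
open import Relation.Binary.PropositionalEquality using (_≡_; _≢_)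
open import Relation.Nullary using (Dec; ¬_)
open import Relation.Nullary.Decidable using (_⊎-dec_; _×-dec_)
open import Data.Nat.Properties using () renaming (_≟_ to _≟ℕ_)

-- A finite loopless multigraph with vertex set Fin n and edge set Fin m.
-- Each edge has two (distinct) endpoints; parallel edges are allowed,
-- since distinct edge indices may have the same endpoints.
record Multigraph (n m : ℕ) : Set where
  field
    ends     : Fin m → Fin n × Fin n
    loopless : ∀ e → proj₁ (ends e) ≢ proj₂ (ends e)
open Multigraph public

module _ {n m : ℕ} (G : Multigraph n m) where

  Incident : Fin n → Fin m → Set
  Incident v e = (v ≡ proj₁ (ends G e)) ⊎ (v ≡ proj₂ (ends G e))

  incident? : ∀ v e → Dec (Incident v e)
  incident? v e = (v ≟ proj₁ (ends G e)) ⊎-dec (v ≟ proj₂ (ends G e))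

  degree : Fin n → ℕ
  degree v = length (filter (incident? v) (allFin m))

  Cubic : Set
  Cubic = ∀ v → degree v ≡ 3

  data ConnectedAvoiding (e : Fin m) : Fin n → Fin n → Set where
    here : ∀ {u} → ConnectedAvoiding e u u
    step : ∀ {u w} (f : Fin m) → f ≢ e →
           ((u ≡ proj₁ (ends G f)) × (w ≡ proj₂ (ends G f)))
             ⊎ ((u ≡ proj₂ (ends G f)) × (w ≡ proj₁ (ends G f))) →
           ∀ {v} → ConnectedAvoiding e w v → ConnectedAvoiding e u v

  -- e is a bridge iff deleting it disconnects its endpoints
  -- (equivalently, increases the number of connected components)
  IsBridge : Fin m → Set
  IsBridge e = ¬ ConnectedAvoiding e (proj₁ (ends G e)) (proj₂ (ends G e))

  Bridgeless : Set
  Bridgeless = ∀ e → ¬ IsBridge e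

  degreeIn : Subset m → Fin n → ℕ
  degreeIn M v = length (filter (λ e → (e ∈? M) ×-dec incident? v e) (allFin m))

  IsPerfectMatching : Subset m → Set
  IsPerfectMatching M = ∀ v → degreeIn M v ≡ 1

  isPerfectMatching? : ∀ M → Dec (IsPerfectMatching M)
  isPerfectMatching? M = all? (λ v → degreeIn M v ≟ℕ 1)

allSubsets : (m : ℕ) → List (Subset m)
allSubsets zero    = [] ∷ []
allSubsets (suc m) = map (true ∷_) (allSubsets m) ++ map (false ∷_) (allSubsets m)

numPerfectMatchings : ∀ {n m} → Multigraph n m → ℕ
numPerfectMatchings {n} {m} G = length (filter (isPerfectMatching? G) (allSubsets m))

{-# OPTIONS --safe #-}
module Submission where

-- Perfect matchings are counted as a sum over all Boolean labellings of the edges of a product of vertex weights. A 3-edge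
-- cut splits this sum as a scalar product, so one side can be contracted to a single weighted vertex without increasing it.
-- If there is no non-trivial 3-edge cut, Voorhoeve's reduction at an edge e gives 3 φ(G) = Σ φ(Gᵢ) over four smaller graphs,
-- φ being the number of perfect matchings avoiding e. The 3-edge cuts of Gᵢ are nested around its new vertex; contracting
-- them one by one makes a potential grow, so that a linear bound for the contracted pieces carries over to Gᵢ almost without
-- loss, and the factor 4/3 multiplies the slope by 5/4. The potential stalls only along a ladder, which survives in G and
-- alone forces exponentially many perfect matchings. Iterating, φ is superlinear. For the general case contract innermost
-- sides of 3-edge cuts: a side without further cuts contributes superlinearly many perfect matchings, while three vertices
-- merge into one weighted vertex, whose total weight eventually outgrows the number of vertices it stands for.

module Development where

  open import Data.Nat
  open import Data.Nat.Properties
  open import Data.Nat.Tactic.RingSolver using (solve-∀)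
  open import Data.Bool using (Bool; true; false; if_then_else_; not)
  open import Data.List using (List; []; _∷_; _++_; map; length)
  open import Data.List.Properties using (map-++; length-map; length-++; ∷-injectiveˡ; ∷-injectiveʳ)
  open import Data.List.Membership.Propositional using (_∈_; _∉_; find; lose)
  open import Data.List.Membership.Propositional.Properties using (∈-∃++; ∈-++⁻; ∈-++⁺ˡ; ∈-++⁺ʳ; ∈-map⁺; ∈-map⁻)
  open import Data.List.Relation.Unary.Any using (here; there; any?)
  open import Data.List.Relation.Binary.Permutation.Propositional renaming (refl to prefl; trans to ptrans; swap to pswap)
  open import Data.List.Relation.Binary.Permutation.Propositional.Properties hiding (sum-↭)
  open import Data.Product using (Σ; ∃-syntax; _×_; _,_; proj₁; proj₂)
  open import Data.Sum using (_⊎_; inj₁; inj₂; [_,_]′)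
  open import Data.Empty using (⊥; ⊥-elim)
  open import Relation.Nullary using (¬_; Dec; yes; no; does)
  open import Relation.Nullary.Decidable using (_×-dec_)
  open import Relation.Binary.PropositionalEquality
  open import Function using (_∘_; id; case_of_)

  -- Sums over Boolean assignments

  ≤-cancel : ∀ {a b l r} k → a ≤ b → l + b + k ≡ r + a → l ≤ r
  ≤-cancel {a} {b} {l} {r} k p e = +-cancelʳ-≤ b l r
    (≤-trans (m≤m+n (l + b) k) (≤-trans (≤-reflexive e) (+-monoʳ-≤ r p)))

  eqL : (m l : ℕ) → m ≡ l ⊎ m ≢ l
  eqL zero zero = inj₁ refl
  eqL zero (suc l) = inj₂ λ ()
  eqL (suc m) zero = inj₂ λ ()
  eqL (suc m) (suc l) with eqL m l
  ... | inj₁ e = inj₁ (cong suc e)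
  ... | inj₂ ne = inj₂ (ne ∘ suc-injective)

  ifE : {A : Set} {P Q : Set} → P ⊎ Q → A → A → A
  ifE (inj₁ _) x y = x
  ifE (inj₂ _) x y = y

  half-pos : ∀ {c} → 1 ≤ c + c → 1 ≤ c
  half-pos {suc c} _ = s≤s z≤n

  mid4 : ∀ a b c d → a + b + (c + d) ≡ a + c + (b + d)
  mid4 = solve-∀

  Asg : Set
  Asg = ℕ → Bool

  upd : Asg → ℕ → Bool → Asg
  upd σ l b m = ifE (eqL m l) b (σ m)

  upd-same : ∀ σ l b → upd σ l b l ≡ b
  upd-same σ l b with eqL l l
  ... | inj₁ _ = refl
  ... | inj₂ ne = ⊥-elim (ne refl)

  upd-diff : ∀ σ {l m} b → m ≢ l → upd σ l b m ≡ σ m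
  upd-diff σ {l} {m} b ne with eqL m l
  ... | inj₁ e = ⊥-elim (ne e)
  ... | inj₂ _ = refl

  Agree : List ℕ → Asg → Asg → Set
  Agree A σ τ = ∀ l → l ∈ A → σ l ≡ τ l

  Dep : List ℕ → (Asg → ℕ) → Set
  Dep A F = ∀ σ τ → Agree A σ τ → F σ ≡ F τ

  sumOver : List ℕ → (Asg → ℕ) → Asg → ℕ
  sumOver [] F σ = F σ
  sumOver (l ∷ L) F σ = sumOver L F (upd σ l true) + sumOver L F (upd σ l false)

  sum-dep : ∀ L {A F} → Dep A F → ∀ σ τ → (∀ l → l ∈ A → l ∉ L → σ l ≡ τ l) →
    sumOver L F σ ≡ sumOver L F τ
  sum-dep [] d σ τ ag = d σ τ (λ l m → ag l m λ ())
  sum-dep (l ∷ L) {A} d σ τ ag = cong₂ _+_ (sum-dep L d _ _ (go true)) (sum-dep L d _ _ (go false))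
    where
    go : ∀ b m → m ∈ A → m ∉ L → upd σ l b m ≡ upd τ l b m
    go b m m∈ m∉ with eqL m l
    ... | inj₁ _ = refl
    ... | inj₂ ne = ag m m∈ λ { (here e) → ne e ; (there h) → m∉ h }

  sum-Dep : ∀ L {A F} → Dep A F → Dep A (sumOver L F)
  sum-Dep L d σ τ ag = sum-dep L d σ τ (λ l m _ → ag l m)

  sum-cong : ∀ L {F H} → (∀ σ → F σ ≡ H σ) → ∀ σ → sumOver L F σ ≡ sumOver L H σ
  sum-cong [] e σ = e σ
  sum-cong (l ∷ L) e σ = cong₂ _+_ (sum-cong L e _) (sum-cong L e _)

  sum-mono : ∀ L {F H} → (∀ σ → F σ ≤ H σ) → ∀ σ → sumOver L F σ ≤ sumOver L H σ
  sum-mono [] e σ = e σ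
  sum-mono (l ∷ L) e σ = +-mono-≤ (sum-mono L e _) (sum-mono L e _)

  sum-+ : ∀ L F H σ → sumOver L (λ τ → F τ + H τ) σ ≡ sumOver L F σ + sumOver L H σ
  sum-+ [] F H σ = refl
  sum-+ (l ∷ L) F H σ rewrite sum-+ L F H (upd σ l true) | sum-+ L F H (upd σ l false) =
    mid4 (sumOver L F (upd σ l true)) (sumOver L H (upd σ l true)) (sumOver L F (upd σ l false)) _

  sum-zero : ∀ L {F} → (∀ σ → F σ ≡ 0) → ∀ σ → sumOver L F σ ≡ 0
  sum-zero [] e σ = e σ
  sum-zero (l ∷ L) e σ = cong₂ _+_ (sum-zero L e _) (sum-zero L e _)

  upd-agree : ∀ σ l b A → l ∉ A → Agree A (upd σ l b) σ
  upd-agree σ l b A l∉ m m∈ = upd-diff σ b λ { refl → l∉ m∈ }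

  sum-mulʳ : ∀ L {A F H} → Dep A H → (∀ {l} → l ∈ L → l ∉ A) → ∀ σ →
    sumOver L (λ τ → F τ * H τ) σ ≡ sumOver L F σ * H σ
  sum-mulʳ [] d dis σ = refl
  sum-mulʳ (l ∷ L) {A} {F} {H} d dis σ
    rewrite sum-mulʳ L {F = F} d (dis ∘ there) (upd σ l true)
          | sum-mulʳ L {F = F} d (dis ∘ there) (upd σ l false)
          | d _ _ (upd-agree σ l true A (dis (here refl)))
          | d _ _ (upd-agree σ l false A (dis (here refl)))
    = sym (*-distribʳ-+ (H σ) (sumOver L F (upd σ l true)) _)

  sum-mulˡ : ∀ L {A F H} → Dep A H → (∀ {l} → l ∈ L → l ∉ A) → ∀ σ →
    sumOver L (λ τ → H τ * F τ) σ ≡ H σ * sumOver L F σ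
  sum-mulˡ L {F = F} {H} d dis σ = trans (sum-cong L (λ τ → *-comm (H τ) (F τ)) σ)
    (trans (sum-mulʳ L d dis σ) (*-comm _ (H σ)))

  sum-++ : ∀ L M F σ → sumOver (L ++ M) F σ ≡ sumOver L (sumOver M F) σ
  sum-++ [] M F σ = refl
  sum-++ (l ∷ L) M F σ = cong₂ _+_ (sum-++ L M F _) (sum-++ L M F _)

  sum-↭ : ∀ {L M A F} → Dep A F → L ↭ M → ∀ σ → sumOver L F σ ≡ sumOver M F σ
  sum-↭ d prefl σ = refl
  sum-↭ d (prep x p) σ = cong₂ _+_ (sum-↭ d p _) (sum-↭ d p _)
  sum-↭ {x ∷ y ∷ L} {_ ∷ _ ∷ M} {A} {F} d (pswap .x .y p) σ with eqL x y
  ... | inj₁ refl = cong₂ _+_ (cong₂ _+_ (sum-↭ d p _) (sum-↭ d p _)) (cong₂ _+_ (sum-↭ d p _) (sum-↭ d p _))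
  ... | inj₂ ne = trans (cong₂ _+_ (cong₂ _+_ (ex true true) (ex true false)) (cong₂ _+_ (ex false true) (ex false false)))
                  (mid4 (sw true true) (sw true false) (sw false true) (sw false false))
    where
    sw : Bool → Bool → ℕ
    sw b c = sumOver M F (upd (upd σ y c) x b)
    ex : ∀ b c → sumOver L F (upd (upd σ x b) y c) ≡ sw b c
    ex b c = trans (sum-↭ d p (upd (upd σ x b) y c)) (sum-Dep M d _ _ λ m _ → go m)
      where
      go : ∀ m → upd (upd σ x b) y c m ≡ upd (upd σ y c) x b m
      go m with eqL m x | eqL m y
      ... | inj₁ refl | inj₁ refl = ⊥-elim (ne refl)
      ... | inj₁ _ | inj₂ _ = refl
      ... | inj₂ _ | inj₁ _ = refl
      ... | inj₂ _ | inj₂ _ = refl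
  sum-↭ d (ptrans p q) σ = trans (sum-↭ d p σ) (sum-↭ d q σ)

  sum-val : ∀ L {l b} (φ : Bool → Asg → ℕ) σ → l ∉ L → σ l ≡ b →
    sumOver L (λ τ → φ (τ l) τ) σ ≡ sumOver L (φ b) σ
  sum-val [] φ σ l∉ e rewrite e = refl
  sum-val (m ∷ L) {l} {b} φ σ l∉ e = cong₂ _+_
    (sum-val L φ (upd σ m true) (l∉ ∘ there) (trans (upd-diff σ true (l∉ ∘ here)) e))
    (sum-val L φ (upd σ m false) (l∉ ∘ there) (trans (upd-diff σ false (l∉ ∘ here)) e))

  sum-peel : ∀ {l} L (φ : Bool → Asg → ℕ) σ → l ∉ L →
    sumOver (l ∷ L) (λ τ → φ (τ l) τ) σ ≡
    sumOver L (φ true) (upd σ l true) + sumOver L (φ false) (upd σ l false)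
  sum-peel {l} L φ σ l∉ = cong₂ _+_ (sum-val L φ _ l∉ (upd-same σ l true)) (sum-val L φ _ l∉ (upd-same σ l false))

  δ= : ℕ → ℕ → ℕ
  δ= l m = ifE (eqL l m) 1 0

  δ-same : ∀ l → δ= l l ≡ 1
  δ-same l with eqL l l
  ... | inj₁ _ = refl
  ... | inj₂ ne = ⊥-elim (ne refl)

  δ-diff : ∀ {l m} → l ≢ m → δ= l m ≡ 0
  δ-diff {l} {m} ne with eqL l m
  ... | inj₁ e = ⊥-elim (ne e)
  ... | inj₂ _ = refl

  δ-sym : ∀ l m → δ= l m ≡ δ= m l
  δ-sym l m with eqL l m
  ... | inj₁ refl = sym (δ-same l)
  ... | inj₂ ne = sym (δ-diff (ne ∘ sym))

  cnt : ℕ → List ℕ → ℕ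
  cnt l [] = 0
  cnt l (m ∷ ms) = δ= l m + cnt l ms

  cnt-++ : ∀ l A B → cnt l (A ++ B) ≡ cnt l A + cnt l B
  cnt-++ l [] B = refl
  cnt-++ l (a ∷ A) B rewrite cnt-++ l A B = sym (+-assoc (δ= l a) (cnt l A) (cnt l B))

  cnt-↭ : ∀ l {A B} → A ↭ B → cnt l A ≡ cnt l B
  cnt-↭ l prefl = refl
  cnt-↭ l (prep x p) = cong (δ= l x +_) (cnt-↭ l p)
  cnt-↭ l (pswap x y p) rewrite cnt-↭ l p = lem (δ= l x) (δ= l y) _
    where
    lem : ∀ a b c → a + (b + c) ≡ b + (a + c)
    lem = solve-∀
  cnt-↭ l (ptrans p q) = trans (cnt-↭ l p) (cnt-↭ l q)

  ∈⇒cnt : ∀ {l A} → l ∈ A → 1 ≤ cnt l A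
  ∈⇒cnt {l} (here refl) rewrite δ-same l = s≤s z≤n
  ∈⇒cnt {l} {a ∷ A} (there p) = ≤-trans (∈⇒cnt p) (m≤n+m _ (δ= l a))

  cnt⇒∈ : ∀ {l} A → 1 ≤ cnt l A → l ∈ A
  cnt⇒∈ {l} (a ∷ A) p with eqL l a
  ... | inj₁ e = here e
  ... | inj₂ _ = there (cnt⇒∈ A p)

  ∉⇒cnt : ∀ {l} A → l ∉ A → cnt l A ≡ 0
  ∉⇒cnt {l} A n with cnt l A in e
  ... | zero = refl
  ... | suc k = ⊥-elim (n (cnt⇒∈ A (≤-trans (s≤s z≤n) (≤-reflexive (sym e)))))

  cnt⇒∉ : ∀ {l A} → cnt l A ≡ 0 → l ∉ A
  cnt⇒∉ e p with ≤-trans (∈⇒cnt p) (≤-reflexive e)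
  ... | ()

  ∈-split : ∀ {X : Set} {x : X} {A} → x ∈ A → ∃[ B ] A ↭ x ∷ B
  ∈-split p with ∈-∃++ p
  ... | ys , zs , refl = ys ++ zs , shift _ ys zs

  cnt⇒↭ : ∀ A B → (∀ l → cnt l A ≡ cnt l B) → A ↭ B
  cnt⇒↭ [] [] e = prefl
  cnt⇒↭ [] (b ∷ B) e with trans (e b) (cong (_+ cnt b B) (δ-same b))
  ... | ()
  cnt⇒↭ (a ∷ A) B e with ∈-split (cnt⇒∈ {a} B (subst (1 ≤_) (e a) (subst (λ z → 1 ≤ z + cnt a A) (sym (δ-same a)) (s≤s z≤n))))
  ... | B' , p = ptrans (prep a (cnt⇒↭ A B' λ l → +-cancelˡ-≡ (δ= l a) _ _ (trans (e l) (cnt-↭ l p)))) (↭-sym p)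

  sel : (ℕ → Bool) → List ℕ → List ℕ
  sel p [] = []
  sel p (l ∷ L) = if p l then l ∷ sel p L else sel p L

  bit : Bool → ℕ
  bit true = 1
  bit false = 0

  cnt-sel : ∀ p l L → cnt l (sel p L) ≡ bit (p l) * cnt l L
  cnt-sel p l [] = sym (*-zeroʳ (bit (p l)))
  cnt-sel p l (m ∷ L) with p m in e | eqL l m
  ... | true | inj₁ refl rewrite δ-same l | cnt-sel p l L | e = refl
  ... | true | inj₂ ne rewrite δ-diff ne | cnt-sel p l L = refl
  ... | false | inj₁ refl rewrite cnt-sel p l L | e = refl
  ... | false | inj₂ _ = cnt-sel p l L

  sumL : (ℕ → ℕ) → List ℕ → ℕ
  sumL f [] = 0
  sumL f (l ∷ L) = f l + sumL f L

  length-sel : ∀ p L → length (sel p L) ≡ sumL (bit ∘ p) L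
  length-sel p [] = refl
  length-sel p (l ∷ L) with p l
  ... | true = cong suc (length-sel p L)
  ... | false = length-sel p L

  sumL-sel : ∀ f p L → sumL f (sel p L) ≡ sumL (λ l → bit (p l) * f l) L
  sumL-sel f p [] = refl
  sumL-sel f p (l ∷ L) with p l
  ... | true = cong₂ _+_ (sym (+-identityʳ (f l))) (sumL-sel f p L)
  ... | false = sumL-sel f p L

  sumL-cong : ∀ {f g} L → (∀ l → f l ≡ g l) → sumL f L ≡ sumL g L
  sumL-cong [] e = refl
  sumL-cong (l ∷ L) e = cong₂ _+_ (e l) (sumL-cong L e)

  sumL-+ : ∀ f g L → sumL (λ l → f l + g l) L ≡ sumL f L + sumL g L
  sumL-+ f g [] = refl
  sumL-+ f g (l ∷ L) rewrite sumL-+ f g L = mid4 (f l) (g l) _ _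

  sumL-δ : ∀ m L → sumL (λ l → δ= l m) L ≡ cnt m L
  sumL-δ m [] = refl
  sumL-δ m (l ∷ L) = cong₂ _+_ (δ-sym l m) (sumL-δ m L)

  sumL-cnt : ∀ A L → (∀ {m} → m ∈ A → cnt m L ≡ 1) → sumL (λ l → cnt l A) L ≡ length A
  sumL-cnt [] L h = sumL-zero L
    where
    sumL-zero : ∀ L → sumL (λ _ → 0) L ≡ 0
    sumL-zero [] = refl
    sumL-zero (_ ∷ L) = sumL-zero L
  sumL-cnt (a ∷ A) L h = trans (sumL-+ (λ l → δ= l a) (λ l → cnt l A) L)
    (cong₂ _+_ (trans (sumL-δ a L) (h (here refl))) (sumL-cnt A L (h ∘ there)))

  -- Cubic graphs and their edge cuts

  -- A cubic multigraph is a list of vertices, each given by the labels of its three edges, over a list L of labels.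
  record Tri : Set where
    constructor tri
    field l₁ l₂ l₃ : ℕ

  labs : List Tri → List ℕ
  labs [] = []
  labs (tri p q r ∷ X) = p ∷ q ∷ r ∷ labs X

  labs-++ : ∀ X Y → labs (X ++ Y) ≡ labs X ++ labs Y
  labs-++ [] Y = refl
  labs-++ (tri p q r ∷ X) Y = cong (λ z → p ∷ q ∷ r ∷ z) (labs-++ X Y)

  length-labs : ∀ X → length (labs X) ≡ 3 * length X
  length-labs [] = refl
  length-labs (_ ∷ X) rewrite length-labs X = lem (length X)
    where
    lem : ∀ n → 3 + 3 * n ≡ 3 * suc n
    lem = solve-∀

  occ : ℕ → List Tri → ℕ
  occ l X = cnt l (labs X)

  occ-++ : ∀ l X Y → occ l (X ++ Y) ≡ occ l X + occ l Y
  occ-++ l X Y = trans (cong (cnt l) (labs-++ X Y)) (cnt-++ l (labs X) (labs Y))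

  labs-↭ : ∀ {X Y} → X ↭ Y → labs X ↭ labs Y
  labs-↭ prefl = prefl
  labs-↭ (prep (tri p q r) e) = prep p (prep q (prep r (labs-↭ e)))
  labs-↭ (pswap {xs} {ys} (tri p q r) (tri s t u) e) =
    ptrans (shifts (p ∷ q ∷ r ∷ []) (s ∷ t ∷ u ∷ [])) (++⁺ˡ (s ∷ t ∷ u ∷ p ∷ q ∷ r ∷ []) (labs-↭ e))
  labs-↭ (ptrans e f) = ptrans (labs-↭ e) (labs-↭ f)

  occ-↭ : ∀ l {X Y} → X ↭ Y → occ l X ≡ occ l Y
  occ-↭ l p = cnt-↭ l (labs-↭ p)

  record WF (L : List ℕ) (G : List Tri) : Set where
    constructor wf
    field
      simple : ∀ l → cnt l L ≤ 1
      twice  : ∀ l → occ l G ≡ cnt l L + cnt l L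
  open WF public

  is1 is2 : ℕ → Bool
  is1 1 = true
  is1 _ = false
  is2 2 = true
  is2 _ = false

  bdl inl outl : List ℕ → List Tri → List ℕ
  bdl L X = sel (λ l → is1 (occ l X)) L
  inl L X = sel (λ l → is2 (occ l X)) L
  outl L X = sel (λ l → not (is2 (occ l X))) L

  -- the number of edges between X and its complement; opaque, so that it is never unfolded to a list of labels
  abstract
    δ : List ℕ → List Tri → ℕ
    δ L X = length (bdl L X)

    δ-len : ∀ L X → δ L X ≡ length (bdl L X)
    δ-len L X = refl

  Br : List ℕ → List Tri → Set
  Br L G = ∀ X Y → G ↭ X ++ Y → δ L X ≢ 1

  δ-sumL : ∀ L X → δ L X ≡ sumL (λ l → bit (is1 (occ l X))) L
  δ-sumL L X = trans (δ-len L X) (length-sel (λ l → is1 (occ l X)) L)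

  δ-↭ : ∀ L {X Y} → X ↭ Y → δ L X ≡ δ L Y
  δ-↭ L {X} {Y} p = trans (δ-sumL L X) (trans (sumL-cong L λ l → cong (bit ∘ is1) (occ-↭ l p)) (sym (δ-sumL L Y)))

  WF-↭ : ∀ {L G H} → G ↭ H → WF L G → WF L H
  WF-↭ p (wf s t) = wf s (λ l → trans (sym (occ-↭ l p)) (t l))

  Br-↭ : ∀ {L G H} → G ↭ H → Br L G → Br L H
  Br-↭ p b X Y q = b X Y (ptrans p q)

  data Three (X Y L : ℕ) : Set where
    c00 : L ≡ 0 → X ≡ 0 → Y ≡ 0 → Three X Y L
    c02 : L ≡ 1 → X ≡ 0 → Y ≡ 2 → Three X Y L
    c11 : L ≡ 1 → X ≡ 1 → Y ≡ 1 → Three X Y L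
    c20 : L ≡ 1 → X ≡ 2 → Y ≡ 0 → Three X Y L

  three : ∀ x y c → c ≤ 1 → x + y ≡ c + c → Three x y c
  three 0 y 0 s refl = c00 refl refl refl
  three 0 y 1 s refl = c02 refl refl refl
  three 1 y 1 s refl = c11 refl refl refl
  three 2 y 1 s refl = c20 refl refl refl
  three (suc (suc (suc x))) y 1 s ()
  three (suc x) y 0 s ()
  three x y (suc (suc c)) (s≤s ()) e

  split3 : ∀ {L X Y} → WF L (X ++ Y) → ∀ l → Three (occ l X) (occ l Y) (cnt l L)
  split3 {L} {X} {Y} w l = three _ _ _ (simple w l) (trans (sym (occ-++ l X Y)) (twice w l))

  δ-compl : ∀ {L} X Y → WF L (X ++ Y) → δ L X ≡ δ L Y
  δ-compl {L} X Y w = trans (δ-sumL L X) (trans (sumL-cong L go) (sym (δ-sumL L Y)))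
    where
    go : ∀ l → bit (is1 (occ l X)) ≡ bit (is1 (occ l Y))
    go l with split3 {X = X} w l
    ... | c00 _ e f rewrite e | f = refl
    ... | c02 _ e f rewrite e | f = refl
    ... | c11 _ e f rewrite e | f = refl
    ... | c20 _ e f rewrite e | f = refl

  handshake : ∀ {L} X Y → WF L (X ++ Y) → δ L X + 2 * length (inl L X) ≡ 3 * length X
  handshake {L} X Y w = trans (cong₂ _+_ (δ-sumL L X) (cong (2 *_) (length-sel (λ l → is2 (occ l X)) L)))
    (trans (lem L) (trans (sumL-cnt (labs X) L one) (length-labs X)))
    where
    pt : ∀ l → bit (is1 (occ l X)) + 2 * bit (is2 (occ l X)) ≡ occ l X
    pt l with split3 {X = X} w l
    ... | c00 _ e f rewrite e = refl
    ... | c02 _ e f rewrite e = refl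
    ... | c11 _ e f rewrite e = refl
    ... | c20 _ e f rewrite e = refl
    step : ∀ x y s t → x + s + 2 * (y + t) ≡ x + 2 * y + (s + 2 * t)
    step = solve-∀
    lem : ∀ M → sumL (λ l → bit (is1 (occ l X))) M + 2 * sumL (λ l → bit (is2 (occ l X))) M ≡ sumL (λ l → occ l X) M
    lem [] = refl
    lem (m ∷ M) = trans (step (bit (is1 (occ m X))) (bit (is2 (occ m X))) _ _) (cong₂ _+_ (pt m) (lem M))
    one : ∀ {m} → m ∈ labs X → cnt m L ≡ 1
    one {m} m∈ with split3 {X = X} w m | ∈⇒cnt m∈
    ... | c00 _ e f | q rewrite e = case q of λ ()
    ... | c02 _ e f | q rewrite e = case q of λ ()
    ... | c11 c e f | q = c
    ... | c20 c e f | q = c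

  module _ {A : Set} where
    ∷-split : ∀ {o : A} {Y A₁ B₁} → o ∷ Y ↭ A₁ ++ B₁ →
      (∃[ A' ] A₁ ↭ o ∷ A' × Y ↭ A' ++ B₁) ⊎ (∃[ B' ] B₁ ↭ o ∷ B' × Y ↭ A₁ ++ B')
    ∷-split {o} {Y} {A₁} {B₁} p with ∈-++⁻ A₁ (∈-resp-↭ p (here refl))
    ... | inj₁ q with ∈-split q
    ...   | A' , r = inj₁ (A' , r , drop-∷ (ptrans p (++⁺ʳ B₁ r)))
    ∷-split {o} {Y} {A₁} {B₁} p | inj₂ q with ∈-split q
    ...   | B' , r = inj₂ (B' , r , drop-∷ (ptrans p (ptrans (++⁺ˡ A₁ r) (shift o A₁ B'))))

    splits : List A → List (List A × List A)
    splits [] = ([] , []) ∷ []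
    splits (x ∷ G) = map (λ s → x ∷ proj₁ s , proj₂ s) (splits G) ++ map (λ s → proj₁ s , x ∷ proj₂ s) (splits G)

    splits-sound : ∀ G {s} → s ∈ splits G → G ↭ proj₁ s ++ proj₂ s
    splits-sound [] (here refl) = prefl
    splits-sound (x ∷ G) p with ∈-++⁻ (map _ (splits G)) p
    ... | inj₁ q with ∈-map⁻ _ q
    ...   | s , r , refl = prep x (splits-sound G r)
    splits-sound (x ∷ G) p | inj₂ q with ∈-map⁻ _ q
    ...   | s , r , refl = ptrans (prep x (splits-sound G r)) (↭-sym (shift x (proj₁ s) (proj₂ s)))

    splits-complete : ∀ G {X Y} → G ↭ X ++ Y → ∃[ s ] s ∈ splits G × proj₁ s ↭ X × proj₂ s ↭ Y
    splits-complete [] {X} {Y} p with X | Y | ↭-empty-inv (↭-sym p)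
    ... | [] | [] | refl = _ , here refl , prefl , prefl
    splits-complete (x ∷ G) p with ∷-split p
    ... | inj₁ (A' , r , q) with splits-complete G q
    ...   | s , i , u , v = _ , ∈-++⁺ˡ (∈-map⁺ _ i) , ptrans (prep x u) (↭-sym r) , v
    splits-complete (x ∷ G) p | inj₂ (B' , r , q) with splits-complete G q
    ...   | s , i , u , v = _ , ∈-++⁺ʳ (map _ (splits G)) (∈-map⁺ _ i) , u , ptrans (prep x v) (↭-sym r)

    searchSplit : ∀ {P : List A → List A → Set} → (∀ X Y → Dec (P X Y)) →
      (∀ {X X' Y Y'} → X ↭ X' → Y ↭ Y' → P X Y → P X' Y') → ∀ G →
      (∃[ X ] ∃[ Y ] G ↭ X ++ Y × P X Y) ⊎ (∀ X Y → G ↭ X ++ Y → ¬ P X Y)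
    searchSplit P? resp G with any? (λ s → P? (proj₁ s) (proj₂ s)) (splits G)
    ... | yes a with find a
    ...   | (X , Y) , i , p = inj₁ (X , Y , splits-sound G i , p)
    searchSplit P? resp G | no na = inj₂ λ X Y q p → case splits-complete G q of
      λ { (s , i , u , v) → na (lose i (resp (↭-sym u) (↭-sym v) p)) }

  No3 : List ℕ → List Tri → Set
  No3 L G = ∀ X Y → G ↭ X ++ Y → 2 ≤ length X → 2 ≤ length Y → δ L X ≢ 3

  Min3 : List ℕ → List Tri → Set
  Min3 L X = ∀ W W' → X ↭ W ++ W' → 2 ≤ length W → 1 ≤ length W' → δ L W ≢ 3

  Cut : ℕ → List ℕ → List Tri → List Tri → Set
  Cut k L X Y = 2 ≤ length X × k ≤ length Y × δ L X ≡ 3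

  cutDec : ∀ k L X Y → Dec (Cut k L X Y)
  cutDec k L X Y = (2 ≤? length X) ×-dec ((k ≤? length Y) ×-dec (δ L X ≟ 3))

  cutResp : ∀ k L {X X' Y Y'} → X ↭ X' → Y ↭ Y' → Cut k L X Y → Cut k L X' Y'
  cutResp k L p q (a , b , c) = subst (2 ≤_) (↭-length p) a , subst (k ≤_) (↭-length q) b , trans (sym (δ-↭ L p)) c

  search3 : ∀ L G → (∃[ X ] ∃[ Y ] G ↭ X ++ Y × 2 ≤ length X × 2 ≤ length Y × δ L X ≡ 3) ⊎ No3 L G
  search3 L G with searchSplit {P = Cut 2 L} (cutDec 2 L) (cutResp 2 L) G
  ... | inj₁ (X , Y , p , a) = inj₁ (X , Y , p , a)
  ... | inj₂ n = inj₂ λ X Y p a b c → n X Y p (a , b , c)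

  shrink3 : ∀ L n X → length X ≤ n → 2 ≤ length X → δ L X ≡ 3 →
    ∃[ W ] ∃[ E ] X ↭ W ++ E × 2 ≤ length W × δ L W ≡ 3 × Min3 L W
  shrink3 L zero X b t d = ⊥-elim (case ≤-trans t b of λ ())
  shrink3 L (suc n) X b t d with searchSplit {P = Cut 1 L} (cutDec 1 L) (cutResp 1 L) X
  ... | inj₂ nc = X , [] , ↭-sym (++-identityʳ X) , t , d , λ W W' p a b c → nc W W' p (a , b , c)
  ... | inj₁ (W , W' , p , t' , e , d') with shrink3 L n W
          (≤-pred (≤-trans (≤-trans (≤-trans (≤-reflexive (+-comm 1 (length W))) (+-monoʳ-≤ (length W) e))
            (≤-reflexive (trans (sym (length-++ W)) (sym (↭-length p))))) b)) t' d'
  ...   | V , E , q , a , c , m = V , E ++ W' , ptrans p (ptrans (++⁺ʳ W' q) (++-assoc V E W')) , a , c , m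

  module Contract {L : List ℕ} (X Y : List Tri) {p q r : ℕ} (w : WF L (X ++ Y))
                  (bd : bdl L X ↭ p ∷ q ∷ r ∷ []) where
    o : Tri
    o = tri p q r

    L' : List ℕ
    L' = outl L X

    occ-o : ∀ l → cnt l (p ∷ q ∷ r ∷ []) ≡ bit (is1 (occ l X)) * cnt l L
    occ-o l = trans (sym (cnt-↭ l bd)) (cnt-sel _ l L)

    occ-oA : ∀ l A → occ l (o ∷ A) ≡ bit (is1 (occ l X)) * cnt l L + occ l A
    occ-oA l A = trans (cnt-++ l (p ∷ q ∷ r ∷ []) (labs A)) (cong (_+ occ l A) (occ-o l))

    WF' : WF L' (o ∷ Y)
    WF' = wf s t
      where
      s : ∀ l → cnt l L' ≤ 1
      s l rewrite cnt-sel (λ l → not (is2 (occ l X))) l L with not (is2 (occ l X))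
      ... | true = subst (_≤ 1) (sym (+-identityʳ _)) (simple w l)
      ... | false = z≤n
      t : ∀ l → occ l (o ∷ Y) ≡ cnt l L' + cnt l L'
      t l rewrite occ-oA l Y | cnt-sel (λ l → not (is2 (occ l X))) l L with split3 {X = X} w l
      ... | c00 a e f rewrite a | e | f = refl
      ... | c02 a e f rewrite a | e | f = refl
      ... | c11 a e f rewrite a | e | f = refl
      ... | c20 a e f rewrite a | e | f = refl

    private
      pt : ∀ c x a b → c ≤ 1 → x + (a + b) ≡ c + c →
        bit (not (is2 x)) * bit (is1 (bit (is1 x) * c + a)) ≡ bit (is1 (x + a))
      pt 0 0 0 0 s e = refl
      pt 1 0 a b s e = +-identityʳ _
      pt 1 1 a b s e = +-identityʳ _
      pt 1 2 0 b s e = refl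
      pt 1 2 (suc a) b s ()
      pt 1 (suc (suc (suc x))) a b s ()
      pt (suc (suc c)) x a b (s≤s ()) e
      pt0 : ∀ c x a b → c ≤ 1 → x + (a + b) ≡ c + c →
        bit (not (is2 x)) * bit (is1 a) ≡ bit (is1 a)
      pt0 0 0 0 0 s e = refl
      pt0 1 0 a b s e = +-identityʳ _
      pt0 1 1 a b s e = +-identityʳ _
      pt0 1 2 0 b s e = refl
      pt0 1 2 (suc a) b s ()
      pt0 1 (suc (suc (suc x))) a b s ()
      pt0 (suc (suc c)) x a b (s≤s ()) e

    module _ (A B : List Tri) (e : Y ↭ A ++ B) where
      private
        tot : ∀ l → occ l X + (occ l A + occ l B) ≡ cnt l L + cnt l L
        tot l = trans (cong (occ l X +_) (trans (sym (occ-++ l A B)) (sym (occ-↭ l e))))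
          (trans (sym (occ-++ l X Y)) (twice w l))

      δ-in : δ L' (o ∷ A) ≡ δ L (X ++ A)
      δ-in = trans (δ-sumL L' (o ∷ A)) (trans (sumL-sel _ _ L) (trans (sumL-cong L go) (sym (δ-sumL L (X ++ A)))))
        where
        go : ∀ l → bit (not (is2 (occ l X))) * bit (is1 (occ l (o ∷ A))) ≡ bit (is1 (occ l (X ++ A)))
        go l rewrite occ-oA l A | occ-++ l X A = pt (cnt l L) (occ l X) (occ l A) (occ l B) (simple w l) (tot l)

      δ-out : δ L' A ≡ δ L A
      δ-out = trans (δ-sumL L' A) (trans (sumL-sel _ _ L) (trans (sumL-cong L go) (sym (δ-sumL L A))))
        where
        go : ∀ l → bit (not (is2 (occ l X))) * bit (is1 (occ l A)) ≡ bit (is1 (occ l A))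
        go l = pt0 (cnt l L) (occ l X) (occ l A) (occ l B) (simple w l) (tot l)

    Br' : Br L (X ++ Y) → Br L' (o ∷ Y)
    Br' b A B e d with ∷-split e
    ... | inj₁ (A' , s , t) = b (X ++ A') B (ptrans (++⁺ˡ X t) (↭-sym (++-assoc X A' B)))
            (trans (sym (δ-in A' B t)) (trans (sym (δ-↭ L' s)) d))
    ... | inj₂ (B' , s , t) = b A (X ++ B') (ptrans (++⁺ˡ X t) (shifts X A)) (trans (sym (δ-out A B' t)) d)

    No3' : Min3 L Y → No3 L' (o ∷ Y)
    No3' m A B e a b d with ∷-split e
    ... | inj₂ (B' , s , t) = m A B' t a (≤-pred (subst (2 ≤_) (↭-length s) b)) (trans (sym (δ-out A B' t)) d)
    ... | inj₁ (A' , s , t) = m B A' t' b (≤-pred (subst (2 ≤_) (↭-length s) a))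
            (trans (sym (δ-out B A' t')) (trans (sym (δ-compl A B (WF-↭ e WF'))) d))
      where
      t' : Y ↭ B ++ A'
      t' = ptrans t (++-comm A' B)

  -- Weighted vertices

  -- The weights of a vertex for the ways to choose an odd number of its edges: only the first, second or third, or all three.
  -- An ordinary vertex is (1, 1, 1; 0).
  record Wt : Set where
    constructor wt
    field a₁ a₂ a₃ a₀ : ℕ
  open Wt public

  Vx : Set
  Vx = Tri × Wt

  w3 : Wt → Bool → Bool → Bool → ℕ
  w3 (wt a b c d) true false false = a
  w3 (wt a b c d) false true false = b
  w3 (wt a b c d) false false true = c
  w3 (wt a b c d) true true true = d
  w3 (wt a b c d) true true false = 0
  w3 (wt a b c d) true false true = 0
  w3 (wt a b c d) false true true = 0
  w3 (wt a b c d) false false false = 0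

  ev : Vx → Asg → ℕ
  ev (tri p q r , a) σ = w3 a (σ p) (σ q) (σ r)

  pr : List Vx → Asg → ℕ
  pr [] σ = 1
  pr (x ∷ X) σ = ev x σ * pr X σ

  tr : List Vx → List Tri
  tr = map proj₁

  plain : Tri → Vx
  plain t = t , wt 1 1 1 0

  pl : List Tri → List Vx
  pl = map plain

  tr-pl : ∀ X → tr (pl X) ≡ X
  tr-pl [] = refl
  tr-pl (x ∷ X) = cong (x ∷_) (tr-pl X)

  tr-++ : ∀ X Y → tr (X ++ Y) ≡ tr X ++ tr Y
  tr-++ [] Y = refl
  tr-++ (x ∷ X) Y = cong (proj₁ x ∷_) (tr-++ X Y)

  pr-++ : ∀ X Y σ → pr (X ++ Y) σ ≡ pr X σ * pr Y σ
  pr-++ [] Y σ = sym (+-identityʳ _)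
  pr-++ (x ∷ X) Y σ rewrite pr-++ X Y σ = sym (*-assoc (ev x σ) _ _)

  pr-↭ : ∀ {X Y} → X ↭ Y → ∀ σ → pr X σ ≡ pr Y σ
  pr-↭ prefl σ = refl
  pr-↭ (prep x p) σ = cong (ev x σ *_) (pr-↭ p σ)
  pr-↭ (pswap x y p) σ rewrite pr-↭ p σ = lem (ev x σ) (ev y σ) _
    where
    lem : ∀ a b c → a * (b * c) ≡ b * (a * c)
    lem = solve-∀
  pr-↭ (ptrans p q) σ = trans (pr-↭ p σ) (pr-↭ q σ)

  pr-dep : ∀ X → Dep (labs (tr X)) (pr X)
  pr-dep [] σ τ ag = refl
  pr-dep ((tri p q r , a) ∷ X) σ τ ag
    rewrite ag p (here refl) | ag q (there (here refl)) | ag r (there (there (here refl)))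
    = cong (w3 a (τ p) (τ q) (τ r) *_) (pr-dep X σ τ λ l m → ag l (there (there (there m))))

  dep-* : ∀ {A B F H} → Dep A F → Dep B H → Dep (A ++ B) (λ σ → F σ * H σ)
  dep-* {A} d e σ τ ag = cong₂ _*_ (d σ τ λ l m → ag l (∈-++⁺ˡ m)) (e σ τ λ l m → ag l (∈-++⁺ʳ A m))

  one : Asg → ℕ
  one _ = 1

  neg : ℕ → Asg → ℕ
  neg e σ = if σ e then 0 else 1

  dep-one : Dep [] one
  dep-one σ τ ag = refl

  dep-neg : ∀ e → Dep (e ∷ []) (neg e)
  dep-neg e σ τ ag rewrite ag e (here refl) = refl

  zeros : Asg
  zeros _ = false

  Z : List ℕ → List Vx → (Asg → ℕ) → ℕ
  Z L G F = sumOver L (λ σ → pr G σ * F σ) zeros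

  Z-↭ : ∀ L {G H} F → G ↭ H → Z L G F ≡ Z L H F
  Z-↭ L F p = sum-cong L (λ σ → cong (_* F σ) (pr-↭ p σ)) zeros

  Z-L↭ : ∀ {L M} G {A F} → Dep A F → L ↭ M → Z L G F ≡ Z M G F
  Z-L↭ G d p = sum-↭ (dep-* (pr-dep G) d) p zeros

  Z-mono : ∀ L {G H F F'} → (∀ σ → pr G σ ≤ pr H σ) → (∀ σ → F σ ≤ F' σ) → Z L G F ≤ Z L H F'
  Z-mono L p q = sum-mono L (λ σ → *-mono-≤ (p σ) (q σ)) zeros

  sum-const : ∀ L c F σ → sumOver L (λ τ → c * F τ) σ ≡ c * sumOver L F σ
  sum-const L c F σ = sum-mulˡ L {A = []} {F = F} {H = λ _ → c} (λ _ _ _ → refl) (λ _ ()) σ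

  is0 : ℕ → Bool
  is0 0 = true
  is0 _ = false

  rest : List ℕ → Tri → List ℕ
  rest L t = sel (λ l → is0 (occ l (t ∷ []))) L

  pat : Tri → Bool → Bool → Bool → Asg
  pat (tri p q r) x y z = upd (upd (upd zeros p x) q y) r z

  U : List ℕ → Tri → List Vx → (Asg → ℕ) → Bool → Bool → Bool → ℕ
  U L t Y F x y z = sumOver (rest L t) (λ σ → pr Y σ * F σ) (pat t x y z)

  Uv : List ℕ → Tri → List Vx → (Asg → ℕ) → Wt
  Uv L t Y F = wt (U L t Y F true false false) (U L t Y F false true false)
                  (U L t Y F false false true) (U L t Y F true true true)

  dot : Wt → Wt → ℕ
  dot (wt a b c d) (wt x y z u) = a * x + b * y + c * z + d * u

  Loopless : Tri → Set
  Loopless t = ∀ l → occ l (t ∷ []) ≤ 1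

  noloop : ∀ {L t Y} → WF L (t ∷ Y) → Br L (t ∷ Y) → Loopless t
  noloop {L} {t} {Y} w b l with split3 {X = t ∷ []} {Y} w l
  ... | c00 _ e _ rewrite e = z≤n
  ... | c02 _ e _ rewrite e = z≤n
  ... | c11 _ e _ rewrite e = ≤-refl
  ... | c20 c e _ = ⊥-elim (fin (δ L (t ∷ [])) (length (inl L (t ∷ []))) (handshake (t ∷ []) Y w) pos (b (t ∷ []) Y prefl))
    where
    len-cnt : ∀ A → 1 ≤ cnt l A → 1 ≤ length A
    len-cnt (_ ∷ A) _ = s≤s z≤n
    pos : 1 ≤ length (inl L (t ∷ []))
    pos = len-cnt (inl L (t ∷ [])) (≤-reflexive (sym (trans (cnt-sel (λ m → is2 (occ m (t ∷ []))) l L) (cong₂ (λ x y → bit (is2 x) * y) e c))))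
    fin : ∀ d i → d + 2 * i ≡ 3 → 1 ≤ i → d ≢ 1 → ⊥
    fin d (suc i) h _ n with trans (sym (lem d i)) h
      where
      lem : ∀ d i → d + 2 * suc i ≡ suc (suc (d + 2 * i))
      lem = solve-∀
    fin 0 (suc zero) h _ n | ()
    fin 0 (suc (suc i)) h _ n | q with trans (sym (lem i)) q
      where
      lem : ∀ i → suc (suc (0 + 2 * suc i)) ≡ suc (suc (suc (suc (2 * i))))
      lem = solve-∀
    ... | ()
    fin 1 (suc i) h _ n | _ = n refl
    fin (suc (suc d)) (suc i) h _ n | ()

  dist3 : ∀ {p q r} → Loopless (tri p q r) → p ≢ q × p ≢ r × q ≢ r
  dist3 {p} {q} {r} h = (λ { refl → f p (δ= p r + 0) (h p) }) ,
    (λ { refl → f p (δ= p q + 0) (subst (_≤ 1) (g (δ= p p) (δ= p q)) (h p)) }) ,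
    (λ { refl → f q (δ= q p + 0) (subst (_≤ 1) (k (δ= q q) (δ= q p)) (h q)) })
    where
    f : ∀ l c → δ= l l + (δ= l l + c) ≤ 1 → ⊥
    f l c x rewrite δ-same l with x
    ... | s≤s ()
    g : ∀ a b → a + (b + (a + 0)) ≡ a + (a + (b + 0))
    g = solve-∀
    k : ∀ a b → b + (a + (a + 0)) ≡ a + (a + (b + 0))
    k = solve-∀

  pat-at : ∀ {p q r} → Loopless (tri p q r) → ∀ x y z →
    pat (tri p q r) x y z p ≡ x × pat (tri p q r) x y z q ≡ y × pat (tri p q r) x y z r ≡ z
  pat-at {p} {q} {r} h x y z with dist3 h
  ... | a , b , c = trans (upd-diff (upd (upd zeros p x) q y) z b) (trans (upd-diff (upd zeros p x) y a) (upd-same zeros p x)) ,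
    trans (upd-diff (upd (upd zeros p x) q y) z c) (upd-same (upd zeros p x) q y) , upd-same (upd (upd zeros p x) q y) r z

  pat-agree : ∀ {p q r} → Loopless (tri p q r) → ∀ σ →
    Agree (p ∷ q ∷ r ∷ []) (pat (tri p q r) (σ p) (σ q) (σ r)) σ
  pat-agree {p} {q} {r} h σ _ (here refl) = proj₁ (pat-at h (σ p) (σ q) (σ r))
  pat-agree {p} {q} {r} h σ _ (there (here refl)) = proj₁ (proj₂ (pat-at h (σ p) (σ q) (σ r)))
  pat-agree {p} {q} {r} h σ _ (there (there (here refl))) = proj₂ (proj₂ (pat-at h (σ p) (σ q) (σ r)))

  rest-↭ : ∀ {L p q r Y} → WF L (tri p q r ∷ Y) → Loopless (tri p q r) → L ↭ p ∷ q ∷ r ∷ rest L (tri p q r)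
  rest-↭ {L} {p} {q} {r} {Y} w h = cnt⇒↭ L _ λ l → trans (go l) (sym (cnt-++ l (p ∷ q ∷ r ∷ []) (rest L (tri p q r))))
    where
    go : ∀ l → cnt l L ≡ occ l (tri p q r ∷ []) + cnt l (rest L (tri p q r))
    go l rewrite cnt-sel (λ m → is0 (occ m (tri p q r ∷ []))) l L with split3 {X = tri p q r ∷ []} {Y} w l | h l
    ... | c00 a e _ | _ rewrite a | e = refl
    ... | c02 a e _ | _ rewrite a | e = refl
    ... | c11 a e _ | _ rewrite a | e = refl
    ... | c20 a e _ | k rewrite e = case k of λ { (s≤s ()) }

  rest-∉ : ∀ L t {l} → l ∈ labs (t ∷ []) → l ∉ rest L t
  rest-∉ L t {l} m = cnt⇒∉ (trans (cnt-sel (λ l → is0 (occ l (t ∷ []))) l L) (lem _ (cnt l L) (∈⇒cnt m)))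
    where
    lem : ∀ n c → 1 ≤ n → bit (is0 n) * c ≡ 0
    lem (suc n) c _ = refl

  vertexSum : ∀ {L t a Y A F} → WF L (t ∷ tr Y) → Loopless t → Dep A F →
    Z L ((t , a) ∷ Y) F ≡ dot a (Uv L t Y F)
  vertexSum {L} {t@(tri p q r)} {a@(wt a₁ a₂ a₃ a₀)} {Y} {A} {F} w h d =
    trans (Z-L↭ ((t , a) ∷ Y) d (rest-↭ w h))
    (trans (sum-cong (p ∷ q ∷ r ∷ M) (λ σ → *-assoc (ev (t , a) σ) (pr Y σ) (F σ)) zeros)
    (trans (sum-peel (q ∷ r ∷ M) (λ b τ → w3 a b (τ q) (τ r) * H τ) zeros p∉)
    (trans (cong₂ _+_ (two true) (two false)) fin)))
    where
    M : List ℕ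
    M = rest L t
    H : Asg → ℕ
    H σ = pr Y σ * F σ
    ds : p ≢ q × p ≢ r × q ≢ r
    ds = dist3 h
    p∉ : p ∉ q ∷ r ∷ M
    p∉ (here e) = proj₁ ds e
    p∉ (there (here e)) = proj₁ (proj₂ ds) e
    p∉ (there (there m)) = rest-∉ L t (here refl) m
    q∉ : q ∉ r ∷ M
    q∉ (here e) = proj₂ (proj₂ ds) e
    q∉ (there m) = rest-∉ L t (there (here refl)) m
    r∉ : r ∉ M
    r∉ = rest-∉ L t (there (there (here refl)))
    T : Bool → Bool → Bool → ℕ
    T x y z = w3 a x y z * U L t Y F x y z
    three' : ∀ x y → sumOver (r ∷ M) (λ τ → w3 a x y (τ r) * H τ) (upd (upd zeros p x) q y) ≡ T x y true + T x y false
    three' x y = trans (sum-peel M (λ b τ → w3 a x y b * H τ) _ r∉)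
      (cong₂ _+_ (sum-const M (w3 a x y true) H _) (sum-const M (w3 a x y false) H _))
    two : ∀ x → sumOver (q ∷ r ∷ M) (λ τ → w3 a x (τ q) (τ r) * H τ) (upd zeros p x)
      ≡ T x true true + T x true false + (T x false true + T x false false)
    two x = trans (sum-peel (r ∷ M) (λ b τ → w3 a x b (τ r) * H τ) _ q∉) (cong₂ _+_ (three' x true) (three' x false))
    ring4 : ∀ a b c d → d + 0 + (0 + a) + (0 + b + (c + 0)) ≡ a + b + c + d
    ring4 = solve-∀
    fin : T true true true + T true true false + (T true false true + T true false false)
      + (T false true true + T false true false + (T false false true + T false false false)) ≡ dot a (Uv L t Y F)
    fin = ring4 (a₁ * U L t Y F true false false) (a₂ * U L t Y F false true false) (a₃ * U L t Y F false false true) _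

  glue : ∀ {L p q r A F B E} X Y → WF L (tr X ++ tr Y) → Loopless (tri p q r) →
    bdl L (tr X) ↭ p ∷ q ∷ r ∷ [] → Dep A F → (∀ {l} → l ∈ A → occ l (tr X) ≢ 2) →
    Dep B E → (∀ {l} → l ∈ B → 1 ≤ occ l (tr X)) →
    Z (outl L (tr X)) ((tri p q r , Uv (outl L (tr Y)) (tri p q r) X E) ∷ Y) F ≤ Z L (X ++ Y) (λ σ → E σ * F σ)
  glue {L} {p} {q} {r} {A} {F} {B} {E} X Y w h bd d dis dE inX = ≤-trans
    (sum-mono L₁ pt zeros)
    (≤-reflexive (sym (trans (Z-L↭ (X ++ Y) (dep-* dE d) part) (trans (sum-++ L₁ L₂ _ zeros) (sum-cong L₁ inner zeros)))))
    where
    t : Tri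
    t = tri p q r
    L₁ L₂ : List ℕ
    L₁ = outl L (tr X)
    L₂ = inl L (tr X)
    part : L ↭ L₁ ++ L₂
    part = cnt⇒↭ L _ λ l → trans (lem (is2 (occ l (tr X))) (cnt l L))
      (sym (trans (cnt-++ l L₁ L₂) (cong₂ _+_ (cnt-sel _ l L) (cnt-sel _ l L))))
      where
      lem : ∀ b c → c ≡ bit (not b) * c + bit b * c
      lem true c = sym (+-identityʳ c)
      lem false c = sym (trans (+-identityʳ _) (+-identityʳ c))
    inn-occ : ∀ {l} → l ∈ L₂ → occ l (tr X) ≡ 2
    inn-occ {l} m with occ l (tr X) | subst (1 ≤_) (cnt-sel (λ l → is2 (occ l (tr X))) l L) (∈⇒cnt m)
    ... | 0 | ()
    ... | 1 | ()
    ... | 2 | _ = refl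
    ... | suc (suc (suc _)) | ()
    dis' : ∀ {l} → l ∈ L₂ → l ∉ labs (tr Y) ++ A
    dis' {l} m k with ∈-++⁻ (labs (tr Y)) k
    ... | inj₂ a = dis a (inn-occ m)
    ... | inj₁ y with split3 {X = tr X} w l
    ...   | c00 _ e _ rewrite inn-occ m = case e of λ ()
    ...   | c02 _ e _ rewrite inn-occ m = case e of λ ()
    ...   | c11 _ e _ rewrite inn-occ m = case e of λ ()
    ...   | c20 _ _ e = cnt⇒∉ e y
    S : Asg → ℕ
    S = sumOver L₂ (λ τ → pr X τ * E τ)
    inner : ∀ σ → sumOver L₂ (λ τ → pr (X ++ Y) τ * (E τ * F τ)) σ ≡ S σ * (pr Y σ * F σ)
    inner σ = trans (sum-cong L₂ (λ τ → trans (cong (_* (E τ * F τ)) (pr-++ X Y τ)) (ring (pr X τ) (pr Y τ) (E τ) (F τ))) σ)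
      (sum-mulʳ L₂ {F = λ τ → pr X τ * E τ} (dep-* (pr-dep Y) d) dis' σ)
      where
      ring : ∀ x y e f → x * y * (e * f) ≡ x * e * (y * f)
      ring = solve-∀
    M↭ : rest (outl L (tr Y)) t ↭ L₂
    M↭ = cnt⇒↭ _ _ λ l → trans (cnt-sel _ l (outl L (tr Y)))
      (trans (cong (bit (is0 (occ l (t ∷ []))) *_) (cnt-sel _ l L)) (trans (go l) (sym (cnt-sel _ l L))))
      where
      go : ∀ l → bit (is0 (occ l (t ∷ []))) * (bit (not (is2 (occ l (tr Y)))) * cnt l L) ≡ bit (is2 (occ l (tr X))) * cnt l L
      go l rewrite trans (sym (cnt-↭ l bd)) (cnt-sel (λ l → is1 (occ l (tr X))) l L) with split3 {X = tr X} w l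
      ... | c00 a e f rewrite a | e | f = refl
      ... | c02 a e f rewrite a | e | f = refl
      ... | c11 a e f rewrite a | e = refl
      ... | c20 a e f rewrite a | e | f = refl
    val : ∀ σ → U (outl L (tr Y)) t X E (σ p) (σ q) (σ r) ≡ S σ
    val σ = trans (sum-↭ (dep-* (pr-dep X) dE) M↭ _)
      (sum-dep L₂ (dep-* (pr-dep X) dE) _ _ λ l m l∉ → pat-agree h σ l (∈-resp-↭ bd (bdm l (inl∪ m) l∉)))
      where
      inl∪ : ∀ {l} → l ∈ labs (tr X) ++ B → l ∈ labs (tr X)
      inl∪ m with ∈-++⁻ (labs (tr X)) m
      ... | inj₁ k = k
      ... | inj₂ k = cnt⇒∈ _ (inX k)
      bdm : ∀ l → l ∈ labs (tr X) → l ∉ L₂ → l ∈ bdl L (tr X)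
      bdm l m l∉ = cnt⇒∈ _ (subst (1 ≤_) (sym (cnt-sel (λ l → is1 (occ l (tr X))) l L)) pos)
        where
        pos : 1 ≤ bit (is1 (occ l (tr X))) * cnt l L
        pos with split3 {X = tr X} w l | ∈⇒cnt m
        ... | c00 a e f | k rewrite e = case k of λ ()
        ... | c02 a e f | k rewrite e = case k of λ ()
        ... | c11 a e f | k rewrite a | e = ≤-refl
        ... | c20 a e f | k = ⊥-elim (l∉ (cnt⇒∈ _ (≤-reflexive (sym (trans (cnt-sel (λ l → is2 (occ l (tr X))) l L) (cong₂ (λ x y → bit (is2 x) * y) e a))))))
    ptev : ∀ σ → ev (t , Uv (outl L (tr Y)) t X E) σ ≤ S σ
    ptev σ = subst (w3 _ (σ p) (σ q) (σ r) ≤_) (val σ) (lem (σ p) (σ q) (σ r))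
      where
      lem : ∀ x y z → w3 (Uv (outl L (tr Y)) t X E) x y z ≤ U (outl L (tr Y)) t X E x y z
      lem true false false = ≤-refl
      lem false true false = ≤-refl
      lem false false true = ≤-refl
      lem true true true = ≤-refl
      lem true true false = z≤n
      lem true false true = z≤n
      lem false true true = z≤n
      lem false false false = z≤n
    pt : ∀ σ → pr ((t , Uv (outl L (tr Y)) t X E) ∷ Y) σ * F σ ≤ S σ * (pr Y σ * F σ)
    pt σ = ≤-trans (≤-reflexive (*-assoc (ev (t , Uv (outl L (tr Y)) t X E) σ) (pr Y σ) (F σ))) (*-monoˡ-≤ _ (ptev σ))

  data Sw : Vx → Vx → Set where
    s0  : ∀ {x} → Sw x x
    s12 : ∀ {p q r a b c d y} → Sw (tri q p r , wt b a c d) y → Sw (tri p q r , wt a b c d) y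
    s23 : ∀ {p q r a b c d y} → Sw (tri p r q , wt a c b d) y → Sw (tri p q r , wt a b c d) y

  labs-sw : ∀ {x y} → Sw x y → labs (proj₁ x ∷ []) ↭ labs (proj₁ y ∷ [])
  labs-sw s0 = prefl
  labs-sw (s12 {p} {q} s) = ptrans (pswap p q prefl) (labs-sw s)
  labs-sw (s23 {p} {q} {r} s) = ptrans (prep p (pswap q r prefl)) (labs-sw s)

  ev-sw : ∀ {x y} → Sw x y → ∀ σ → ev x σ ≡ ev y σ
  ev-sw s0 σ = refl
  ev-sw (s12 {p} {q} {r} {a} {b} {c} {d} s) σ = trans (lem (σ p) (σ q) (σ r)) (ev-sw s σ)
    where
    lem : ∀ x y z → w3 (wt a b c d) x y z ≡ w3 (wt b a c d) y x z
    lem true true true = refl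
    lem true true false = refl
    lem true false true = refl
    lem true false false = refl
    lem false true true = refl
    lem false true false = refl
    lem false false true = refl
    lem false false false = refl
  ev-sw (s23 {p} {q} {r} {a} {b} {c} {d} s) σ = trans (lem (σ p) (σ q) (σ r)) (ev-sw s σ)
    where
    lem : ∀ x y z → w3 (wt a b c d) x y z ≡ w3 (wt a c b d) x z y
    lem true true true = refl
    lem true true false = refl
    lem true false true = refl
    lem true false false = refl
    lem false true true = refl
    lem false true false = refl
    lem false false true = refl
    lem false false false = refl

  occ-sw : ∀ {x y} → Sw x y → ∀ l A → occ l (proj₁ x ∷ A) ≡ occ l (proj₁ y ∷ A)
  occ-sw {x} {y} s l A = trans (occ-++ l (proj₁ x ∷ []) A)
    (trans (cong (_+ occ l A) (cnt-↭ l (labs-sw s))) (sym (occ-++ l (proj₁ y ∷ []) A)))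

  δ-occ : ∀ L {X Y} → (∀ l → occ l X ≡ occ l Y) → δ L X ≡ δ L Y
  δ-occ L {X} {Y} e = trans (δ-sumL L X) (trans (sumL-cong L λ l → cong (bit ∘ is1) (e l)) (sym (δ-sumL L Y)))

  infix 3 _⇝_
  record _⇝_ (G H : List Vx) : Set where
    field
      ⇝wf  : ∀ {L} → WF L (tr G) → WF L (tr H)
      ⇝br  : ∀ {L} → Br L (tr G) → Br L (tr H)
      ⇝n3  : ∀ {L} → No3 L (tr G) → No3 L (tr H)
      ⇝Z   : ∀ L F → Z L G F ≡ Z L H F
      ⇝len : length G ≡ length H
  open _⇝_ public

  ⇝refl : ∀ {G} → G ⇝ G
  ⇝refl = record { ⇝wf = id ; ⇝br = id ; ⇝n3 = id ; ⇝Z = λ _ _ → refl ; ⇝len = refl }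

  _⇝∙_ : ∀ {G H K} → G ⇝ H → H ⇝ K → G ⇝ K
  p ⇝∙ q = record { ⇝wf = ⇝wf q ∘ ⇝wf p ; ⇝br = ⇝br q ∘ ⇝br p ; ⇝n3 = ⇝n3 q ∘ ⇝n3 p
    ; ⇝Z = λ L F → trans (⇝Z p L F) (⇝Z q L F) ; ⇝len = trans (⇝len p) (⇝len q) }

  tr-↭ : ∀ {G H} → G ↭ H → tr G ↭ tr H
  tr-↭ = map⁺ proj₁

  No3-↭ : ∀ {L G H} → G ↭ H → No3 L G → No3 L H
  No3-↭ p b X Y q = b X Y (ptrans p q)

  ⇝↭ : ∀ {G H} → G ↭ H → G ⇝ H
  ⇝↭ p = record { ⇝wf = WF-↭ (tr-↭ p) ; ⇝br = Br-↭ (tr-↭ p) ; ⇝n3 = No3-↭ (tr-↭ p)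
    ; ⇝Z = λ L F → Z-↭ L F p ; ⇝len = ↭-length p }

  ⇝sw : ∀ {x y Y} → Sw x y → x ∷ Y ⇝ y ∷ Y
  ⇝sw {x} {y} {Y} s = record
    { ⇝wf = λ w → wf (simple w) (λ l → trans (sym (occ-sw s l (tr Y))) (twice w l))
    ; ⇝br = λ b A B e d → case ∷-split e of λ
        { (inj₁ (A' , p , q)) → b (proj₁ x ∷ A') B (prep _ q) (trans (in' A' p) d)
        ; (inj₂ (B' , p , q)) → b A (proj₁ x ∷ B') (ptrans (prep _ q) (↭-sym (shift _ A B'))) d }
    ; ⇝n3 = λ b A B e k m d → case ∷-split e of λ
        { (inj₁ (A' , p , q)) → b (proj₁ x ∷ A') B (prep _ q) (subst (2 ≤_) (↭-length p) k) m (trans (in' A' p) d)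
        ; (inj₂ (B' , p , q)) → b A (proj₁ x ∷ B') (ptrans (prep _ q) (↭-sym (shift _ A B'))) k (subst (2 ≤_) (↭-length p) m) d }
    ; ⇝Z = λ L F → sum-cong L (λ σ → cong (λ z → z * pr Y σ * F σ) (ev-sw s σ)) zeros
    ; ⇝len = refl }
    where
    in' : ∀ {L A} A' → A ↭ proj₁ y ∷ A' → δ L (proj₁ x ∷ A') ≡ δ L A
    in' {L} {A} A' p = trans (δ-occ L {proj₁ x ∷ A'} {proj₁ y ∷ A'} (λ l → occ-sw s l A')) (sym (δ-↭ L p))

  frontSw : ∀ {l} t a → l ∈ labs (t ∷ []) → ∃[ m ] ∃[ n ] ∃[ b ] Sw (t , a) (tri l m n , b)
  frontSw (tri p q r) (wt a b c d) (here refl) = _ , _ , _ , s0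
  frontSw (tri p q r) (wt a b c d) (there (here refl)) = _ , _ , _ , s12 s0
  frontSw (tri p q r) (wt a b c d) (there (there (here refl))) = _ , _ , _ , s23 (s12 s0)

  frontPl : ∀ {l} t → l ∈ labs (t ∷ []) → ∃[ m ] ∃[ n ] Sw (plain t) (plain (tri l m n))
  frontPl (tri p q r) (here refl) = _ , _ , s0
  frontPl (tri p q r) (there (here refl)) = _ , _ , s12 s0
  frontPl (tri p q r) (there (there (here refl))) = _ , _ , s23 (s12 s0)

  labs-find : ∀ {l} (Y : List Tri) → l ∈ labs Y → ∃[ t ] ∃[ Y' ] Y ↭ t ∷ Y' × l ∈ labs (t ∷ [])
  labs-find (tri p q r ∷ Y) (here e) = _ , _ , prefl , here e
  labs-find (tri p q r ∷ Y) (there (here e)) = _ , _ , prefl , there (here e)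
  labs-find (tri p q r ∷ Y) (there (there (here e))) = _ , _ , prefl , there (there (here e))
  labs-find (tri p q r ∷ Y) (there (there (there m))) with labs-find Y m
  ... | t , Y' , p , i = t , _ ∷ Y' , ptrans (prep _ p) (pswap _ _ prefl) , i

  pl-↭ : ∀ {G H} → G ↭ H → pl G ↭ pl H
  pl-↭ = map⁺ plain

  pull : ∀ {l} A (Y : List Tri) → l ∈ labs Y → ∃[ m ] ∃[ n ] ∃[ Y' ] (A ++ pl Y ⇝ A ++ pl (tri l m n ∷ Y'))
  pull {l} A Y i with labs-find Y i
  ... | t , Y' , p , j with frontPl t j
  ...   | m , n , s = m , n , Y' ,
    (⇝↭ (++⁺ˡ A (pl-↭ p)) ⇝∙ (⇝↭ (shift (plain t) A (pl Y')) ⇝∙ (⇝sw s ⇝∙ ⇝↭ (↭-sym (shift (plain (tri l m n)) A (pl Y'))))))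

  other-end : ∀ {L X Y l} → WF L (X ++ Y) → occ l X ≡ 1 → l ∈ labs Y
  other-end {X = X} {Y} {l} w e with split3 {X = X} {Y} w l
  ... | c00 _ x _ rewrite e = case x of λ ()
  ... | c02 _ x _ rewrite e = case x of λ ()
  ... | c11 _ _ y = cnt⇒∈ _ (≤-reflexive (sym y))
  ... | c20 _ x _ rewrite e = case x of λ ()

  length3 : ∀ {x y z A} → x ∈ A → y ∈ A → z ∈ A → x ≢ y → x ≢ z → y ≢ z → 3 ≤ length A
  length3 {x} {y} {z} {A} i j k a b c with ∈-split i
  ... | B , p with ∈-split (tl (∈-resp-↭ p j) a)
    where
    tl : ∀ {u v : ℕ} {B} → v ∈ u ∷ B → u ≢ v → v ∈ B
    tl (here e) n = ⊥-elim (n (sym e))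
    tl (there m) n = m
  ...   | C , q with ∈-split (tl (∈-resp-↭ q (tl (∈-resp-↭ p k) b)) c)
    where
    tl : ∀ {u v : ℕ} {B} → v ∈ u ∷ B → u ≢ v → v ∈ B
    tl (here e) n = ⊥-elim (n (sym e))
    tl (there m) n = m
  ...     | D , r = subst (3 ≤_) (sym (trans (↭-length p) (cong suc (trans (↭-length q) (cong suc (↭-length r)))))) (s≤s (s≤s (s≤s z≤n)))

  inl-∈ : ∀ {L X Y l} → WF L (X ++ Y) → 2 ≤ occ l X → l ∈ inl L X
  inl-∈ {L} {X} {Y} {l} w h with split3 {X = X} {Y} w l
  ... | c00 _ x _ rewrite x = case h of λ ()
  ... | c02 _ x _ rewrite x = case h of λ ()
  ... | c11 _ x _ rewrite x = case h of λ { (s≤s ()) }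
  ... | c20 c x _ = cnt⇒∈ _ (≤-reflexive (sym (trans (cnt-sel (λ m → is2 (occ m X)) l L) (cong₂ (λ u v → bit (is2 u) * v) x c))))

  noTriple : ∀ {L} X Y → WF L (X ++ Y) → Br L (X ++ Y) → No3 L (X ++ Y) → length X ≡ 3 → 2 ≤ length Y →
    ∀ x y z → 2 ≤ occ x X → 2 ≤ occ y X → 2 ≤ occ z X → x ≢ y → x ≢ z → y ≢ z → ⊥
  noTriple {L} X Y w b n len ly x y z i j k a c d =
    fin (δ L X) (length (inl L X)) (trans (handshake X Y w) (cong (3 *_) len))
      (length3 (inl-∈ {X = X} w i) (inl-∈ {X = X} w j) (inl-∈ {X = X} w k) a c d)
      (b X Y prefl) (n X Y prefl (subst (2 ≤_) (sym len) (s≤s (s≤s z≤n))) ly)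
    where
    fin : ∀ d i → d + 2 * i ≡ 9 → 3 ≤ i → d ≢ 1 → d ≢ 3 → ⊥
    fin d (suc (suc (suc zero))) h _ _ n3 = n3 (+-cancelʳ-≡ 6 d 3 h)
    fin d (suc (suc (suc (suc zero)))) h _ n1 _ = n1 (+-cancelʳ-≡ 8 d 1 h)
    fin d (suc (suc (suc (suc (suc i))))) h _ _ _ = case +-cancelʳ-≡ 9 (d + (1 + 2 * i)) 0 (trans (lem d i) h) of λ e → case m+n≡0⇒n≡0 d e of λ ()
      where
      lem : ∀ d i → d + (1 + 2 * i) + 9 ≡ d + 2 * suc (suc (suc (suc (suc i))))
      lem = solve-∀
    fin d (suc zero) h (s≤s ()) _ _
    fin d (suc (suc zero)) h (s≤s (s≤s ())) _ _

  -- Voorhoeve's reduction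

  abstract
    eqD : (m l : ℕ) → m ≡ l ⊎ m ≢ l
    eqD = eqL

  record Uq (xs : List ℕ) : Set where
    constructor uq
    field once : ∀ l → cnt l xs ≤ 1
  open Uq public

  uniq-head : ∀ {x xs} → Uq (x ∷ xs) → x ∉ xs
  uniq-head {x} {xs} (uq h) m = case ≤-trans (+-mono-≤ (≤-reflexive (sym (δ-same x))) (∈⇒cnt m)) (h x) of λ { (s≤s ()) }

  uniq-tail : ∀ {x xs} → Uq (x ∷ xs) → Uq xs
  uniq-tail {x} {xs} (uq h) = uq λ l → ≤-trans (m≤n+m (cnt l xs) (δ= l x)) (h l)

  sel-cong : ∀ {p q : ℕ → Bool} L → (∀ l → p l ≡ q l) → sel p L ≡ sel q L
  sel-cong [] h = refl
  sel-cong {p} {q} (l ∷ L) h rewrite h l | sel-cong {p} {q} L h = refl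

  ren : ℕ → ℕ → ℕ → ℕ
  ren g e l = ifE (eqL l g) e l

  renT : ℕ → ℕ → Tri → Tri
  renT g e (tri p q r) = tri (ren g e p) (ren g e q) (ren g e r)

  δ-ren-e : ∀ {g e} → g ≢ e → ∀ p → δ= e (ren g e p) ≡ δ= e p + δ= g p
  δ-ren-e {g} {e} ne p with eqL p g
  ... | inj₁ refl rewrite δ-same e | δ-diff (ne ∘ sym) | δ-same p = refl
  ... | inj₂ n rewrite δ-diff (n ∘ sym) = sym (+-identityʳ _)

  δ-ren-g : ∀ {g e} → g ≢ e → ∀ p → δ= g (ren g e p) ≡ 0
  δ-ren-g {g} {e} ne p with eqL p g
  ... | inj₁ refl = δ-diff ne
  ... | inj₂ n = δ-diff (n ∘ sym)

  δ-ren-o : ∀ {g e l} → l ≢ g → l ≢ e → ∀ p → δ= l (ren g e p) ≡ δ= l p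
  δ-ren-o {g} {e} {l} ng ne p with eqL p g
  ... | inj₁ refl rewrite δ-diff ne | δ-diff ng = refl
  ... | inj₂ n = refl

  occ-ren-e : ∀ {g e} A → g ≢ e → occ e (map (renT g e) A) ≡ occ e A + occ g A
  occ-ren-e [] ne = refl
  occ-ren-e {g} {e} (tri p q r ∷ A) ne rewrite occ-ren-e A ne | δ-ren-e ne p | δ-ren-e ne q | δ-ren-e ne r =
    lem (δ= e p) (δ= g p) (δ= e q) (δ= g q) (δ= e r) (δ= g r) (occ e A) (occ g A)
    where
    lem : ∀ a b c d u v x y → a + b + (c + d + (u + v + (x + y))) ≡ a + (c + (u + x)) + (b + (d + (v + y)))
    lem = solve-∀

  occ-ren-g : ∀ {g e} A → g ≢ e → occ g (map (renT g e) A) ≡ 0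
  occ-ren-g [] ne = refl
  occ-ren-g {g} {e} (tri p q r ∷ A) ne rewrite occ-ren-g A ne | δ-ren-g ne p | δ-ren-g ne q | δ-ren-g ne r = refl

  occ-ren-o : ∀ {g e l} A → l ≢ g → l ≢ e → occ l (map (renT g e) A) ≡ occ l A
  occ-ren-o [] _ _ = refl
  occ-ren-o {g} {e} {l} (tri p q r ∷ A) ng ne
    rewrite occ-ren-o A ng ne | δ-ren-o ng ne p | δ-ren-o ng ne q | δ-ren-o ng ne r = refl

  pr-ren : ∀ {g e} A σ → pr (pl (map (renT g e) A)) σ ≡ pr (pl A) (σ ∘ ren g e)
  pr-ren [] σ = refl
  pr-ren (tri p q r ∷ A) σ = cong (w3 (wt 1 1 1 0) (σ (ren _ _ p)) (σ (ren _ _ q)) (σ (ren _ _ r)) *_) (pr-ren A σ)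

  map-split : ∀ {A B : Set} (f : A → B) R X Y → map f R ≡ X ++ Y → ∃[ X' ] ∃[ Y' ] R ≡ X' ++ Y' × X ≡ map f X' × Y ≡ map f Y'
  map-split f R [] Y e = [] , R , refl , refl , sym e
  map-split f (r ∷ R) (x ∷ X) Y e with map-split f R X Y (∷-injectiveʳ e)
  ... | X' , Y' , a , b , c = r ∷ X' , Y' , cong (r ∷_) a , cong₂ _∷_ (sym (∷-injectiveˡ e)) b , c

  map-split↭ : ∀ {A B : Set} (f : A → B) R {X Y} → map f R ↭ X ++ Y → ∃[ X' ] ∃[ Y' ] R ↭ X' ++ Y' × X ≡ map f X' × Y ≡ map f Y'
  map-split↭ f R {X} {Y} p with ↭-map-inv f p
  ... | R' , e , q with map-split f R' X Y (sym e)
  ...   | X' , Y' , a , b , c = X' , Y' , ptrans q (↭-reflexive a) , b , c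

  record Good (L₁ : List ℕ) (w : Tri) (R₁ R : List Tri) (e : ℕ) : Set where
    field
      gwf   : WF L₁ (w ∷ R₁)
      gbr   : Br L₁ (w ∷ R₁)
      gstar : ∀ A B → R₁ ↭ A ++ B → 2 ≤ length A → δ L₁ A ≡ 3 → occ e A ≡ 2
      glen  : length R₁ ≡ length R
      gold  : ∀ X Y → R₁ ↭ X ++ Y → (∀ {t} → t ∈ X → e ∉ labs (t ∷ [])) → ∃[ Y' ] R ↭ X ++ Y'
      gin   : occ e R₁ ≡ 2
      gw    : occ e (w ∷ []) ≡ 0
  open Good public

  wP : Bool → Bool → Bool → ℕ
  wP = w3 (wt 1 1 1 0)

  nb : Bool → ℕ
  nb b = if b then 0 else 1

  w4 : Bool → Bool → Bool → Bool → ℕ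
  w4 true false false false = 1
  w4 false true false false = 1
  w4 false false true false = 1
  w4 false false false true = 1
  w4 _ _ _ _ = 0

  -- Voorhoeve's reduction: the vertex e a b and its neighbours across a and b are replaced by one vertex carrying three of
  -- the four outer labels, and the fourth is identified with e.
  module Voor {L e a b g₁ g₂ g₃ g₄ R}
    (w : WF L (tri e a b ∷ tri a g₁ g₂ ∷ tri b g₃ g₄ ∷ R))
    (br : Br L (tri e a b ∷ tri a g₁ g₂ ∷ tri b g₃ g₄ ∷ R))
    (n3 : No3 L (tri e a b ∷ tri a g₁ g₂ ∷ tri b g₃ g₄ ∷ R)) (lr : 3 ≤ length R) where

    X : List Tri
    X = tri e a b ∷ tri a g₁ g₂ ∷ tri b g₃ g₄ ∷ []

    occX : ∀ l → occ l X ≡ cnt l (e ∷ a ∷ b ∷ g₁ ∷ g₂ ∷ g₃ ∷ g₄ ∷ []) + δ= l a + δ= l b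
    occX l = lem (δ= l e) (δ= l a) (δ= l b) (δ= l g₁) (δ= l g₂) (δ= l g₃) (δ= l g₄)
      where
      lem : ∀ e a b g h i j → e + (a + (b + (a + (g + (h + (b + (i + (j + 0)))))))) ≡ e + (a + (b + (g + (h + (i + (j + 0)))))) + a + b
      lem = solve-∀

    occX≤2 : ∀ l → occ l X ≤ 2
    occX≤2 l with split3 {X = X} {R} w l
    ... | c00 _ x _ rewrite x = z≤n
    ... | c02 _ x _ rewrite x = z≤n
    ... | c11 _ x _ rewrite x = s≤s z≤n
    ... | c20 _ x _ rewrite x = ≤-refl

    occ-ge : ∀ l m n → m ≤ cnt l (e ∷ a ∷ b ∷ g₁ ∷ g₂ ∷ g₃ ∷ g₄ ∷ []) → n ≤ δ= l a + δ= l b → m + n ≤ occ l X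
    occ-ge l m n p q = ≤-trans (+-mono-≤ p q) (≤-reflexive (trans (sym (+-assoc _ (δ= l a) (δ= l b))) (sym (occX l))))

    a≢b : a ≢ b
    a≢b = proj₂ (proj₂ (dist3 (noloop w br)))

    δa : 1 ≤ δ= a a + δ= a b
    δa = ≤-trans (≤-reflexive (sym (δ-same a))) (m≤m+n _ _)

    δb : 1 ≤ δ= b a + δ= b b
    δb = ≤-trans (≤-reflexive (sym (δ-same b))) (m≤n+m _ (δ= b a))

    seven : ∀ l → cnt l (e ∷ a ∷ b ∷ g₁ ∷ g₂ ∷ g₃ ∷ g₄ ∷ []) ≤ 1
    seven l with cnt l (e ∷ a ∷ b ∷ g₁ ∷ g₂ ∷ g₃ ∷ g₄ ∷ []) in eq
    ... | 0 = z≤n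
    ... | 1 = ≤-refl
    ... | suc (suc k) with eqD l a | eqD l b
    ...   | inj₁ refl | _ = case ≤-trans (occ-ge l 2 1 ge δa) (occX≤2 l) of λ { (s≤s (s≤s ())) }
      where
      ge : 2 ≤ cnt l (e ∷ a ∷ b ∷ g₁ ∷ g₂ ∷ g₃ ∷ g₄ ∷ [])
      ge = ≤-trans (s≤s (s≤s z≤n)) (≤-reflexive (sym eq))
    ...   | inj₂ _ | inj₁ refl = case ≤-trans (occ-ge l 2 1 ge δb) (occX≤2 l) of λ { (s≤s (s≤s ())) }
      where
      ge : 2 ≤ cnt l (e ∷ a ∷ b ∷ g₁ ∷ g₂ ∷ g₃ ∷ g₄ ∷ [])
      ge = ≤-trans (s≤s (s≤s z≤n)) (≤-reflexive (sym eq))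
    ...   | inj₂ na | inj₂ nb' = ⊥-elim (noTriple X R w br n3 refl (≤-trans (s≤s (s≤s z≤n)) lr) a b l
        (occ-ge a 1 1 (∈⇒cnt {A = e ∷ a ∷ b ∷ g₁ ∷ g₂ ∷ g₃ ∷ g₄ ∷ []} (there (here refl))) δa)
        (occ-ge b 1 1 (∈⇒cnt {A = e ∷ a ∷ b ∷ g₁ ∷ g₂ ∷ g₃ ∷ g₄ ∷ []} (there (there (here refl)))) δb)
        (≤-trans (≤-trans (s≤s (s≤s z≤n)) (≤-reflexive (sym eq))) (≤-trans (≤-reflexive (sym (+-identityʳ _))) (occ-ge l _ 0 ≤-refl z≤n)))
        a≢b (na ∘ sym) (nb' ∘ sym))

    uqs : Uq (e ∷ a ∷ b ∷ g₁ ∷ g₂ ∷ g₃ ∷ g₄ ∷ [])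
    uqs = uq seven
    e∉ : e ∉ a ∷ b ∷ g₁ ∷ g₂ ∷ g₃ ∷ g₄ ∷ []
    e∉ = uniq-head uqs
    a∉ : a ∉ b ∷ g₁ ∷ g₂ ∷ g₃ ∷ g₄ ∷ []
    a∉ = uniq-head (uniq-tail uqs)
    b∉ : b ∉ g₁ ∷ g₂ ∷ g₃ ∷ g₄ ∷ []
    b∉ = uniq-head (uniq-tail (uniq-tail uqs))
    g∉ : g₁ ∉ g₂ ∷ g₃ ∷ g₄ ∷ []
    g∉ = uniq-head (uniq-tail (uniq-tail (uniq-tail uqs)))

    g≢e : g₁ ≢ e
    g≢e x = e∉ (there (there (here (sym x))))
    a≢e : a ≢ e
    a≢e x = e∉ (here (sym x))
    b≢e : b ≢ e
    b≢e x = e∉ (there (here (sym x)))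
    a≢g : a ≢ g₁
    a≢g x = a∉ (there (here x))
    b≢g : b ≢ g₁
    b≢g x = b∉ (here x)

    private
      thr : ∀ l → Three (occ l X) (occ l R) (cnt l L)
      thr l = split3 {X = X} {R} w l

    ones : ∀ l → 1 ≤ cnt l (e ∷ g₁ ∷ g₂ ∷ g₃ ∷ g₄ ∷ []) → l ≢ a → l ≢ b → occ l R ≡ 1 × cnt l L ≡ 1 × occ l X ≡ 1
    ones l p na nb' with thr l | occ≡1
      where
      le : 1 ≤ cnt l (e ∷ a ∷ b ∷ g₁ ∷ g₂ ∷ g₃ ∷ g₄ ∷ [])
      le = ≤-trans p (≤-trans (m≤m+n _ (δ= l a + δ= l b)) (≤-reflexive (lem (δ= l e) (δ= l a) (δ= l b) (δ= l g₁) (δ= l g₂) (δ= l g₃) (δ= l g₄))))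
        where
        lem : ∀ e a b g h i j → e + (g + (h + (i + (j + 0)))) + (a + b) ≡ e + (a + (b + (g + (h + (i + (j + 0))))))
        lem = solve-∀
      occ≡1 : occ l X ≡ 1
      occ≡1 = trans (occX l) (trans (cong₂ (λ x y → cnt l (e ∷ a ∷ b ∷ g₁ ∷ g₂ ∷ g₃ ∷ g₄ ∷ []) + x + y) (δ-diff na) (δ-diff nb'))
        (trans (+-identityʳ _) (trans (+-identityʳ _) (≤-antisym (seven l) le))))
    ... | c00 _ x _ | y = case trans (sym x) y of λ ()
    ... | c02 _ x _ | y = case trans (sym x) y of λ ()
    ... | c11 c x r | y = r , c , x
    ... | c20 _ x _ | y = case trans (sym x) y of λ ()

    e1 : occ e R ≡ 1 × cnt e L ≡ 1 × occ e X ≡ 1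
    e1 = ones e (∈⇒cnt {A = e ∷ g₁ ∷ g₂ ∷ g₃ ∷ g₄ ∷ []} (here refl)) (a≢e ∘ sym) (b≢e ∘ sym)

    g1 : occ g₁ R ≡ 1 × cnt g₁ L ≡ 1 × occ g₁ X ≡ 1
    g1 = ones g₁ (∈⇒cnt {A = e ∷ g₁ ∷ g₂ ∷ g₃ ∷ g₄ ∷ []} (there (here refl))) (a≢g ∘ sym) (b≢g ∘ sym)

    zer : ∀ l → 1 ≤ δ= l a + δ= l b → occ l R ≡ 0 × cnt l L ≡ 1
    zer l p with thr l | occ-ge l 1 1 pos p
      where
      pos : 1 ≤ cnt l (e ∷ a ∷ b ∷ g₁ ∷ g₂ ∷ g₃ ∷ g₄ ∷ [])
      pos = ≤-trans p (≤-trans (m≤n+m _ (δ= l e + (δ= l g₁ + (δ= l g₂ + (δ= l g₃ + (δ= l g₄ + 0)))))) (≤-reflexive (lem (δ= l e) (δ= l a) (δ= l b) (δ= l g₁) (δ= l g₂) (δ= l g₃) (δ= l g₄))))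
        where
        lem : ∀ e a b g h i j → e + (g + (h + (i + (j + 0)))) + (a + b) ≡ e + (a + (b + (g + (h + (i + (j + 0))))))
        lem = solve-∀
    ... | c00 _ x _ | y rewrite x = case y of λ ()
    ... | c02 _ x _ | y rewrite x = case y of λ ()
    ... | c11 _ x _ | y rewrite x = case y of λ { (s≤s ()) }
    ... | c20 c _ r | _ = r , c

    az : occ a R ≡ 0 × cnt a L ≡ 1
    az = zer a δa
    bz : occ b R ≡ 0 × cnt b L ≡ 1
    bz = zer b δb

    k₅ k₁ : ℕ → Bool
    k₅ l = ifE (eqL l a) false (ifE (eqL l b) false true)
    k₁ l = ifE (eqL l a) false (ifE (eqL l b) false (ifE (eqL l g₁) false true))

    L₅ L₁ : List ℕ
    L₅ = sel k₅ L
    L₁ = sel k₁ L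

    R₁ : List Tri
    R₁ = map (renT g₁ e) R

    W : Tri
    W = tri g₂ g₃ g₄

    oth : ∀ l → l ≢ e → l ≢ a → l ≢ b → l ≢ g₁ → cnt l (g₂ ∷ g₃ ∷ g₄ ∷ []) + occ l R ≡ cnt l L + cnt l L
    oth l ne na nb' ng = trans (cong (_+ occ l R) (sym eq)) (trans (sym (occ-++ l X R)) (twice w l))
      where
      eq : occ l X ≡ cnt l (g₂ ∷ g₃ ∷ g₄ ∷ [])
      eq rewrite δ-diff ne | δ-diff na | δ-diff nb' | δ-diff ng = refl

    W∌ : ∀ {l} → l ∉ g₂ ∷ g₃ ∷ g₄ ∷ [] → cnt l (g₂ ∷ g₃ ∷ g₄ ∷ []) ≡ 0
    W∌ = ∉⇒cnt _

    W∌e : cnt e (g₂ ∷ g₃ ∷ g₄ ∷ []) ≡ 0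
    W∌e = W∌ (λ m → e∉ (there (there (there m))))

    WF₁ : WF L₁ (W ∷ R₁)
    WF₁ = wf s t
      where
      s : ∀ l → cnt l L₁ ≤ 1
      s l rewrite cnt-sel k₁ l L with k₁ l
      ... | true = subst (_≤ 1) (sym (+-identityʳ _)) (simple w l)
      ... | false = z≤n
      t : ∀ l → occ l (W ∷ R₁) ≡ cnt l L₁ + cnt l L₁
      t l rewrite cnt-++ l (g₂ ∷ g₃ ∷ g₄ ∷ []) (labs R₁) | cnt-sel k₁ l L with eqL l a | eqL l b | eqL l g₁
      ... | inj₁ refl | _ | _ rewrite W∌ {l} (λ m → a∉ (there (there m))) | occ-ren-o {g₁} {e} {l} R a≢g a≢e | proj₁ az = refl
      ... | inj₂ _ | inj₁ refl | _ rewrite W∌ {l} (λ m → b∉ (there m)) | occ-ren-o {g₁} {e} {l} R b≢g b≢e | proj₁ bz = refl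
      ... | inj₂ _ | inj₂ _ | inj₁ refl rewrite W∌ {l} g∉ | occ-ren-g {l} {e} R g≢e = refl
      ... | inj₂ na | inj₂ nb' | inj₂ ng with eqL l e
      ...   | inj₁ refl rewrite W∌e | occ-ren-e {g₁} {l} R g≢e | proj₁ e1 | proj₁ g1 | proj₁ (proj₂ e1) = refl
      ...   | inj₂ ne rewrite occ-ren-o {g₁} {e} {l} R ng ne | oth l ne na nb' ng | +-identityʳ (cnt l L) = refl

  sumL-cδ : ∀ c m L → sumL (λ l → c * δ= l m) L ≡ c * cnt m L
  sumL-cδ c m [] = sym (*-zeroʳ c)
  sumL-cδ c m (l ∷ L) = trans (cong₂ _+_ (cong (c *_) (δ-sym l m)) (sumL-cδ c m L)) (sym (*-distribˡ-+ c (δ= m l) (cnt m L)))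

  map-ren : ∀ {g e} X → g ≢ e → (∀ {t} → t ∈ map (renT g e) X → e ∉ labs (t ∷ [])) → map (renT g e) X ≡ X
  map-ren [] ne n = refl
  map-ren {g} {e} (tri p q r ∷ X) ne n = cong₂ _∷_
      (cong₃ (same p (n (here refl) ∘ here)) (same q (n (here refl) ∘ there ∘ here)) (same r (n (here refl) ∘ there ∘ there ∘ here))) (map-ren X ne (n ∘ there))
    where
    same : ∀ p → e ≢ ren g e p → ren g e p ≡ p
    same p h with eqL p g
    ... | inj₁ _ = ⊥-elim (h refl)
    ... | inj₂ _ = refl
    cong₃ : ∀ {a b c d u v} → a ≡ b → c ≡ d → u ≡ v → tri a c u ≡ tri b d v
    cong₃ refl refl refl = refl

  module Voor2 {L e a b g₁ g₂ g₃ g₄ R}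
    (w : WF L (tri e a b ∷ tri a g₁ g₂ ∷ tri b g₃ g₄ ∷ R))
    (br : Br L (tri e a b ∷ tri a g₁ g₂ ∷ tri b g₃ g₄ ∷ R))
    (n3 : No3 L (tri e a b ∷ tri a g₁ g₂ ∷ tri b g₃ g₄ ∷ R)) (lr : 3 ≤ length R) where
    open Voor w br n3 lr public

    k1a : bit (k₁ a) ≡ 0
    k1a with eqL a a
    ... | inj₁ _ = refl
    ... | inj₂ n = ⊥-elim (n refl)

    k1b : bit (k₁ b) ≡ 0
    k1b with eqL b a | eqL b b
    ... | inj₁ _ | _ = refl
    ... | inj₂ _ | inj₁ _ = refl
    ... | inj₂ _ | inj₂ n = ⊥-elim (n refl)

    k1g : bit (k₁ g₁) ≡ 0
    k1g with eqL g₁ a | eqL g₁ b | eqL g₁ g₁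
    ... | inj₁ _ | _ | _ = refl
    ... | inj₂ _ | inj₁ _ | _ = refl
    ... | inj₂ _ | inj₂ _ | inj₁ _ = refl
    ... | inj₂ _ | inj₂ _ | inj₂ n = ⊥-elim (n refl)

    k1o : ∀ {l} → l ≢ a → l ≢ b → l ≢ g₁ → bit (k₁ l) ≡ 1
    k1o {l} na nb' ng with eqL l a | eqL l b | eqL l g₁
    ... | inj₁ h | _ | _ = ⊥-elim (na h)
    ... | inj₂ _ | inj₁ h | _ = ⊥-elim (nb' h)
    ... | inj₂ _ | inj₂ _ | inj₁ h = ⊥-elim (ng h)
    ... | inj₂ _ | inj₂ _ | inj₂ _ = refl

    module _ (A B : List Tri) (p : R ↭ A ++ B) where
      x y : ℕ
      x = occ e A
      y = occ g₁ A

      occA≤ : ∀ l → occ l A ≤ occ l R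
      occA≤ l = ≤-trans (m≤m+n _ _) (≤-reflexive (trans (sym (occ-++ l A B)) (sym (occ-↭ l p))))

      f : ℕ → ℕ
      f l = bit (is1 (occ l A))

      zA : ∀ l → occ l R ≡ 0 → f l ≡ 0
      zA l h rewrite n≤0⇒n≡0 (≤-trans (occA≤ l) (≤-reflexive h)) = refl

      δ-ren : δ L₁ (map (renT g₁ e) A) + (f e + f g₁) ≡ δ L A + bit (is1 (x + y))
      δ-ren = trans (cong₂ _+_ (trans (δ-sumL L₁ _) (sumL-sel _ k₁ L)) (sym (trans (sumL-+ _ _ L)
          (cong₂ _+_ (trans (sumL-cδ (f e) e L) (trans (cong (f e *_) (proj₁ (proj₂ e1))) (*-identityʳ (f e))))
                     (trans (sumL-cδ (f g₁) g₁ L) (trans (cong (f g₁ *_) (proj₁ (proj₂ g1))) (*-identityʳ (f g₁))))))))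
        (trans (sym (sumL-+ _ _ L)) (trans (sumL-cong L go) (trans (sumL-+ f _ L)
          (cong₂ _+_ (sym (δ-sumL L A)) (trans (sumL-cδ (bit (is1 (x + y))) e L) (trans (cong (bit (is1 (x + y)) *_) (proj₁ (proj₂ e1))) (*-identityʳ _)))))))
        where
        lem0 : ∀ a b c → a ≡ 0 → b * 0 + c * 0 ≡ a + bit (is1 (x + y)) * 0
        lem0 a b c refl rewrite *-zeroʳ b | *-zeroʳ c | *-zeroʳ (bit (is1 (x + y))) = refl
        go : ∀ l → bit (k₁ l) * bit (is1 (occ l (map (renT g₁ e) A))) + (f e * δ= l e + f g₁ * δ= l g₁)
               ≡ f l + bit (is1 (x + y)) * δ= l e
        go l with eqD l a | eqD l b | eqD l g₁ | eqD l e
        ... | inj₁ refl | _ | _ | _ rewrite k1a | δ-diff a≢e | δ-diff a≢g = lem0 (f a) (f e) (f g₁) (zA a (proj₁ az))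
        ... | inj₂ na | inj₁ refl | _ | _ rewrite k1b | δ-diff b≢e | δ-diff b≢g = lem0 (f b) (f e) (f g₁) (zA b (proj₁ bz))
        ... | inj₂ na | inj₂ nb' | inj₁ refl | _ rewrite k1g | δ-diff g≢e | δ-same g₁ | *-zeroʳ (f e) | *-zeroʳ (bit (is1 (x + y))) | *-identityʳ (f g₁) = sym (+-identityʳ _)
        ... | inj₂ na | inj₂ nb' | inj₂ ng | inj₁ refl rewrite k1o na nb' ng | occ-ren-e {g₁} {e} A g≢e | δ-same e | δ-diff (ng) | *-identityʳ (f e) | *-zeroʳ (f g₁) | *-identityʳ (bit (is1 (x + y))) | +-identityʳ (f e) | +-identityʳ (bit (is1 (x + y))) = +-comm _ (f e)
        ... | inj₂ na | inj₂ nb' | inj₂ ng | inj₂ ne rewrite k1o na nb' ng | occ-ren-o {g₁} {e} {l} A ng ne | δ-diff ne | δ-diff ng | *-zeroʳ (f e) | *-zeroʳ (f g₁) | *-zeroʳ (bit (is1 (x + y))) | +-identityʳ (f l) | +-identityʳ (f l) = refl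

      Keq : X ++ R ↭ A ++ (B ++ X)
      Keq = ptrans (++-comm X R) (ptrans (++⁺ʳ X p) (++-assoc A B X))

      lenBX : 2 ≤ length (B ++ X)
      lenBX = ≤-trans (s≤s (s≤s z≤n)) (≤-trans (m≤n+m 3 (length B)) (≤-reflexive (sym (length-++ B))))

      data Alt : Set where
        same : δ L₁ (map (renT g₁ e) A) ≡ δ L A → Alt
        both : x ≡ 1 → y ≡ 1 → δ L A ≡ 2 + δ L₁ (map (renT g₁ e) A) → Alt

      alt : Alt
      alt with x in ex | y in ey | δ-ren | ≤-trans (occA≤ e) (≤-reflexive (proj₁ e1)) | ≤-trans (occA≤ g₁) (≤-reflexive (proj₁ g1))
      ... | 0 | 0 | h | _ | _ = same (+-cancelʳ-≡ 0 _ _ h)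
      ... | 1 | 0 | h | _ | _ = same (+-cancelʳ-≡ 1 _ _ h)
      ... | 0 | 1 | h | _ | _ = same (+-cancelʳ-≡ 1 _ _ h)
      ... | 1 | 1 | h | _ | _ = both ex ey (trans (sym (trans h (+-identityʳ _))) (+-comm _ 2))
      ... | suc (suc _) | _ | _ | k | _ = case k of λ { (s≤s ()) }
      ... | 0 | suc (suc _) | _ | _ | k = case k of λ { (s≤s ()) }
      ... | 1 | suc (suc _) | _ | _ | k = case k of λ { (s≤s ()) }

      δ₁≢1 : δ L₁ (map (renT g₁ e) A) ≢ 1
      δ₁≢1 h with alt
      ... | same q = br A (B ++ X) Keq (trans (sym q) h)
      ... | both ex ey q = go A p ex ey (trans q (cong (2 +_) h)) Keq
        where
        go : ∀ A → R ↭ A ++ B → occ e A ≡ 1 → occ g₁ A ≡ 1 → δ L A ≡ 3 → X ++ R ↭ A ++ (B ++ X) → ⊥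
        go [] _ () _ _ _
        go (t ∷ s ∷ A) p ex ey h k = n3 (t ∷ s ∷ A) (B ++ X) k (s≤s (s≤s z≤n)) lenBX h
        go (t ∷ []) p ex ey h k = noTriple (tri e a b ∷ tri a g₁ g₂ ∷ t ∷ []) (tri b g₃ g₄ ∷ B)
          (WF-↭ qq w) (Br-↭ qq br) (No3-↭ qq n3) refl (s≤s (≤-trans (s≤s z≤n) (≤-pred (subst (3 ≤_) (↭-length p) lr))))
          e a g₁
          (ge e (tri e a b ∷ tri a g₁ g₂ ∷ []) t (∈⇒cnt {A = e ∷ a ∷ b ∷ a ∷ g₁ ∷ g₂ ∷ []} (here refl)) ex)
          (≤-trans (two a e b g₁ g₂) (≤-trans (m≤m+n _ _) (≤-reflexive (sym (occ-++ a (tri e a b ∷ tri a g₁ g₂ ∷ []) (t ∷ []))))))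
          (ge g₁ (tri e a b ∷ tri a g₁ g₂ ∷ []) t (∈⇒cnt {A = e ∷ a ∷ b ∷ a ∷ g₁ ∷ g₂ ∷ []} (there (there (there (there (here refl)))))) ey)
          (a≢e ∘ sym) (g≢e ∘ sym) a≢g
          where
          qq : X ++ R ↭ (tri e a b ∷ tri a g₁ g₂ ∷ t ∷ []) ++ (tri b g₃ g₄ ∷ B)
          qq = prep _ (prep _ (ptrans (prep _ p) (pswap _ _ prefl)))
          ge : ∀ l P t → 1 ≤ occ l P → occ l (t ∷ []) ≡ 1 → 2 ≤ occ l (P ++ t ∷ [])
          ge l P t h k = ≤-trans (+-mono-≤ h (≤-reflexive (sym k))) (≤-reflexive (sym (occ-++ l P (t ∷ []))))
          two : ∀ a e b g h → 2 ≤ cnt a (e ∷ a ∷ b ∷ a ∷ g ∷ h ∷ [])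
          two a e b g h rewrite δ-same a = ≤-trans (≤-trans (s≤s (s≤s z≤n)) (m≤n+m 2 (δ= a e + δ= a b + (δ= a g + (δ= a h + 0)))))
            (≤-reflexive (lem (δ= a e) (δ= a b) (δ= a g + (δ= a h + 0))))
            where
            lem : ∀ x y z → x + y + z + 2 ≡ x + (1 + (y + (1 + z)))
            lem = solve-∀

      δ₁≡3 : 2 ≤ length A → δ L₁ (map (renT g₁ e) A) ≡ 3 → occ e (map (renT g₁ e) A) ≡ 2
      δ₁≡3 len h with alt
      ... | same q = ⊥-elim (n3 A (B ++ X) Keq len lenBX (trans (sym q) h))
      ... | both ex ey q = trans (occ-ren-e A g≢e) (cong₂ _+_ ex ey)

    Br₁ : Br L₁ (W ∷ R₁)
    Br₁ A B p h with ∷-split p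
    ... | inj₂ (B' , q , r) with map-split↭ (renT g₁ e) R {A} {B'} r
    ...   | A₀ , B₀ , s , refl , refl = δ₁≢1 A₀ B₀ s h
    Br₁ A B p h | inj₁ (A' , q , r) with map-split↭ (renT g₁ e) R {A'} {B} r
    ...   | A₀ , B₀ , s , refl , refl = δ₁≢1 B₀ A₀ (ptrans s (++-comm A₀ B₀)) (trans (sym (δ-compl A B (WF-↭ p WF₁))) h)

    good : Good L₁ W R₁ R e
    good = record
      { gwf = WF₁ ; gbr = Br₁
      ; gstar = λ A B p len h → case map-split↭ (renT g₁ e) R {A} {B} p of λ
          { (A₀ , B₀ , s , refl , refl) → δ₁≡3 A₀ B₀ s (subst (2 ≤_) (length-map (renT g₁ e) A₀) len) h }
      ; glen = length-map (renT g₁ e) R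
      ; gold = λ X Y p n → case map-split↭ (renT g₁ e) R {X} {Y} p of λ
          { (X₀ , Y₀ , s , refl , refl) → Y₀ , subst (λ z → R ↭ z ++ Y₀) (sym (map-ren X₀ g≢e n)) s }
      ; gin = trans (occ-ren-e R g≢e) (cong₂ _+_ (proj₁ e1) (proj₁ g1))
      ; gw = W∌e }

  w4-tab : ∀ E p q r s → wP E true true * wP true p q * wP true r s * nb E + wP E true false * wP true p q * wP false r s * nb E
    + (wP E false true * wP false p q * wP true r s * nb E + wP E false false * wP false p q * wP false r s * nb E) ≡ nb E * w4 p q r s
  w4-tab true true true true true = refl
  w4-tab true true true true false = refl
  w4-tab true true true false true = refl
  w4-tab true true true false false = refl
  w4-tab true true false true true = refl
  w4-tab true true false true false = refl
  w4-tab true true false false true = refl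
  w4-tab true true false false false = refl
  w4-tab true false true true true = refl
  w4-tab true false true true false = refl
  w4-tab true false true false true = refl
  w4-tab true false true false false = refl
  w4-tab true false false true true = refl
  w4-tab true false false true false = refl
  w4-tab true false false false true = refl
  w4-tab true false false false false = refl
  w4-tab false true true true true = refl
  w4-tab false true true true false = refl
  w4-tab false true true false true = refl
  w4-tab false true true false false = refl
  w4-tab false true false true true = refl
  w4-tab false true false true false = refl
  w4-tab false true false false true = refl
  w4-tab false true false false false = refl
  w4-tab false false true true true = refl
  w4-tab false false true true false = refl
  w4-tab false false true false true = refl
  w4-tab false false true false false = refl
  w4-tab false false false true true = refl
  w4-tab false false false true false = refl
  w4-tab false false false false true = refl
  w4-tab false false false false false = refl

  w4-split : ∀ p q r s → nb p * wP q r s + nb q * wP p r s + (nb r * wP s p q + nb s * wP r p q) ≡ 3 * w4 p q r s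
  w4-split true true true true = refl
  w4-split true true true false = refl
  w4-split true true false true = refl
  w4-split true true false false = refl
  w4-split true false true true = refl
  w4-split true false true false = refl
  w4-split true false false true = refl
  w4-split true false false false = refl
  w4-split false true true true = refl
  w4-split false true true false = refl
  w4-split false true false true = refl
  w4-split false true false false = refl
  w4-split false false true true = refl
  w4-split false false true false = refl
  w4-split false false false true = refl
  w4-split false false false false = refl

  w4-neg : ∀ p q r s → nb p * wP q r s ≡ w4 p q r s * nb p
  w4-neg true true true true = refl
  w4-neg true true true false = refl
  w4-neg true true false true = refl
  w4-neg true true false false = refl
  w4-neg true false true true = refl
  w4-neg true false true false = refl
  w4-neg true false false true = refl
  w4-neg true false false false = refl
  w4-neg false true true true = refl
  w4-neg false true true false = refl
  w4-neg false true false true = refl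
  w4-neg false true false false = refl
  w4-neg false false true true = refl
  w4-neg false false true false = refl
  w4-neg false false false true = refl
  w4-neg false false false false = refl

  module Voor3 {L e a b g₁ g₂ g₃ g₄ R}
    (w : WF L (tri e a b ∷ tri a g₁ g₂ ∷ tri b g₃ g₄ ∷ R))
    (br : Br L (tri e a b ∷ tri a g₁ g₂ ∷ tri b g₃ g₄ ∷ R))
    (n3 : No3 L (tri e a b ∷ tri a g₁ g₂ ∷ tri b g₃ g₄ ∷ R)) (lr : 3 ≤ length R)
    {A F} (dF : Dep A F) (a∉A : a ∉ A) (b∉A : b ∉ A) where
    open Voor2 w br n3 lr public

    Q : Asg → ℕ
    Q = pr (pl R)

    φ : Bool → Bool → Asg → ℕ
    φ x y τ = wP (τ e) x y * (wP x (τ g₁) (τ g₂) * (wP y (τ g₃) (τ g₄) * Q τ)) * (nb (τ e) * F τ)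

    depQ : Dep (labs R) Q
    depQ = subst (λ z → Dep (labs z) Q) (tr-pl R) (pr-dep (pl R))

    φ-upd : ∀ x y u v σ → φ x y (upd (upd σ a u) b v) ≡ φ x y σ
    φ-upd x y u v σ = eq (ag e (λ z → e∉ (here z)) (λ z → e∉ (there (here z))))
        (ag g₁ (λ z → a≢g (sym z)) (λ z → b≢g (sym z)))
        (ag g₂ (λ z → a∉ (there (there (here (sym z))))) (λ z → b∉ (there (here (sym z)))))
        (ag g₃ (λ z → a∉ (there (there (there (here (sym z)))))) (λ z → b∉ (there (there (here (sym z))))))
        (ag g₄ (λ z → a∉ (there (there (there (there (here (sym z))))))) (λ z → b∉ (there (there (there (here (sym z)))))))
        (depQ _ _ λ l m → ag l (λ { refl → cnt⇒∉ (proj₁ az) m }) (λ { refl → cnt⇒∉ (proj₁ bz) m }))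
        (dF _ _ λ l m → ag l (λ { refl → a∉A m }) (λ { refl → b∉A m }))
      where
      ag : ∀ l → l ≢ a → l ≢ b → upd (upd σ a u) b v l ≡ σ l
      ag l na nb' = trans (upd-diff (upd σ a u) v nb') (upd-diff σ u na)
      eq : ∀ {τ} → τ e ≡ σ e → τ g₁ ≡ σ g₁ → τ g₂ ≡ σ g₂ → τ g₃ ≡ σ g₃ → τ g₄ ≡ σ g₄ → Q τ ≡ Q σ → F τ ≡ F σ → φ x y τ ≡ φ x y σ
      eq h1 h2 h3 h4 h5 h6 h7 rewrite h1 | h2 | h3 | h4 | h5 | h6 | h7 = refl

    E4 : Asg → ℕ
    E4 σ = nb (σ e) * (w4 (σ g₁) (σ g₂) (σ g₃) (σ g₄) * (Q σ * F σ))

    inner : ∀ σ → sumOver (a ∷ b ∷ []) (λ τ → φ (τ a) (τ b) τ) σ ≡ E4 σ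
    inner σ = trans (sum-peel (b ∷ []) (λ x τ → φ x (τ b) τ) σ (λ { (here z) → a≢b z }))
      (trans (cong₂ _+_ (pb true) (pb false)) (num (σ e) (σ g₁) (σ g₂) (σ g₃) (σ g₄) (Q σ) (F σ)))
      where
      pb : ∀ x → sumOver (b ∷ []) (λ τ → φ x (τ b) τ) (upd σ a x) ≡ φ x true σ + φ x false σ
      pb x = trans (sum-peel [] (λ y τ → φ x y τ) (upd σ a x) (λ ()))
        (cong₂ _+_ (φ-upd x true x true σ) (φ-upd x false x false σ))
      fac : ∀ α β γ n q f → α * (β * (γ * q)) * (n * f) ≡ α * β * γ * n * (q * f)
      fac = solve-∀
      add4 : ∀ c d u v q → c * q + d * q + (u * q + v * q) ≡ (c + d + (u + v)) * q
      add4 = solve-∀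
      num : ∀ E p q r s Qv Fv →
        wP E true true * (wP true p q * (wP true r s * Qv)) * (nb E * Fv) + wP E true false * (wP true p q * (wP false r s * Qv)) * (nb E * Fv)
        + (wP E false true * (wP false p q * (wP true r s * Qv)) * (nb E * Fv) + wP E false false * (wP false p q * (wP false r s * Qv)) * (nb E * Fv))
        ≡ nb E * (w4 p q r s * (Qv * Fv))
      num E p q r s Qv Fv = trans (cong₂ _+_
          (cong₂ _+_ (fac (wP E true true) (wP true p q) (wP true r s) (nb E) Qv Fv) (fac (wP E true false) (wP true p q) (wP false r s) (nb E) Qv Fv))
          (cong₂ _+_ (fac (wP E false true) (wP false p q) (wP true r s) (nb E) Qv Fv) (fac (wP E false false) (wP false p q) (wP false r s) (nb E) Qv Fv)))
        (trans (add4 (wP E true true * wP true p q * wP true r s * nb E) (wP E true false * wP true p q * wP false r s * nb E)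
                     (wP E false true * wP false p q * wP true r s * nb E) (wP E false false * wP false p q * wP false r s * nb E) (Qv * Fv))
        (trans (cong (_* (Qv * Fv)) (w4-tab E p q r s)) (*-assoc (nb E) (w4 p q r s) _)))

    L₅↭ : L ↭ L₅ ++ a ∷ b ∷ []
    L₅↭ = cnt⇒↭ L _ λ l → trans (go l) (sym (cnt-++ l L₅ (a ∷ b ∷ [])))
      where
      go : ∀ l → cnt l L ≡ cnt l L₅ + cnt l (a ∷ b ∷ [])
      go l rewrite cnt-sel k₅ l L with eqL l a | eqL l b
      ... | inj₁ refl | inj₁ h = ⊥-elim (a≢b h)
      ... | inj₁ refl | inj₂ _ = proj₂ az
      ... | inj₂ _ | inj₁ refl = proj₂ bz
      ... | inj₂ _ | inj₂ _ = lem (cnt l L)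
        where
        lem : ∀ c → c ≡ c + 0 + 0
        lem c = sym (trans (+-identityʳ _) (+-identityʳ c))

    dK : Dep (labs (tr (pl (X ++ R))) ++ (e ∷ []) ++ A) (λ σ → pr (pl (X ++ R)) σ * (neg e σ * F σ))
    dK = dep-* (pr-dep (pl (X ++ R))) (dep-* (dep-neg e) dF)

    VE : Z L (pl (X ++ R)) (λ σ → neg e σ * F σ) ≡ sumOver L₅ E4 zeros
    VE = trans (sum-↭ dK L₅↭ zeros) (trans (sum-++ L₅ (a ∷ b ∷ []) _ zeros) (sum-cong L₅ inner zeros))

    H4 : Asg → ℕ
    H4 σ = nb (σ e) * (nb (σ g₁) * wP (σ g₂) (σ g₃) (σ g₄) * (Q σ * F σ))

    L₁↭ : L₅ ↭ L₁ ++ g₁ ∷ []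
    L₁↭ = cnt⇒↭ L₅ _ λ l → trans (go l) (sym (cnt-++ l L₁ (g₁ ∷ [])))
      where
      go : ∀ l → cnt l L₅ ≡ cnt l L₁ + cnt l (g₁ ∷ [])
      go l rewrite cnt-sel k₅ l L | cnt-sel k₁ l L with eqL l a | eqL l b | eqL l g₁
      ... | inj₁ refl | _ | inj₁ h = ⊥-elim (a≢g h)
      ... | inj₁ refl | _ | inj₂ _ = refl
      ... | inj₂ _ | inj₁ refl | inj₁ h = ⊥-elim (b≢g h)
      ... | inj₂ _ | inj₁ refl | inj₂ _ = refl
      ... | inj₂ _ | inj₂ _ | inj₁ refl = trans (+-identityʳ _) (proj₁ (proj₂ g1))
      ... | inj₂ _ | inj₂ _ | inj₂ _ = sym (+-identityʳ _)

    module _ (g∉A : g₁ ∉ A) where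
      dH : Dep (e ∷ g₁ ∷ g₂ ∷ g₃ ∷ g₄ ∷ labs R ++ A) H4
      dH σ τ ag rewrite ag e (here refl) | ag g₁ (there (here refl)) | ag g₂ (there (there (here refl)))
        | ag g₃ (there (there (there (here refl)))) | ag g₄ (there (there (there (there (here refl)))))
        | dep-* depQ dF σ τ (λ l m → ag l (there (there (there (there (there m)))))) = refl

      VH : Z L₁ (pl (W ∷ R₁)) (λ σ → neg e σ * F σ) ≡ sumOver L₅ H4 zeros
      VH = sym (trans (sum-↭ dH L₁↭ zeros) (trans (sum-++ L₁ (g₁ ∷ []) H4 zeros) (sum-cong L₁ go zeros)))
        where
        hT : ∀ σ → H4 (upd σ g₁ true) ≡ 0
        hT σ rewrite upd-same σ g₁ true = *-zeroʳ (nb (upd σ g₁ true e))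
        R≡ : ∀ σ → σ e ≡ false → Q (upd σ g₁ false) ≡ pr (pl R₁) σ
        R≡ σ h = trans (depQ _ _ λ l _ → pt l) (sym (pr-ren R σ))
          where
          pt : ∀ l → upd σ g₁ false l ≡ σ (ren g₁ e l)
          pt l with eqL l g₁
          ... | inj₁ _ = sym h
          ... | inj₂ _ = refl
        val : ∀ E wv q f q' → (E ≡ false → q ≡ q') → nb E * (1 * wv * (q * f)) ≡ wv * q' * (nb E * f)
        val true wv q f q' h = sym (*-zeroʳ (wv * q'))
        val false wv q f q' h rewrite h refl = lem wv q' f
          where
          lem : ∀ w q f → 1 * (1 * w * (q * f)) ≡ w * q * (1 * f)
          lem = solve-∀
        hF : ∀ σ → H4 (upd σ g₁ false) ≡ wP (σ g₂) (σ g₃) (σ g₄) * pr (pl R₁) σ * (neg e σ * F σ)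
        hF σ rewrite upd-same σ g₁ false | upd-diff σ {g₁} {e} false (λ z → g≢e (sym z))
          | upd-diff σ {g₁} {g₂} false (λ z → g∉ (here (sym z)))
          | upd-diff σ {g₁} {g₃} false (λ z → g∉ (there (here (sym z))))
          | upd-diff σ {g₁} {g₄} false (λ z → g∉ (there (there (here (sym z)))))
          | dF _ _ (upd-agree σ g₁ false A g∉A) = val (σ e) (wP (σ g₂) (σ g₃) (σ g₄)) _ (F σ) _ (R≡ σ)
        go : ∀ σ → sumOver (g₁ ∷ []) H4 σ ≡ pr (pl (W ∷ R₁)) σ * (neg e σ * F σ)
        go σ = trans (cong (_+ H4 (upd σ g₁ false)) (hT σ)) (hF σ)

  plwf : ∀ {L G H} → pl G ⇝ pl H → WF L G → WF L H
  plwf {L} {G} {H} s w = subst (WF L) (tr-pl H) (⇝wf s (subst (WF L) (sym (tr-pl G)) w))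

  plbr : ∀ {L G H} → pl G ⇝ pl H → Br L G → Br L H
  plbr {L} {G} {H} s w = subst (Br L) (tr-pl H) (⇝br s (subst (Br L) (sym (tr-pl G)) w))

  pln3 : ∀ {L G H} → pl G ⇝ pl H → No3 L G → No3 L H
  pln3 {L} {G} {H} s w = subst (No3 L) (tr-pl H) (⇝n3 s (subst (No3 L) (sym (tr-pl G)) w))

  module _ {e a b g₁ g₂ g₃ g₄ : ℕ} {R : List Tri} where
    private
      K₁ K₂ K₃ K₄ : List Tri
      K₁ = tri e a b ∷ tri a g₁ g₂ ∷ tri b g₃ g₄ ∷ R
      K₂ = tri e a b ∷ tri a g₂ g₁ ∷ tri b g₃ g₄ ∷ R
      K₃ = tri e b a ∷ tri b g₃ g₄ ∷ tri a g₁ g₂ ∷ R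
      K₄ = tri e b a ∷ tri b g₄ g₃ ∷ tri a g₁ g₂ ∷ R

    K₁₂ : pl K₁ ⇝ pl K₂
    K₁₂ = ⇝↭ (pswap _ _ prefl) ⇝∙ (⇝sw (s23 s0) ⇝∙ ⇝↭ (pswap _ _ prefl))

    K₁₃ : pl K₁ ⇝ pl K₃
    K₁₃ = ⇝sw (s23 s0) ⇝∙ ⇝↭ (prep _ (pswap _ _ prefl))

    K₁₄ : pl K₁ ⇝ pl K₄
    K₁₄ = K₁₃ ⇝∙ (⇝↭ (pswap _ _ prefl) ⇝∙ (⇝sw (s23 s0) ⇝∙ ⇝↭ (pswap _ _ prefl)))

  k₅-comm : ∀ L a b → sel (λ l → ifE (eqL l a) false (ifE (eqL l b) false true)) L
    ≡ sel (λ l → ifE (eqL l b) false (ifE (eqL l a) false true)) L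
  k₅-comm L a b = sel-cong L go
    where
    go : ∀ l → ifE (eqL l a) false (ifE (eqL l b) false true) ≡ ifE (eqL l b) false (ifE (eqL l a) false true)
    go l with eqL l a | eqL l b
    ... | inj₁ _ | inj₁ _ = refl
    ... | inj₁ _ | inj₂ _ = refl
    ... | inj₂ _ | inj₁ _ = refl
    ... | inj₂ _ | inj₂ _ = refl

  module Voor4 {L e a b g₁ g₂ g₃ g₄ R}
    (w : WF L (tri e a b ∷ tri a g₁ g₂ ∷ tri b g₃ g₄ ∷ R))
    (br : Br L (tri e a b ∷ tri a g₁ g₂ ∷ tri b g₃ g₄ ∷ R))
    (n3 : No3 L (tri e a b ∷ tri a g₁ g₂ ∷ tri b g₃ g₄ ∷ R)) (lr : 3 ≤ length R) where

    K : List Tri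
    K = tri e a b ∷ tri a g₁ g₂ ∷ tri b g₃ g₄ ∷ R

    voor4 : ∀ {A F} (dF : Dep A F) → (∀ {l} → l ∈ A → l ∉ a ∷ b ∷ g₁ ∷ g₂ ∷ g₃ ∷ g₄ ∷ []) → ∀ lb →
      (∀ L₁ W R₁ → Good L₁ W R₁ R e → lb ≤ Z L₁ (pl (W ∷ R₁)) (λ σ → neg e σ * F σ)) →
      4 * lb ≤ 3 * Z L (pl K) (λ σ → neg e σ * F σ)
    voor4 {A} {F} dF dis lb hyp = ≤-trans (≤-reflexive (lem lb))
      (≤-trans (+-mono-≤ (+-mono-≤ b₁ b₂) (+-mono-≤ b₃ b₄)) (≤-reflexive total))
      where
      lem : ∀ l → 4 * l ≡ l + l + (l + l)
      lem = solve-∀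
      i : ∀ {x} → x ∈ a ∷ b ∷ g₁ ∷ g₂ ∷ g₃ ∷ g₄ ∷ [] → x ∉ A
      i m k = dis k m
      module V₁ = Voor3 w br n3 lr dF (i (here refl)) (i (there (here refl)))
      module V₂ = Voor3 (plwf K₁₂ w) (plbr K₁₂ br) (pln3 K₁₂ n3) lr dF (i (here refl)) (i (there (here refl)))
      module V₃ = Voor3 (plwf K₁₃ w) (plbr K₁₃ br) (pln3 K₁₃ n3) lr dF (i (there (here refl))) (i (here refl))
      module V₄ = Voor3 (plwf K₁₄ w) (plbr K₁₄ br) (pln3 K₁₄ n3) lr dF (i (there (here refl))) (i (here refl))
      b₁ : lb ≤ sumOver V₁.L₅ V₁.H4 zeros
      b₁ = ≤-trans (hyp _ _ _ V₁.good) (≤-reflexive (V₁.VH (i (there (there (here refl))))))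
      b₂ : lb ≤ sumOver V₁.L₅ V₂.H4 zeros
      b₂ = ≤-trans (hyp _ _ _ V₂.good) (≤-reflexive (V₂.VH (i (there (there (there (here refl)))))))
      b₃ : lb ≤ sumOver V₁.L₅ V₃.H4 zeros
      b₃ = ≤-trans (hyp _ _ _ V₃.good) (≤-reflexive (trans (V₃.VH (i (there (there (there (there (here refl)))))))
             (cong (λ M → sumOver M V₃.H4 zeros) (k₅-comm L b a))))
      b₄ : lb ≤ sumOver V₁.L₅ V₄.H4 zeros
      b₄ = ≤-trans (hyp _ _ _ V₄.good) (≤-reflexive (trans (V₄.VH (i (there (there (there (there (there (here refl))))))))
             (cong (λ M → sumOver M V₄.H4 zeros) (k₅-comm L b a))))
      pt : ∀ σ → V₁.H4 σ + V₂.H4 σ + (V₃.H4 σ + V₄.H4 σ) ≡ 3 * V₁.E4 σ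
      pt σ = trans (fac (nb (σ e)) (nb (σ g₁) * wP (σ g₂) (σ g₃) (σ g₄)) (nb (σ g₂) * wP (σ g₁) (σ g₃) (σ g₄))
                        (nb (σ g₃) * wP (σ g₄) (σ g₁) (σ g₂)) (nb (σ g₄) * wP (σ g₃) (σ g₁) (σ g₂)) (V₁.Q σ * F σ))
        (trans (cong (λ z → nb (σ e) * (z * (V₁.Q σ * F σ))) (w4-split (σ g₁) (σ g₂) (σ g₃) (σ g₄)))
          (lem3 (nb (σ e)) (w4 (σ g₁) (σ g₂) (σ g₃) (σ g₄)) (V₁.Q σ * F σ)))
        where
        fac : ∀ n x y z u q → n * (x * q) + n * (y * q) + (n * (z * q) + n * (u * q)) ≡ n * ((x + y + (z + u)) * q)
        fac = solve-∀
        lem3 : ∀ n x q → n * (3 * x * q) ≡ 3 * (n * (x * q))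
        lem3 = solve-∀
      total : sumOver V₁.L₅ V₁.H4 zeros + sumOver V₁.L₅ V₂.H4 zeros + (sumOver V₁.L₅ V₃.H4 zeros + sumOver V₁.L₅ V₄.H4 zeros)
        ≡ 3 * Z L (pl K) (λ σ → neg e σ * F σ)
      total = trans (cong₂ _+_ (sym (sum-+ V₁.L₅ V₁.H4 V₂.H4 zeros)) (sym (sum-+ V₁.L₅ V₃.H4 V₄.H4 zeros)))
        (trans (sym (sum-+ V₁.L₅ (λ σ → V₁.H4 σ + V₂.H4 σ) (λ σ → V₃.H4 σ + V₄.H4 σ) zeros))
        (trans (sum-cong V₁.L₅ pt zeros) (trans (sum-const V₁.L₅ 3 V₁.E4 zeros) (cong (3 *_) (sym V₁.VE)))))

    voorG : ∀ {A F} (dF : Dep A F) → (∀ {l} → l ∈ A → l ∉ a ∷ b ∷ g₁ ∷ []) →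
      ∃[ L₁ ] ∃[ W ] ∃[ R₁ ] Good L₁ W R₁ R e ×
      Z L₁ (pl (W ∷ R₁)) (λ σ → neg e σ * F σ) ≤ Z L (pl K) (λ σ → neg e σ * (neg g₁ σ * F σ))
    voorG {A} {F} dF dis = _ , _ , _ , V.good ,
      ≤-reflexive (trans (V.VH (λ m → dis m (there (there (here refl))))) (trans (sum-cong V.L₅ pt zeros) (sym V'.VE)))
      where
      module V = Voor3 w br n3 lr dF (λ m → dis m (here refl)) (λ m → dis m (there (here refl)))
      dd : Dep (g₁ ∷ A) (λ σ → neg g₁ σ * F σ)
      dd = dep-* (dep-neg g₁) dF
      a∉gA : a ∉ g₁ ∷ A
      a∉gA (here z) = V.a≢g z
      a∉gA (there m) = dis m (here refl)
      b∉gA : b ∉ g₁ ∷ A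
      b∉gA (here z) = V.b≢g z
      b∉gA (there m) = dis m (there (here refl))
      module V' = Voor3 w br n3 lr dd a∉gA b∉gA
      pt : ∀ σ → V.H4 σ ≡ V'.E4 σ
      pt σ = cong (nb (σ e) *_) (trans (cong (_* (V.Q σ * F σ)) (w4-neg (σ g₁) (σ g₂) (σ g₃) (σ g₄)))
        (lem (w4 (σ g₁) (σ g₂) (σ g₃) (σ g₄)) (nb (σ g₁)) (V.Q σ) (F σ)))
        where
        lem : ∀ x n q f → x * n * (q * f) ≡ x * (q * (n * f))
        lem = solve-∀

  bdl3 : ∀ L X → δ L X ≡ 3 → ∃[ p ] ∃[ q ] ∃[ r ] bdl L X ↭ p ∷ q ∷ r ∷ []
  bdl3 L X e with bdl L X | trans (sym (δ-len L X)) e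
  ... | p ∷ q ∷ r ∷ [] | refl = p , q , r , prefl

  bd-loopless : ∀ {L p q r} X Y → WF L (X ++ Y) → bdl L X ↭ p ∷ q ∷ r ∷ [] → Loopless (tri p q r)
  bd-loopless {L} X Y w bd l = ≤-trans (≤-reflexive (trans (sym (cnt-↭ l bd)) (cnt-sel _ l L))) (lem (is1 (occ l X)))
    where
    lem : ∀ b → bit b * cnt l L ≤ 1
    lem true = ≤-trans (≤-reflexive (+-identityʳ _)) (simple w l)
    lem false = z≤n

  bdl-compl : ∀ {L} X Y → WF L (X ++ Y) → bdl L Y ↭ bdl L X
  bdl-compl {L} X Y w = cnt⇒↭ _ _ λ l → trans (cnt-sel (λ l → is1 (occ l Y)) l L) (trans (go l) (sym (cnt-sel (λ l → is1 (occ l X)) l L)))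
    where
    go : ∀ l → bit (is1 (occ l Y)) * cnt l L ≡ bit (is1 (occ l X)) * cnt l L
    go l with split3 {X = X} w l
    ... | c00 _ e f rewrite e | f = refl
    ... | c02 _ e f rewrite e | f = refl
    ... | c11 _ e f rewrite e | f = refl
    ... | c20 _ e f rewrite e | f = refl

  U-scale : ∀ L t Y F l b x y z → l ∉ rest L t → pat t x y z l ≡ b →
    U L t Y (λ σ → F σ * neg l σ) x y z ≡ nb b * U L t Y F x y z
  U-scale L t Y F l b x y z l∉ e = trans (sum-val (rest L t) (λ c τ → pr Y τ * (F τ * nb c)) _ l∉ e)
    (trans (sum-cong (rest L t) (λ τ → lem (pr Y τ) (F τ) (nb b)) _) (sum-const (rest L t) (nb b) _ _))
    where
    lem : ∀ p f n → p * (f * n) ≡ n * (p * f)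
    lem = solve-∀

  module _ {L p q r} {Y : List Vx} (w : WF L (tri p q r ∷ tr Y)) (h : Loopless (tri p q r)) where
    private
      t : Tri
      t = tri p q r

    U-neg₁ : ∀ F x y z → U L t Y (λ σ → F σ * neg p σ) x y z ≡ nb x * U L t Y F x y z
    U-neg₁ F x y z = U-scale L t Y F p x x y z (rest-∉ L t (here refl)) (proj₁ (pat-at h x y z))

    U-neg₂ : ∀ F x y z → U L t Y (λ σ → F σ * neg q σ) x y z ≡ nb y * U L t Y F x y z
    U-neg₂ F x y z = U-scale L t Y F q y x y z (rest-∉ L t (there (here refl))) (proj₁ (proj₂ (pat-at h x y z)))

    U-neg₃ : ∀ F x y z → U L t Y (λ σ → F σ * neg r σ) x y z ≡ nb z * U L t Y F x y z
    U-neg₃ F x y z = U-scale L t Y F r z x y z (rest-∉ L t (there (there (here refl)))) (proj₂ (proj₂ (pat-at h x y z)))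

    Zsum : ∀ {A F} → Dep A F → Z L (plain t ∷ Y) F ≡ U L t Y F true false false + U L t Y F false true false + U L t Y F false false true
    Zsum {F = F} d = trans (vertexSum w h d) (lem (U L t Y F true false false) (U L t Y F false true false) (U L t Y F false false true) (U L t Y F true true true))
      where
      lem : ∀ a b c d → 1 * a + 1 * b + 1 * c + 0 * d ≡ a + b + c
      lem = solve-∀

    module _ {A F} (d : Dep A F) where
      private
        N : ∀ {B} → Dep B F → ∀ l → Dep (B ++ l ∷ []) (λ σ → F σ * neg l σ)
        N e l = dep-* e (dep-neg l)

      avoid₁ : Z L (plain t ∷ Y) (λ σ → F σ * neg p σ) ≡ U L t Y F false true false + U L t Y F false false true
      avoid₁ = trans (Zsum (N d p)) (trans (cong₂ _+_ (cong₂ _+_ (U-neg₁ F true false false) (U-neg₁ F false true false)) (U-neg₁ F false false true))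
        (lem (U L t Y F false true false) _))
        where
        lem : ∀ a b → 0 + 1 * a + 1 * b ≡ a + b
        lem = solve-∀

      avoid₂ : Z L (plain t ∷ Y) (λ σ → F σ * neg q σ) ≡ U L t Y F true false false + U L t Y F false false true
      avoid₂ = trans (Zsum (N d q)) (trans (cong₂ _+_ (cong₂ _+_ (U-neg₂ F true false false) (U-neg₂ F false true false)) (U-neg₂ F false false true))
        (lem (U L t Y F true false false) _))
        where
        lem : ∀ a b → 1 * a + 0 + 1 * b ≡ a + b
        lem = solve-∀

      avoid₃ : Z L (plain t ∷ Y) (λ σ → F σ * neg r σ) ≡ U L t Y F true false false + U L t Y F false true false
      avoid₃ = trans (Zsum (N d r)) (trans (cong₂ _+_ (cong₂ _+_ (U-neg₃ F true false false) (U-neg₃ F false true false)) (U-neg₃ F false false true))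
        (lem (U L t Y F true false false) _))
        where
        lem : ∀ a b → 1 * a + 1 * b + 0 ≡ a + b
        lem = solve-∀

  record At2 (u : Wt) : Set where
    constructor at2
    field
      no₁ : 1 ≤ a₂ u + a₃ u
      no₂ : 1 ≤ a₁ u + a₃ u
      no₃ : 1 ≤ a₁ u + a₂ u
  open At2 public

  record All1 (u : Wt) : Set where
    constructor all1
    field
      p₁ : 1 ≤ a₁ u
      p₂ : 1 ≤ a₂ u
      p₃ : 1 ≤ a₃ u
  open All1 public

  Ples : List ℕ → List Tri → Set
  Ples L G = ∀ e f → 1 ≤ Z L (pl G) (λ σ → neg e σ * neg f σ)

  module _ {L p q r Y} (w : WF L (tri p q r ∷ Y)) (h : Loopless (tri p q r)) (P : Ples L (tri p q r ∷ Y)) where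
    private
      t : Tri
      t = tri p q r
      w' : WF L (t ∷ tr (pl Y))
      w' = subst (λ z → WF L (t ∷ z)) (sym (tr-pl Y)) w

    ples-at2 : ∀ e → At2 (Uv L t (pl Y) (neg e))
    ples-at2 e = at2 (≤-trans (P e p) (≤-reflexive (avoid₁ w' h (dep-neg e))))
                     (≤-trans (P e q) (≤-reflexive (avoid₂ w' h (dep-neg e))))
                     (≤-trans (P e r) (≤-reflexive (avoid₃ w' h (dep-neg e))))

    private
      eq1 : ∀ (n : Asg → ℕ) x y z → (∀ σ → n σ ≡ 1 * n σ) → U L t (pl Y) n x y z ≡ U L t (pl Y) (λ σ → 1 * n σ) x y z
      eq1 n x y z e = sum-cong (rest L t) (λ σ → cong (pr (pl Y) σ *_) (e σ)) _
      to1 : ∀ (n : Asg → ℕ) σ → n σ ≡ 1 * n σ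
      to1 n σ = sym (+-identityʳ (n σ))

    ples-all1 : All1 (Uv L t (pl Y) one)
    ples-all1 = all1
      (≤-trans (P q r) (≤-reflexive (trans (avoid₃ w' h (dep-neg q)) (trans (cong₂ _+_ (n₂ true false false) (n₂ false true false)) (lemʳ _)))))
      (≤-trans (P p r) (≤-reflexive (trans (avoid₃ w' h (dep-neg p)) (trans (cong₂ _+_ (n₁ true false false) (n₁ false true false)) (lemˡ _)))))
      (≤-trans (P p q) (≤-reflexive (trans (avoid₂ w' h (dep-neg p)) (trans (cong₂ _+_ (n₁ true false false) (n₁ false false true)) (lemˡ _)))))
      where
      n₁ : ∀ x y z → U L t (pl Y) (neg p) x y z ≡ nb x * U L t (pl Y) one x y z
      n₁ x y z = trans (eq1 (neg p) x y z (to1 (neg p))) (U-neg₁ w' h one x y z)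
      n₂ : ∀ x y z → U L t (pl Y) (neg q) x y z ≡ nb y * U L t (pl Y) one x y z
      n₂ x y z = trans (eq1 (neg q) x y z (to1 (neg q))) (U-neg₂ w' h one x y z)
      lemʳ : ∀ a → 1 * a + 0 ≡ a
      lemʳ = solve-∀
      lemˡ : ∀ a → 0 + 1 * a ≡ a
      lemˡ = solve-∀

  at2-pos : ∀ {u v} → At2 u → At2 v → 1 ≤ a₁ u * a₁ v + a₂ u * a₂ v + a₃ u * a₃ v
  at2-pos {wt 0 0 c d} {v} (at2 _ _ ()) _
  at2-pos {wt 0 b 0 d} {v} (at2 _ () _) _
  at2-pos {wt (suc a) 0 0 d} {v} (at2 () _ _) _
  at2-pos {wt (suc a) b c d} {wt (suc x) y z k} _ _ = s≤s z≤n
  at2-pos {wt (suc a) (suc b) c d} {wt 0 (suc y) z k} _ _ rewrite *-zeroʳ a = s≤s z≤n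
  at2-pos {wt (suc a) (suc b) c d} {wt 0 0 z k} _ (at2 _ _ ())
  at2-pos {wt (suc a) 0 (suc c) d} {wt 0 y (suc z) k} _ _ rewrite *-zeroʳ a = s≤s z≤n
  at2-pos {wt (suc a) 0 (suc c) d} {wt 0 y 0 k} _ (at2 _ () _)
  at2-pos {wt 0 (suc b) (suc c) d} {wt x (suc y) z k} _ _ = s≤s z≤n
  at2-pos {wt 0 (suc b) (suc c) d} {wt x 0 (suc z) k} _ _ rewrite *-zeroʳ b = s≤s z≤n
  at2-pos {wt 0 (suc b) (suc c) d} {wt x 0 0 k} _ (at2 () _ _)

  all1-pos : ∀ {u v} → 1 ≤ a₁ u + a₂ u + a₃ u → All1 v → 1 ≤ a₁ u * a₁ v + a₂ u * a₂ v + a₃ u * a₃ v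
  all1-pos {wt a b c d} {v} s (all1 x y z) = ≤-trans s (+-mono-≤ (+-mono-≤ (m a x) (m b y)) (m c z))
    where
    m : ∀ a {x} → 1 ≤ x → a ≤ a * x
    m a h = ≤-trans (≤-reflexive (sym (*-identityʳ a))) (*-monoʳ-≤ a h)

  neg-drop : ∀ {L f} G F → cnt f L ≡ 0 → Z L G (λ σ → F σ * neg f σ) ≡ Z L G F
  neg-drop {L} {f} G F h = trans (sum-val L (λ b τ → pr G τ * (F τ * nb b)) zeros (cnt⇒∉ h) refl)
    (sum-cong L (λ τ → cong (pr G τ *_) (*-identityʳ (F τ))) zeros)

  sum-ge : ∀ L {A F} → Dep A F → ∀ σ τ → (∀ l → l ∈ A → l ∉ L → σ l ≡ τ l) → F σ ≤ sumOver L F τ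
  sum-ge [] d σ τ ag = ≤-reflexive (d σ τ λ l m → ag l m λ ())
  sum-ge (l ∷ L) {A} {F} d σ τ ag = lem (σ l) refl
    where
    go : ∀ b → σ l ≡ b → F σ ≤ sumOver L F (upd τ l b)
    go b e = sum-ge L d σ (upd τ l b) λ m m∈ m∉ → ag' m m∈ m∉
      where
      ag' : ∀ m → m ∈ A → m ∉ L → σ m ≡ upd τ l b m
      ag' m m∈ m∉ with eqL m l
      ... | inj₁ refl = e
      ... | inj₂ ne = ag m m∈ λ { (here z) → ne z ; (there k) → m∉ k }
    lem : ∀ b → σ l ≡ b → F σ ≤ sumOver (l ∷ L) F τ
    lem true e = ≤-trans (go true e) (m≤m+n _ _)
    lem false e = ≤-trans (go false e) (m≤n+m _ _)

  -- Three vertices behind a 3-edge cut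

  infix 3 _≈_
  data _≈_ : List Vx → List Vx → Set where
    ≈refl : ∀ {X} → X ≈ X
    ≈↭ : ∀ {X Y Z} → X ↭ Y → Y ≈ Z → X ≈ Z
    ≈sw : ∀ {x y X Z} → Sw x y → y ∷ X ≈ Z → x ∷ X ≈ Z

  ≈trans : ∀ {X Y Z} → X ≈ Y → Y ≈ Z → X ≈ Z
  ≈trans ≈refl b = b
  ≈trans (≈↭ p a) b = ≈↭ p (≈trans a b)
  ≈trans (≈sw s a) b = ≈sw s (≈trans a b)

  ≈⇝ : ∀ {X Z} → X ≈ Z → ∀ Y → X ++ Y ⇝ Z ++ Y
  ≈⇝ ≈refl Y = ⇝refl
  ≈⇝ (≈↭ p a) Y = ⇝↭ (++⁺ʳ Y p) ⇝∙ ≈⇝ a Y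
  ≈⇝ (≈sw s a) Y = ⇝sw s ⇝∙ ≈⇝ a Y

  ≈occ : ∀ {X Z} → X ≈ Z → ∀ l → occ l (tr X) ≡ occ l (tr Z)
  ≈occ ≈refl l = refl
  ≈occ (≈↭ p a) l = trans (occ-↭ l (tr-↭ p)) (≈occ a l)
  ≈occ (≈sw {X = X} s a) l = trans (occ-sw s l (tr X)) (≈occ a l)

  data Shape : List Vx → (f₁ f₂ f₃ α β γ : ℕ) → Set where
    triangle : ∀ {f₁ f₂ f₃ α β γ} a b c →
      Shape ((tri f₁ α β , a) ∷ (tri f₂ α γ , b) ∷ (tri f₃ β γ , c) ∷ []) f₁ f₂ f₃ α β γ
    double : ∀ {f₁ f₂ f₃ α β γ} a b c →
      Shape ((tri f₁ f₂ α , a) ∷ (tri α β γ , b) ∷ (tri β γ f₃ , c) ∷ []) f₁ f₂ f₃ α β γ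
    triple : ∀ {f₁ f₂ f₃ α β γ} a b c →
      Shape ((tri f₁ f₂ f₃ , a) ∷ (tri α β γ , b) ∷ (tri α β γ , c) ∷ []) f₁ f₂ f₃ α β γ

  record NF (X : List Vx) : Set where
    constructor nf
    field
      {X'} : List Vx
      {f₁ f₂ f₃ α β γ} : ℕ
      shape : Shape X' f₁ f₂ f₃ α β γ
      eqv   : X ≈ X'

  pullV : ∀ {l} x (X : List Vx) → l ∈ labs (tr (x ∷ X)) → ∃[ m ] ∃[ n ] ∃[ a ] ∃[ X' ] (x ∷ X ≈ (tri l m n , a) ∷ X') × length X' ≡ length X
  pullV {l} x X i with find' (x ∷ X) i
    where
    find' : ∀ (Y : List Vx) → l ∈ labs (tr Y) → ∃[ t ] ∃[ Y' ] Y ↭ t ∷ Y' × l ∈ labs (proj₁ t ∷ [])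
    find' ((tri p q r , a) ∷ Y) (here e) = _ , _ , prefl , here e
    find' ((tri p q r , a) ∷ Y) (there (here e)) = _ , _ , prefl , there (here e)
    find' ((tri p q r , a) ∷ Y) (there (there (here e))) = _ , _ , prefl , there (there (here e))
    find' ((tri p q r , a) ∷ Y) (there (there (there m))) with find' Y m
    ... | t , Y' , p , i = t , _ ∷ Y' , ptrans (prep _ p) (pswap _ _ prefl) , i
  ... | (t , a) , Y' , p , j with frontSw t a j
  ...   | m , n , b , s = m , n , b , Y' , ≈↭ p (≈sw s ≈refl) , suc-injective (sym (↭-length p))

  ≈cong : ∀ {x X Z} → X ≈ Z → x ∷ X ≈ x ∷ Z
  ≈cong ≈refl = ≈refl
  ≈cong (≈↭ p a) = ≈↭ (prep _ p) (≈cong a)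
  ≈cong {x} (≈sw s a) = ≈↭ (pswap _ _ prefl) (≈sw s (≈↭ (pswap _ _ prefl) (≈cong a)))

  record Tied (X : List Vx) (α β γ : ℕ) : Set where
    field
      ll : ∀ {x} → x ∈ X → Loopless (proj₁ x)
      tα : occ α (tr X) ≡ 2
      tβ : occ β (tr X) ≡ 2
      tγ : occ γ (tr X) ≡ 2
      α≢β : α ≢ β
      α≢γ : α ≢ γ
      β≢γ : β ≢ γ
  open Tied

  ll-↭ : ∀ {X Y : List Vx} → X ↭ Y → (∀ {x} → x ∈ X → Loopless (proj₁ x)) → ∀ {x} → x ∈ Y → Loopless (proj₁ x)
  ll-↭ p h m = h (∈-resp-↭ (↭-sym p) m)

  ll-≈ : ∀ {X Y : List Vx} → X ≈ Y → (∀ {x} → x ∈ X → Loopless (proj₁ x)) → ∀ {x} → x ∈ Y → Loopless (proj₁ x)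
  ll-≈ ≈refl h = h
  ll-≈ (≈↭ p a) h = ll-≈ a (ll-↭ p h)
  ll-≈ (≈sw s a) h = ll-≈ a λ { (here refl) l → subst (_≤ 1) (cnt-↭ l (labs-sw s)) (h (here refl) l) ; (there m) → h (there m) }

  tied-≈ : ∀ {X Y α β γ} → X ≈ Y → Tied X α β γ → Tied Y α β γ
  tied-≈ {α = α} {β} {γ} e t = record { ll = ll-≈ e (ll t) ; tα = trans (sym (≈occ e α)) (tα t) ; tβ = trans (sym (≈occ e β)) (tβ t)
    ; tγ = trans (sym (≈occ e γ)) (tγ t) ; α≢β = α≢β t ; α≢γ = α≢γ t ; β≢γ = β≢γ t }

  occ2-second : ∀ {l t} {X : List Vx} → Loopless t → occ l (t ∷ tr X) ≡ 2 → 1 ≤ occ l (tr X)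
  occ2-second {l} {t} {X} h e = lem _ _ (h l) (trans (sym (occ-++ l (t ∷ []) (tr X))) e)
    where
    lem : ∀ a b → a ≤ 1 → a + b ≡ 2 → 1 ≤ b
    lem 0 .2 _ refl = s≤s z≤n
    lem 1 .1 _ refl = s≤s z≤n
    lem (suc (suc a)) b (s≤s ()) _

  sum3 : ∀ {l x y z} → occ l (x ∷ y ∷ z ∷ []) ≡ 2 → occ l (x ∷ []) + (occ l (y ∷ []) + occ l (z ∷ [])) ≡ 2
  sum3 {l} {x} {y} {z} e = trans (sym (trans (occ-++ l (x ∷ []) (y ∷ z ∷ [])) (cong (occ l (x ∷ []) +_) (occ-++ l (y ∷ []) (z ∷ []))))) e

  locZ : ∀ l z a → (∃[ u ] ∃[ v ] ∃[ b ] Sw (z , a) (tri l u v , b)) ⊎ occ l (z ∷ []) ≡ 0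
  locZ l z a with occ l (z ∷ []) in e
  ... | 0 = inj₂ refl
  ... | suc k = inj₁ (frontSw z a (cnt⇒∈ _ (≤-trans (s≤s z≤n) (≤-reflexive (sym e)))))

  loc1 : ∀ l α m n a → l ≢ α → (∃[ n' ] ∃[ b ] Sw (tri α m n , a) (tri α l n' , b)) ⊎ occ l (tri α m n ∷ []) ≡ 0
  loc1 l α m n a ne with eqD l m | eqD l n
  ... | inj₁ refl | _ = inj₁ (_ , _ , s0)
  ... | inj₂ _ | inj₁ refl = inj₁ (_ , _ , s23 s0)
  ... | inj₂ p | inj₂ q rewrite δ-diff ne | δ-diff p | δ-diff q = inj₂ refl

  loc2 : ∀ l α β n → l ≢ α → l ≢ β → l ≡ n ⊎ occ l (tri α β n ∷ []) ≡ 0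
  loc2 l α β n p q with eqD l n
  ... | inj₁ e = inj₁ e
  ... | inj₂ r rewrite δ-diff p | δ-diff q | δ-diff r = inj₂ refl

  two-of : ∀ {A : Set} a b c → a + (b + c) ≡ 2 → a ≤ 1 → b ≤ 1 → c ≤ 1 → (a ≡ 0 → b ≡ 0 → A) × (a ≡ 0 → c ≡ 0 → A) × (b ≡ 0 → c ≡ 0 → A)
  two-of 0 0 .2 refl _ _ (s≤s ())
  two-of 0 1 1 refl _ _ _ = (λ _ ()) , (λ _ ()) , (λ ())
  two-of 0 (suc (suc b)) c e _ (s≤s ()) _
  two-of 1 0 1 refl _ _ _ = (λ ()) , (λ ()) , (λ _ ())
  two-of 1 1 0 refl _ _ _ = (λ ()) , (λ ()) , (λ ())
  two-of 1 (suc (suc b)) c e _ (s≤s ()) _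
  two-of (suc (suc a)) b c e (s≤s ()) _ _

  module _ {α β γ : ℕ} where
    private
      rot : ∀ {p q r a b c d} → Sw (tri p q r , wt a b c d) (tri r p q , wt c a b d)
      rot = s23 (s12 s0)
      rot' : ∀ {p q r a b c d} → Sw (tri p q r , wt a b c d) (tri q r p , wt b c a d)
      rot' = s12 (s23 s0)

      impγ : ∀ {x y z : Vx} {A : Set} → Tied (x ∷ y ∷ z ∷ []) α β γ →
        (occ γ (proj₁ x ∷ []) ≡ 0 → occ γ (proj₁ y ∷ []) ≡ 0 → A) × (occ γ (proj₁ x ∷ []) ≡ 0 → occ γ (proj₁ z ∷ []) ≡ 0 → A) × (occ γ (proj₁ y ∷ []) ≡ 0 → occ γ (proj₁ z ∷ []) ≡ 0 → A)
      impγ {x} {y} {z} t = two-of _ _ _ (sum3 {γ} {proj₁ x} {proj₁ y} {proj₁ z} (tγ t)) (ll t (here refl) γ) (ll t (there (here refl)) γ) (ll t (there (there (here refl))) γ)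
      impβ : ∀ {x y z : Vx} {A : Set} → Tied (x ∷ y ∷ z ∷ []) α β γ →
        (occ β (proj₁ x ∷ []) ≡ 0 → occ β (proj₁ y ∷ []) ≡ 0 → A) × (occ β (proj₁ x ∷ []) ≡ 0 → occ β (proj₁ z ∷ []) ≡ 0 → A) × (occ β (proj₁ y ∷ []) ≡ 0 → occ β (proj₁ z ∷ []) ≡ 0 → A)
      impβ {x} {y} {z} t = two-of _ _ _ (sum3 {β} {proj₁ x} {proj₁ y} {proj₁ z} (tβ t)) (ll t (here refl) β) (ll t (there (here refl)) β) (ll t (there (there (here refl))) β)

      at1 : ∀ {x x' y z} → Sw x x' → x ∷ y ∷ z ∷ [] ≈ x' ∷ y ∷ z ∷ []
      at1 s = ≈sw s ≈refl
      at2' : ∀ {x y y' z} → Sw y y' → x ∷ y ∷ z ∷ [] ≈ x ∷ y' ∷ z ∷ []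
      at2' s = ≈↭ (pswap _ _ prefl) (≈sw s (≈↭ (pswap _ _ prefl) ≈refl))
      at3 : ∀ {x y z z'} → Sw z z' → x ∷ y ∷ z ∷ [] ≈ x ∷ y ∷ z' ∷ []
      at3 s = ≈cong (at2'' s)
        where
        at2'' : ∀ {y z z'} → Sw z z' → y ∷ z ∷ [] ≈ y ∷ z' ∷ []
        at2'' s = ≈↭ (pswap _ _ prefl) (≈sw s (≈↭ (pswap _ _ prefl) ≈refl))

      via : ∀ {X Y} → X ≈ Y → NF Y → NF X
      via e (nf s q) = nf s (≈trans e q)

    case1 : ∀ {n n' a b z} → Tied ((tri α β n , a) ∷ (tri α β n' , b) ∷ z ∷ []) α β γ → NF ((tri α β n , a) ∷ (tri α β n' , b) ∷ z ∷ [])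
    case1 {n} {n'} {a} {b} {tri u v x , c} t
      with loc2 γ α β n (λ e → α≢γ t (sym e)) (λ e → β≢γ t (sym e)) | loc2 γ α β n' (λ e → α≢γ t (sym e)) (λ e → β≢γ t (sym e))
    ... | inj₁ refl | inj₁ refl = nf (triple c a b) (≈↭ (shifts (_ ∷ _ ∷ []) (_ ∷ [])) ≈refl)
    ... | inj₂ p | inj₂ q = proj₁ (impγ {A = NF _} t) p q
    ... | inj₁ refl | inj₂ q with locZ γ (tri u v x) c
    ...   | inj₂ r = proj₂ (proj₂ (impγ {A = NF _} t)) q r
    ...   | inj₁ (u' , v' , c' , s) = via (at3 s) (via (at3 rot') (via (at1 rot) (nf (double _ _ _) (≈↭ (shifts (_ ∷ _ ∷ []) (_ ∷ [])) ≈refl))))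
    case1 {n} {n'} {a} {b} {tri u v x , c} t | inj₂ p | inj₁ refl with locZ γ (tri u v x) c
    ...   | inj₂ r = proj₁ (proj₂ (impγ {A = NF _} t)) p r
    ...   | inj₁ (u' , v' , c' , s) = via (at3 s) (via (at3 rot') (via (at2' rot) (nf (double _ _ _) (≈↭ (ptrans (shifts (_ ∷ _ ∷ []) (_ ∷ [])) (prep _ (pswap _ _ prefl))) ≈refl))))

    case2 : ∀ {n m' n' u v a b c} → Tied ((tri α β n , a) ∷ (tri α m' n' , b) ∷ (tri β u v , c) ∷ []) α β γ →
      NF ((tri α β n , a) ∷ (tri α m' n' , b) ∷ (tri β u v , c) ∷ [])
    case2 {n} {m'} {n'} {u} {v} {a} {b} {c} t
      with loc2 γ α β n (λ e → α≢γ t (sym e)) (λ e → β≢γ t (sym e)) | loc1 γ α m' n' b (λ e → α≢γ t (sym e)) | loc1 γ β u v c (λ e → β≢γ t (sym e))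
    ... | inj₁ refl | inj₁ (_ , _ , s) | _ = via (at2' s) (via (at3 rot') (via (at1 (s12 s0)) (nf (double _ _ _) (≈↭ (shifts (_ ∷ _ ∷ []) (_ ∷ [])) ≈refl))))
    ... | inj₁ refl | inj₂ q | inj₁ (_ , _ , s) = via (at3 s) (via (at2' rot') (nf (double _ _ _) (≈↭ (pswap _ _ prefl) ≈refl)))
    ... | inj₁ _ | inj₂ q | inj₂ r = proj₂ (proj₂ (impγ {A = NF _} t)) q r
    ... | inj₂ p | inj₁ (_ , _ , s) | inj₁ (_ , _ , s') = via (at2' s) (via (at3 s') (via (at1 rot) (via (at2' rot) (via (at3 rot) (nf (triangle _ _ _) ≈refl)))))
    ... | inj₂ p | inj₁ _ | inj₂ r = proj₁ (proj₂ (impγ {A = NF _} t)) p r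
    ... | inj₂ p | inj₂ q | _ = proj₁ (impγ {A = NF _} t) p q

    case0 : ∀ {m n m' n' a b z} → Tied ((tri α m n , a) ∷ (tri α m' n' , b) ∷ z ∷ []) α β γ → NF ((tri α m n , a) ∷ (tri α m' n' , b) ∷ z ∷ [])
    case0 {m} {n} {m'} {n'} {a} {b} {tri p q r , c} t
      with loc1 β α m n a (λ e → α≢β t (sym e)) | loc1 β α m' n' b (λ e → α≢β t (sym e)) | locZ β (tri p q r) c
    ... | inj₁ (_ , _ , s) | inj₁ (_ , _ , s') | _ = via (≈trans (at1 s) (at2' s')) (case1 (tied-≈ (≈trans (at1 s) (at2' s')) t))
    ... | inj₁ (_ , _ , s) | inj₂ _ | inj₁ (_ , _ , _ , s') = via (≈trans (at1 s) (at3 s')) (case2 (tied-≈ (≈trans (at1 s) (at3 s')) t))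
    ... | inj₂ _ | inj₁ (_ , _ , s) | inj₁ (_ , _ , _ , s') = via e (case2 (tied-≈ e t))
      where
      e = ≈↭ (pswap _ _ prefl) (≈trans (at1 s) (at3 s'))
    ... | inj₂ x | inj₂ y | _ = proj₁ (impβ {A = NF _} t) x y
    ... | inj₂ x | inj₁ _ | inj₂ y = proj₁ (proj₂ (impβ {A = NF _} t)) x y
    ... | inj₁ _ | inj₂ x | inj₂ y = proj₂ (proj₂ (impβ {A = NF _} t)) x y

    mkNF : ∀ X → length X ≡ 3 → Tied X α β γ → NF X
    mkNF (x ∷ X) len t with pullV {α} x X (cnt⇒∈ _ (≤-trans (s≤s z≤n) (≤-reflexive (sym (tα t)))))
    ... | m , n , a , y ∷ Y , e , len' with tied-≈ e t
    ...   | t' with pullV {α} y Y (cnt⇒∈ _ (occ2-second {α} {tri α m n} {y ∷ Y} (ll t' (here refl)) (tα t')))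
    ...     | m' , n' , b , z ∷ [] , e' , len'' = via (≈trans e (≈cong e')) (case0 (tied-≈ (≈cong e') t'))
    ...     | m' , n' , b , [] , e' , len'' = case trans (cong suc len'') (trans len' (suc-injective len)) of λ ()
    ...     | m' , n' , b , z ∷ z' ∷ Z , e' , len'' = case trans (cong suc len'') (trans len' (suc-injective len)) of λ ()
    mkNF (x ∷ X) len t | m , n , a , [] , e , len' = case trans len' (suc-injective len) of λ ()

  perm3 : ∀ {x y z : ℕ} {A} → x ∈ A → y ∈ A → z ∈ A → x ≢ y → x ≢ z → y ≢ z → length A ≡ 3 → A ↭ x ∷ y ∷ z ∷ []
  perm3 {x} {y} {z} {A} i j k a b c len with ∈-split i
  ... | B , p with ∈-split (drop≢ (∈-resp-↭ p j) a)
    where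
    drop≢ : ∀ {u v : ℕ} {B} → v ∈ u ∷ B → u ≢ v → v ∈ B
    drop≢ (here e) n = ⊥-elim (n (sym e))
    drop≢ (there m) n = m
  ...   | C , q with ∈-split (drop≢ (∈-resp-↭ q (drop≢ (∈-resp-↭ p k) b)) c)
    where
    drop≢ : ∀ {u v : ℕ} {B} → v ∈ u ∷ B → u ≢ v → v ∈ B
    drop≢ (here e) n = ⊥-elim (n (sym e))
    drop≢ (there m) n = m
  ...     | D , r with D | r | trans (sym (trans (↭-length p) (cong suc (trans (↭-length q) (cong suc (↭-length r)))))) len
  ...       | [] | r' | _ = ptrans p (prep x (ptrans q (prep y r')))

  six : (f₁ f₂ f₃ α β γ : ℕ) → List ℕ
  six f₁ f₂ f₃ α β γ = f₁ ∷ f₂ ∷ f₃ ∷ α ∷ β ∷ γ ∷ []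

  shape-occ : ∀ {X f₁ f₂ f₃ α β γ} → Shape X f₁ f₂ f₃ α β γ → ∀ l → occ l (tr X) ≡ cnt l (six f₁ f₂ f₃ α β γ) + cnt l (α ∷ β ∷ γ ∷ [])
  shape-occ {f₁ = f₁} {f₂} {f₃} {α} {β} {γ} (triangle a b c) l = lem (δ= l f₁) (δ= l f₂) (δ= l f₃) (δ= l α) (δ= l β) (δ= l γ)
    where
    lem : ∀ f g h a b c → f + (a + (b + (g + (a + (c + (h + (b + (c + 0)))))))) ≡ f + (g + (h + (a + (b + (c + 0))))) + (a + (b + (c + 0)))
    lem = solve-∀
  shape-occ {f₁ = f₁} {f₂} {f₃} {α} {β} {γ} (double a b c) l = lem (δ= l f₁) (δ= l f₂) (δ= l f₃) (δ= l α) (δ= l β) (δ= l γ)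
    where
    lem : ∀ f g h a b c → f + (g + (a + (a + (b + (c + (b + (c + (h + 0)))))))) ≡ f + (g + (h + (a + (b + (c + 0))))) + (a + (b + (c + 0)))
    lem = solve-∀
  shape-occ {f₁ = f₁} {f₂} {f₃} {α} {β} {γ} (triple a b c) l = lem (δ= l f₁) (δ= l f₂) (δ= l f₃) (δ= l α) (δ= l β) (δ= l γ)
    where
    lem : ∀ f g h a b c → f + (g + (h + (a + (b + (c + (a + (b + (c + 0)))))))) ≡ f + (g + (h + (a + (b + (c + 0))))) + (a + (b + (c + 0)))
    lem = solve-∀

  shape-dist : ∀ {X f₁ f₂ f₃ α β γ} → Shape X f₁ f₂ f₃ α β γ → (∀ {x} → x ∈ X → Loopless (proj₁ x)) → α ≢ β × α ≢ γ × β ≢ γ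
  shape-dist (triangle a b c) h = proj₂ (proj₂ (dist3 (h (here refl)))) , proj₂ (proj₂ (dist3 (h (there (here refl))))) , proj₂ (proj₂ (dist3 (h (there (there (here refl))))))
  shape-dist (double a b c) h = dist3 (h (there (here refl)))
  shape-dist (triple a b c) h = dist3 (h (there (here refl)))

  shape-len : ∀ {X f₁ f₂ f₃ α β γ} → Shape X f₁ f₂ f₃ α β γ → length (tr X) ≡ 3
  shape-len (triangle a b c) = refl
  shape-len (double a b c) = refl
  shape-len (triple a b c) = refl

  loopless-all : ∀ {L G t} → WF L G → Br L G → t ∈ G → Loopless t
  loopless-all w b m with ∈-split m
  ... | B , p = noloop (WF-↭ p w) (Br-↭ p b)

  module _ {L X Y f₁ f₂ f₃ α β γ} (s : Shape X f₁ f₂ f₃ α β γ) (w : WF L (tr X ++ Y)) (b : Br L (tr X ++ Y)) (d : δ L (tr X) ≡ 3) where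
    private
      six' tri' fff : List ℕ
      six' = six f₁ f₂ f₃ α β γ
      tri' = α ∷ β ∷ γ ∷ []
      fff = f₁ ∷ f₂ ∷ f₃ ∷ []
      ds : α ≢ β × α ≢ γ × β ≢ γ
      ds = shape-dist s λ m → loopless-all w b (∈-++⁺ˡ (∈-map⁺ proj₁ m))
      len : length (inl L (tr X)) ≡ 3
      len = go _ _ (trans (handshake (tr X) Y w) (cong (3 *_) (shape-len s))) d
        where
        go : ∀ d i → d + 2 * i ≡ 9 → d ≡ 3 → i ≡ 3
        go .3 i e refl = *-cancelˡ-≡ i 3 2 (+-cancelˡ-≡ 3 (2 * i) 6 e)
      two : ∀ {l} → l ∈ tri' → l ∈ inl L (tr X)
      two {l} m = inl-∈ {X = tr X} w (≤-trans (+-mono-≤ (∈⇒cnt {A = six'} (there (there (there m)))) (∈⇒cnt m)) (≤-reflexive (sym (shape-occ s l))))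
      inl↭ : inl L (tr X) ↭ tri'
      inl↭ = perm3 (two (here refl)) (two (there (here refl))) (two (there (there (here refl)))) (proj₁ ds) (proj₁ (proj₂ ds)) (proj₂ (proj₂ ds)) len
      sixf : ∀ l → cnt l six' ≡ cnt l fff + cnt l tri'
      sixf l = cnt-++ l fff tri'

    shape-uq : Uq (six f₁ f₂ f₃ α β γ)
    shape-uq = uq go
      where
      go : ∀ l → cnt l six' ≤ 1
      go l = aux (cnt l six') (cnt l tri') refl refl
        where
        aux : ∀ s t → cnt l six' ≡ s → cnt l tri' ≡ t → s ≤ 1
        aux 0 _ _ _ = z≤n
        aux 1 _ _ _ = ≤-refl
        aux (suc (suc k)) zero e e' = ⊥-elim (cnt⇒∉ e' (∈-resp-↭ inl↭ (inl-∈ {X = tr X} w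
              (≤-trans (≤-trans (s≤s (s≤s z≤n)) (≤-reflexive (sym e))) (≤-trans (m≤m+n _ _) (≤-reflexive (sym (shape-occ s l))))))))
        aux (suc (suc k)) (suc j) e e' = ⊥-elim (bad (occ l (tr X)) (split3 {X = tr X} w l)
              (≤-trans (+-mono-≤ {2} {_} {1} (≤-trans (s≤s (s≤s z≤n)) (≤-reflexive (sym e))) (≤-trans (s≤s z≤n) (≤-reflexive (sym e')))) (≤-reflexive (sym (shape-occ s l)))))
         where
          bad : ∀ n → Three n (occ l Y) (cnt l L) → 3 ≤ n → ⊥
          bad .0 (c00 _ refl _) ()
          bad .0 (c02 _ refl _) ()
          bad .1 (c11 _ refl _) (s≤s ())
          bad .2 (c20 _ refl _) (s≤s (s≤s ()))

    shape-bdl : bdl L (tr X) ↭ f₁ ∷ f₂ ∷ f₃ ∷ []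
    shape-bdl = cnt⇒↭ _ _ λ l → trans (cnt-sel (λ l → is1 (occ l (tr X))) l L)
        (go l (cnt l six') (cnt l fff) (cnt l tri') (once shape-uq l) (sixf l) (shape-occ s l))
      where
      L1 : ∀ l → occ l (tr X) ≡ 1 → cnt l L ≡ 1
      L1 l e with split3 {X = tr X} w l
      ... | c00 _ x _ = case trans (sym e) x of λ ()
      ... | c02 c _ _ = c
      ... | c11 c _ _ = c
      ... | c20 c _ _ = c
      go : ∀ l s f t → s ≤ 1 → s ≡ f + t → occ l (tr X) ≡ s + t → bit (is1 (occ l (tr X))) * cnt l L ≡ f
      go l 0 0 0 h e o rewrite o = refl
      go l 1 1 0 h e o with L1 l o
      ... | c rewrite o | c = refl
      go l 1 0 1 h e o rewrite o = refl
      go l 1 (suc (suc _)) t h () o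
      go l 1 1 (suc t) h () o
      go l 1 0 (suc (suc t)) h () o
      go l (suc (suc _)) f t (s≤s ()) e o

  shape-rest : ∀ {L X f₁ f₂ f₃ α β γ} → Shape X f₁ f₂ f₃ α β γ → Uq (six f₁ f₂ f₃ α β γ) → WF L (tri f₁ f₂ f₃ ∷ tr X) → rest L (tri f₁ f₂ f₃) ↭ α ∷ β ∷ γ ∷ []
  shape-rest {L} {X} {f₁} {f₂} {f₃} {α} {β} {γ} s u w = cnt⇒↭ _ _ λ l → trans (cnt-sel _ l L)
      (go (cnt l L) (cnt l (f₁ ∷ f₂ ∷ f₃ ∷ [])) (cnt l (α ∷ β ∷ γ ∷ [])) (subst (_≤ 1) (sixf l) (once u l)) (simple w l)
        (trans (sym (twice w l)) (trans (occ-++ l (tri f₁ f₂ f₃ ∷ []) (tr X)) (cong (occ l (tri f₁ f₂ f₃ ∷ []) +_) (trans (shape-occ s l) (cong (_+ cnt l (α ∷ β ∷ γ ∷ [])) (sixf l)))))))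
    where
    sixf : ∀ l → cnt l (six f₁ f₂ f₃ α β γ) ≡ cnt l (f₁ ∷ f₂ ∷ f₃ ∷ []) + cnt l (α ∷ β ∷ γ ∷ [])
    sixf l = cnt-++ l (f₁ ∷ f₂ ∷ f₃ ∷ []) (α ∷ β ∷ γ ∷ [])
    go : ∀ c f t → f + t ≤ 1 → c ≤ 1 → c + c ≡ f + (f + t + t) → bit (is0 f) * c ≡ t
    go 0 0 0 h k e = refl
    go 1 0 1 h k e = refl
    go c 0 (suc (suc _)) (s≤s ()) k e
    go c (suc (suc _)) t (s≤s ()) k e
    go c 1 (suc t) (s≤s ()) k e
    go 0 0 1 h k ()
    go 1 0 0 h k ()
    go c 1 0 h k e = refl
    go (suc (suc _)) 0 t h (s≤s ()) e

  sum8 : (Bool → Bool → Bool → ℕ) → ℕ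
  sum8 h = h true true true + h true true false + (h true false true + h true false false)
    + (h false true true + h false true false + (h false false true + h false false false))

  sum6 : ∀ {f₁ f₂ f₃ α β γ} → Uq (six f₁ f₂ f₃ α β γ) → ∀ (Ψ : Bool → Bool → Bool → Bool → Bool → Bool → ℕ) σ →
    sumOver (α ∷ β ∷ γ ∷ []) (λ τ → Ψ (τ f₁) (τ f₂) (τ f₃) (τ α) (τ β) (τ γ)) σ ≡ sum8 (Ψ (σ f₁) (σ f₂) (σ f₃))
  sum6 {f₁} {f₂} {f₃} {α} {β} {γ} u Ψ σ =
    trans (sum-peel (β ∷ γ ∷ []) (λ x τ → Ψ (τ f₁) (τ f₂) (τ f₃) x (τ β) (τ γ)) σ α∉) (cong₂ _+_ (two true) (two false))
    where
    t1 = uniq-tail u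
    t2 = uniq-tail t1
    t3 = uniq-tail t2
    α∉ : α ∉ β ∷ γ ∷ []
    α∉ = uniq-head t3
    β∉ : β ∉ γ ∷ []
    β∉ = uniq-head (uniq-tail t3)
    up : ∀ {f} → f ∉ α ∷ β ∷ γ ∷ [] → ∀ x y z → upd (upd (upd σ α x) β y) γ z f ≡ σ f
    up n x y z = trans (upd-diff (upd (upd σ α x) β y) z (n ∘ there ∘ there ∘ here))
      (trans (upd-diff (upd σ α x) y (n ∘ there ∘ here)) (upd-diff σ x (n ∘ here)))
    n1 : f₁ ∉ α ∷ β ∷ γ ∷ []
    n1 m = uniq-head u (there (there m))
    n2 : f₂ ∉ α ∷ β ∷ γ ∷ []
    n2 m = uniq-head t1 (there m)
    n3 : f₃ ∉ α ∷ β ∷ γ ∷ []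
    n3 m = uniq-head t2 m
    base : ∀ x y z → Ψ (upd (upd (upd σ α x) β y) γ z f₁) (upd (upd (upd σ α x) β y) γ z f₂) (upd (upd (upd σ α x) β y) γ z f₃) x y z ≡ Ψ (σ f₁) (σ f₂) (σ f₃) x y z
    base x y z rewrite up n1 x y z | up n2 x y z | up n3 x y z = refl
    one' : ∀ x y → sumOver (γ ∷ []) (λ τ → Ψ (τ f₁) (τ f₂) (τ f₃) x y (τ γ)) (upd (upd σ α x) β y) ≡ Ψ (σ f₁) (σ f₂) (σ f₃) x y true + Ψ (σ f₁) (σ f₂) (σ f₃) x y false
    one' x y = trans (sum-peel [] (λ z τ → Ψ (τ f₁) (τ f₂) (τ f₃) x y z) (upd (upd σ α x) β y) (λ ())) (cong₂ _+_ (base x y true) (base x y false))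
    two : ∀ x → sumOver (β ∷ γ ∷ []) (λ τ → Ψ (τ f₁) (τ f₂) (τ f₃) x (τ β) (τ γ)) (upd σ α x)
      ≡ Ψ (σ f₁) (σ f₂) (σ f₃) x true true + Ψ (σ f₁) (σ f₂) (σ f₃) x true false + (Ψ (σ f₁) (σ f₂) (σ f₃) x false true + Ψ (σ f₁) (σ f₂) (σ f₃) x false false)
    two x = trans (sum-peel (γ ∷ []) (λ y τ → Ψ (τ f₁) (τ f₂) (τ f₃) x y (τ γ)) (upd σ α x) β∉) (cong₂ _+_ (one' x true) (one' x false))

  TriΨ DblΨ TplΨ : Wt → Wt → Wt → Bool → Bool → Bool → Bool → Bool → Bool → ℕ
  TriΨ a b c f g h x y z = w3 a f x y * (w3 b g x z * (w3 c h y z * 1)) * 1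
  DblΨ a b c f g h x y z = w3 a f g x * (w3 b x y z * (w3 c y z h * 1)) * 1
  TplΨ a b c f g h x y z = w3 a f g h * (w3 b x y z * (w3 c x y z * 1)) * 1

  shapeΨ : ∀ {X f₁ f₂ f₃ α β γ} → Shape X f₁ f₂ f₃ α β γ → Bool → Bool → Bool → Bool → Bool → Bool → ℕ
  shapeΨ (triangle a b c) = TriΨ a b c
  shapeΨ (double a b c) = DblΨ a b c
  shapeΨ (triple a b c) = TplΨ a b c

  shapeU : ∀ {L X f₁ f₂ f₃ α β γ} (s : Shape X f₁ f₂ f₃ α β γ) → Uq (six f₁ f₂ f₃ α β γ) → WF L (tri f₁ f₂ f₃ ∷ tr X) →
    Loopless (tri f₁ f₂ f₃) → ∀ x y z → U L (tri f₁ f₂ f₃) X one x y z ≡ sum8 (shapeΨ s x y z)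
  shapeU {L} {X} {f₁} {f₂} {f₃} {α} {β} {γ} s u w h x y z =
    trans (sum-↭ (dep-* (pr-dep X) dep-one) (shape-rest s u w) _) (go s)
    where
    σ : Asg
    σ = pat (tri f₁ f₂ f₃) x y z
    fix : ∀ (s' : Shape X f₁ f₂ f₃ α β γ) → sum8 (shapeΨ s' (σ f₁) (σ f₂) (σ f₃)) ≡ sum8 (shapeΨ s' x y z)
    fix s' rewrite proj₁ (pat-at h x y z) | proj₁ (proj₂ (pat-at h x y z)) | proj₂ (proj₂ (pat-at h x y z)) = refl
    go : (s' : Shape X f₁ f₂ f₃ α β γ) → sumOver (α ∷ β ∷ γ ∷ []) (λ τ → pr X τ * one τ) σ ≡ sum8 (shapeΨ s' x y z)
    go s'@(triangle a b c) = trans (sum6 u (TriΨ a b c) σ) (fix s')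
    go s'@(double a b c) = trans (sum6 u (DblΨ a b c) σ) (fix s')
    go s'@(triple a b c) = trans (sum6 u (TplΨ a b c) σ) (fix s')

  toTied : ∀ {L X Y} → WF L (tr X ++ Y) → Br L (tr X ++ Y) → δ L (tr X) ≡ 3 → length X ≡ 3 → ∃[ α ] ∃[ β ] ∃[ γ ] Tied X α β γ
  toTied {L} {X} {Y} w b d len with inl L (tr X) in eq | lenI
    where
    lenI : length (inl L (tr X)) ≡ 3
    lenI = go _ _ (trans (handshake (tr X) Y w) (cong (3 *_) (trans (length-map proj₁ X) len))) d
      where
      go : ∀ d i → d + 2 * i ≡ 9 → d ≡ 3 → i ≡ 3
      go .3 i e refl = *-cancelˡ-≡ i 3 2 (+-cancelˡ-≡ 3 (2 * i) 6 e)
  ... | α ∷ β ∷ γ ∷ [] | _ = α , β , γ , record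
      { ll = λ m → loopless-all w b (∈-++⁺ˡ (∈-map⁺ proj₁ m))
      ; tα = two (here refl) ; tβ = two (there (here refl)) ; tγ = two (there (there (here refl)))
      ; α≢β = λ e → uniq-head us (here e) ; α≢γ = λ e → uniq-head us (there (here e)) ; β≢γ = λ e → uniq-head (uniq-tail us) (here e) }
    where
    cI : ∀ l → cnt l (α ∷ β ∷ γ ∷ []) ≡ bit (is2 (occ l (tr X))) * cnt l L
    cI l = trans (cong (cnt l) (sym eq)) (cnt-sel _ l L)
    us : Uq (α ∷ β ∷ γ ∷ [])
    us = uq λ l → ≤-trans (≤-reflexive (cI l)) (lem (is2 (occ l (tr X))) (simple w l))
      where
      lem : ∀ b {c} → c ≤ 1 → bit b * c ≤ 1
      lem true {c} h = subst (_≤ 1) (sym (+-identityʳ c)) h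
      lem false h = z≤n
    two : ∀ {l} → l ∈ α ∷ β ∷ γ ∷ [] → occ l (tr X) ≡ 2
    two {l} m = lem (occ l (tr X)) (subst (1 ≤_) (cI l) (∈⇒cnt m))
      where
      lem : ∀ n {c} → 1 ≤ bit (is2 n) * c → n ≡ 2
      lem 0 ()
      lem 1 ()
      lem 2 _ = refl
      lem (suc (suc (suc _))) ()

  toNF : ∀ {L X Y} → WF L (tr X ++ Y) → Br L (tr X ++ Y) → δ L (tr X) ≡ 3 → length X ≡ 3 → NF X
  toNF {X = X} w b d len with toTied {X = X} w b d len
  ... | _ , _ , _ , t = mkNF X len t

  δ-one : ∀ {L o X} → WF L (o ∷ X) → Br L (o ∷ X) → δ L (o ∷ []) ≡ 3
  δ-one {L} {o} {X} w b = go (δ L (o ∷ [])) (length (inl L (o ∷ []))) (handshake (o ∷ []) X w) (b (o ∷ []) X prefl)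
    where
    go : ∀ d i → d + 2 * i ≡ 3 → d ≢ 1 → d ≡ 3
    go d 0 e _ = trans (sym (+-identityʳ d)) e
    go d 1 e n = ⊥-elim (n (+-cancelʳ-≡ 2 d 1 e))
    go d (suc (suc i)) e _ = case +-cancelʳ-≡ 3 (d + (1 + 2 * i)) 0 (trans (lem d i) e) of λ z → case m+n≡0⇒n≡0 d z of λ ()
      where
      lem : ∀ d i → d + (1 + 2 * i) + 3 ≡ d + 2 * suc (suc i)
      lem = solve-∀

  bdl-one : ∀ {L p q r X} → WF L (tri p q r ∷ X) → Br L (tri p q r ∷ X) → bdl L (tri p q r ∷ []) ↭ p ∷ q ∷ r ∷ []
  bdl-one {L} {p} {q} {r} {X} w b = cnt⇒↭ _ _ λ l → trans (cnt-sel _ l L) (go l (split3 {X = tri p q r ∷ []} {X} w l) (noloop w b l))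
    where
    go : ∀ l → Three (occ l (tri p q r ∷ [])) (occ l X) (cnt l L) → occ l (tri p q r ∷ []) ≤ 1 →
      bit (is1 (occ l (tri p q r ∷ []))) * cnt l L ≡ occ l (tri p q r ∷ [])
    go l (c00 c x _) _ rewrite x = refl
    go l (c02 c x _) _ rewrite x = refl
    go l (c11 c x _) _ rewrite x | c = refl
    go l (c20 c x _) h rewrite x = case h of λ { (s≤s ()) }

  sumL-↭ : ∀ f {A B} → A ↭ B → sumL f A ≡ sumL f B
  sumL-↭ f prefl = refl
  sumL-↭ f (prep x p) = cong (f x +_) (sumL-↭ f p)
  sumL-↭ f (pswap x y p) rewrite sumL-↭ f p = lem (f x) (f y) _
    where
    lem : ∀ a b c → a + (b + c) ≡ b + (a + c)
    lem = solve-∀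
  sumL-↭ f (ptrans p q) = trans (sumL-↭ f p) (sumL-↭ f q)

  wP-sum : ∀ x y z → wP x y z ≡ bit (is1 (bit x + (bit y + (bit z + 0))))
  wP-sum true true true = refl
  wP-sum true true false = refl
  wP-sum true false true = refl
  wP-sum true false false = refl
  wP-sum false true true = refl
  wP-sum false true false = refl
  wP-sum false false true = refl
  wP-sum false false false = refl

  ev-plain-↭ : ∀ {t s} → labs (t ∷ []) ↭ labs (s ∷ []) → ∀ σ → ev (plain t) σ ≡ ev (plain s) σ
  ev-plain-↭ {tri p q r} {tri u v w} e σ = trans (wP-sum (σ p) (σ q) (σ r))
    (trans (cong (bit ∘ is1) (sumL-↭ (bit ∘ σ) e)) (sym (wP-sum (σ u) (σ v) (σ w))))

  sh : ℕ → ℕ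
  sh 0 = 0
  sh (suc k) = suc (suc k)

  idx : ℕ → List ℕ → ℕ
  idx l [] = 0
  idx l (m ∷ ms) = ifE (eqL l m) 1 (sh (idx l ms))

  idx-pos : ∀ pre m post → Uq (pre ++ m ∷ post) → idx m (pre ++ m ∷ post) ≡ suc (length pre)
  idx-pos [] m post u with eqL m m
  ... | inj₁ _ = refl
  ... | inj₂ n = ⊥-elim (n refl)
  idx-pos (x ∷ pre) m post u with eqL m x
  ... | inj₁ refl = ⊥-elim (uniq-head u (∈-++⁺ʳ pre (here refl)))
  ... | inj₂ _ rewrite idx-pos pre m post (uniq-tail u) = refl

  idx-∉ : ∀ {l} A → l ∉ A → idx l A ≡ 0
  idx-∉ [] n = refl
  idx-∉ {l} (m ∷ A) n with eqL l m
  ... | inj₁ e = ⊥-elim (n (here e))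
  ... | inj₂ _ rewrite idx-∉ A (n ∘ there) = refl

  indic : (ℕ → ℕ) → ℕ → Asg
  indic c i l = c l ≡ᵇ i

  ≡ᵇ-false : ∀ m n → m ≢ n → (m ≡ᵇ n) ≡ false
  ≡ᵇ-false zero zero h = ⊥-elim (h refl)
  ≡ᵇ-false zero (suc n) h = refl
  ≡ᵇ-false (suc m) zero h = refl
  ≡ᵇ-false (suc m) (suc n) h = ≡ᵇ-false m n (h ∘ cong suc)

  data Col : ℕ → Set where
    k1 : Col 1
    k2 : Col 2
    k3 : Col 3

  third : ∀ x y → ∃[ i ] Col i × x ≢ i × y ≢ i
  third x y with x ≟ 1 | y ≟ 1 | x ≟ 2 | y ≟ 2
  ... | no a | no b | _ | _ = 1 , k1 , a , b
  ... | yes refl | _ | _ | no b = 2 , k2 , (λ ()) , b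
  ... | yes refl | _ | _ | yes refl = 3 , k3 , (λ ()) , (λ ())
  ... | no _ | yes refl | no a | _ = 2 , k2 , a , (λ ())
  ... | no _ | yes refl | yes refl | _ = 3 , k3 , (λ ()) , (λ ())

  -- a proper 3-edge-colouring yields three disjoint perfect matchings, and two labels meet at most two of them
  colouring : ∀ {L D} (c : ℕ → ℕ) → (∀ i → Col i → pr D (indic c i) ≡ 1) → (∀ l → cnt l L ≡ 0 → c l ≡ 0) →
    ∀ e f → 1 ≤ Z L D (λ σ → neg e σ * neg f σ)
  colouring {L} {D} c pm out e f with third (c e) (c f)
  ... | i , ci , ne , nf' = ≤-trans (≤-reflexive (sym val)) (sum-ge L (dep-* (pr-dep D) (dep-* (dep-neg e) (dep-neg f))) (indic c i) zeros
      λ l _ l∉ → trans (cong (_≡ᵇ i) (out l (∉⇒cnt L l∉))) (z ci))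
    where
    z : ∀ {i} → Col i → (0 ≡ᵇ i) ≡ false
    z k1 = refl
    z k2 = refl
    z k3 = refl
    val : pr D (indic c i) * (neg e (indic c i) * neg f (indic c i)) ≡ 1
    val rewrite pm i ci | ≡ᵇ-false (c e) i ne | ≡ᵇ-false (c f) i nf' = refl

  plainW : List Vx → Set
  plainW X = ∀ {x} → x ∈ X → proj₂ x ≡ wt 1 1 1 0

  plainW-pl : ∀ X → plainW (pl X)
  plainW-pl X m with ∈-map⁻ plain m
  ... | t , _ , refl = refl

  plainW-≈ : ∀ {X Y} → X ≈ Y → plainW X → plainW Y
  plainW-≈ ≈refl h = h
  plainW-≈ (≈↭ p a) h = plainW-≈ a (λ m → h (∈-resp-↭ (↭-sym p) m))
  plainW-≈ (≈sw s a) h = plainW-≈ a λ { (here refl) → go s (h (here refl)) ; (there m) → h (there m) }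
    where
    go : ∀ {x y} → Sw x y → proj₂ x ≡ wt 1 1 1 0 → proj₂ y ≡ wt 1 1 1 0
    go s0 e = e
    go (s12 s) refl = go s refl
    go (s23 s) refl = go s refl

  gT gD : ℕ → ℕ
  gT 1 = 1
  gT 2 = 2
  gT 3 = 3
  gT 4 = 3
  gT 5 = 2
  gT 6 = 1
  gT _ = 0
  gD 1 = 1
  gD 2 = 2
  gD 3 = 3
  gD 4 = 3
  gD 5 = 1
  gD 6 = 2
  gD _ = 0

  shapeCol : ∀ {X f₁ f₂ f₃ α β γ} → Shape X f₁ f₂ f₃ α β γ → ℕ → ℕ
  shapeCol (triangle _ _ _) = gT
  shapeCol (double _ _ _) = gD
  shapeCol (triple _ _ _) = gD

  shape-proper : ∀ {X f₁ f₂ f₃ α β γ} (s : Shape X f₁ f₂ f₃ α β γ) → Uq (six f₁ f₂ f₃ α β γ) → plainW X → ∀ i → Col i →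
    ev (plain (tri f₁ f₂ f₃)) (indic (λ l → shapeCol s (idx l (six f₁ f₂ f₃ α β γ))) i) * pr X (indic (λ l → shapeCol s (idx l (six f₁ f₂ f₃ α β γ))) i) ≡ 1
  shape-proper {f₁ = f₁} {f₂} {f₃} {α} {β} {γ} s u h i ci = go s h ci
    where
    i1 = idx-pos [] f₁ (f₂ ∷ f₃ ∷ α ∷ β ∷ γ ∷ []) u
    i2 = idx-pos (f₁ ∷ []) f₂ (f₃ ∷ α ∷ β ∷ γ ∷ []) u
    i3 = idx-pos (f₁ ∷ f₂ ∷ []) f₃ (α ∷ β ∷ γ ∷ []) u
    i4 = idx-pos (f₁ ∷ f₂ ∷ f₃ ∷ []) α (β ∷ γ ∷ []) u
    i5 = idx-pos (f₁ ∷ f₂ ∷ f₃ ∷ α ∷ []) β (γ ∷ []) u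
    i6 = idx-pos (f₁ ∷ f₂ ∷ f₃ ∷ α ∷ β ∷ []) γ [] u
    go : ∀ {X} (s : Shape X f₁ f₂ f₃ α β γ) → plainW X → Col i →
      ev (plain (tri f₁ f₂ f₃)) (indic (λ l → shapeCol s (idx l (six f₁ f₂ f₃ α β γ))) i) * pr X (indic (λ l → shapeCol s (idx l (six f₁ f₂ f₃ α β γ))) i) ≡ 1
    go (triangle a b c) h ci with h (here refl) | h (there (here refl)) | h (there (there (here refl)))
    ... | refl | refl | refl rewrite i1 | i2 | i3 | i4 | i5 | i6 = fin ci
      where
      fin : ∀ {i} → Col i → wP (1 ≡ᵇ i) (2 ≡ᵇ i) (3 ≡ᵇ i) * (wP (1 ≡ᵇ i) (3 ≡ᵇ i) (2 ≡ᵇ i) * (wP (2 ≡ᵇ i) (3 ≡ᵇ i) (1 ≡ᵇ i) * (wP (3 ≡ᵇ i) (2 ≡ᵇ i) (1 ≡ᵇ i) * 1))) ≡ 1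
      fin k1 = refl
      fin k2 = refl
      fin k3 = refl
    go (double a b c) h ci with h (here refl) | h (there (here refl)) | h (there (there (here refl)))
    ... | refl | refl | refl rewrite i1 | i2 | i3 | i4 | i5 | i6 = fin ci
      where
      fin : ∀ {i} → Col i → wP (1 ≡ᵇ i) (2 ≡ᵇ i) (3 ≡ᵇ i) * (wP (1 ≡ᵇ i) (2 ≡ᵇ i) (3 ≡ᵇ i) * (wP (3 ≡ᵇ i) (1 ≡ᵇ i) (2 ≡ᵇ i) * (wP (1 ≡ᵇ i) (2 ≡ᵇ i) (3 ≡ᵇ i) * 1))) ≡ 1
      fin k1 = refl
      fin k2 = refl
      fin k3 = refl
    go (triple a b c) h ci with h (here refl) | h (there (here refl)) | h (there (there (here refl)))
    ... | refl | refl | refl rewrite i1 | i2 | i3 | i4 | i5 | i6 = fin ci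
      where
      fin : ∀ {i} → Col i → wP (1 ≡ᵇ i) (2 ≡ᵇ i) (3 ≡ᵇ i) * (wP (1 ≡ᵇ i) (2 ≡ᵇ i) (3 ≡ᵇ i) * (wP (3 ≡ᵇ i) (1 ≡ᵇ i) (2 ≡ᵇ i) * (wP (3 ≡ᵇ i) (1 ≡ᵇ i) (2 ≡ᵇ i) * 1))) ≡ 1
      fin k1 = refl
      fin k2 = refl
      fin k3 = refl

  ples2 : ∀ {L t s} → WF L (t ∷ s ∷ []) → Br L (t ∷ s ∷ []) → Ples L (t ∷ s ∷ [])
  ples2 {L} {t@(tri p q r)} {s} w b = colouring {L} {pl (t ∷ s ∷ [])} c pm out
    where
    w' = WF-↭ (pswap t s prefl) w
    b' = Br-↭ {L = L} (pswap t s prefl) b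
    same : labs (s ∷ []) ↭ p ∷ q ∷ r ∷ []
    same = ptrans (↭-sym (bdl-one w' b')) (ptrans (bdl-compl (t ∷ []) (s ∷ []) w) (bdl-one w b))
    u : Uq (p ∷ q ∷ r ∷ [])
    u = uq (noloop w b)
    c : ℕ → ℕ
    c l = gD (idx l (p ∷ q ∷ r ∷ []))
    et : ∀ i → Col i → ev (plain t) (indic c i) ≡ 1
    et i ci rewrite idx-pos [] p (q ∷ r ∷ []) u | idx-pos (p ∷ []) q (r ∷ []) u | idx-pos (p ∷ q ∷ []) r [] u = fin ci
      where
      fin : ∀ {i} → Col i → wP (1 ≡ᵇ i) (2 ≡ᵇ i) (3 ≡ᵇ i) ≡ 1
      fin k1 = refl
      fin k2 = refl
      fin k3 = refl
    pm : ∀ i → Col i → pr (pl (t ∷ s ∷ [])) (indic c i) ≡ 1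
    pm i ci rewrite ev-plain-↭ {s} {t} same (indic c i) = cong₂ (λ x y → x * (y * 1)) (et i ci) (et i ci)
    out : ∀ l → cnt l L ≡ 0 → c l ≡ 0
    out l h = cong gD (idx-∉ {l} (p ∷ q ∷ r ∷ []) (cnt⇒∉ {l} {p ∷ q ∷ r ∷ []} (n≤0⇒n≡0 (≤-trans (m≤m+n _ (occ l (s ∷ [])))
      (≤-reflexive (trans (sym (occ-++ l (t ∷ []) (s ∷ []))) (trans (twice w l) (cong (λ z → z + z) h))))))))

  ≈WF : ∀ {L X X' Y} → X ≈ X' → WF L (tr X ++ tr Y) → WF L (tr X' ++ tr Y)
  ≈WF {L} {X} {X'} {Y} e w = subst (WF L) (tr-++ X' Y) (⇝wf (≈⇝ e Y) (subst (WF L) (sym (tr-++ X Y)) w))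

  ≈Br : ∀ {L X X' Y} → X ≈ X' → Br L (tr X ++ tr Y) → Br L (tr X' ++ tr Y)
  ≈Br {L} {X} {X'} {Y} e w = subst (Br L) (tr-++ X' Y) (⇝br (≈⇝ e Y) (subst (Br L) (sym (tr-++ X Y)) w))

  ≈δ : ∀ {L X X'} → X ≈ X' → δ L (tr X') ≡ δ L (tr X)
  ≈δ {L} {X} {X'} e = δ-occ L λ l → sym (≈occ e l)

  ples4 : ∀ {L o x y z} → WF L (o ∷ x ∷ y ∷ z ∷ []) → Br L (o ∷ x ∷ y ∷ z ∷ []) → Ples L (o ∷ x ∷ y ∷ z ∷ [])
  ples4 {L} {o@(tri p q r)} {x} {y} {z} w b = go (toNF {L} {X₀} {o ∷ []} wX bX d refl)
    where
    X₀ : List Vx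
    X₀ = pl (x ∷ y ∷ z ∷ [])
    rotp : ∀ {A : Set} {o : A} {X} → o ∷ X ↭ X ++ o ∷ []
    rotp {o = o} {X} = ++-comm (o ∷ []) X
    wX : WF L (tr X₀ ++ o ∷ [])
    wX = WF-↭ rotp w
    bX : Br L (tr X₀ ++ o ∷ [])
    bX = Br-↭ {L = L} rotp b
    d : δ L (tr X₀) ≡ 3
    d = trans (δ-compl (tr X₀) (o ∷ []) wX) (δ-one w b)
    go : NF X₀ → Ples L (o ∷ x ∷ y ∷ z ∷ [])
    go (nf {X'} {f₁} {f₂} {f₃} {α} {β} {γ} s e) g f = ≤-trans (colouring {L} {X' ++ plain o ∷ []} c pm out g f)
        (≤-reflexive (sym (trans (Z-↭ L (λ σ → neg g σ * neg f σ) (rotp {o = plain o} {X₀})) (⇝Z (≈⇝ e (plain o ∷ [])) L (λ σ → neg g σ * neg f σ)))))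
      where
      w'' : WF L (tr X' ++ o ∷ [])
      w'' = ≈WF {X = X₀} {X'} {plain o ∷ []} e wX
      b'' : Br L (tr X' ++ o ∷ [])
      b'' = ≈Br {L} {X₀} {X'} {plain o ∷ []} e bX
      d'' : δ L (tr X') ≡ 3
      d'' = trans (≈δ e) d
      u : Uq (six f₁ f₂ f₃ α β γ)
      u = shape-uq s w'' b'' d''
      same : labs (o ∷ []) ↭ f₁ ∷ f₂ ∷ f₃ ∷ []
      same = ptrans (↭-sym (bdl-one w b)) (ptrans (bdl-compl {L} (tr X') (o ∷ []) w'') (shape-bdl s w'' b'' d''))
      c : ℕ → ℕ
      c l = shapeCol s (idx l (six f₁ f₂ f₃ α β γ))
      pm : ∀ i → Col i → pr (X' ++ plain o ∷ []) (indic c i) ≡ 1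
      pm i ci = trans (pr-++ X' (plain o ∷ []) (indic c i)) (trans (cong (λ v → pr X' (indic c i) * (v * 1)) (ev-plain-↭ {o} {tri f₁ f₂ f₃} same (indic c i)))
        (trans (lem (pr X' (indic c i)) (ev (plain (tri f₁ f₂ f₃)) (indic c i))) (shape-proper s u (plainW-≈ e (plainW-pl (x ∷ y ∷ z ∷ []))) i ci)))
        where
        lem : ∀ a b → a * (b * 1) ≡ b * a
        lem = solve-∀
      col0 : ∀ {X f₁ f₂ f₃ α β γ} (s : Shape X f₁ f₂ f₃ α β γ) → shapeCol s 0 ≡ 0
      col0 (triangle _ _ _) = refl
      col0 (double _ _ _) = refl
      col0 (triple _ _ _) = refl
      out : ∀ l → cnt l L ≡ 0 → c l ≡ 0
      out l h = trans (cong (shapeCol s) (idx-∉ {l} (six f₁ f₂ f₃ α β γ) (cnt⇒∉ {l} {six f₁ f₂ f₃ α β γ} (n≤0⇒n≡0 (≤-trans (≤-trans (m≤m+n _ (cnt l (α ∷ β ∷ γ ∷ []))) (≤-reflexive (sym (shape-occ s l))))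
        (≤-trans (m≤m+n _ (occ l (o ∷ []))) (≤-reflexive (trans (sym (occ-++ l (tr X') (o ∷ []))) (trans (twice w'' l) (cong (λ z → z + z) h)))))))))) (col0 s)

  evenLength : ∀ {L G} → WF L G → ∃[ k ] length G ≡ k + k
  evenLength {L} {G} w = half (length G) (length (inl L G)) (trans (sym (cong (_+ 2 * length (inl L G)) d0)) (handshake G [] wG))
    where
    wG : WF L (G ++ [])
    wG = WF-↭ (↭-sym (++-identityʳ G)) w
    d0 : δ L G ≡ 0
    d0 = trans (δ-compl G [] wG) (trans (δ-sumL L []) (z L))
      where
      z : ∀ L → sumL (λ l → bit (is1 (occ l []))) L ≡ 0
      z [] = refl
      z (_ ∷ L) = z L
    half : ∀ n i → 2 * i ≡ 3 * n → ∃[ k ] n ≡ k + k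
    half 0 i e = 0 , refl
    half 1 0 ()
    half 1 1 ()
    half 1 (suc (suc i)) e = case trans (sym (+-cancelˡ-≡ 3 0 (1 + 2 * i) (trans (sym e) (lem i)))) refl of λ ()
      where
      lem : ∀ i → 2 * suc (suc i) ≡ 3 + (1 + 2 * i)
      lem = solve-∀
    half (suc (suc n)) (suc (suc (suc i))) e with half n i (+-cancelˡ-≡ 6 _ _ (trans (sym (l1 i)) (trans e (l2 n))))
      where
      l1 : ∀ i → 2 * suc (suc (suc i)) ≡ 6 + 2 * i
      l1 = solve-∀
      l2 : ∀ n → 3 * suc (suc n) ≡ 6 + 3 * n
      l2 = solve-∀
    ... | k , refl = suc k , cong suc (sym (+-suc k k))
    half (suc (suc n)) 0 ()
    half (suc (suc n)) 1 e = case trans e (l2 n) of λ ()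
      where
      l2 : ∀ n → 3 * suc (suc n) ≡ 6 + 3 * n
      l2 = solve-∀
    half (suc (suc n)) 2 e = case trans e (l2 n) of λ ()
      where
      l2 : ∀ n → 3 * suc (suc n) ≡ 6 + 3 * n
      l2 = solve-∀

  nodigon : ∀ {L e a b s t R} → WF L (tri e a b ∷ tri e s t ∷ R) → Br L (tri e a b ∷ tri e s t ∷ R) → No3 L (tri e a b ∷ tri e s t ∷ R) →
    4 ≤ length R → a ∉ s ∷ t ∷ []
  nodigon {L} {e} {a} {b} {s} {t} {R} w br n3 lr a∈ = go (proj₁ (proj₂ z)) (proj₂ (proj₂ z))
    where
    u y : Tri
    u = tri e a b
    y = tri e s t
    ds = dist3 (noloop w br)
    one' : ∀ {l} → l ∈ e ∷ a ∷ b ∷ [] → occ l (u ∷ []) ≡ 1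
    one' {l} m = ≤-antisym (noloop w br l) (∈⇒cnt {A = e ∷ a ∷ b ∷ []} m)
    two' : ∀ {l} → l ∈ e ∷ a ∷ b ∷ [] → l ∈ e ∷ s ∷ t ∷ [] → 2 ≤ occ l (u ∷ y ∷ [])
    two' {l} m k = ≤-trans (+-mono-≤ (∈⇒cnt {A = e ∷ a ∷ b ∷ []} m) (∈⇒cnt {A = labs (y ∷ [])} k)) (≤-reflexive (sym (occ-++ l (u ∷ []) (y ∷ []))))
    more : ∀ {l} z → 2 ≤ occ l (u ∷ y ∷ []) → 2 ≤ occ l (u ∷ y ∷ z ∷ [])
    more {l} z h = ≤-trans h (≤-trans (m≤m+n _ _) (≤-reflexive (sym (occ-++ l (u ∷ y ∷ []) (z ∷ [])))))
    z : ∃[ x ] ∃[ R' ] R ↭ x ∷ R' × 2 ≤ occ b (u ∷ y ∷ x ∷ [])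
    z with ∈-++⁻ (labs (y ∷ [])) {labs R} (other-end {X = u ∷ []} {y ∷ R} {b} w (one' {b} (there (there (here refl)))))
    ... | inj₁ m = hd R lr
      where
      hd : ∀ R → 4 ≤ length R → ∃[ x ] ∃[ R' ] R ↭ x ∷ R' × 2 ≤ occ b (u ∷ y ∷ x ∷ [])
      hd (x ∷ R') _ = x , R' , prefl , more {b} x (two' {b} (there (there (here refl))) m)
    z | inj₂ m with labs-find R m
    ... | x , R' , p , i = x , R' , p , ≤-trans (+-mono-≤ (∈⇒cnt {A = labs (u ∷ [])} (there (there (here refl)))) (∈⇒cnt i))
          (≤-trans (+-monoʳ-≤ (occ b (u ∷ [])) (≤-trans (m≤n+m _ (occ b (y ∷ []))) (≤-reflexive (sym (occ-++ b (y ∷ []) (x ∷ [])))))) (≤-reflexive (sym (occ-++ b (u ∷ []) (y ∷ x ∷ [])))))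
    go : ∀ R' → R ↭ proj₁ z ∷ R' × 2 ≤ occ b (u ∷ y ∷ proj₁ z ∷ []) → ⊥
    go R' (p , h) = noTriple (u ∷ y ∷ proj₁ z ∷ []) R' (WF-↭ q w) (Br-↭ q br) (No3-↭ q n3) refl
        (≤-trans (s≤s (s≤s z≤n)) (≤-pred (subst (4 ≤_) (↭-length p) lr))) e a b
        (more {e} (proj₁ z) (two' {e} (here refl) (here refl))) (more {a} (proj₁ z) (two' {a} (there (here refl)) (there a∈))) h
        (proj₁ ds) (proj₁ (proj₂ ds)) (proj₂ (proj₂ ds))
      where
      q : u ∷ y ∷ R ↭ (u ∷ y ∷ proj₁ z ∷ []) ++ R'
      q = prep u (prep y p)

  pull1 : ∀ {l} (Y : List Tri) → l ∈ labs Y → ∃[ m ] ∃[ n ] ∃[ Y' ] (pl Y ⇝ pl (tri l m n ∷ Y'))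
  pull1 Y i = pull [] Y i

  Expanded : ℕ → ℕ → ℕ → ℕ → ℕ → List Tri → Set
  Expanded e s t a b R = ∃[ g₁ ] ∃[ g₂ ] ∃[ g₃ ] ∃[ g₄ ] ∃[ R' ]
    pl (tri e s t ∷ tri e a b ∷ R) ⇝ pl (tri e a b ∷ tri a g₁ g₂ ∷ tri b g₃ g₄ ∷ tri e s t ∷ R')

  expand : ∀ {L e s t a b R} → WF L (tri e s t ∷ tri e a b ∷ R) → Br L (tri e s t ∷ tri e a b ∷ R) → No3 L (tri e s t ∷ tri e a b ∷ R) → 4 ≤ length R → Expanded e s t a b R
  expand {L} {e} {s} {t} {a} {b} {R} w br n3 lr = fin (pull (plain u ∷ plain y ∷ []) R a∈R)
    where
    u y : Tri
    u = tri e a b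
    y = tri e s t
    π₁ : pl (y ∷ u ∷ R) ⇝ pl (u ∷ y ∷ R)
    π₁ = ⇝↭ (pswap _ _ prefl)
    w₁ = plwf {L} {y ∷ u ∷ R} {u ∷ y ∷ R} π₁ w
    br₁ = plbr {L} {y ∷ u ∷ R} {u ∷ y ∷ R} π₁ br
    n₁ = pln3 {L} {y ∷ u ∷ R} {u ∷ y ∷ R} π₁ n3
    ds = dist3 (noloop w₁ br₁)
    once-u : ∀ {l} → l ∈ e ∷ a ∷ b ∷ [] → occ l (u ∷ []) ≡ 1
    once-u {l} m = ≤-antisym (noloop w₁ br₁ l) (∈⇒cnt {A = e ∷ a ∷ b ∷ []} m)
    a∉y : a ∉ s ∷ t ∷ []
    a∉y = nodigon w₁ br₁ n₁ lr
    b∉y : b ∉ s ∷ t ∷ []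
    b∉y = nodigon (plwf {L} {u ∷ y ∷ R} {tri e b a ∷ y ∷ R} sw w₁) (plbr {L} {u ∷ y ∷ R} {tri e b a ∷ y ∷ R} sw br₁) (pln3 {L} {u ∷ y ∷ R} {tri e b a ∷ y ∷ R} sw n₁) lr
      where
      sw : pl (u ∷ y ∷ R) ⇝ pl (tri e b a ∷ y ∷ R)
      sw = ⇝sw (s23 s0)
    past : ∀ {l A} → l ∈ e ∷ s ∷ t ∷ A → l ≢ e → l ∉ s ∷ t ∷ [] → l ∈ A
    past (here x) n m = ⊥-elim (n x)
    past (there (here x)) n m = ⊥-elim (m (here x))
    past (there (there (here x))) n m = ⊥-elim (m (there (here x)))
    past (there (there (there k))) n m = k
    a∈R : a ∈ labs R
    a∈R = past (other-end {X = u ∷ []} {y ∷ R} {a} w₁ (once-u {a} (there (here refl)))) (λ x → proj₁ ds (sym x)) a∉y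
    fin : ∃[ m ] ∃[ n ] ∃[ Y' ] (plain u ∷ plain y ∷ pl R ⇝ plain u ∷ plain y ∷ pl (tri a m n ∷ Y')) → Expanded e s t a b R
    fin (g₁ , g₂ , Y' , q) = fin2 (pull (plain u ∷ plain (tri a g₁ g₂) ∷ plain y ∷ []) Y' b∈Y')
      where
      x₁ : Tri
      x₁ = tri a g₁ g₂
      w₂ : WF L (u ∷ y ∷ x₁ ∷ Y')
      w₂ = plwf {L} {u ∷ y ∷ R} q w₁
      lenY : 3 ≤ length Y'
      lenY = ≤-pred (≤-trans lr (≤-reflexive (suc-injective (suc-injective (trans (cong (λ z → suc (suc z)) (sym (length-map plain R))) (trans (⇝len q) (cong (λ z → suc (suc (suc z))) (length-map plain Y'))))))))
      π₂ : pl (u ∷ y ∷ R) ⇝ pl (tri a b e ∷ x₁ ∷ y ∷ Y')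
      π₂ = q ⇝∙ (⇝↭ (prep _ (pswap _ _ prefl)) ⇝∙ (⇝sw (s12 (s23 s0))))
      b∉x : b ∉ g₁ ∷ g₂ ∷ []
      b∉x = nodigon (plwf {L} {u ∷ y ∷ R} π₂ w₁) (plbr {L} {u ∷ y ∷ R} π₂ br₁) (pln3 {L} {u ∷ y ∷ R} π₂ n₁) (s≤s lenY)
      b∈Y' : b ∈ labs Y'
      b∈Y' = skip (past (other-end {X = u ∷ []} {y ∷ x₁ ∷ Y'} {b} w₂ (once-u {b} (there (there (here refl))))) (λ x → proj₁ (proj₂ ds) (sym x)) b∉y)
        where
        skip : b ∈ a ∷ g₁ ∷ g₂ ∷ labs Y' → b ∈ labs Y'
        skip (here x) = ⊥-elim (proj₂ (proj₂ ds) (sym x))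
        skip (there (here x)) = ⊥-elim (b∉x (here x))
        skip (there (there (here x))) = ⊥-elim (b∉x (there (here x)))
        skip (there (there (there k))) = k
      fin2 : ∃[ m ] ∃[ n ] ∃[ Y'' ] (plain u ∷ plain x₁ ∷ plain y ∷ pl Y' ⇝ plain u ∷ plain x₁ ∷ plain y ∷ pl (tri b m n ∷ Y'')) → Expanded e s t a b R
      fin2 (g₃ , g₄ , Y'' , r) = g₁ , g₂ , g₃ , g₄ , Y'' ,
        π₁ ⇝∙ (q ⇝∙ (⇝↭ (prep _ (pswap _ _ prefl)) ⇝∙ (r ⇝∙ ⇝↭ (prep _ (prep _ (pswap _ _ prefl))))))

  Ends : List Tri → ℕ → Set
  Ends G e = ∃[ s ] ∃[ t ] ∃[ a ] ∃[ b ] ∃[ R ] pl G ⇝ pl (tri e s t ∷ tri e a b ∷ R)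

  endsOf : ∀ {L G e} → WF L G → Br L G → 1 ≤ cnt e L → Ends G e
  endsOf {L} {G} {e} w br h = first (pull1 {e} G (cnt⇒∈ _ (≤-trans h (≤-trans (m≤m+n _ _) (≤-reflexive (sym (twice w e)))))))
    where
    first : ∃[ m ] ∃[ n ] ∃[ Y ] (pl G ⇝ pl (tri e m n ∷ Y)) → Ends G e
    first (s , t , Y , q) = second (pull (plain (tri e s t) ∷ []) Y (other-end {X = tri e s t ∷ []} {Y} {e} (plwf {L} {G} q w)
        (≤-antisym (noloop (plwf {L} {G} q w) (plbr {L} {G} q br) e) (∈⇒cnt {A = e ∷ s ∷ t ∷ []} (here refl)))))
      where
      second : ∃[ m ] ∃[ n ] ∃[ Y' ] (plain (tri e s t) ∷ pl Y ⇝ plain (tri e s t) ∷ pl (tri e m n ∷ Y')) → Ends G e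
      second (a , b , Y' , r) = s , t , a , b , Y' , (q ⇝∙ r)

  pllen : ∀ {G H} → pl G ⇝ pl H → length G ≡ length H
  pllen {G} {H} q = trans (sym (length-map plain G)) (trans (⇝len q) (length-map plain H))

  mem? : ∀ l (A : List ℕ) → l ∈ A ⊎ l ∉ A
  mem? l [] = inj₂ λ ()
  mem? l (a ∷ A) with eqD l a | mem? l A
  ... | inj₁ e | _ = inj₁ (here e)
  ... | inj₂ n | inj₁ m = inj₁ (there m)
  ... | inj₂ n | inj₂ m = inj₂ λ { (here e) → n e ; (there k) → m k }

  Centre : List Tri → ℕ → ℕ → Set
  Centre G e f = ∃[ s ] ∃[ t ] ∃[ a ] ∃[ b ] ∃[ g₁ ] ∃[ g₂ ] ∃[ g₃ ] ∃[ g₄ ] ∃[ R ]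
    f ∉ a ∷ b ∷ [] × pl G ⇝ pl (tri e a b ∷ tri a g₁ g₂ ∷ tri b g₃ g₄ ∷ tri e s t ∷ R)

  centre : ∀ {L G e} → WF L G → Br L G → No3 L G → 6 ≤ length G → 1 ≤ cnt e L → ∀ f → Centre G e f
  centre {L} {G} {e} w br n3 l6 h f = go (endsOf w br h)
    where
    go : Ends G e → Centre G e f
    go (s , t , a , b , R , q) = pick (mem? f (a ∷ b ∷ [])) (mem? f (s ∷ t ∷ []))
      where
      l4 : 4 ≤ length R
      l4 = ≤-pred (≤-pred (subst (6 ≤_) (pllen {G} q) l6))
      q₁ : pl G ⇝ pl (tri e a b ∷ tri e s t ∷ R)
      q₁ = q ⇝∙ ⇝↭ (pswap _ _ prefl)
      q₂ : pl G ⇝ pl (tri e b a ∷ tri e s t ∷ R)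
      q₂ = q₁ ⇝∙ ⇝sw (s23 s0)
      bad : f ∈ a ∷ b ∷ [] → f ∈ s ∷ t ∷ [] → ⊥
      bad (here refl) f∈' = nodigon (plwf {L} {G} q₁ w) (plbr {L} {G} q₁ br) (pln3 {L} {G} q₁ n3) l4 f∈'
      bad (there (here refl)) f∈' = nodigon (plwf {L} {G} q₂ w) (plbr {L} {G} q₂ br) (pln3 {L} {G} q₂ n3) l4 f∈'
      out₁ : f ∉ a ∷ b ∷ [] → Expanded e s t a b R → Centre G e f
      out₁ n (g₁ , g₂ , g₃ , g₄ , R' , r) = s , t , a , b , g₁ , g₂ , g₃ , g₄ , R' , n , (q ⇝∙ r)
      out₂ : f ∉ s ∷ t ∷ [] → Expanded e a b s t R → Centre G e f
      out₂ n (g₁ , g₂ , g₃ , g₄ , R' , r) = a , b , s , t , g₁ , g₂ , g₃ , g₄ , R' , n , (q₁ ⇝∙ r)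
      pick : f ∈ a ∷ b ∷ [] ⊎ f ∉ a ∷ b ∷ [] → f ∈ s ∷ t ∷ [] ⊎ f ∉ s ∷ t ∷ [] → Centre G e f
      pick (inj₂ n) _ = out₁ n (expand (plwf {L} {G} q w) (plbr {L} {G} q br) (pln3 {L} {G} q n3) l4)
      pick (inj₁ m) (inj₂ n) = out₂ n (expand (plwf {L} {G} q₁ w) (plbr {L} {G} q₁ br) (pln3 {L} {G} q₁ n3) l4)
      pick (inj₁ m) (inj₁ m') = ⊥-elim (bad m m')

  -- Perfect matchings avoiding two edges

  glue' : ∀ {L p q r A F B E TX TY} X Y → tr X ≡ TX → tr Y ≡ TY → WF L (TX ++ TY) → Loopless (tri p q r) →
    bdl L TX ↭ p ∷ q ∷ r ∷ [] → Dep A F → (∀ {l} → l ∈ A → occ l TX ≢ 2) →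
    Dep B E → (∀ {l} → l ∈ B → 1 ≤ occ l TX) →
    Z (outl L TX) ((tri p q r , Uv (outl L TY) (tri p q r) X E) ∷ Y) F ≤ Z L (X ++ Y) (λ σ → E σ * F σ)
  glue' X Y refl refl = glue X Y

  module Sides {L p q r TX TY} (X Y : List Vx) (eX : tr X ≡ TX) (eY : tr Y ≡ TY) (w : WF L (TX ++ TY)) (br : Br L (TX ++ TY))
               (bd : bdl L TX ↭ p ∷ q ∷ r ∷ []) where
    o : Tri
    o = tri p q r
    h : Loopless o
    h = bd-loopless TX TY w bd
    LX LY : List ℕ
    LX = outl L TY
    LY = outl L TX
    module CY = Contract TX TY w bd
    module CX = Contract TY TX (WF-↭ (++-comm TX TY) w) (ptrans (bdl-compl TX TY w) bd)
    wY : WF LY (o ∷ TY)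
    wY = CY.WF'
    wX : WF LX (o ∷ TX)
    wX = CX.WF'
    bY : Br LY (o ∷ TY)
    bY = CY.Br' br
    bX : Br LX (o ∷ TX)
    bX = CX.Br' (Br-↭ (++-comm TX TY) br)

    split-dot : ∀ {A F B E} → Dep A F → (∀ {l} → l ∈ A → occ l TX ≢ 2) → Dep B E → (∀ {l} → l ∈ B → 1 ≤ occ l TX) →
      dot (Uv LX o X E) (Uv LY o Y F) ≤ Z L (X ++ Y) (λ σ → E σ * F σ)
    split-dot d dis dE inX = ≤-trans (≤-reflexive (sym (vertexSum (subst (λ z → WF LY (o ∷ z)) (sym eY) wY) h d)))
      (glue' X Y eX eY w h bd d dis dE inX)

  dot-ge : ∀ a u {n} → n ≤ a₁ a * a₁ u + a₂ a * a₂ u + a₃ a * a₃ u → n ≤ dot a u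
  dot-ge a u h = ≤-trans h (m≤m+n _ _)

  *-pos : ∀ {e f : ℕ} (σ : Asg) → neg e σ * neg f σ ≤ neg e σ
  *-pos {e} {f} σ with σ e | σ f
  ... | true | true = z≤n
  ... | true | false = z≤n
  ... | false | true = z≤n
  ... | false | false = ≤-refl

  data Small : List Tri → Set where
    sz0 : Small []
    sz2 : ∀ {a b} → Small (a ∷ b ∷ [])
    sz4 : ∀ {a b c d} → Small (a ∷ b ∷ c ∷ d ∷ [])
    sz6 : ∀ {G} → 6 ≤ length G → Small G

  small : ∀ {L G} → WF L G → Small G
  small {G = G} w = go G (evenLength w)
    where
    odd : ∀ k → 1 ≢ k + k
    odd (suc k) e = case trans (suc-injective e) (+-suc k k) of λ ()
    go : ∀ G → ∃[ k ] length G ≡ k + k → Small G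
    go [] _ = sz0
    go (a ∷ []) (k , e) = ⊥-elim (odd k e)
    go (a ∷ b ∷ []) _ = sz2
    go (a ∷ b ∷ c ∷ []) (suc k , e) = ⊥-elim (odd k (suc-injective (trans (suc-injective e) (+-suc k k))))
    go (a ∷ b ∷ c ∷ d ∷ []) _ = sz4
    go (a ∷ b ∷ c ∷ d ∷ f ∷ []) (suc (suc k) , e) = ⊥-elim (odd k (suc-injective (suc-injective (trans (suc-injective (suc-injective e)) (trans (+-suc k (suc k)) (cong suc (+-suc k k)))))))
    go (a ∷ b ∷ c ∷ d ∷ f ∷ []) (suc zero , ())
    go (a ∷ b ∷ c ∷ d ∷ f ∷ g ∷ G) _ = sz6 (s≤s (s≤s (s≤s (s≤s (s≤s (s≤s z≤n))))))

  Z-comm : ∀ L G (F H : Asg → ℕ) → Z L G (λ σ → F σ * H σ) ≡ Z L G (λ σ → H σ * F σ)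
  Z-comm L G F H = sum-cong L (λ σ → cong (pr G σ *_) (*-comm (F σ) (H σ))) zeros

  ples-cut : ∀ {L p q r} X Y → WF L (X ++ Y) → Br L (X ++ Y) → bdl L X ↭ p ∷ q ∷ r ∷ [] →
    Ples (outl L Y) (tri p q r ∷ X) → Ples (outl L X) (tri p q r ∷ Y) → Ples L (X ++ Y)
  ples-cut {L} {p} {q} {r} X Y w b bd PX PY e f = subst (λ G → 1 ≤ Z L G (λ σ → neg e σ * neg f σ)) (sym (map-++ plain X Y)) (go (side e) (side f))
    where
    open Sides (pl X) (pl Y) (tr-pl X) (tr-pl Y) w b bd
    uX = λ F → Uv LX o (pl X) F
    uY = λ F → Uv LY o (pl Y) F
    wX' : WF LX (o ∷ tr (pl X))
    wX' = subst (λ z → WF LX (o ∷ z)) (sym (tr-pl X)) wX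
    wY' : WF LY (o ∷ tr (pl Y))
    wY' = subst (λ z → WF LY (o ∷ z)) (sym (tr-pl Y)) wY
    side : ∀ l → 1 ≤ occ l X ⊎ occ l X ≡ 0
    side l with occ l X
    ... | 0 = inj₂ refl
    ... | suc k = inj₁ (s≤s z≤n)
    not2 : ∀ {l} → occ l X ≡ 0 → occ l X ≢ 2
    not2 h k = case trans (sym h) k of λ ()
    dn : ∀ l → Dep (l ∷ []) (neg l)
    dn = dep-neg
    dnn : Dep (e ∷ f ∷ []) (λ σ → neg e σ * neg f σ)
    dnn = dep-* (dn e) (dn f)
    go : 1 ≤ occ e X ⊎ occ e X ≡ 0 → 1 ≤ occ f X ⊎ occ f X ≡ 0 → 1 ≤ Z L (pl X ++ pl Y) (λ σ → neg e σ * neg f σ)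
    go (inj₁ he) (inj₁ hf) = ≤-trans (≤-trans (dot-ge (uX _) (uY _) (all1-pos {uX (λ σ → neg e σ * neg f σ)}
          (≤-trans (PX e f) (≤-reflexive (Zsum wX' h dnn))) (ples-all1 wY h PY)))
        (split-dot dep-one (λ ()) dnn (λ { (here refl) → he ; (there (here refl)) → hf })))
      (≤-reflexive (sum-cong L (λ σ → cong (pr (pl X ++ pl Y) σ *_) (*-identityʳ _)) zeros))
    go (inj₁ he) (inj₂ hf) = ≤-trans (dot-ge (uX _) (uY _) (at2-pos (ples-at2 wX h PX e) (ples-at2 wY h PY f)))
        (split-dot (dn f) (λ { (here refl) → not2 hf }) (dn e) (λ { (here refl) → he }))
    go (inj₂ he) (inj₁ hf) = ≤-trans (≤-trans (dot-ge (uX _) (uY _) (at2-pos (ples-at2 wX h PX f) (ples-at2 wY h PY e)))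
        (split-dot (dn e) (λ { (here refl) → not2 he }) (dn f) (λ { (here refl) → hf }))) (≤-reflexive (Z-comm L (pl X ++ pl Y) (neg f) (neg e)))
    go (inj₂ he) (inj₂ hf) = ≤-trans (≤-trans (dot-ge (uX one) (uY _) (≤-trans (all1-pos {uY (λ σ → neg e σ * neg f σ)}
          (≤-trans (PY e f) (≤-reflexive (Zsum wY' h dnn))) (ples-all1 wX h PX)) (≤-reflexive (cc (uY (λ σ → neg e σ * neg f σ)) (uX one)))))
        (split-dot dnn (λ { (here refl) → not2 he ; (there (here refl)) → not2 hf }) dep-one (λ ())))
      (≤-reflexive (sum-cong L (λ σ → cong (pr (pl X ++ pl Y) σ *_) (*-identityˡ _)) zeros))
      where
      cc : ∀ u v → a₁ u * a₁ v + a₂ u * a₂ v + a₃ u * a₃ v ≡ a₁ v * a₁ u + a₂ v * a₂ u + a₃ v * a₃ u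
      cc u v = cong₂ _+_ (cong₂ _+_ (*-comm (a₁ u) (a₁ v)) (*-comm (a₂ u) (a₂ v))) (*-comm (a₃ u) (a₃ v))

  len-Good : ∀ {L₁ W R₁ R e} → Good L₁ W R₁ R e → length (W ∷ R₁) ≡ suc (length R)
  len-Good g = cong suc (glen g)

  ples-prime : ∀ {L G} → (∀ {L₁ G₁} → suc (length G₁) ≤ length G → WF L₁ G₁ → Br L₁ G₁ → Ples L₁ G₁) →
    WF L G → Br L G → No3 L G → 6 ≤ length G → ∀ e f → 1 ≤ cnt e L → 1 ≤ Z L (pl G) (λ σ → neg e σ * neg f σ)
  ples-prime {L} {G} ih w br n3 l6 e f he with eqD f e
  ... | inj₁ refl = go (centre w br n3 l6 he e)
    where
    go : Centre G e e → 1 ≤ Z L (pl G) (λ σ → neg e σ * neg e σ)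
    go (s , t , a , b , g₁ , g₂ , g₃ , g₄ , R , _ , q) = ≤-trans (lem _ (V.voor4 (dep-neg e) (λ { (here refl) → V0.e∉ }) 1
        λ L₁ W R₁ g → ih (≤-trans (≤-reflexive (cong suc (len-Good g))) (≤-trans (n≤1+n _) (≤-reflexive (sym (pllen {G} q))))) (gwf g) (gbr g) e e))
        (≤-reflexive (sym (⇝Z q L _)))
      where
      lr : 3 ≤ length (tri e s t ∷ R)
      lr = ≤-pred (≤-pred (≤-pred (subst (6 ≤_) (pllen {G} q) l6)))
      module V = Voor4 (plwf {L} {G} q w) (plbr {L} {G} q br) (pln3 {L} {G} q n3) lr
      module V0 = Voor (plwf {L} {G} q w) (plbr {L} {G} q br) (pln3 {L} {G} q n3) lr
      lem : ∀ z → 4 ≤ 3 * z → 1 ≤ z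
      lem (suc z) _ = s≤s z≤n
  ... | inj₂ fe = go (centre w br n3 l6 he f)
    where
    go : Centre G e f → 1 ≤ Z L (pl G) (λ σ → neg e σ * neg f σ)
    go (s , t , a , b , g₁ , g₂ , g₃ , g₄ , R , f∉ , q) = ≤-trans (cases (mem? f (g₁ ∷ g₂ ∷ g₃ ∷ g₄ ∷ []))) (≤-reflexive (sym (⇝Z q L _)))
      where
      K : List Tri
      K = tri e a b ∷ tri a g₁ g₂ ∷ tri b g₃ g₄ ∷ tri e s t ∷ R
      lr : 3 ≤ length (tri e s t ∷ R)
      lr = ≤-pred (≤-pred (≤-pred (subst (6 ≤_) (pllen {G} q) l6)))
      ihG : ∀ {L₁ W R₁} → Good L₁ W R₁ (tri e s t ∷ R) e → Ples L₁ (W ∷ R₁)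
      ihG g = ih (≤-trans (≤-reflexive (cong suc (len-Good g))) (≤-trans (n≤1+n _) (≤-reflexive (sym (pllen {G} q))))) (gwf g) (gbr g)
      module _ {a b g₁ g₂ g₃ g₄} (q' : pl K ⇝ pl (tri e a b ∷ tri a g₁ g₂ ∷ tri b g₃ g₄ ∷ tri e s t ∷ R)) where
        private
          module V = Voor4 (plwf {L} {K} q' (plwf {L} {G} q w)) (plbr {L} {K} q' (plbr {L} {G} q br)) (pln3 {L} {K} q' (pln3 {L} {G} q n3)) lr
        viaG : 1 ≤ Z L (pl K) (λ σ → neg e σ * neg g₁ σ)
        viaG = lower (V.voorG dep-one (λ ()))
          where
          lower : (∃[ L₁ ] ∃[ W ] ∃[ R₁ ] Good L₁ W R₁ (tri e s t ∷ R) e ×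
                Z L₁ (pl (W ∷ R₁)) (λ σ → neg e σ * one σ) ≤ Z L (pl (tri e a b ∷ tri a g₁ g₂ ∷ tri b g₃ g₄ ∷ tri e s t ∷ R)) (λ σ → neg e σ * (neg g₁ σ * one σ))) →
               1 ≤ Z L (pl K) (λ σ → neg e σ * neg g₁ σ)
          lower (L₁ , W , R₁ , g , le) = ≤-trans (ihG g e e) (≤-trans (Z-mono L₁ {pl (W ∷ R₁)} {pl (W ∷ R₁)} {λ σ → neg e σ * neg e σ} {λ σ → neg e σ * one σ} (λ _ → ≤-refl) (λ σ → ≤-trans (*-pos {e} {e} σ) (≤-reflexive (sym (*-identityʳ _)))))
            (≤-trans le (≤-reflexive (trans (sum-cong L (λ σ → cong (λ z → pr (pl (tri e a b ∷ tri a g₁ g₂ ∷ tri b g₃ g₄ ∷ tri e s t ∷ R)) σ * (neg e σ * z)) (*-identityʳ (neg g₁ σ))) zeros)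
              (sym (⇝Z q' L (λ σ → neg e σ * neg g₁ σ)))))))
      cases : f ∈ g₁ ∷ g₂ ∷ g₃ ∷ g₄ ∷ [] ⊎ f ∉ g₁ ∷ g₂ ∷ g₃ ∷ g₄ ∷ [] → 1 ≤ Z L (pl K) (λ σ → neg e σ * neg f σ)
      cases (inj₁ (here refl)) = viaG ⇝refl
      cases (inj₁ (there (here refl))) = viaG K₁₂
      cases (inj₁ (there (there (here refl)))) = viaG K₁₃
      cases (inj₁ (there (there (there (here refl))))) = viaG K₁₄
      cases (inj₂ n) = lem _ (V.voor4 (dep-neg f) (λ { (here refl) → λ { (here z) → f∉ (here z) ; (there (here z)) → f∉ (there (here z)) ; (there (there m)) → n m } }) 1
          λ L₁ W R₁ g → ihG g e f)
        where
        module V = Voor4 (plwf {L} {G} q w) (plbr {L} {G} q br) (pln3 {L} {G} q n3) lr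
        lem : ∀ z → 4 ≤ 3 * z → 1 ≤ z
        lem (suc z) _ = s≤s z≤n

  ples : ∀ n {L G} → length G ≤ n → WF L G → Br L G → Ples L G
  ples n {L} {G} ln w br with small w
  ... | sz2 = ples2 w br
  ... | sz4 = ples4 w br
  ... | sz0 = λ e f → nil L w e f
    where
    nil : ∀ L → WF L [] → ∀ e f → 1 ≤ Z L [] (λ σ → neg e σ * neg f σ)
    nil [] w e f = s≤s z≤n
    nil (l ∷ L) w e f with ≤-trans (∈⇒cnt {l} {l ∷ L} (here refl)) (≤-trans (m≤m+n _ _) (≤-reflexive (sym (twice w l))))
    ... | ()
  ples (suc n) {L} {G} ln w br | sz6 l6 with search3 L G
  ... | inj₂ n3 = λ e f → by e f (mem? e L)
    where
    core : ∀ e f → 1 ≤ cnt e L → 1 ≤ Z L (pl G) (λ σ → neg e σ * neg f σ)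
    core = ples-prime (λ lt → ples n (≤-pred (≤-trans lt ln))) w br n3 l6
    some' : ∀ G → WF L G → 6 ≤ length G → ∃[ p ] 1 ≤ cnt p L
    some' (tri p q r ∷ G') w' _ = p , lem (cnt p L) (≤-trans (∈⇒cnt {p} {p ∷ q ∷ r ∷ labs G'} (here refl)) (≤-reflexive (twice w' p)))
      where
      lem : ∀ c → 1 ≤ c + c → 1 ≤ c
      lem (suc c) _ = s≤s z≤n
    some : ∃[ p ] 1 ≤ cnt p L
    some = some' G w l6
    by : ∀ e f → e ∈ L ⊎ e ∉ L → 1 ≤ Z L (pl G) (λ σ → neg e σ * neg f σ)
    by e f (inj₁ m) = core e f (∈⇒cnt m)
    by e f (inj₂ m) = ≤-trans (core (proj₁ some) f (proj₂ some))
      (≤-trans (≤-reflexive (Z-comm L (pl G) (neg (proj₁ some)) (neg f)))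
      (≤-trans (Z-mono L {pl G} {pl G} {λ σ → neg f σ * neg (proj₁ some) σ} {neg f} (λ _ → ≤-refl) (λ σ → *-pos {f} {proj₁ some} σ))
      (≤-reflexive (trans (sym (neg-drop {L} {e} (pl G) (neg f) (∉⇒cnt L m))) (Z-comm L (pl G) (neg f) (neg e))))))
  ... | inj₁ (X , Y , p , lX , lY , d) with bdl3 L X d
  ...   | x , y , z , bd = λ e f → ≤-trans (ples-cut X Y w' br' bd
            (ples n (lenle X Y lY (↭-length p)) CX.WF' (CX.Br' (Br-↭ (++-comm X Y) br')))
            (ples n (lenle Y X lX (trans (↭-length p) (trans (length-++ X) (trans (+-comm (length X) _) (sym (length-++ Y)))))) CY.WF' (CY.Br' br')) e f)
          (≤-reflexive (Z-↭ L _ (pl-↭ (↭-sym p))))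
    where
    w' : WF L (X ++ Y)
    w' = WF-↭ p w
    br' : Br L (X ++ Y)
    br' = Br-↭ p br
    module CY = Contract X Y w' bd
    module CX = Contract Y X (WF-↭ (++-comm X Y) w') (ptrans (bdl-compl X Y w') bd)
    lenle : ∀ (X Y : List Tri) → 2 ≤ length Y → length G ≡ length (X ++ Y) → suc (length X) ≤ n
    lenle X Y h e = ≤-pred (≤-trans (≤-trans (≤-reflexive (+-comm 2 (length X))) (+-monoʳ-≤ (length X) h))
      (≤-trans (≤-reflexive (trans (sym (length-++ X)) (sym e))) ln))
  ples zero ln w br | sz6 l6 = ⊥-elim (case ≤-trans l6 ln of λ ())

  ples! : ∀ {L G} → WF L G → Br L G → Ples L G
  ples! {G = G} = ples (length G) ≤-refl

  record Prime (L : List ℕ) (G : List Tri) : Set where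
    field
      pwf : WF L G
      pbr : Br L G
      pn3 : No3 L G
      p6  : 6 ≤ length G
  open Prime public

  prime-⇝ : ∀ {L G H} → pl G ⇝ pl H → Prime L G → Prime L H
  prime-⇝ {L} {G} {H} q P = record { pwf = plwf {L} {G} {H} q (pwf P) ; pbr = plbr {L} {G} {H} q (pbr P)
    ; pn3 = pln3 {L} {G} {H} q (pn3 P) ; p6 = subst (6 ≤_) (pllen {G} {H} q) (p6 P) }

  notri : ∀ {L e a b c s t g R} → Prime L (tri e a b ∷ tri a c g ∷ tri e s t ∷ R) → s ∉ e ∷ a ∷ [] → s ∉ c ∷ g ∷ []
  notri {L} {e} {a} {b} {c} {s} {t} {g} {R} P n m = noTriple X R (pwf P) (pbr P) (pn3 P) refl
    (≤-trans (s≤s (s≤s z≤n)) (≤-pred (≤-pred (≤-pred (p6 P))))) e a s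
    (ge e (tri e a b ∷ []) (tri a c g ∷ tri e s t ∷ []) (here refl) (there (there (there (here refl)))))
    (ge a (tri e a b ∷ []) (tri a c g ∷ tri e s t ∷ []) (there (here refl)) (here refl))
    (ge s (tri e a b ∷ tri a c g ∷ []) (tri e s t ∷ []) (there (there (there (there m')))) (there (here refl)))
    (proj₁ (dist3 (noloop (pwf P) (pbr P)))) (λ z → n (here (sym z))) (λ z → n (there (here (sym z))))
    where
    X : List Tri
    X = tri e a b ∷ tri a c g ∷ tri e s t ∷ []
    m' : s ∈ c ∷ g ∷ []
    m' = m
    ge : ∀ l A B → l ∈ labs A → l ∈ labs B → 2 ≤ occ l (A ++ B)
    ge l A B i j = ≤-trans (+-mono-≤ (∈⇒cnt i) (∈⇒cnt j)) (≤-reflexive (sym (occ-++ l A B)))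

  -- the factor 4/3 of the reduction, rounded up
  twoPM : ∀ {L e s t Y} → Prime L (tri e s t ∷ Y) → 2 ≤ Z L (pl (tri e s t ∷ Y)) (λ σ → neg e σ * neg s σ)
  twoPM {L} {e} {s} {t} {Y} P = go (pull (plain y ∷ []) Y (other-end {X = y ∷ []} {Y} {e} (pwf P)
      (≤-antisym (noloop (pwf P) (pbr P) e) (∈⇒cnt {A = e ∷ s ∷ t ∷ []} (here refl)))))
    where
    y : Tri
    y = tri e s t
    lem : ∀ z → 4 ≤ 3 * z → 2 ≤ z
    lem (suc zero) (s≤s (s≤s (s≤s ())))
    lem (suc (suc z)) _ = s≤s (s≤s z≤n)
    go : ∃[ m ] ∃[ n ] ∃[ Y' ] (plain y ∷ pl Y ⇝ plain y ∷ pl (tri e m n ∷ Y')) → 2 ≤ Z L (pl (y ∷ Y)) (λ σ → neg e σ * neg s σ)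
    go (a , b , Y' , q) = go2 (expand (pwf P') (pbr P') (pn3 P') l4)
      where
      P' : Prime L (y ∷ tri e a b ∷ Y')
      P' = prime-⇝ {L} {y ∷ Y} {y ∷ tri e a b ∷ Y'} q P
      l4 : 4 ≤ length Y'
      l4 = ≤-pred (≤-pred (p6 P'))
      go2 : Expanded e s t a b Y' → 2 ≤ Z L (pl (y ∷ Y)) (λ σ → neg e σ * neg s σ)
      go2 (g₁ , g₂ , g₃ , g₄ , R , r) = ≤-trans (lem _ (V.voor4 (dep-neg s) (λ { (here refl) → dis }) 1
          λ L₁ W R₁ g → ples! (gwf g) (gbr g) e s)) (≤-reflexive (sym (trans (⇝Z q L _) (⇝Z r L _))))
        where
        K : List Tri
        K = tri e a b ∷ tri a g₁ g₂ ∷ tri b g₃ g₄ ∷ y ∷ R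
        PK : Prime L K
        PK = prime-⇝ {L} {y ∷ tri e a b ∷ Y'} {K} r P'
        lr : 3 ≤ length (y ∷ R)
        lr = ≤-pred (≤-pred (≤-pred (p6 PK)))
        module V = Voor4 (pwf PK) (pbr PK) (pn3 PK) lr
        qy : pl K ⇝ pl (y ∷ tri e a b ∷ tri a g₁ g₂ ∷ tri b g₃ g₄ ∷ R)
        qy = ⇝↭ (shifts (_ ∷ _ ∷ _ ∷ []) (_ ∷ []))
        q₁ : pl K ⇝ pl (tri e a b ∷ tri a g₁ g₂ ∷ y ∷ tri b g₃ g₄ ∷ R)
        q₁ = ⇝↭ (prep _ (prep _ (pswap _ _ prefl)))
        q₂ : pl K ⇝ pl (tri e b a ∷ tri b g₃ g₄ ∷ y ∷ tri a g₁ g₂ ∷ R)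
        q₂ = ⇝sw (s23 s0) ⇝∙ ⇝↭ (prep _ (ptrans (pswap _ _ prefl) (prep _ (pswap _ _ prefl))))
        Pu : Prime L (tri e a b ∷ y ∷ tri a g₁ g₂ ∷ tri b g₃ g₄ ∷ R)
        Pu = prime-⇝ {L} {K} {tri e a b ∷ y ∷ tri a g₁ g₂ ∷ tri b g₃ g₄ ∷ R} (qy ⇝∙ ⇝↭ (pswap _ _ prefl)) PK
        Pu' : Prime L (tri e b a ∷ y ∷ tri a g₁ g₂ ∷ tri b g₃ g₄ ∷ R)
        Pu' = prime-⇝ {L} {tri e a b ∷ y ∷ tri a g₁ g₂ ∷ tri b g₃ g₄ ∷ R} {tri e b a ∷ y ∷ tri a g₁ g₂ ∷ tri b g₃ g₄ ∷ R} (⇝sw (s23 s0)) Pu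
        l4' : 4 ≤ length (tri a g₁ g₂ ∷ tri b g₃ g₄ ∷ R)
        l4' = ≤-pred (≤-pred (p6 Pu))
        a∉ : a ∉ s ∷ t ∷ []
        a∉ = nodigon (pwf Pu) (pbr Pu) (pn3 Pu) l4'
        b∉ : b ∉ s ∷ t ∷ []
        b∉ = nodigon (pwf Pu') (pbr Pu') (pn3 Pu') l4'
        s≢e : s ≢ e
        s≢e z = proj₁ (dist3 (noloop (pwf P) (pbr P))) (sym z)
        s∉₁ : s ∉ g₁ ∷ g₂ ∷ []
        s∉₁ = notri (prime-⇝ {L} {K} {tri e a b ∷ tri a g₁ g₂ ∷ y ∷ tri b g₃ g₄ ∷ R} q₁ PK) λ { (here z) → s≢e z ; (there (here z)) → a∉ (here (sym z)) }
        s∉₂ : s ∉ g₃ ∷ g₄ ∷ []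
        s∉₂ = notri (prime-⇝ {L} {K} {tri e b a ∷ tri b g₃ g₄ ∷ y ∷ tri a g₁ g₂ ∷ R} q₂ PK) λ { (here z) → s≢e z ; (there (here z)) → b∉ (here (sym z)) }
        dis : s ∉ a ∷ b ∷ g₁ ∷ g₂ ∷ g₃ ∷ g₄ ∷ []
        dis (here z) = a∉ (here (sym z))
        dis (there (here z)) = b∉ (here (sym z))
        dis (there (there (here z))) = s∉₁ (here z)
        dis (there (there (there (here z)))) = s∉₁ (there (here z))
        dis (there (there (there (there m)))) = s∉₂ m

  record AllGe (k : ℕ) (u : Wt) : Set where
    constructor allge
    field
      g₁ : k ≤ a₁ u
      g₂ : k ≤ a₂ u
      g₃ : k ≤ a₃ u
  open AllGe public

  module _ {L p q r Y} (w : WF L (tri p q r ∷ Y)) (h : Loopless (tri p q r)) where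
    private
      t : Tri
      t = tri p q r
      w' : WF L (t ∷ tr (pl Y))
      w' = subst (λ z → WF L (t ∷ z)) (sym (tr-pl Y)) w
      to1 : ∀ l x y z → U L t (pl Y) (neg l) x y z ≡ U L t (pl Y) (λ σ → one σ * neg l σ) x y z
      to1 l x y z = sum-cong (rest L t) (λ σ → cong (pr (pl Y) σ *_) (sym (+-identityʳ (neg l σ)))) _

    U₁-eq : Z L (pl (t ∷ Y)) (λ σ → neg q σ * neg r σ) ≡ U L t (pl Y) one true false false
    U₁-eq = trans (avoid₃ w' h (dep-neg q)) (trans (cong₂ _+_ (trans (to1 q true false false) (U-neg₂ w' h one true false false)) (trans (to1 q false true false) (U-neg₂ w' h one false true false))) (lem (U L t (pl Y) one true false false) (U L t (pl Y) one false true false)))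
      where
      lem : ∀ a b → 1 * a + 0 * b ≡ a
      lem = solve-∀

    U₂-eq : Z L (pl (t ∷ Y)) (λ σ → neg p σ * neg r σ) ≡ U L t (pl Y) one false true false
    U₂-eq = trans (avoid₃ w' h (dep-neg p)) (trans (cong₂ _+_ (trans (to1 p true false false) (U-neg₁ w' h one true false false)) (trans (to1 p false true false) (U-neg₁ w' h one false true false))) (lem (U L t (pl Y) one true false false) _))
      where
      lem : ∀ a b → 0 * a + 1 * b ≡ b
      lem = solve-∀

    U₃-eq : Z L (pl (t ∷ Y)) (λ σ → neg p σ * neg q σ) ≡ U L t (pl Y) one false false true
    U₃-eq = trans (avoid₂ w' h (dep-neg p)) (trans (cong₂ _+_ (trans (to1 p true false false) (U-neg₁ w' h one true false false)) (trans (to1 p false false true) (U-neg₁ w' h one false false true))) (lem (U L t (pl Y) one true false false) _))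
      where
      lem : ∀ a b → 0 * a + 1 * b ≡ b
      lem = solve-∀

  prime-all2 : ∀ {L p q r Y} → Prime L (tri p q r ∷ Y) → AllGe 2 (Uv L (tri p q r) (pl Y) one)
  prime-all2 {L} {p} {q} {r} {Y} P = allge
      (≤-trans (twoPM (prime-⇝ {L} {tri p q r ∷ Y} {tri q r p ∷ Y} e₁ P)) (≤-reflexive (trans (sym (⇝Z e₁ L (λ σ → neg q σ * neg r σ))) (U₁-eq (pwf P) h))))
      (≤-trans (twoPM (prime-⇝ {L} {tri p q r ∷ Y} {tri p r q ∷ Y} e₂ P)) (≤-reflexive (trans (sym (⇝Z e₂ L (λ σ → neg p σ * neg r σ))) (U₂-eq (pwf P) h))))
      (≤-trans (twoPM P) (≤-reflexive (U₃-eq (pwf P) h)))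
    where
    h : Loopless (tri p q r)
    h = noloop (pwf P) (pbr P)
    e₁ : pl (tri p q r ∷ Y) ⇝ pl (tri q r p ∷ Y)
    e₁ = ⇝sw (s12 (s23 s0))
    e₂ : pl (tri p q r ∷ Y) ⇝ pl (tri p r q ∷ Y)
    e₂ = ⇝sw (s23 s0)

  Φ : List ℕ → List Tri → ℕ → ℕ
  Φ L G e = Z L (pl G) (neg e)

  record Pair (π : ℕ) (v : Wt) : Set where
    constructor pair
    field
      p12 : π ≤ a₁ v + a₂ v
      p13 : π ≤ a₁ v + a₃ v
      p23 : π ≤ a₂ v + a₃ v
  open Pair public

  sum₃ : Wt → ℕ
  sum₃ u = a₁ u + a₂ u + a₃ u

  dotpair : ∀ {x π u v} → At2 u → AllGe x v → Pair π v → π + x * sum₃ u ≤ dot v u + 2 * x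
  dotpair {x} {π} {wt b₁ b₂ b₃ b₀} {wt c₁ c₂ c₃ c₀} (at2 n₁ n₂ n₃) (allge h₁ h₂ h₃) (pair q₁ q₂ q₃)
    with m≤n⇒∃[o]m+o≡n h₁ | m≤n⇒∃[o]m+o≡n h₂ | m≤n⇒∃[o]m+o≡n h₃
  ... | w₁ , refl | w₂ , refl | w₃ , refl = go b₁ b₂ b₃ n₁ n₂ n₃
    where
    base : ∀ b₁ b₂ b₃ k → π ≤ k + 2 * x → k ≤ b₁ * w₁ + b₂ * w₂ + b₃ * w₃ →
      π + x * (b₁ + b₂ + b₃) ≤ (x + w₁) * b₁ + (x + w₂) * b₂ + (x + w₃) * b₃ + c₀ * b₀ + 2 * x
    base b₁ b₂ b₃ k h g = ≤-trans (+-monoˡ-≤ (x * (b₁ + b₂ + b₃)) (≤-trans h (+-monoˡ-≤ (2 * x) g)))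
      (≤-trans (m≤m+n _ (c₀ * b₀)) (≤-reflexive (ring x w₁ w₂ w₃ b₁ b₂ b₃ (c₀ * b₀))))
      where
      ring : ∀ x w₁ w₂ w₃ b₁ b₂ b₃ c → b₁ * w₁ + b₂ * w₂ + b₃ * w₃ + 2 * x + x * (b₁ + b₂ + b₃) + c
        ≡ (x + w₁) * b₁ + (x + w₂) * b₂ + (x + w₃) * b₃ + c + 2 * x
      ring = solve-∀
    xs : ∀ u v → x + u + (x + v) ≡ u + v + 2 * x
    xs u v = ring x u v
      where
      ring : ∀ x u v → x + u + (x + v) ≡ u + v + 2 * x
      ring = solve-∀
    ge1 : ∀ b w → w ≤ suc b * w
    ge1 b w = m≤m+n w (b * w)
    go : ∀ b₁ b₂ b₃ → 1 ≤ b₂ + b₃ → 1 ≤ b₁ + b₃ → 1 ≤ b₁ + b₂ →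
      π + x * (b₁ + b₂ + b₃) ≤ (x + w₁) * b₁ + (x + w₂) * b₂ + (x + w₃) * b₃ + c₀ * b₀ + 2 * x
    go (suc b₁) (suc b₂) b₃ _ _ _ = base (suc b₁) (suc b₂) b₃ (w₁ + w₂) (≤-trans q₁ (≤-reflexive (xs w₁ w₂)))
      (≤-trans (+-mono-≤ (ge1 b₁ w₁) (ge1 b₂ w₂)) (m≤m+n _ _))
    go (suc b₁) zero (suc b₃) _ _ _ = base (suc b₁) 0 (suc b₃) (w₁ + w₃) (≤-trans q₂ (≤-reflexive (xs w₁ w₃)))
      (+-mono-≤ (≤-trans (ge1 b₁ w₁) (m≤m+n _ _)) (ge1 b₃ w₃))
    go zero (suc b₂) (suc b₃) _ _ _ = base 0 (suc b₂) (suc b₃) (w₂ + w₃) (≤-trans q₃ (≤-reflexive (xs w₂ w₃)))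
      (+-mono-≤ (ge1 b₂ w₂) (ge1 b₃ w₃))
    go (suc b₁) zero zero () _ _
    go zero (suc b₂) zero _ () _
    go zero zero b₃ _ _ ()

  dot-low : ∀ {x u v} → AllGe x v → x * sum₃ u ≤ dot v u
  dot-low {x} {u} {v} (allge h₁ h₂ h₃) = ≤-trans (≤-reflexive (ring x (a₁ u) (a₂ u) (a₃ u)))
    (≤-trans (+-mono-≤ (+-mono-≤ (*-monoˡ-≤ (a₁ u) h₁) (*-monoˡ-≤ (a₂ u) h₂)) (*-monoˡ-≤ (a₃ u) h₃)) (m≤m+n _ _))
    where
    ring : ∀ x a b c → x * (a + b + c) ≡ x * a + x * b + x * c
    ring = solve-∀

  Zsum' : ∀ {L t Y A F} → WF L (t ∷ Y) → Loopless t → Dep A F → Z L (pl (t ∷ Y)) F ≡ sum₃ (Uv L t (pl Y) F)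
  Zsum' {L} {t} {Y} w h d = Zsum (subst (λ z → WF L (t ∷ z)) (sym (tr-pl Y)) w) h d

  module Heavy {L t Y} (w : WF L (t ∷ Y)) (br : Br L (t ∷ Y)) (v : Wt) where
    private
      h : Loopless t
      h = noloop w br
      w' : WF L (t ∷ tr (pl Y))
      w' = subst (λ z → WF L (t ∷ z)) (sym (tr-pl Y)) w

    heavy-low : ∀ {x A F} → Dep A F → AllGe x v → x * Z L (pl (t ∷ Y)) F ≤ Z L ((t , v) ∷ pl Y) F
    heavy-low {x} {F = F} d a = ≤-trans (*-monoʳ-≤ x (≤-reflexive (Zsum' w h d)))
      (≤-trans (dot-low {x} {Uv L t (pl Y) F} {v} a) (≤-reflexive (sym (vertexSum w' h d))))

    heavy-pair : ∀ {x π} e → AllGe x v → Pair π v → π + x * Φ L (t ∷ Y) e ≤ Z L ((t , v) ∷ pl Y) (neg e) + 2 * x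
    heavy-pair {x} {π} e a p = ≤-trans (+-monoʳ-≤ π (*-monoʳ-≤ x (≤-reflexive (Zsum' w h (dep-neg e)))))
      (≤-trans (dotpair {x} {π} {Uv L t (pl Y) (neg e)} {v} (ples-at2 w h (ples! w br) e) a p)
        (+-monoˡ-≤ (2 * x) (≤-reflexive (sym (vertexSum w' h (dep-neg e))))))

  module HeavyInner {L p q r tz Y} (w : WF L (tri p q r ∷ tz ∷ Y)) (br : Br L (tri p q r ∷ tz ∷ Y)) (v : Wt) where
    private
      o : Tri
      o = tri p q r
      h : Loopless o
      h = noloop w br
      D : List Vx
      D = (tz , v) ∷ pl Y
      wD : WF L (o ∷ tr D)
      wD = subst (λ z → WF L (o ∷ tz ∷ z)) (sym (tr-pl Y)) w
      sw : tz ∷ o ∷ Y ↭ o ∷ tz ∷ Y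
      sw = pswap tz o prefl
      w₂ : WF L (tz ∷ o ∷ Y)
      w₂ = WF-↭ (↭-sym sw) w
      b₂ : Br L (tz ∷ o ∷ Y)
      b₂ = Br-↭ {L = L} (↭-sym sw) br
      module H = Heavy w₂ b₂ v
      swp : ∀ (F : Asg → ℕ) → Z L ((tz , v) ∷ pl (o ∷ Y)) F ≡ Z L (plain o ∷ D) F
      swp F = Z-↭ L {(tz , v) ∷ pl (o ∷ Y)} {plain o ∷ D} F (pswap (tz , v) (plain o) prefl)
      swpl : ∀ (F : Asg → ℕ) → Z L (pl (o ∷ tz ∷ Y)) F ≡ Z L (pl (tz ∷ o ∷ Y)) F
      swpl F = Z-↭ L {pl (o ∷ tz ∷ Y)} {pl (tz ∷ o ∷ Y)} F (pswap (plain o) (plain tz) prefl)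

    v' : Wt
    v' = Uv L o D one

    private
      to1 : ∀ l x y z → U L o D (neg l) x y z ≡ U L o D (λ σ → one σ * neg l σ) x y z
      to1 l x y z = sum-cong (rest L o) (λ σ → cong (pr D σ *_) (sym (+-identityʳ (neg l σ)))) _
      drop1 : ∀ l → Z L (plain o ∷ D) (neg l) ≡ Z L (plain o ∷ D) (λ σ → one σ * neg l σ)
      drop1 l = sum-cong L (λ σ → cong (pr (plain o ∷ D) σ *_) (sym (+-identityʳ (neg l σ)))) zeros

    inner-pair : ∀ {x π φ} → AllGe x v → Pair π v → φ ≤ Φ L (o ∷ tz ∷ Y) p → φ ≤ Φ L (o ∷ tz ∷ Y) q → φ ≤ Φ L (o ∷ tz ∷ Y) r →
      π + x * φ ≤ a₂ v' + a₃ v' + 2 * x × π + x * φ ≤ a₁ v' + a₃ v' + 2 * x × π + x * φ ≤ a₁ v' + a₂ v' + 2 * x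
    inner-pair {x} {π} {φ} a P hp hq hr = one' p hp (avoid₁ wD h dep-one) , one' q hq (avoid₂ wD h dep-one) , one' r hr (avoid₃ wD h dep-one)
      where
      one' : ∀ l {s} → φ ≤ Φ L (o ∷ tz ∷ Y) l → Z L (plain o ∷ D) (λ σ → one σ * neg l σ) ≡ s → π + x * φ ≤ s + 2 * x
      one' l hl e = ≤-trans (+-monoʳ-≤ π (*-monoʳ-≤ x (≤-trans hl (≤-reflexive (swpl (neg l))))))
        (≤-trans (H.heavy-pair {x} {π} l a P) (+-monoˡ-≤ (2 * x) (≤-reflexive (trans (swp (neg l)) (trans (drop1 l) e)))))

    private
      N2 : ∀ l m → Dep (l ∷ m ∷ []) (λ σ → neg l σ * neg m σ)
      N2 l m = dep-* (dep-neg l) (dep-neg m)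
      lo : ∀ {k x} l m → AllGe x v → k ≤ Z L (pl (o ∷ tz ∷ Y)) (λ σ → neg l σ * neg m σ) → x * k ≤ Z L (plain o ∷ D) (λ σ → neg l σ * neg m σ)
      lo {k} {x} l m a g = ≤-trans (*-monoʳ-≤ x (≤-trans g (≤-reflexive (swpl (λ σ → neg l σ * neg m σ)))))
        (≤-trans (H.heavy-low {x} (N2 l m) a) (≤-reflexive (swp (λ σ → neg l σ * neg m σ))))
      U₁ : Z L (plain o ∷ D) (λ σ → neg q σ * neg r σ) ≡ a₁ v'
      U₁ = trans (avoid₃ wD h (dep-neg q)) (trans (cong₂ _+_ (trans (to1 q true false false) (U-neg₂ wD h one true false false)) (trans (to1 q false true false) (U-neg₂ wD h one false true false))) (lem (a₁ v') (a₂ v')))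
        where
        lem : ∀ a b → 1 * a + 0 * b ≡ a
        lem = solve-∀
      U₂ : Z L (plain o ∷ D) (λ σ → neg p σ * neg r σ) ≡ a₂ v'
      U₂ = trans (avoid₃ wD h (dep-neg p)) (trans (cong₂ _+_ (trans (to1 p true false false) (U-neg₁ wD h one true false false)) (trans (to1 p false true false) (U-neg₁ wD h one false true false))) (lem (a₁ v') (a₂ v')))
        where
        lem : ∀ a b → 0 * a + 1 * b ≡ b
        lem = solve-∀
      U₃ : Z L (plain o ∷ D) (λ σ → neg p σ * neg q σ) ≡ a₃ v'
      U₃ = trans (avoid₂ wD h (dep-neg p)) (trans (cong₂ _+_ (trans (to1 p true false false) (U-neg₁ wD h one true false false)) (trans (to1 p false false true) (U-neg₁ wD h one false false true))) (lem (a₁ v') (a₃ v')))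
        where
        lem : ∀ a b → 0 * a + 1 * b ≡ b
        lem = solve-∀

    inner-low : ∀ {k x} → AllGe x v → AllGe k (Uv L o (pl (tz ∷ Y)) one) → AllGe (x * k) v'
    inner-low {k} {x} a (allge e₁ e₂ e₃) = allge
      (≤-trans (lo {k} {x} q r a (≤-trans e₁ (≤-reflexive (sym (U₁-eq w h))))) (≤-reflexive U₁))
      (≤-trans (lo {k} {x} p r a (≤-trans e₂ (≤-reflexive (sym (U₂-eq w h))))) (≤-reflexive U₂))
      (≤-trans (lo {k} {x} p q a (≤-trans e₃ (≤-reflexive (sym (U₃-eq w h))))) (≤-reflexive U₃))

  prime-φ4 : ∀ {L G e} → Prime L G → 1 ≤ cnt e L → 4 ≤ Φ L G e
  prime-φ4 {L} {G} {e} P he = go (endsOf (pwf P) (pbr P) he)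
    where
    go : Ends G e → 4 ≤ Φ L G e
    go (s , t , a , b , R , q) = ≤-trans (≤-trans (+-mono-≤ (g₂ A) (g₃ A)) (≤-reflexive (sym (trans
        (sum-cong L (λ σ → cong (pr (pl G') σ *_) (sym (+-identityʳ (neg e σ)))) zeros) (avoid₁ w' (noloop (pwf P') (pbr P')) dep-one)))))
        (≤-reflexive (sym (⇝Z q L (neg e))))
      where
      G' : List Tri
      G' = tri e s t ∷ tri e a b ∷ R
      P' : Prime L G'
      P' = prime-⇝ {L} {G} {G'} q P
      A : AllGe 2 (Uv L (tri e s t) (pl (tri e a b ∷ R)) one)
      A = prime-all2 P'
      w' : WF L (tri e s t ∷ tr (pl (tri e a b ∷ R)))
      w' = subst (WF L) (cong (λ z → tri e s t ∷ tri e a b ∷ z) (sym (tr-pl R))) (pwf P')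

  -- Contracting three vertices

  triW dblW tplW : Wt → Wt → Wt → Wt
  triW (wt a b c d) (wt p q r s) (wt x y z u) =
    wt (a * (r * z) + d * (q * y)) (c * (p * y) + b * (s * z)) (b * (q * x) + c * (r * u)) (a * (p * x) + d * (s * u))
  dblW (wt a b c d) (wt p q r s) (wt x y z u) =
    wt (a * (q * x + r * y)) (b * (q * x + r * y)) (c * (p * z + s * u)) (d * (p * z + s * u))
  tplW (wt a b c d) (wt p q r s) (wt x y z u) =
    wt (a * (p * x + q * y + r * z + s * u)) (b * (p * x + q * y + r * z + s * u))
       (c * (p * x + q * y + r * z + s * u)) (d * (p * x + q * y + r * z + s * u))

  shapeW : ∀ {X f₁ f₂ f₃ α β γ} → Shape X f₁ f₂ f₃ α β γ → Wt
  shapeW (triangle a b c) = triW a b c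
  shapeW (double a b c) = dblW a b c
  shapeW (triple a b c) = tplW a b c

  wt-cong : ∀ {a b c d a' b' c' d'} → a ≡ a' → b ≡ b' → c ≡ c' → d ≡ d' → wt a b c d ≡ wt a' b' c' d'
  wt-cong refl refl refl refl = refl

  private
    T8 : ∀ {a b c d e f g h a' b' c' d' e' f' g' h'} → a ≡ a' → b ≡ b' → c ≡ c' → d ≡ d' → e ≡ e' → f ≡ f' → g ≡ g' → h ≡ h' →
      a + b + (c + d) + (e + f + (g + h)) ≡ a' + b' + (c' + d') + (e' + f' + (g' + h'))
    T8 refl refl refl refl refl refl refl refl = refl
    z0 : 0 ≡ 0
    z0 = refl
    m3 : ∀ a b c → a * (b * (c * 1)) * 1 ≡ a * (b * c)
    m3 a b c = trans (*-identityʳ _) (cong (λ z → a * (b * z)) (*-identityʳ c))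
    m0 : ∀ a → a * 0 * 1 ≡ 0
    m0 a = trans (*-identityʳ _) (*-zeroʳ a)

  shapeSum : ∀ {X f₁ f₂ f₃ α β γ} (s : Shape X f₁ f₂ f₃ α β γ) → wt (sum8 (shapeΨ s true false false)) (sum8 (shapeΨ s false true false))
      (sum8 (shapeΨ s false false true)) (sum8 (shapeΨ s true true true)) ≡ shapeW s
  shapeSum (triangle (wt a b c d) (wt p q r s) (wt x y z u)) = wt-cong
      (trans (T8 (m0 d) (m3 d q y) z0 z0 z0 z0 (m3 a r z) (m0 a)) (e₁ (d * (q * y)) (a * (r * z))))
      (trans (T8 z0 z0 (m3 b s z) (m0 b) (m0 c) (m3 c p y) z0 z0) (e₂ (b * (s * z)) (c * (p * y))))
      (trans (T8 z0 z0 (m0 b) (m3 b q x) (m3 c r u) (m0 c) z0 z0) (e₃ (b * (q * x)) (c * (r * u))))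
      (trans (T8 (m3 d s u) (m0 d) z0 z0 z0 z0 (m0 a) (m3 a p x)) (e₀ (d * (s * u)) (a * (p * x))))
    where
    e₁ : ∀ a b → 0 + a + 0 + (0 + (b + 0)) ≡ b + a
    e₁ = solve-∀
    e₂ : ∀ a b → 0 + 0 + (a + 0) + (0 + b + (0 + 0)) ≡ b + a
    e₂ = solve-∀
    e₃ : ∀ a b → 0 + 0 + (0 + a) + (b + 0 + (0 + 0)) ≡ a + b
    e₃ = solve-∀
    e₀ : ∀ a b → a + 0 + (0 + 0) + (0 + 0 + (0 + b)) ≡ b + a
    e₀ = solve-∀
  shapeSum (double (wt a b c d) (wt p q r s) (wt x y z u)) = wt-cong
      (trans (T8 z0 z0 z0 z0 (m0 a) (m3 a q x) (m3 a r y) (m0 a)) (e₁ a (q * x) (r * y)))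
      (trans (T8 z0 z0 z0 z0 (m0 b) (m3 b q x) (m3 b r y) (m0 b)) (e₁ b (q * x) (r * y)))
      (trans (T8 (m3 c s u) (m0 c) (m0 c) (m3 c p z) z0 z0 z0 z0) (e₃ c (s * u) (p * z)))
      (trans (T8 (m3 d s u) (m0 d) (m0 d) (m3 d p z) z0 z0 z0 z0) (e₃ d (s * u) (p * z)))
    where
    e₁ : ∀ a x y → 0 + 0 + (0 + 0) + (0 + a * x + (a * y + 0)) ≡ a * (x + y)
    e₁ = solve-∀
    e₃ : ∀ a x y → a * x + 0 + (0 + a * y) + (0 + 0 + (0 + 0)) ≡ a * (y + x)
    e₃ = solve-∀
  shapeSum (triple (wt a b c d) (wt p q r s) (wt x y z u)) = wt-cong (f a) (f b) (f c) (f d)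
    where
    e : ∀ a p q r s → a * s + 0 + (0 + a * p) + (0 + a * q + (a * r + 0)) ≡ a * (p + q + r + s)
    e = solve-∀
    f : ∀ a → a * (s * (u * 1)) * 1 + a * 0 * 1 + (a * 0 * 1 + a * (p * (x * 1)) * 1)
        + (a * 0 * 1 + a * (q * (y * 1)) * 1 + (a * (r * (z * 1)) * 1 + a * 0 * 1)) ≡ a * (p * x + q * y + r * z + s * u)
    f a = trans (T8 (m3 a s u) (m0 a) (m0 a) (m3 a p x) (m0 a) (m3 a q y) (m3 a r z) (m0 a)) (e a (p * x) (q * y) (r * z) (s * u))

  shapeV : ∀ {L X f₁ f₂ f₃ α β γ} (s : Shape X f₁ f₂ f₃ α β γ) → Uq (six f₁ f₂ f₃ α β γ) → WF L (tri f₁ f₂ f₃ ∷ tr X) →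
    Loopless (tri f₁ f₂ f₃) → Uv L (tri f₁ f₂ f₃) X one ≡ shapeW s
  shapeV {L} {X} {f₁} {f₂} {f₃} {α} {β} {γ} s u w h = trans
    (wt-cong (shapeU s u w h true false false) (shapeU s u w h false true false) (shapeU s u w h false false true) (shapeU s u w h true true true)) (shapeSum s)
  sw-trans : ∀ {x y z} → Sw x y → Sw y z → Sw x z
  sw-trans s0 t = t
  sw-trans (s12 s) t = s12 (sw-trans s t)
  sw-trans (s23 s) t = s23 (sw-trans s t)

  sw-plain : ∀ {t y} → Sw (plain t) y → ∃[ s ] y ≡ plain s
  sw-plain {t} s0 = t , refl
  sw-plain (s12 s) = sw-plain s
  sw-plain (s23 s) = sw-plain s

  infix 4 _∼_
  _∼_ : Tri → Tri → Set
  t ∼ s = labs (t ∷ []) ↭ labs (s ∷ [])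

  -- the vertices z, p, q of a list of three, followed through ≈
  record Track (z : Vx) (p q : Tri) (X : List Vx) : Set where
    field
      {z'} : Vx
      {p' q'} : Tri
      perm : X ↭ z' ∷ plain p' ∷ plain q' ∷ []
      sz   : Sw z z'
      lp   : p ∼ p'
      lq   : q ∼ q'

  track-sw : ∀ {z p q x y X} → Sw x y → Track z p q (x ∷ X) → Track z p q (y ∷ X)
  track-sw {z} {p} {q} {x} {y} {X} s T = go (∈-resp-↭ perm (here refl))
    where
    open Track T
    go : x ∈ z' ∷ plain p' ∷ plain q' ∷ [] → Track z p q (y ∷ X)
    go (here refl) = record { perm = prep y (drop-∷ perm) ; sz = sw-trans sz s ; lp = lp ; lq = lq }
    go (there (here refl)) with sw-plain s
    ... | s' , refl = record { perm = ptrans (prep y (drop-∷ (ptrans perm (pswap _ _ prefl)))) (pswap _ _ prefl) ; sz = sz ; lp = ptrans lp (labs-sw s) ; lq = lq }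
    go (there (there (here refl))) with sw-plain s
    ... | s' , refl = record { perm = ptrans (prep y (drop-∷ (ptrans perm (shifts (_ ∷ _ ∷ []) (_ ∷ []))))) (↭-sym (shifts (_ ∷ _ ∷ []) (_ ∷ []))) ; sz = sz ; lp = lp ; lq = ptrans lq (labs-sw s) }

  track-≈ : ∀ {z p q X Y} → X ≈ Y → Track z p q X → Track z p q Y
  track-≈ ≈refl T = T
  track-≈ (≈↭ p a) T = track-≈ a (record { perm = ptrans (↭-sym p) (Track.perm T) ; sz = Track.sz T ; lp = Track.lp T ; lq = Track.lq T })
  track-≈ (≈sw s a) T = track-≈ a (track-sw s T)

  data Two (p q : Tri) : Vx → Vx → Set where
    two₁ : ∀ {t t'} → p ∼ t → q ∼ t' → Two p q (plain t) (plain t')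
    two₂ : ∀ {t t'} → q ∼ t → p ∼ t' → Two p q (plain t) (plain t')

  data Pos (z : Vx) (p q : Tri) : Vx → Vx → Vx → Set where
    at₁ : ∀ {x y w} → Sw z x → Two p q y w → Pos z p q x y w
    at₂ : ∀ {x y w} → Sw z y → Two p q x w → Pos z p q x y w
    at₃ : ∀ {x y w} → Sw z w → Two p q x y → Pos z p q x y w

  pair↭ : ∀ {A : Set} {a b c d : A} → a ∷ b ∷ [] ↭ c ∷ d ∷ [] → (a ≡ c × b ≡ d) ⊎ (a ≡ d × b ≡ c)
  pair↭ {a = a} {b} {c} {d} p with ∈-resp-↭ p (here refl)
  ... | here refl = inj₁ (refl , one' (drop-∷ p))
    where
    one' : ∀ {A : Set} {b d : A} → b ∷ [] ↭ d ∷ [] → b ≡ d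
    one' p with ∈-resp-↭ p (here refl)
    ... | here e = e
  ... | there (here refl) = inj₂ (refl , one' (drop-∷ (ptrans p (pswap _ _ prefl))))
    where
    one' : ∀ {A : Set} {b d : A} → b ∷ [] ↭ d ∷ [] → b ≡ d
    one' p with ∈-resp-↭ p (here refl)
    ... | here e = e

  track-pos : ∀ {z p q x y w} → Track z p q (x ∷ y ∷ w ∷ []) → Pos z p q x y w
  track-pos {z} {p} {q} {x} {y} {w} T = go (∈-resp-↭ (↭-sym perm) (here refl))
    where
    open Track T
    two' : ∀ {a b} → a ∷ b ∷ [] ↭ plain p' ∷ plain q' ∷ [] → Two p q a b
    two' e with pair↭ e
    ... | inj₁ (refl , refl) = two₁ lp lq
    ... | inj₂ (refl , refl) = two₂ lq lp
    go : z' ∈ x ∷ y ∷ w ∷ [] → Pos z p q x y w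
    go (here refl) = at₁ sz (two' (drop-∷ perm))
    go (there (here refl)) = at₂ sz (two' (drop-∷ (ptrans (pswap _ _ prefl) perm)))
    go (there (there (here refl))) = at₃ sz (two' (drop-∷ (ptrans (↭-sym (shifts (_ ∷ _ ∷ []) (_ ∷ []))) perm)))

  data WPerm : Wt → Wt → Set where
    w0  : ∀ {v} → WPerm v v
    w12 : ∀ {a b c d u} → WPerm (wt b a c d) u → WPerm (wt a b c d) u
    w23 : ∀ {a b c d u} → WPerm (wt a c b d) u → WPerm (wt a b c d) u

  wtrans : ∀ {u v w} → WPerm u v → WPerm v w → WPerm u w
  wtrans w0 q = q
  wtrans (w12 p) q = w12 (wtrans p q)
  wtrans (w23 p) q = w23 (wtrans p q)

  sw→wperm : ∀ {x y} → Sw x y → WPerm (proj₂ x) (proj₂ y)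
  sw→wperm s0 = w0
  sw→wperm (s12 s) = w12 (sw→wperm s)
  sw→wperm (s23 s) = w23 (sw→wperm s)

  record Gain (v v' : Wt) : Set where
    constructor gain
    field
      {u} : Wt
      up  : WPerm v u
      ug  : ∀ y → y ≤ a₁ u → y ≤ a₂ u → a₁ u + y ≤ a₁ v' × a₂ u + y ≤ a₂ v' × a₃ u ≤ a₃ v'

  railW : Wt → Wt
  railW (wt a b c d) = wt (a + d) c b a

  data Small3 (z : Vx) (p q : Tri) (X : List Vx) : Set where
    ktri : ∀ {f α β f' f'' d u} → X ≈ (tri f α β , u) ∷ plain (tri f' α d) ∷ plain (tri f'' β d) ∷ [] →
      Sw z (tri f α β , u) → Two p q (plain (tri f' α d)) (plain (tri f'' β d)) → Small3 z p q X
    kheavy : ∀ {X' f₁ f₂ f₃ α β γ} (s : Shape X' f₁ f₂ f₃ α β γ) → X ≈ X' → Gain (proj₂ z) (shapeW s) → Small3 z p q X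

  swap-two : ∀ {p q x y} → Two p q x y → Two p q y x
  swap-two (two₁ a b) = two₂ b a
  swap-two (two₂ a b) = two₁ b a

  two-sw₂ : ∀ {p q x a b c} → Two p q x (plain (tri a b c)) → Two p q x (plain (tri a c b))
  two-sw₂ {a = a} (two₁ i j) = two₁ i (ptrans j (prep a (pswap _ _ prefl)))
  two-sw₂ {a = a} (two₂ i j) = two₂ i (ptrans j (prep a (pswap _ _ prefl)))

  small3 : ∀ {z p q X} → NF X → Track z p q X → Small3 z p q X
  small3 {z} {p} {q} {X} (nf {X'} s e) T = go s e (track-≈ e T)
    where
    go : ∀ {Y f₁ f₂ f₃ α β γ} → Shape Y f₁ f₂ f₃ α β γ → X ≈ Y → Track z p q Y → Small3 z p q X
    go (triangle a b c) e T with track-pos T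
    ... | at₁ s t@(two₁ _ _) = ktri e s t
    ... | at₁ s t@(two₂ _ _) = ktri e s t
    ... | at₂ s t@(two₁ _ _) = ktri (≈trans e (≈↭ (pswap _ _ prefl) (≈cong (≈↭ (pswap _ _ prefl) (≈sw (s23 s0) (≈↭ (pswap _ _ prefl) ≈refl)))))) s (two-sw₂ t)
    ... | at₂ s t@(two₂ _ _) = ktri (≈trans e (≈↭ (pswap _ _ prefl) (≈cong (≈↭ (pswap _ _ prefl) (≈sw (s23 s0) (≈↭ (pswap _ _ prefl) ≈refl)))))) s (two-sw₂ t)
    ... | at₃ s t@(two₁ _ _) = ktri (≈trans e (≈↭ (shifts (_ ∷ _ ∷ []) (_ ∷ [])) (≈cong (≈sw (s23 s0) (≈↭ (pswap _ _ prefl) (≈sw (s23 s0) (≈↭ (pswap _ _ prefl) ≈refl)))))))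
          s (two-sw₂ (swap-two (two-sw₂ (swap-two t))))
    ... | at₃ s t@(two₂ _ _) = ktri (≈trans e (≈↭ (shifts (_ ∷ _ ∷ []) (_ ∷ [])) (≈cong (≈sw (s23 s0) (≈↭ (pswap _ _ prefl) (≈sw (s23 s0) (≈↭ (pswap _ _ prefl) ≈refl)))))))
          s (two-sw₂ (swap-two (two-sw₂ (swap-two t))))
    go (double a b c) e T with track-pos T
    ... | at₁ s t = kheavy (double a b c) e (gain (sw→wperm s) (dbl₁ a t))
      where
      dbl₁ : ∀ (u : Wt) {b c t t' } → Two p q (t , b) (t' , c) → ∀ y → y ≤ a₁ u → y ≤ a₂ u → a₁ u + y ≤ a₁ (dblW u b c) × a₂ u + y ≤ a₂ (dblW u b c) × a₃ u ≤ a₃ (dblW u b c)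
      dbl₁ (wt m n o l) (two₁ _ _) y i j = ≤-trans (+-monoʳ-≤ m i) (≤-reflexive (d m)) , ≤-trans (+-monoʳ-≤ n j) (≤-reflexive (d n)) , ≤-reflexive (sym (*-identityʳ o))
        where
        d : ∀ m → m + m ≡ m * 2
        d = solve-∀
      dbl₁ (wt m n o l) (two₂ _ _) y i j = ≤-trans (+-monoʳ-≤ m i) (≤-reflexive (d m)) , ≤-trans (+-monoʳ-≤ n j) (≤-reflexive (d n)) , ≤-reflexive (sym (*-identityʳ o))
        where
        d : ∀ m → m + m ≡ m * 2
        d = solve-∀
    ... | at₂ s t = kheavy (double a b c) e (gain (wtrans (sw→wperm s) (rot b)) (dbl₂ b t))
      where
      rot : ∀ b → WPerm b (wt (a₂ b) (a₃ b) (a₁ b) (a₀ b))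
      rot (wt _ _ _ _) = w12 (w23 w0)
      dbl₂ : ∀ (u : Wt) {b c t t' } → Two p q (t , b) (t' , c) → ∀ y → y ≤ a₂ u → y ≤ a₃ u →
        a₂ u + y ≤ a₁ (dblW b u c) × a₃ u + y ≤ a₂ (dblW b u c) × a₁ u ≤ a₃ (dblW b u c)
      ev' : ∀ m n o l y → y ≤ n → y ≤ o → n + y ≤ 1 * (n * 1 + o * 1) × o + y ≤ 1 * (n * 1 + o * 1) × m ≤ 1 * (m * 1 + l * 0)
      ev' m n o l y j k = ≤-trans (+-monoʳ-≤ n k) (≤-reflexive (r n o)) , ≤-trans (+-monoʳ-≤ o j) (≤-reflexive (r' n o)) , ≤-reflexive (r'' m l)
        where
        r : ∀ n o → n + o ≡ 1 * (n * 1 + o * 1)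
        r = solve-∀
        r' : ∀ n o → o + n ≡ 1 * (n * 1 + o * 1)
        r' = solve-∀
        r'' : ∀ m l → m ≡ 1 * (m * 1 + l * 0)
        r'' = solve-∀
      dbl₂ (wt m n o l) (two₁ _ _) y i j = ev' m n o l y i j
      dbl₂ (wt m n o l) (two₂ _ _) y i j = ev' m n o l y i j
    ... | at₃ s t = kheavy (double a b c) e (gain (sw→wperm s) (dbl₃ c t))
      where
      ev' : ∀ m n o l y → y ≤ m → y ≤ n → m + y ≤ 1 * (1 * m + 1 * n) × n + y ≤ 1 * (1 * m + 1 * n) × o ≤ 1 * (1 * o + 0 * l)
      ev' m n o l y j k = ≤-trans (+-monoʳ-≤ m k) (≤-reflexive (r m n)) , ≤-trans (+-monoʳ-≤ n j) (≤-reflexive (r' m n)) , ≤-reflexive (r'' o l)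
        where
        r : ∀ n o → n + o ≡ 1 * (1 * n + 1 * o)
        r = solve-∀
        r' : ∀ n o → o + n ≡ 1 * (1 * n + 1 * o)
        r' = solve-∀
        r'' : ∀ m l → m ≡ 1 * (1 * m + 0 * l)
        r'' = solve-∀
      dbl₃ : ∀ (u : Wt) {b c t t' } → Two p q (t , b) (t' , c) → ∀ y → y ≤ a₁ u → y ≤ a₂ u → a₁ u + y ≤ a₁ (dblW b c u) × a₂ u + y ≤ a₂ (dblW b c u) × a₃ u ≤ a₃ (dblW b c u)
      dbl₃ (wt m n o l) (two₁ _ _) y i j = ev' m n o l y i j
      dbl₃ (wt m n o l) (two₂ _ _) y i j = ev' m n o l y i j
    go (triple a b c) e T with track-pos T
    ... | at₁ s t = kheavy (triple a b c) e (gain (sw→wperm s) (tp₁ a t))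
      where
      d : ∀ {y} m → y ≤ m → m + y ≤ m * 3
      d {y} m h = ≤-trans (+-monoʳ-≤ m h) (≤-trans (m≤m+n (m + m) m) (≤-reflexive (r m)))
        where
        r : ∀ m → m + m + m ≡ m * 3
        r = solve-∀
      tp₁ : ∀ (u : Wt) {b c t t' } → Two p q (t , b) (t' , c) → ∀ y → y ≤ a₁ u → y ≤ a₂ u → a₁ u + y ≤ a₁ (tplW u b c) × a₂ u + y ≤ a₂ (tplW u b c) × a₃ u ≤ a₃ (tplW u b c)
      tp₁ (wt m n o l) (two₁ _ _) y i j = d m i , d n j , m≤m*n o 3
      tp₁ (wt m n o l) (two₂ _ _) y i j = d m i , d n j , m≤m*n o 3
    ... | at₂ s t = kheavy (triple a b c) e (gain (sw→wperm s) (tp₂ b t))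
      where
      ev' : ∀ m n o l y → y ≤ m → y ≤ n → let T = 1 * (m * 1 + n * 1 + o * 1 + l * 0) in m + y ≤ T × n + y ≤ T × o ≤ T
      ev' m n o l y j k = ≤-trans (+-monoʳ-≤ m k) (≤-trans (m≤m+n (m + n) o) (≤-reflexive (r m n o l))) ,
        ≤-trans (+-monoʳ-≤ n j) (≤-trans (≤-reflexive (+-comm n m)) (≤-trans (m≤m+n (m + n) o) (≤-reflexive (r m n o l)))) , ≤-trans (m≤n+m o (m + n)) (≤-reflexive (r m n o l))
        where
        r : ∀ m n o l → m + n + o ≡ 1 * (m * 1 + n * 1 + o * 1 + l * 0)
        r = solve-∀
      tp₂ : ∀ (u : Wt) {b c t t' } → Two p q (t , b) (t' , c) → ∀ y → y ≤ a₁ u → y ≤ a₂ u → a₁ u + y ≤ a₁ (tplW b u c) × a₂ u + y ≤ a₂ (tplW b u c) × a₃ u ≤ a₃ (tplW b u c)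
      tp₂ (wt m n o l) (two₁ _ _) y i j = ev' m n o l y i j
      tp₂ (wt m n o l) (two₂ _ _) y i j = ev' m n o l y i j
    ... | at₃ s t = kheavy (triple a b c) e (gain (sw→wperm s) (tp₃ c t))
      where
      ev' : ∀ m n o l y → y ≤ m → y ≤ n → let T = 1 * (1 * m + 1 * n + 1 * o + 0 * l) in m + y ≤ T × n + y ≤ T × o ≤ T
      ev' m n o l y j k = ≤-trans (+-monoʳ-≤ m k) (≤-trans (m≤m+n (m + n) o) (≤-reflexive (r m n o l))) ,
        ≤-trans (+-monoʳ-≤ n j) (≤-trans (≤-reflexive (+-comm n m)) (≤-trans (m≤m+n (m + n) o) (≤-reflexive (r m n o l)))) , ≤-trans (m≤n+m o (m + n)) (≤-reflexive (r m n o l))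
        where
        r : ∀ m n o l → m + n + o ≡ 1 * (1 * m + 1 * n + 1 * o + 0 * l)
        r = solve-∀
      tp₃ : ∀ (u : Wt) {b c t t' } → Two p q (t , b) (t' , c) → ∀ y → y ≤ a₁ u → y ≤ a₂ u → a₁ u + y ≤ a₁ (tplW b c u) × a₂ u + y ≤ a₂ (tplW b c u) × a₃ u ≤ a₃ (tplW b c u)
      tp₃ (wt m n o l) (two₁ _ _) y i j = ev' m n o l y i j
      tp₃ (wt m n o l) (two₂ _ _) y i j = ev' m n o l y i j

  -- The potential of a chain of 3-edge cuts

  record Cert (K : ℕ) (v : Wt) (x T π : ℕ) : Set where
    constructor cert
    field
      {t₁ t₂ t₃} : ℕ
      u₁ : t₁ ≤ a₁ v
      u₂ : t₂ ≤ a₂ v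
      u₃ : t₃ ≤ a₃ v
      k₁ : t₁ ≤ K
      k₂ : t₂ ≤ K
      k₃ : t₃ ≤ K
      tot : T ≤ t₁ + t₂ + t₃
      low : AllGe x v
      prs : Pair π v
  open Cert public using (low; prs)

  +-comm-≤ : ∀ {n} a b → n ≤ a + b → n ≤ b + a
  +-comm-≤ a b h = ≤-trans h (≤-reflexive (+-comm a b))

  cert-perm : ∀ {K v u x T π} → WPerm v u → Cert K v x T π → Cert K u x T π
  cert-perm w0 c = c
  cert-perm (w12 {a} {b} w) (cert {t₁} {t₂} {t₃} p q r i j k t (allge l m n) (pair d e f)) =
    cert-perm w (cert q p r j i k (≤-trans t (≤-reflexive (cong (_+ t₃) (+-comm t₁ t₂)))) (allge m l n) (pair (+-comm-≤ a b d) f e))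
  cert-perm (w23 {a} {b} {c} w) (cert {t₁} {t₂} {t₃} p q r i j k t (allge l m n) (pair d e f)) =
    cert-perm w (cert p r q i k j (≤-trans t (≤-reflexive (lem t₁ t₂ t₃))) (allge l n m) (pair e d (+-comm-≤ b c f)))
    where
    lem : ∀ a b c → a + b + c ≡ a + c + b
    lem = solve-∀

  gain-step : ∀ {K v v' x T π} → 1 ≤ x → Cert K v x T π → Gain v v' → Cert K v' x (suc T) π ⊎ Cert K v' x T (π + K)
  gain-step {K} {v} {v'} {x} {T} {π} x1 c (gain {u} w g) = go (cert-perm w c)
    where
    go : Cert K u x T π → Cert K v' x (suc T) π ⊎ Cert K v' x T (π + K)
    go (cert {t₁} {t₂} {t₃} p q r i j k t (allge l m n) (pair d e f)) with t₁ <? K | t₂ <? K | g 1 (≤-trans x1 l) (≤-trans x1 m)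
    ... | yes h | _ | (b₁ , b₂ , b₃) = inj₁ (cert {t₁ = suc t₁} (≤-trans (s≤s p) (≤-trans (≤-reflexive (+-comm 1 (a₁ u))) b₁)) (≤-trans q m₂) (≤-trans r b₃) h j k (s≤s t)
        (allge (≤-trans l m₁) (≤-trans m m₂) (≤-trans n b₃)) (pair (≤-trans d (+-mono-≤ m₁ m₂)) (≤-trans e (+-mono-≤ m₁ b₃)) (≤-trans f (+-mono-≤ m₂ b₃))))
      where
      m₁ = ≤-trans (m≤m+n (a₁ u) 1) b₁
      m₂ = ≤-trans (m≤m+n (a₂ u) 1) b₂
    ... | no _ | yes h | (b₁ , b₂ , b₃) = inj₁ (cert {t₂ = suc t₂} (≤-trans p m₁) (≤-trans (s≤s q) (≤-trans (≤-reflexive (+-comm 1 (a₂ u))) b₂)) (≤-trans r b₃) i h k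
        (≤-trans (s≤s t) (≤-reflexive (cong (_+ t₃) (sym (+-suc t₁ t₂)))))
        (allge (≤-trans l m₁) (≤-trans m m₂) (≤-trans n b₃)) (pair (≤-trans d (+-mono-≤ m₁ m₂)) (≤-trans e (+-mono-≤ m₁ b₃)) (≤-trans f (+-mono-≤ m₂ b₃))))
      where
      m₁ = ≤-trans (m≤m+n (a₁ u) 1) b₁
      m₂ = ≤-trans (m≤m+n (a₂ u) 1) b₂
    ... | no h | no h' | _ with g K (≤-trans (≮⇒≥ h) p) (≤-trans (≮⇒≥ h') q)
    ...   | (b₁ , b₂ , b₃) = inj₂ (cert (≤-trans p m₁) (≤-trans q m₂) (≤-trans r b₃) i j k t
        (allge (≤-trans l m₁) (≤-trans m m₂) (≤-trans n b₃))
        (pair (≤-trans (+-monoˡ-≤ K d) (≤-trans (≤-reflexive (lem (a₁ u) (a₂ u) K)) (+-mono-≤ b₁ m₂)))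
              (≤-trans (+-monoˡ-≤ K e) (≤-trans (≤-reflexive (lem (a₁ u) (a₃ u) K)) (+-mono-≤ b₁ b₃)))
              (≤-trans (+-monoˡ-≤ K f) (≤-trans (≤-reflexive (lem (a₂ u) (a₃ u) K)) (+-mono-≤ b₂ b₃)))))
      where
      m₁ = ≤-trans (m≤m+n (a₁ u) K) b₁
      m₂ = ≤-trans (m≤m+n (a₂ u) K) b₂
      lem : ∀ a b c → a + b + c ≡ a + c + b
      lem = solve-∀

  rail-step : ∀ {K v x T π} → Cert K v x T π → Cert K (railW v) x T π
  rail-step {v = wt a b c d} (cert {t₁} {t₂} {t₃} p q r i j k t (allge l m n) (pair e f g)) =
    cert (≤-trans p (m≤m+n a d)) r q i k j (≤-trans t (≤-reflexive (lem t₁ t₂ t₃))) (allge (≤-trans l (m≤m+n a d)) n m)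
      (pair (≤-trans f (+-monoˡ-≤ c (m≤m+n a d))) (≤-trans e (+-monoˡ-≤ b (m≤m+n a d))) (+-comm-≤ b c g))
    where
    lem : ∀ a b c → a + b + c ≡ a + c + b
    lem = solve-∀

  rail-low : ∀ {K v x T π} → 1 ≤ a₀ v → Cert K v x T π → Cert K (railW v) x (suc T) π ⊎ K ≤ a₁ v
  rail-low {K} {v = v@(wt a b c d)} s C@(cert {t₁} p q r i j k t l o) with t₁ <? K
  ... | no h = inj₂ (≤-trans (≮⇒≥ h) p)
  ... | yes h with rail-step C
  ...   | cert p' q' r' i' j' k' t' l' o' = inj₁ (cert {t₁ = suc t₁} (≤-trans (≤-reflexive (+-comm 1 t₁)) (+-mono-≤ p s)) r q h k j (s≤s (≤-trans t (≤-reflexive (lem t₁ _ _)))) l' o')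
    where
    lem : ∀ a b c → a + b + c ≡ a + c + b
    lem = solve-∀

  cert-pair : ∀ {K v x T π π'} → Pair π' v → Cert K v x T π → Cert K v x T π'
  cert-pair P (cert p q r i j k t l _) = cert p q r i j k t l P

  record Mark (K π : ℕ) (v : Wt) : Set where
    constructor mark
    field
      m12 : π + K ≤ a₁ v + a₂ v
      m13 : π + K ≤ a₁ v + a₃ v

  mark-new : ∀ {K π v} → K ≤ a₀ v → Pair π v → Mark K π (railW v)
  mark-new {K} {π} {wt a b c d} h (pair e f g) = mark (≤-trans (+-mono-≤ f h) (≤-reflexive (lem a c d))) (≤-trans (+-mono-≤ e h) (≤-reflexive (lem a b d)))
    where
    lem : ∀ a b c → a + b + c ≡ a + c + b
    lem = solve-∀

  mark-rail : ∀ {K π v} → Mark K π v → Mark K π (railW v)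
  mark-rail {v = wt a b c d} (mark e f) = mark (≤-trans f (+-monoˡ-≤ c (m≤m+n a d))) (≤-trans e (+-monoˡ-≤ b (m≤m+n a d)))

  mark-pair : ∀ {K π a b c d} → K ≤ d → Mark K π (wt a b c d) → Pair π (wt a b c d) → Pair (π + K) (railW (wt b a c d))
  mark-pair {K} {π} {a} {b} {c} {d} h (mark e f) (pair _ _ g) = pair
      (≤-trans (+-mono-≤ g h) (≤-reflexive (lem b c d)))
      (≤-trans e (≤-trans (≤-reflexive (+-comm a b)) (+-monoˡ-≤ a (m≤m+n b d))))
      (+-comm-≤ a c f)
    where
    lem : ∀ a b c → a + b + c ≡ a + c + b
    lem = solve-∀

  module Potential (A L₀ p q β M : ℕ) where
    K C c₁ B : ℕ
    K = A * (L₀ + 3)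
    C = K * (3 * K) + K
    c₁ = β + 4 * p
    B = K * (3 * K) + C * K + A * (L₀ + 3)

    -- π bounds all pair sums of v. By i1 the vertices absorbed so far (M ∸ m) are paid for by π at the rate p / q, up to c₁ for
    -- each of the S steps; by i2 the number of steps is small against the potential π + K T + C x.
    record Num (v : Wt) (π m cr : ℕ) : Set where
      constructor num
      field
        {x T S} : ℕ
        crt : Cert K v x T π
        x1 : 1 ≤ x
        xK : x ≤ K
        i1 : p * M + 2 * q ≤ p * m + q * π + c₁ * S
        i2 : A * S ≤ π + K * T + C * x + A * cr
    open Num public

    num-perm : ∀ {v u π m cr} → WPerm v u → Num v π m cr → Num u π m cr
    num-perm w (num c a b d e) = num (cert-perm w c) a b d e

    num-weaken : ∀ {v π m cr cr'} → cr ≤ cr' → Num v π m cr → Num v π m cr'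
    num-weaken {π = π} h (num {x} {T} c a b d e) = num c a b d (≤-trans e (+-monoʳ-≤ (π + K * T + C * x) (*-monoʳ-≤ A h)))

    private
      pay : ∀ {S P cr P'} → A * S ≤ P + A * cr → cr ≤ L₀ + 2 → P + K ≤ P' → A * suc S ≤ P' + A * 0
      pay {S} {P} {cr} {P'} h c g = ≤-trans (≤-reflexive (*-suc A S)) (≤-trans (+-monoʳ-≤ A h) (≤-trans (≤-reflexive (ring A P cr))
        (≤-trans (≤-trans (+-monoʳ-≤ P (*-monoʳ-≤ A (≤-trans (s≤s c) (≤-reflexive (sym (+-suc L₀ 2)))))) g) (m≤m+n P' (A * 0)))))
        where
        ring : ∀ a b c → a + (b + a * c) ≡ b + a * suc c
        ring = solve-∀
      two : ∀ {π π' S m} → π ≤ π' → p * M + 2 * q ≤ p * (2 + m) + q * π + c₁ * S → p * M + 2 * q ≤ p * m + q * π' + c₁ * suc S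
      two {π} {π'} {S} {m} h g = ≤-trans g (≤-trans (+-monoˡ-≤ (c₁ * S) (+-monoʳ-≤ (p * (2 + m)) (*-monoʳ-≤ q h)))
        (≤-trans (m≤m+n _ (β + 2 * p)) (≤-reflexive (ring p m (q * π') β S))))
        where
        ring : ∀ p m Q β S → p * (2 + m) + Q + (β + 4 * p) * S + (β + 2 * p) ≡ p * m + Q + (β + 4 * p) * suc S
        ring = solve-∀
      up : ∀ π T x → π + K * T + C * x + K ≡ π + K * suc T + C * x
      up π T x = ring π K T (C * x)
        where
        ring : ∀ π K T c → π + K * T + c + K ≡ π + K * suc T + c
        ring = solve-∀
      up' : ∀ π T x → π + K * T + C * x + K ≡ π + K + K * T + C * x
      up' π T x = ring π (K * T) (C * x) K
        where
        ring : ∀ π T c k → π + T + c + k ≡ π + k + T + c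
        ring = solve-∀

    num-gain : ∀ {v v' π m cr} → cr ≤ L₀ + 2 → Gain v v' → Num v π (2 + m) cr → ∃[ π' ] Num v' π' m 0
    num-gain {v} {v'} {π} {m} h g (num {x} {T} c a b d e) with gain-step a c g
    ... | inj₁ c' = π , num c' a b (two ≤-refl d) (pay e h (≤-reflexive (up π T x)))
    ... | inj₂ c' = π + K , num c' a b (two (m≤m+n π K) d) (pay e h (≤-reflexive (up' π T x)))

    num-rail : ∀ {v π m cr} → Num v π (2 + m) cr → Num (railW v) π m (suc cr)
    num-rail {v} {π} {m} {cr} (num {x} {T} {S} c a b d e) = num (rail-step c) a b (two ≤-refl d)
        (≤-trans (≤-reflexive (*-suc A S)) (≤-trans (+-monoʳ-≤ A e) (≤-reflexive (ring A (π + K * T + C * x) cr))))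
      where
      ring : ∀ a b c → a + (b + a * c) ≡ b + a * suc c
      ring = solve-∀

    num-low : ∀ {v π m cr} → cr ≤ L₀ + 2 → 1 ≤ a₀ v → Num v π (2 + m) cr → Num (railW v) π m 0 ⊎ K ≤ a₁ v
    num-low {v} {π} h s (num {x} {T} c a b d e) with rail-low s c
    ... | inj₁ c' = inj₁ (num c' a b (two ≤-refl d) (pay e h (≤-reflexive (up π T x))))
    ... | inj₂ k = inj₂ k

    num-pair : ∀ {v π m cr} → cr ≤ L₀ + 2 → Pair (π + K) (railW v) → Num v π (2 + m) cr → Num (railW v) (π + K) m 0
    num-pair {v} {π} h P (num {x} {T} c a b d e) = num (cert-pair P (rail-step c)) a b (two (m≤m+n π K) d) (pay e h (≤-reflexive (up' π T x)))

    num-prime : ∀ {v v' π m k φ cr} → cr ≤ L₀ + 2 → 4 ≤ φ → p * (2 + k) + 2 * q ≤ q * φ + β →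
      (∀ {x} → AllGe x v → AllGe (x * 2) v') →
      (∀ {x} → AllGe x v → (π + x * φ ≤ a₂ v' + a₃ v' + 2 * x × π + x * φ ≤ a₁ v' + a₃ v' + 2 * x × π + x * φ ≤ a₁ v' + a₂ v' + 2 * x)) →
      Num v π (k + m) cr → ∃[ π' ] Num v' π' m 0
    num-prime {v} {v'} {π} {m} {k} {suc (suc φ)} {cr} h (s≤s (s≤s f)) hk dbl prs' (num {x} {T} {S} c@(cert {t₁} {t₂} {t₃} _ _ _ k₁ k₂ k₃ tt _ _) a b d e) = π + x * φ , out (x <? K)
      where
      AG : AllGe (x * 2) v'
      AG = dbl (low c)
      dp : ∀ {s} → π + x * suc (suc φ) ≤ s + 2 * x → π + x * φ ≤ s
      dp {s} g = +-cancelʳ-≤ (2 * x) _ _ (≤-trans (≤-reflexive (ring π x φ)) g)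
        where
        ring : ∀ π x φ → π + x * φ + 2 * x ≡ π + x * suc (suc φ)
        ring = solve-∀
      P' : Pair (π + x * φ) v'
      P' with prs' (low c)
      ... | e₁ , e₂ , e₃ = pair (dp e₃) (dp e₂) (dp e₁)
      T≤ : T ≤ 3 * K
      T≤ = ≤-trans tt (≤-trans (+-mono-≤ (+-mono-≤ k₁ k₂) k₃) (≤-reflexive (ring K)))
        where
        ring : ∀ K → K + K + K ≡ 3 * K
        ring = solve-∀
      x≤ : φ ≤ x * φ
      x≤ = ≤-trans (≤-reflexive (sym (+-identityʳ φ))) (*-monoˡ-≤ φ a)
      hk' : p * (2 + k) ≤ q * φ + β
      hk' = +-cancelʳ-≤ (2 * q) _ _ (≤-trans hk (≤-reflexive (ring q φ β)))
        where
        ring : ∀ q φ β → q * suc (suc φ) + β ≡ q * φ + β + 2 * q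
        ring = solve-∀
      j1 : p * M + 2 * q ≤ p * m + q * (π + x * φ) + c₁ * suc S
      j1 = ≤-trans d (≤-trans (+-monoˡ-≤ (c₁ * S) (+-monoˡ-≤ (q * π) (≤-trans (m≤m+n (p * (k + m)) (p * 2)) (≤-trans (≤-reflexive (r₁ p k m)) (+-monoˡ-≤ (p * m) hk')))))
        (≤-trans (≤-reflexive (r₂ q φ β (p * m) π (c₁ * S))) (≤-trans (+-monoˡ-≤ (c₁ * S) (+-monoˡ-≤ β (+-monoʳ-≤ (p * m) (*-monoʳ-≤ q (+-monoʳ-≤ π x≤)))))
        (≤-trans (m≤m+n _ (4 * p)) (≤-reflexive (r₃ (p * m) (q * (π + x * φ)) β p S))))))
        where
        r₁ : ∀ p k m → p * (k + m) + p * 2 ≡ p * (2 + k) + p * m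
        r₁ = solve-∀
        r₂ : ∀ q φ β P π c → q * φ + β + P + q * π + c ≡ P + q * (π + φ) + β + c
        r₂ = solve-∀
        r₃ : ∀ P Q β p S → P + Q + β + (β + 4 * p) * S + 4 * p ≡ P + Q + (β + 4 * p) * suc S
        r₃ = solve-∀
      out : Dec (x < K) → Num v' (π + x * φ) m 0
      out (yes l) = num {x = suc x} {0} (cert {t₁ = 0} {0} {0} z≤n z≤n z≤n z≤n z≤n z≤n z≤n
          (allge (≤-trans 2x (g₁ AG)) (≤-trans 2x (g₂ AG)) (≤-trans 2x (g₃ AG))) P') (s≤s z≤n) l j1
          (pay e h (≤-trans (+-monoˡ-≤ K (+-monoˡ-≤ (C * x) (+-monoʳ-≤ π (*-monoʳ-≤ K T≤))))
            (≤-trans (m≤m+n _ (x * φ)) (≤-reflexive (ring π (x * φ) (K * (3 * K)) K x)))))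
        where
        2x : suc x ≤ x * 2
        2x = ≤-trans (+-monoˡ-≤ x a) (≤-reflexive (r x))
          where
          r : ∀ x → x + x ≡ x * 2
          r = solve-∀
        ring : ∀ π f t K x → π + t + (t + K) * x + K + f ≡ π + f + K * 0 + (t + K) * suc x
        ring = solve-∀
      out (no l) = num {x = x} {T} (cert (≤-trans k₁ (≤-trans Kx (g₁ AG))) (≤-trans k₂ (≤-trans Kx (g₂ AG))) (≤-trans k₃ (≤-trans Kx (g₃ AG))) k₁ k₂ k₃ tt
          (allge (≤-trans xx (g₁ AG)) (≤-trans xx (g₂ AG)) (≤-trans xx (g₃ AG))) P') a b j1
          (pay e h (≤-trans (≤-reflexive (up' π T x)) (+-monoˡ-≤ (C * x) (+-monoˡ-≤ (K * T) (+-monoʳ-≤ π (≤-trans Kx (*-monoʳ-≤ x f)))))))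
        where
        xx : x ≤ x * 2
        xx = m≤m*n x 2
        Kx : K ≤ x * 2
        Kx = ≤-trans (≮⇒≥ l) xx

    num-end : ∀ {v π m cr N} → cr ≤ L₀ + 3 → π ≤ N → (P : Num v π m cr) → A * S P ≤ N + B
    num-end {v} {π} {m} {cr} {N} h g (num {x} {T} {S} (cert _ _ _ k₁ k₂ k₃ tt _ _) a b d e) = ≤-trans e
      (≤-trans (+-mono-≤ (+-mono-≤ (+-mono-≤ g (*-monoʳ-≤ K T≤)) (*-monoʳ-≤ C b)) (*-monoʳ-≤ A h)) (≤-reflexive (ring N (K * (3 * K)) (C * K) (A * (L₀ + 3)))))
      where
      T≤ : T ≤ 3 * K
      T≤ = ≤-trans tt (≤-trans (+-mono-≤ (+-mono-≤ k₁ k₂) k₃) (≤-reflexive (r K)))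
        where
        r : ∀ K → K + K + K ≡ 3 * K
        r = solve-∀
      ring : ∀ n a b c → n + a + b + c ≡ n + (a + b + c)
      ring = solve-∀

    num-start : 1 ≤ K → Num (wt 1 1 1 0) 2 M 0
    num-start h = num {x = 1} {0} {0} (cert {t₁ = 0} {0} {0} z≤n z≤n z≤n z≤n z≤n z≤n z≤n (allge ≤-refl ≤-refl ≤-refl) (pair ≤-refl ≤-refl ≤-refl)) ≤-refl h
      (≤-trans (≤-reflexive (cong (p * M +_) (*-comm 2 q))) (m≤m+n _ _)) (≤-trans (≤-reflexive (*-zeroʳ A)) z≤n)

  data Lad (r₀ s₀ : ℕ) : ℕ → ℕ → ℕ → List Tri → Set where
    lad1 : ∀ {t t' r s d} → t ∼ tri r r₀ d → t' ∼ tri s s₀ d → Lad r₀ s₀ 1 r s (t ∷ t' ∷ [])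
    lad+ : ∀ {n r s W t t' r' s' d} → Lad r₀ s₀ n r s W → t ∼ tri r' r d → t' ∼ tri s' s d → Lad r₀ s₀ (suc n) r' s' (t ∷ t' ∷ W)

  lad-swap : ∀ {r₀ s₀ n r s W} → Lad r₀ s₀ n r s W → ∃[ W' ] Lad s₀ r₀ n s r W' × W ↭ W'
  lad-swap (lad1 a b) = _ , lad1 b a , pswap _ _ prefl
  lad-swap (lad+ l a b) with lad-swap l
  ... | W' , l' , p = _ , lad+ l' b a , pswap _ _ p

  RawLad : ℕ → List Tri → Set
  RawLad k U = ∃[ n ] ∃[ r₀ ] ∃[ s₀ ] ∃[ r ] ∃[ s ] ∃[ W ] ∃[ O ] k < n × Lad r₀ s₀ n r s W × U ↭ W ++ O

  data Arr : Vx → Vx → Set where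
    c123 : ∀ {p q r a b c d} → Arr (tri p q r , wt a b c d) (tri p q r , wt a b c d)
    c132 : ∀ {p q r a b c d} → Arr (tri p q r , wt a b c d) (tri p r q , wt a c b d)
    c213 : ∀ {p q r a b c d} → Arr (tri p q r , wt a b c d) (tri q p r , wt b a c d)
    c231 : ∀ {p q r a b c d} → Arr (tri p q r , wt a b c d) (tri q r p , wt b c a d)
    c312 : ∀ {p q r a b c d} → Arr (tri p q r , wt a b c d) (tri r p q , wt c a b d)
    c321 : ∀ {p q r a b c d} → Arr (tri p q r , wt a b c d) (tri r q p , wt c b a d)

  arr12 : ∀ {p q r a b c d y} → Arr (tri q p r , wt b a c d) y → Arr (tri p q r , wt a b c d) y
  arr12 c123 = c213
  arr12 c132 = c231
  arr12 c213 = c123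
  arr12 c231 = c132
  arr12 c312 = c321
  arr12 c321 = c312

  arr23 : ∀ {p q r a b c d y} → Arr (tri p r q , wt a c b d) y → Arr (tri p q r , wt a b c d) y
  arr23 c123 = c132
  arr23 c132 = c123
  arr23 c213 = c312
  arr23 c231 = c321
  arr23 c312 = c213
  arr23 c321 = c231

  arr : ∀ {x y} → Sw x y → Arr x y
  arr {tri _ _ _ , wt _ _ _ _} s0 = c123
  arr (s12 s) = arr12 (arr s)
  arr (s23 s) = arr23 (arr s)

  sw-a₀ : ∀ {x y} → Sw x y → a₀ (proj₂ x) ≡ a₀ (proj₂ y)
  sw-a₀ s0 = refl
  sw-a₀ (s12 s) = sw-a₀ s
  sw-a₀ (s23 s) = sw-a₀ s

  pair-23 : ∀ {π a b c d} → Pair π (wt a b c d) → Pair π (wt a c b d)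
  pair-23 {b = b} {c} (pair e f g) = pair f e (+-comm-≤ b c g)

  Rungs : Tri → Tri → ℕ → ℕ → ℕ → ℕ → ℕ → Set
  Rungs p q r r₀ s s₀ d = ∃[ t ] ∃[ t' ] p ∷ q ∷ [] ↭ t ∷ t' ∷ [] × t ∼ tri r r₀ d × t' ∼ tri s s₀ d

  two→rungs : ∀ {p q r r₀ s s₀ d} → Two p q (plain (tri r r₀ d)) (plain (tri s s₀ d)) → Rungs p q r r₀ s s₀ d
  two→rungs {p} {q} (two₁ i j) = p , q , prefl , i , j
  two→rungs {p} {q} (two₂ i j) = q , p , pswap p q prefl , i , j

  module Rail (A L₀ p q β M : ℕ) (1≤K : 1 ≤ A * (L₀ + 3)) where
    open Potential A L₀ p q β M public

    -- how far a run of steps along one rail has gone, and the credit it may use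
    data Phase (U : List Tri) (π : ℕ) : Vx → ℕ → Set where
      pz : ∀ {z} → Phase U π z 0
      p0 : ∀ {z} → 1 ≤ a₀ (proj₂ z) → Phase U π z 1
      p1 : ∀ {z} → K ≤ a₀ (proj₂ z) → Phase U π z 2
      p2 : ∀ {l₁ l₂ l₃ v n r₀ s₀ W O} → K ≤ a₀ v → Mark K π v → Lad r₀ s₀ n l₂ l₃ W → U ↭ W ++ O → n ≤ L₀ →
        Phase U π (tri l₁ l₂ l₃ , v) (2 + n)

    cr≤ : ∀ {U π z cr} → Phase U π z cr → cr ≤ L₀ + 2
    cr≤ pz = z≤n
    cr≤ (p0 _) = ≤-trans (s≤s z≤n) (m≤n+m 2 L₀)
    cr≤ (p1 _) = m≤n+m 2 L₀
    cr≤ (p2 _ _ _ _ h) = ≤-trans (+-monoʳ-≤ 2 h) (≤-reflexive (+-comm 2 L₀))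

    Next : List Tri → Vx → ℕ → Set
    Next U z m = (∃[ π ] ∃[ cr ] Num (proj₂ z) π m cr × Phase U π z cr) ⊎ RawLad L₀ U

    private
      n1 : ∀ {u π m cr} → Num u π m cr → 1 ≤ a₁ u
      n1 N = ≤-trans (x1 N) (g₁ (low (crt N)))
      toP0 : ∀ {U t u π m} → 1 ≤ a₁ u → Num (railW u) π m 0 → Next U (t , railW u) m
      toP0 h N = inj₁ (_ , 1 , num-weaken z≤n N , p0 h)
      mkP2 : ∀ {U f r s u π m n r₀ s₀ W O} → Num (railW u) π m (2 + n) → K ≤ a₁ u → Mark K π (railW u) → Lad r₀ s₀ n r s W → U ↭ W ++ O →
        Next U (tri f r s , railW u) m
      mkP2 {n = n} N k mk l e with n ≤? L₀
      ... | yes h = inj₁ (_ , _ , N , p2 k mk l e h)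
      ... | no h = inj₂ (_ , _ , _ , _ , _ , _ , _ , ≰⇒> h , l , e)
      addU : ∀ {p q t t' : Tri} {U W O} → p ∷ q ∷ [] ↭ t ∷ t' ∷ [] → U ↭ W ++ O → p ∷ q ∷ U ↭ (t ∷ t' ∷ W) ++ O
      addU {t = t} {t'} {U} {W} {O} e g = ++⁺ e g
      off : ∀ {U t u π m cr} → cr ≤ L₀ + 2 → 1 ≤ a₀ u → Pair (π + K) (railW u) → Num u π (2 + m) cr → Next U (t , railW u) m
      off h s P N with num-low h s N
      ... | inj₁ N' = toP0 (n1 N) N'
      ... | inj₂ k = inj₁ (_ , 2 , num-weaken z≤n (num-pair h P N) , p1 k)

    rail : ∀ {tz v U π m cr P Q f α β' f' f'' d u} → Num v π (2 + m) cr → Phase U π (tz , v) cr → Sw (tz , v) (tri f α β' , u) →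
      Rungs P Q f' α f'' β' d → Next (P ∷ Q ∷ U) (tri f f' f'' , railW u) m
    rail {tz} {v} {U} {π} {m} {cr} {P} {Q} {f} {α} {β'} {f'} {f''} {d} {u} N ph sw (t , t' , e , i , j) = go ph
      where
      N' : Num u π (2 + m) cr
      N' = num-perm (sw→wperm sw) N
      st : ∀ {k} → k ≤ a₀ v → k ≤ a₀ u
      st h = ≤-trans h (≤-reflexive (sw-a₀ sw))
      along : ∀ {n r₀ s₀ W O u'} → Num u' π (2 + m) (2 + n) → K ≤ a₀ u' → Mark K π u' → Lad r₀ s₀ n α β' W → U ↭ W ++ O → n ≤ L₀ →
        Next (P ∷ Q ∷ U) (tri f f' f'' , railW u') m
      along {W = W} {O} {u' = u'} N₁ k mk l g h with num-low (≤-trans (+-monoʳ-≤ 2 h) (≤-reflexive (+-comm 2 L₀))) (≤-trans 1≤K k) N₁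
      ... | inj₁ N₂ = toP0 (n1 N₁) N₂
      ... | inj₂ k' = mkP2 {W = t ∷ t' ∷ W} {O} (num-rail N₁) k' (mark-rail mk) (lad+ l i j) (addU {W = W} {O} e g)
      marked : ∀ {l₁ l₂ l₃ v n r₀ s₀ W O} → Arr (tri l₁ l₂ l₃ , v) (tri f α β' , u) → Num u π (2 + m) (2 + n) → Pair π v →
        K ≤ a₀ v → Mark K π v → Lad r₀ s₀ n l₂ l₃ W → U ↭ W ++ O → n ≤ L₀ → Next (P ∷ Q ∷ U) (tri f f' f'' , railW u) m
      marked c123 N₁ Pr k mk l g h = along N₁ k mk l g h
      marked c132 N₁ Pr k (mark a b) l g h with lad-swap l
      ... | W' , l' , w = along N₁ k (mark b a) l' (ptrans g (++⁺ʳ _ w)) h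
      marked c213 N₁ Pr k mk l g h = off (≤-trans (+-monoʳ-≤ 2 h) (≤-reflexive (+-comm 2 L₀))) (≤-trans 1≤K k) (mark-pair k mk Pr) N₁
      marked c231 N₁ Pr k mk l g h = off (≤-trans (+-monoʳ-≤ 2 h) (≤-reflexive (+-comm 2 L₀))) (≤-trans 1≤K k) (pair-23 (mark-pair k mk Pr)) N₁
      marked c312 N₁ Pr k (mark a b) l g h = off (≤-trans (+-monoʳ-≤ 2 h) (≤-reflexive (+-comm 2 L₀))) (≤-trans 1≤K k) (mark-pair k (mark b a) (pair-23 Pr)) N₁
      marked c321 N₁ Pr k (mark a b) l g h = off (≤-trans (+-monoʳ-≤ 2 h) (≤-reflexive (+-comm 2 L₀))) (≤-trans 1≤K k) (pair-23 (mark-pair k (mark b a) (pair-23 Pr))) N₁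
      go : Phase U π (tz , v) cr → Next (P ∷ Q ∷ U) (tri f f' f'' , railW u) m
      go pz = inj₁ (π , 1 , num-rail N' , p0 (n1 N'))
      go (p0 s) with num-low (≤-trans (s≤s z≤n) (m≤n+m 2 L₀)) (st s) N'
      ... | inj₁ N₂ = toP0 (n1 N') N₂
      ... | inj₂ k = inj₁ (π , 2 , num-rail N' , p1 k)
      go (p1 s) with num-low (m≤n+m 2 L₀) (≤-trans 1≤K (st s)) N'
      ... | inj₁ N₂ = toP0 (n1 N') N₂
      ... | inj₂ k = mkP2 {W = t ∷ t' ∷ []} {U} (num-rail N') k (mark-new (st s) (prs (crt N'))) (lad1 i j) (++⁺ʳ U e)
      go (p2 k mk l g h) = marked (arr sw) N' (prs (crt N)) k mk l g h

  -- Chains of 3-edge cuts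

  record St (h : ℕ) (L : List ℕ) (tz : Tri) (R : List Tri) : Set where
    field
      sw    : WF L (tz ∷ R)
      sb    : Br L (tz ∷ R)
      sstar : ∀ A B → R ↭ A ++ B → 2 ≤ length A → δ L A ≡ 3 → occ h A ≡ 2
      sR    : occ h R ≡ 2
  open St public

  st-o : ∀ {h L tz R} → WF L (tz ∷ R) → occ h R ≡ 2 → occ h (tz ∷ []) ≡ 0
  st-o {h} {L} {tz} {R} w e with split3 {X = tz ∷ []} {R} w h
  ... | c00 _ a _ = a
  ... | c02 _ a _ = a
  ... | c11 _ _ b = case trans (sym e) b of λ ()
  ... | c20 _ _ b = case trans (sym e) b of λ ()

  st-cut : ∀ {h L tz R f₁ f₂ f₃} X₀ Y TX → St h L tz R → R ↭ X₀ ++ Y → (w : WF L (TX ++ Y)) → Br L (TX ++ Y) →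
    (bd : bdl L TX ↭ f₁ ∷ f₂ ∷ f₃ ∷ []) → occ h Y ≡ 2 → St h (outl L TX) (tri f₁ f₂ f₃) Y
  st-cut {h} {L} {tz} {R} X₀ Y TX s p w br bd hY = record { sw = WF' ; sb = Br' br ; sR = hY
    ; sstar = λ A B e l d → sstar s A (B ++ X₀) (ptrans p (ptrans (++-comm X₀ Y) (ptrans (++⁺ʳ X₀ e) (++-assoc A B X₀)))) l (trans (sym (δ-out A B e)) d) }
    where
    open Contract TX Y w bd

  CutZ : ℕ → List ℕ → Tri → List Tri → Set
  CutZ h L tz R = ∃[ X₀ ] ∃[ Y ] R ↭ X₀ ++ Y × 1 ≤ length X₀ × 2 ≤ length Y × δ L (tz ∷ X₀) ≡ 3 × Min3 L (tz ∷ X₀) × occ h Y ≡ 2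

  min3-↭ : ∀ {L X X'} → X ↭ X' → Min3 L X → Min3 L X'
  min3-↭ p m W W' q = m W W' (ptrans p q)

  length≥ : ∀ (A B : List Tri) {C} → 2 ≤ length B → C ↭ A ++ B → 2 ≤ length C
  length≥ A B h e = ≤-trans h (≤-trans (m≤n+m _ (length A)) (≤-reflexive (sym (trans (↭-length e) (length-++ A)))))

  cutz : ∀ {h L tz R} → St h L tz R → CutZ h L tz R ⊎ No3 L (tz ∷ R)
  cutz {h} {L} {tz} {R} s = go (search3 L (tz ∷ R))
    where
    module _ (A' B : List Tri) (pA : R ↭ A' ++ B) (lA : 1 ≤ length A') (lB : 2 ≤ length B) (dA : δ L (tz ∷ A') ≡ 3) where
      wA : WF L ((tz ∷ A') ++ B)
      wA = WF-↭ (prep tz pA) (sw s)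
      hB : occ h B ≡ 2
      hB = sstar s B A' (ptrans pA (++-comm A' B)) lB (trans (sym (δ-compl (tz ∷ A') B wA)) dA)
      fin : (∃[ W ] ∃[ E ] tz ∷ A' ↭ W ++ E × 2 ≤ length W × δ L W ≡ 3 × Min3 L W) → CutZ h L tz R
      fin (W , E , q , lW , dW , mW) = side (∷-split q)
        where
        side : (∃[ X₀ ] W ↭ tz ∷ X₀ × A' ↭ X₀ ++ E) ⊎ (∃[ E' ] E ↭ tz ∷ E' × A' ↭ W ++ E') → CutZ h L tz R
        side (inj₁ (X₀ , a , b)) = X₀ , E ++ B , pY , ≤-pred (subst (2 ≤_) (↭-length a) lW) , lY , dX , min3-↭ a mW ,
            sstar s (E ++ B) X₀ (ptrans pY (++-comm X₀ (E ++ B))) lY (trans (sym (δ-compl (tz ∷ X₀) (E ++ B) (WF-↭ (prep tz pY) (sw s)))) dX)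
          where
          pY : R ↭ X₀ ++ (E ++ B)
          pY = ptrans pA (ptrans (++⁺ʳ B b) (++-assoc X₀ E B))
          lY : 2 ≤ length (E ++ B)
          lY = length≥ E B {E ++ B} lB prefl
          dX : δ L (tz ∷ X₀) ≡ 3
          dX = trans (sym (δ-↭ L a)) dW
        side (inj₂ (E' , a , b)) = ⊥-elim (bad (occ h E') (trans (sym eq) (sR s)))
          where
          pW : R ↭ W ++ (E' ++ B)
          pW = ptrans pA (ptrans (++⁺ʳ B b) (++-assoc W E' B))
          eq : occ h R ≡ 2 + (occ h E' + 2)
          eq = trans (occ-↭ h pW) (trans (occ-++ h W (E' ++ B)) (cong₂ _+_ (sstar s W (E' ++ B) pW lW dW) (trans (occ-++ h E' B) (cong (occ h E' +_) hB))))
          bad : ∀ k → 2 + (k + 2) ≡ 2 → ⊥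
          bad k e = case m+n≡0⇒n≡0 k (suc-injective (suc-injective e)) of λ ()
    go : (∃[ X ] ∃[ Y ] tz ∷ R ↭ X ++ Y × 2 ≤ length X × 2 ≤ length Y × δ L X ≡ 3) ⊎ No3 L (tz ∷ R) → CutZ h L tz R ⊎ No3 L (tz ∷ R)
    go (inj₂ n) = inj₂ n
    go (inj₁ (X , Y , p , lX , lY , d)) = inj₁ (side (∷-split p))
      where
      side : (∃[ A' ] X ↭ tz ∷ A' × R ↭ A' ++ Y) ⊎ (∃[ B' ] Y ↭ tz ∷ B' × R ↭ X ++ B') → CutZ h L tz R
      side (inj₁ (A' , a , b)) = fin A' Y b lA lY dA (shrink3 L _ (tz ∷ A') ≤-refl (s≤s lA) dA)
        where
        lA = ≤-pred (subst (2 ≤_) (↭-length a) lX)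
        dA = trans (sym (δ-↭ L a)) d
      side (inj₂ (B' , a , b)) = fin B' X (ptrans b (++-comm X B')) lB lX dB (shrink3 L _ (tz ∷ B') ≤-refl (s≤s lB) dB)
        where
        lB = ≤-pred (subst (2 ≤_) (↭-length a) lY)
        dB = trans (sym (δ-↭ L a)) (trans (sym (δ-compl X Y (WF-↭ p (sw s)))) d)

  min3-choose : ∀ (P : ℕ → Set) a b c → P a → P b → P c → ∃[ m ] P m × m ≤ a × m ≤ b × m ≤ c
  min3-choose P a b c pa pb pc with ≤-total a b | ≤-total a c | ≤-total b c
  ... | inj₁ i | inj₁ j | _ = a , pa , ≤-refl , i , j
  ... | inj₁ i | inj₂ j | _ = c , pc , j , ≤-trans j i , ≤-refl
  ... | inj₂ i | _ | inj₁ k = b , pb , i , ≤-refl , k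
  ... | inj₂ i | _ | inj₂ k = c , pc , ≤-trans k i , k , ≤-refl

  rail-eq : ∀ u → triW u (wt 1 1 1 0) (wt 1 1 1 0) ≡ railW u
  rail-eq (wt a b c d) = wt-cong (cong₂ _+_ (*-identityʳ a) (*-identityʳ d)) (trans (cong₂ _+_ (*-identityʳ c) (*-zeroʳ b)) (+-identityʳ c))
    (trans (cong₂ _+_ (*-identityʳ b) (*-zeroʳ c)) (+-identityʳ b)) (trans (cong₂ _+_ (*-identityʳ a) (*-zeroʳ d)) (+-identityʳ a))

  module Chain (A L₀ p q β M : ℕ) (1≤K : 1 ≤ A * (L₀ + 3))
    (hyp : ∀ {L Q e} → length Q ≤ suc M → Prime L Q → 1 ≤ cnt e L → p * length Q + 2 * q ≤ q * Φ L Q e + β)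
    (h : ℕ) (R₁ : List Tri) (lenR₁ : length R₁ ≡ M) (hR₁ : occ h R₁ ≡ 2) where
    open Rail A L₀ p q β M 1≤K public

    LadOut : Set
    LadOut = ∃[ n ] ∃[ r₀ ] ∃[ s₀ ] ∃[ r ] ∃[ s ] ∃[ W ] ∃[ O ] L₀ < n × Lad r₀ s₀ n r s W × R₁ ↭ W ++ O × occ h W ≡ 0

    data Out (N : ℕ) : Set where
      ladder : LadOut → Out N
      bound  : ∀ S → A * S ≤ N + B → p * M + 2 * q ≤ q * N + c₁ * suc S → Out N

    out-mono : ∀ {N N'} → N ≤ N' → Out N → Out N'
    out-mono g (ladder l) = ladder l
    out-mono g (bound S a b) = bound S (≤-trans a (+-monoˡ-≤ B g)) (≤-trans b (+-monoˡ-≤ (c₁ * suc S) (*-monoʳ-≤ q g)))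

    toOut : ∀ {N U Y} → R₁ ↭ U ++ Y → occ h Y ≡ 2 → RawLad L₀ U → Out N
    toOut {N} {U} {Y} e hY (n , r₀ , s₀ , r , s , W , O , l , lad , g) =
      ladder (n , r₀ , s₀ , r , s , W , O ++ Y , l , lad , eW , zero' _ _ (trans (sym (trans (occ-↭ h eW) (trans (occ-++ h W (O ++ Y)) (cong (occ h W +_) (trans (occ-++ h O Y) (cong (occ h O +_) hY)))))) hR₁))
      where
      eW : R₁ ↭ W ++ (O ++ Y)
      eW = ptrans e (ptrans (++⁺ʳ Y g) (++-assoc W O Y))
      zero' : ∀ a b → a + (b + 2) ≡ 2 → a ≡ 0
      zero' a b e' = m+n≡0⇒m≡0 a (+-cancelʳ-≡ 2 (a + b) 0 (trans (+-assoc a b 2) e'))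

    cut-le : ∀ {L f₁ f₂ f₃} X' Y {TX} → tr X' ≡ TX → (w : WF L (TX ++ Y)) → (br : Br L (TX ++ Y)) → bdl L TX ↭ f₁ ∷ f₂ ∷ f₃ ∷ [] → occ h TX ≡ 0 →
      Z (outl L TX) ((tri f₁ f₂ f₃ , Uv (outl L Y) (tri f₁ f₂ f₃) X' one) ∷ pl Y) (neg h) ≤ Z L (X' ++ pl Y) (neg h)
    cut-le {L} X' Y {TX} eX w br bd hX = ≤-trans
      (glue' X' (pl Y) eX (tr-pl Y) w (bd-loopless TX Y w bd) bd (dep-neg h) (λ { (here refl) e → case trans (sym hX) e of λ () }) dep-one (λ ()))
      (≤-reflexive (sum-cong L (λ σ → cong (pr (X' ++ pl Y) σ *_) (+-identityʳ (neg h σ))) zeros))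

    low1 : ∀ {v π m cr} → Num v π m cr → AllGe 1 v
    low1 N = allge (≤-trans (x1 N) (g₁ (low (crt N)))) (≤-trans (x1 N) (g₂ (low (crt N)))) (≤-trans (x1 N) (g₃ (low (crt N))))

    module _ {L tz R v π cr U} (X₀ Y : List Tri) (pR : R ↭ X₀ ++ Y) (lX : 1 ≤ length X₀) (lY : 2 ≤ length Y) (dX : δ L (tz ∷ X₀) ≡ 3)
        (mX : Min3 L (tz ∷ X₀)) (hY : occ h Y ≡ 2) (st : St h L tz R) (eU : R₁ ↭ U ++ R) (N : Num v π (length R) cr) (ph : Phase U π (tz , v) cr)
        (rec : ∀ {L' tz' v' π' cr' U'} → St h L' tz' Y → R₁ ↭ U' ++ Y → Num v' π' (length Y) cr' → Phase U' π' (tz' , v') cr' → Out (Z L' ((tz' , v') ∷ pl Y) (neg h))) where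
      private
        Xv : List Vx
        Xv = (tz , v) ∷ pl X₀
        eX : tr Xv ≡ tz ∷ X₀
        eX = cong (tz ∷_) (tr-pl X₀)
        w : WF L ((tz ∷ X₀) ++ Y)
        w = WF-↭ (prep tz pR) (sw st)
        br : Br L ((tz ∷ X₀) ++ Y)
        br = Br-↭ {L = L} (prep tz pR) (sb st)
        Zeq : Z L ((tz , v) ∷ pl R) (neg h) ≡ Z L (Xv ++ pl Y) (neg h)
        Zeq = trans (Z-↭ L (neg h) (prep (tz , v) (pl-↭ pR))) (cong (λ z → Z L ((tz , v) ∷ z) (neg h)) (map-++ plain X₀ Y))
        eU' : R₁ ↭ (X₀ ++ U) ++ Y
        eU' = ptrans eU (ptrans (++⁺ˡ U pR) (ptrans (↭-sym (++-assoc U X₀ Y)) (++⁺ʳ Y (++-comm U X₀))))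
        lenEq : length R ≡ length X₀ + length Y
        lenEq = trans (↭-length pR) (length-++ X₀)
        N' : Num v π (length X₀ + length Y) cr
        N' = subst (λ m → Num v π m cr) lenEq N
        zeroX : ∀ TX → WF L (TX ++ Y) → occ h TX ≡ 0
        zeroX TX w with split3 {X = TX} {Y} w h
        ... | c00 _ a _ = a
        ... | c02 _ a _ = a
        ... | c11 _ _ b = case trans (sym hY) b of λ ()
        ... | c20 _ _ b = case trans (sym hY) b of λ ()

      prime-step : ∀ {x y z} → bdl L (tz ∷ X₀) ↭ x ∷ y ∷ z ∷ [] → 6 ≤ length (tri x y z ∷ tz ∷ X₀) → Out (Z L ((tz , v) ∷ pl R) (neg h))
      prime-step {x} {y} {z} bd l6 = done (min3-choose (λ φ → 4 ≤ φ × p * length H + 2 * q ≤ q * φ + β) _ _ _ (each (here refl)) (each (there (here refl))) (each (there (there (here refl)))))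
        where
        open Sides Xv (pl Y) eX (tr-pl Y) w br bd hiding (h)
        H : List Tri
        H = o ∷ tz ∷ X₀
        P : Prime LX H
        P = record { pwf = wX ; pbr = bX ; pn3 = CX.No3' mX ; p6 = l6 }
        lenH : length H ≤ suc M
        lenH = s≤s (≤-trans (≤-trans (≤-reflexive (+-comm 1 (length X₀))) (+-monoʳ-≤ (length X₀) (≤-trans (s≤s z≤n) lY))) (≤-trans (≤-reflexive (sym lenEq))
          (≤-trans (m≤n+m _ (length U)) (≤-reflexive (sym (trans (sym lenR₁) (trans (↭-length eU) (length-++ U))))))))
        inL : ∀ {e} → e ∈ labs (o ∷ []) → 1 ≤ cnt e LX
        inL {e} m = half-pos (≤-trans (∈⇒cnt {e} {labs H} (∈-++⁺ˡ m)) (≤-reflexive (twice wX e)))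
        each : ∀ {e} → e ∈ labs (o ∷ []) → 4 ≤ Φ LX H e × p * length H + 2 * q ≤ q * Φ LX H e + β
        each m = prime-φ4 P (inL m) , hyp lenH P (inL m)
        module I = HeavyInner wX bX v
        done : (∃[ φ ] (4 ≤ φ × p * length H + 2 * q ≤ q * φ + β) × φ ≤ Φ LX H x × φ ≤ Φ LX H y × φ ≤ Φ LX H z) → Out (Z L ((tz , v) ∷ pl R) (neg h))
        done (φ , (f4 , fl) , b₁ , b₂ , b₃) = next (num-prime {v' = I.v'} {π} {length Y} {length X₀} {φ} (cr≤ ph) f4 fl (λ {x} a → I.inner-low {2} {x} a (prime-all2 P))
            (λ {x} a → I.inner-pair {x} {π} {φ} a (prs (crt N)) b₁ b₂ b₃) N')
          where
          next : (∃[ π' ] Num I.v' π' (length Y) 0) → Out (Z L ((tz , v) ∷ pl R) (neg h))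
          next (π' , N₂) = out-mono (≤-trans (cut-le Xv Y eX w br bd (zeroX (tz ∷ X₀) w)) (≤-reflexive (sym Zeq)))
              (rec (st-cut X₀ Y (tz ∷ X₀) st pR w br bd hY) eU' N₂ pz)

      module _ {f₁ f₂ f₃ α β' γ} {X' : List Vx} (s : Shape X' f₁ f₂ f₃ α β' γ) (e : Xv ≈ X') where
        private
          w' : WF L (tr X' ++ Y)
          w' = subst (λ z → WF L (tr X' ++ z)) (tr-pl Y) (≈WF {X = Xv} {X'} {pl Y} e (subst₂ (λ a b → WF L (a ++ b)) (sym eX) (sym (tr-pl Y)) w))
          b' : Br L (tr X' ++ Y)
          b' = subst (λ z → Br L (tr X' ++ z)) (tr-pl Y) (≈Br {L} {Xv} {X'} {pl Y} e (subst₂ (λ a b → Br L (a ++ b)) (sym eX) (sym (tr-pl Y)) br))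
          d' : δ L (tr X') ≡ 3
          d' = trans (≈δ e) (trans (cong (δ L) eX) dX)
          bd : bdl L (tr X') ↭ f₁ ∷ f₂ ∷ f₃ ∷ []
          bd = shape-bdl s w' b' d'
          open Sides X' (pl Y) refl (tr-pl Y) w' b' bd hiding (h)
          v≡ : Uv LX o X' one ≡ shapeW s
          v≡ = shapeV s (shape-uq s w' b' d') wX (bd-loopless (tr X') Y w' bd)

        shape-step : ∀ {π' cr' U' v'} → shapeW s ≡ v' → R₁ ↭ U' ++ Y → Num v' π' (length Y) cr' → Phase U' π' (tri f₁ f₂ f₃ , v') cr' → Out (Z L ((tz , v) ∷ pl R) (neg h))
        shape-step {v' = v'} ev eV N₂ ph₂ = out-mono (≤-trans (subst (λ z → Z LY ((o , z) ∷ pl Y) (neg h) ≤ Z L (X' ++ pl Y) (neg h)) (trans v≡ ev)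
              (cut-le X' Y refl w' b' bd (zeroX (tr X') w')))
            (≤-reflexive (trans (sym (⇝Z (≈⇝ e (pl Y)) L (neg h))) (sym Zeq))))
            (rec (st-cut X₀ Y (tr X') st pR w' b' bd hY) eV N₂ ph₂)

    three-step : ∀ {L tz R v π cr U} P Q Y → R ↭ P ∷ Q ∷ Y → 2 ≤ length Y → δ L (tz ∷ P ∷ Q ∷ []) ≡ 3 → Min3 L (tz ∷ P ∷ Q ∷ []) → occ h Y ≡ 2 →
        St h L tz R → R₁ ↭ U ++ R → Num v π (length R) cr → Phase U π (tz , v) cr →
        (∀ {L' tz' v' π' cr' U'} → St h L' tz' Y → R₁ ↭ U' ++ Y → Num v' π' (length Y) cr' → Phase U' π' (tz' , v') cr' → Out (Z L' ((tz' , v') ∷ pl Y) (neg h))) →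
        Out (Z L ((tz , v) ∷ pl R) (neg h))
    three-step {L} {tz} {R} {v} {π} {cr} {U} P Q Y pR lY dX mX hY st eU N ph rec = go (small3 nform (record { perm = prefl ; sz = s0 ; lp = prefl ; lq = prefl }))
      where
      nform : NF ((tz , v) ∷ plain P ∷ plain Q ∷ [])
      nform = toNF {L} {(tz , v) ∷ plain P ∷ plain Q ∷ []} {Y} (WF-↭ (prep tz pR) (sw st)) (Br-↭ {L = L} (prep tz pR) (sb st)) dX refl
      eU' : R₁ ↭ (P ∷ Q ∷ U) ++ Y
      eU' = ptrans eU (ptrans (++⁺ˡ U pR) (shifts U (P ∷ Q ∷ [])))
      N' : Num v π (2 + length Y) cr
      N' = subst (λ m → Num v π m cr) (↭-length pR) N
      SS : ∀ {f₁ f₂ f₃ α β' γ X'} (s : Shape X' f₁ f₂ f₃ α β' γ) → (tz , v) ∷ plain P ∷ plain Q ∷ [] ≈ X' → ∀ {π' cr' U' v'} → shapeW s ≡ v' → R₁ ↭ U' ++ Y →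
        Num v' π' (length Y) cr' → Phase U' π' (tri f₁ f₂ f₃ , v') cr' → Out (Z L ((tz , v) ∷ pl R) (neg h))
      SS = shape-step (P ∷ Q ∷ []) Y pR (s≤s z≤n) lY dX mX hY st eU N ph rec
      go : Small3 (tz , v) P Q ((tz , v) ∷ plain P ∷ plain Q ∷ []) → Out (Z L ((tz , v) ∷ pl R) (neg h))
      go (kheavy s e g) = next (num-gain (cr≤ ph) g N')
        where
        next : (∃[ π' ] Num (shapeW s) π' (length Y) 0) → Out (Z L ((tz , v) ∷ pl R) (neg h))
        next (π' , N₂) = SS s e refl eU' N₂ pz
      go (ktri {u = u} e s t) = next (rail N' ph s (two→rungs t))
        where
        next : Next (P ∷ Q ∷ U) (_ , railW u) (length Y) → Out (Z L ((tz , v) ∷ pl R) (neg h))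
        next (inj₁ (π' , cr' , N₂ , ph₂)) = SS (triangle u (wt 1 1 1 0) (wt 1 1 1 0)) e (rail-eq u) eU' N₂ ph₂
        next (inj₂ l) = toOut eU' hY l

    cut-step : ∀ {L tz R v π cr U} X₀ Y → R ↭ X₀ ++ Y → 1 ≤ length X₀ → 2 ≤ length Y → δ L (tz ∷ X₀) ≡ 3 → Min3 L (tz ∷ X₀) → occ h Y ≡ 2 →
        St h L tz R → R₁ ↭ U ++ R → Num v π (length R) cr → Phase U π (tz , v) cr →
        (∀ {L' tz' v' π' cr' U'} → St h L' tz' Y → R₁ ↭ U' ++ Y → Num v' π' (length Y) cr' → Phase U' π' (tz' , v') cr' → Out (Z L' ((tz' , v') ∷ pl Y) (neg h))) →
        Out (Z L ((tz , v) ∷ pl R) (neg h))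
    cut-step {L} {tz} {R} {v} X₀ Y pR lX lY dX mX hY st eU N ph rec = go (bdl3 L (tz ∷ X₀) dX)
      where
      w : WF L ((tz ∷ X₀) ++ Y)
      w = WF-↭ (prep tz pR) (sw st)
      go : ∃[ x ] ∃[ y ] ∃[ z ] bdl L (tz ∷ X₀) ↭ x ∷ y ∷ z ∷ [] → Out (Z L ((tz , v) ∷ pl R) (neg h))
      go (x , y , z , bd) = which X₀ refl (small CX.WF')
        where
        module CX = Contract Y (tz ∷ X₀) (WF-↭ (++-comm (tz ∷ X₀) Y) w) (ptrans (bdl-compl (tz ∷ X₀) Y w) bd)
        which : ∀ X → X₀ ≡ X → Small (tri x y z ∷ tz ∷ X) → Out (Z L ((tz , v) ∷ pl R) (neg h))
        which [] refl s = ⊥-elim (case lX of λ ())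
        which (P ∷ Q ∷ []) refl s = three-step P Q Y pR lY dX mX hY st eU N ph rec
        which X refl (sz6 l6) = prime-step X₀ Y pR lX lY dX mX hY st eU N ph rec bd l6

    chain : ∀ n {L tz R v π cr U} → length R ≤ n → St h L tz R → R₁ ↭ U ++ R → Num v π (length R) cr → Phase U π (tz , v) cr →
      Out (Z L ((tz , v) ∷ pl R) (neg h))
    chain n {L} {tz} {R} {v} {π} {cr} {U} ln st eU N ph = go (cutz st)
      where
      lenR : length R ≤ M
      lenR = ≤-trans (m≤n+m _ (length U)) (≤-reflexive (sym (trans (sym lenR₁) (trans (↭-length eU) (length-++ U)))))
      hL : 1 ≤ cnt h L
      hL = half-pos (≤-trans (s≤s z≤n) (≤-reflexive (sym (trans (sym (twice (sw st) h)) (trans (occ-++ h (tz ∷ []) R) (cong₂ _+_ (st-o (sw st) (sR st)) (sR st)))))))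
      module H = Heavy (sw st) (sb st) v
      πN : π ≤ Z L ((tz , v) ∷ pl R) (neg h)
      πN = ≤-trans (m≤m+n π _) (≤-trans (H.heavy-pair {0} h (allge z≤n z≤n z≤n) (prs (crt N))) (≤-reflexive (+-identityʳ _)))
      end : p * M + 2 * q ≤ q * Z L ((tz , v) ∷ pl R) (neg h) + c₁ * suc (S N) → Out (Z L ((tz , v) ∷ pl R) (neg h))
      end = bound (S N) (num-end (≤-trans (cr≤ ph) (+-monoʳ-≤ L₀ (s≤s (s≤s z≤n)))) πN N)
      small-end : length R ≤ 4 → Out (Z L ((tz , v) ∷ pl R) (neg h))
      small-end l4 = end (≤-trans (i1 N) (≤-trans (+-monoˡ-≤ (c₁ * S N) (+-mono-≤ (≤-trans (*-monoʳ-≤ p l4) (≤-trans (≤-reflexive (*-comm p 4)) (m≤n+m (4 * p) β))) (*-monoʳ-≤ q πN)))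
        (≤-reflexive (ring c₁ (q * Z L ((tz , v) ∷ pl R) (neg h)) (S N)))))
        where
        ring : ∀ c z s → c + z + c * s ≡ z + c * suc s
        ring = solve-∀
      prime-end : Prime L (tz ∷ R) → Out (Z L ((tz , v) ∷ pl R) (neg h))
      prime-end P = end (≤-trans (fin (hyp (s≤s lenR) P hL) (i1 N)
          (≤-trans (≤-reflexive (cong (π +_) (sym (+-identityʳ _)))) (H.heavy-pair {1} h (low1 N) (prs (crt N)))))
          (≤-reflexive (cong (q * Z L ((tz , v) ∷ pl R) (neg h) +_) (sym (*-suc c₁ (S N))))))
        where
        fin : ∀ {φ z c} → p * suc (length R) + 2 * q ≤ q * φ + β → p * M + 2 * q ≤ p * length R + q * π + c → π + φ ≤ z + 2 → p * M + 2 * q ≤ q * z + (β + 4 * p + c)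
        fin {φ} {z} {c} a b d = +-cancelʳ-≤ (2 * q) _ _ (≤-trans (+-monoˡ-≤ (2 * q) b) (≤-trans (≤-reflexive (r₁ (p * length R) (q * π) c (2 * q)))
          (≤-trans (+-monoˡ-≤ (q * π + c) (≤-trans (+-monoˡ-≤ (2 * q) (*-monoʳ-≤ p (n≤1+n (length R)))) a)) (≤-trans (≤-reflexive (r₂ q φ β π c))
          (≤-trans (+-monoˡ-≤ (β + c) (*-monoʳ-≤ q d)) (≤-trans (m≤m+n _ (4 * p)) (≤-reflexive (r₃ q z β c p))))))))
          where
          r₁ : ∀ a b c d → a + b + c + d ≡ a + d + (b + c)
          r₁ = solve-∀
          r₂ : ∀ q φ β π c → q * φ + β + (q * π + c) ≡ q * (π + φ) + (β + c)
          r₂ = solve-∀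
          r₃ : ∀ q z β c p → q * (z + 2) + (β + c) + 4 * p ≡ q * z + (β + 4 * p + c) + 2 * q
          r₃ = solve-∀
      step : CutZ h L tz R → Out (Z L ((tz , v) ∷ pl R) (neg h))
      step (X₀ , Y , pR , lX , lY , dX , mX , hY) = sized n ln
        where
        sized : ∀ n → length R ≤ n → Out (Z L ((tz , v) ∷ pl R) (neg h))
        sized zero l = ⊥-elim (case ≤-trans lX (≤-trans (m≤m+n _ (length Y)) (≤-trans (≤-reflexive (sym (trans (↭-length pR) (length-++ X₀)))) l)) of λ ())
        sized (suc n) l = cut-step X₀ Y pR lX lY dX mX hY st eU N ph (chain n (≤-pred (≤-trans (+-monoˡ-≤ (length Y) lX)
          (≤-trans (≤-reflexive (sym (trans (↭-length pR) (length-++ X₀)))) l))))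
      go : CutZ h L tz R ⊎ No3 L (tz ∷ R) → Out (Z L ((tz , v) ∷ pl R) (neg h))
      go (inj₁ c) = step c
      go (inj₂ n3) = which (small (sw st))
        where
        which : Small (tz ∷ R) → Out (Z L ((tz , v) ∷ pl R) (neg h))
        which sz2 = small-end (s≤s z≤n)
        which sz4 = small-end (s≤s (s≤s (s≤s z≤n)))
        which (sz6 l) = prime-end record { pwf = sw st ; pbr = sb st ; pn3 = n3 ; p6 = l }

  -- Ladders

  ⇝lb : ∀ {t s Y} → t ∼ s → plain t ∷ Y ⇝ plain s ∷ Y
  ⇝lb {t} {s} {Y} e = record
    { ⇝wf = λ w → wf (simple w) (λ l → trans (sym (o l (tr Y))) (twice w l))
    ; ⇝br = λ b A B q d → case ∷-split q of λ
        { (inj₁ (A' , a , c)) → b (t ∷ A') B (prep _ c) (trans (in' A' a) d)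
        ; (inj₂ (B' , a , c)) → b A (t ∷ B') (ptrans (prep _ c) (↭-sym (shift _ A B'))) d }
    ; ⇝n3 = λ b A B q k m d → case ∷-split q of λ
        { (inj₁ (A' , a , c)) → b (t ∷ A') B (prep _ c) (subst (2 ≤_) (↭-length a) k) m (trans (in' A' a) d)
        ; (inj₂ (B' , a , c)) → b A (t ∷ B') (ptrans (prep _ c) (↭-sym (shift _ A B'))) k (subst (2 ≤_) (↭-length a) m) d }
    ; ⇝Z = λ L F → sum-cong L (λ σ → cong (λ z → z * pr Y σ * F σ) (ev-plain-↭ {t} {s} e σ)) zeros
    ; ⇝len = refl }
    where
    o : ∀ l A → occ l (t ∷ A) ≡ occ l (s ∷ A)
    o l A = trans (occ-++ l (t ∷ []) A) (trans (cong (_+ occ l A) (cnt-↭ l e)) (sym (occ-++ l (s ∷ []) A)))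
    in' : ∀ {L A} A' → A ↭ s ∷ A' → δ L (t ∷ A') ≡ δ L A
    in' {L} {A} A' p = trans (δ-occ L {t ∷ A'} {s ∷ A'} (λ l → o l A')) (sym (δ-↭ L p))

  -- perfect matchings of a ladder of n rungs in which both rails at the bottom are in the state y₀ and both at the top in y
  cl : ℕ → Bool → Bool → ℕ
  cl zero false false = 1
  cl zero true true = 1
  cl zero false true = 0
  cl zero true false = 0
  cl (suc n) y₀ true = cl n y₀ false
  cl (suc n) y₀ false = cl n y₀ false + cl n y₀ true

  cl-false : ∀ k m y₀ → 2 ^ k ≤ cl (1 + (k + k) + m) y₀ false
  cl-false zero zero false = ≤-refl
  cl-false zero zero true = ≤-refl
  cl-false zero (suc m) y₀ = ≤-trans (cl-false zero m y₀) (m≤m+n _ _)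
  cl-false (suc k) m y₀ = subst (λ z → 2 ^ suc k ≤ cl (2 + z + m) y₀ false) (sym (+-suc k k))
    (+-mono-≤ (≤-trans (cl-false k m y₀) (m≤m+n _ _)) (≤-trans (≤-reflexive (+-identityʳ (2 ^ k))) (cl-false k m y₀)))

  cl-pow : ∀ k m y₀ y → 2 ^ k ≤ cl (2 + (k + k) + m) y₀ y
  cl-pow k m y₀ true = cl-false k m y₀
  cl-pow k m y₀ false = ≤-trans (cl-false k m y₀) (m≤m+n _ _)

  mid : ∀ {r₀ s₀ n r s W} → Lad r₀ s₀ n r s W → List ℕ
  mid (lad1 {d = d} _ _) = d ∷ []
  mid (lad+ {r = r} {s} {d = d} l _ _) = r ∷ s ∷ d ∷ mid l

  occ-∼ : ∀ l {t s Y} → t ∼ s → occ l (t ∷ Y) ≡ occ l (s ∷ []) + occ l Y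
  occ-∼ l {t} {s} {Y} e = trans (occ-++ l (t ∷ []) Y) (cong (_+ occ l Y) (cnt-↭ l e))

  mid-occ : ∀ {r₀ s₀ n r s W} (lad : Lad r₀ s₀ n r s W) l → occ l W ≡ cnt l (mid lad) + cnt l (mid lad) + cnt l (r₀ ∷ s₀ ∷ r ∷ s ∷ [])
  mid-occ {r₀} {s₀} (lad1 {t} {t'} {r} {s} {d} i j) l = trans (occ-∼ l {Y = t' ∷ []} i) (trans (cong (occ l (tri r r₀ d ∷ []) +_) (occ-∼ l {Y = []} j))
    (lem (δ= l r) (δ= l r₀) (δ= l s) (δ= l s₀) (δ= l d)))
    where
    lem : ∀ r r₀ s s₀ d → r + (r₀ + (d + 0)) + (s + (s₀ + (d + 0)) + 0) ≡ d + 0 + (d + 0) + (r₀ + (s₀ + (r + (s + 0))))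
    lem = solve-∀
  mid-occ {r₀} {s₀} (lad+ {r = r} {s} {W} {t} {t'} {r'} {s'} {d} lad i j) l = trans (occ-∼ l {Y = t' ∷ W} i)
    (trans (cong (occ l (tri r' r d ∷ []) +_) (trans (occ-∼ l {Y = W} j) (cong (occ l (tri s' s d ∷ []) +_) (mid-occ lad l))))
    (lem (δ= l r) (δ= l r₀) (δ= l s) (δ= l s₀) (δ= l d) (δ= l r') (δ= l s') (cnt l (mid lad))))
    where
    lem : ∀ r r₀ s s₀ d r' s' m → r' + (r + (d + 0)) + (s' + (s + (d + 0)) + (m + m + (r₀ + (s₀ + (r + (s + 0)))))) ≡
      r + (s + (d + m)) + (r + (s + (d + m))) + (r₀ + (s₀ + (r' + (s' + 0))))
    lem = solve-∀

  module _ {r₀ s₀ n r s W} (lad : Lad r₀ s₀ n r s W) (tw : ∀ l → occ l W ≤ 2) where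
    mid-uq : Uq (mid lad)
    mid-uq = uq λ l → half (cnt l (mid lad)) (≤-trans (m≤m+n _ _) (≤-trans (≤-reflexive (sym (mid-occ lad l))) (tw l)))
      where
      half : ∀ c → c + c ≤ 2 → c ≤ 1
      half 0 _ = z≤n
      half 1 _ = ≤-refl
      half (suc (suc c)) (s≤s (s≤s x)) = case subst (_≤ 0) (+-suc c (suc c)) x of λ ()

    mid-out : ∀ {l} → l ∈ r₀ ∷ s₀ ∷ r ∷ s ∷ [] → l ∉ mid lad
    mid-out {l} m k = case ≤-trans (+-mono-≤ (+-mono-≤ (∈⇒cnt {l} k) (∈⇒cnt {l} k)) (∈⇒cnt {l} m)) (≤-trans (≤-reflexive (sym (mid-occ lad l))) (tw l)) of λ { (s≤s (s≤s ())) }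

    mid-two : ∀ {l} → l ∈ mid lad → occ l W ≡ 2
    mid-two {l} k = ≤-antisym (tw l) (≤-trans (+-mono-≤ (∈⇒cnt {l} k) (∈⇒cnt {l} k)) (≤-trans (m≤m+n _ _) (≤-reflexive (sym (mid-occ lad l)))))

  tail-occ : ∀ {t t' W} → (∀ l → occ l (t ∷ t' ∷ W) ≤ 2) → ∀ l → occ l W ≤ 2
  tail-occ {t} {t'} {W} h l = ≤-trans (m≤n+m _ _) (≤-trans (≤-reflexive (sym (occ-++ l (t ∷ t' ∷ []) W))) (h l))

  upd3-out : ∀ σ {r s d x} a b c → x ≢ r → x ≢ s → x ≢ d → upd (upd (upd σ r a) s b) d c x ≡ σ x
  upd3-out σ {r} {s} {d} a b c p q u = trans (upd-diff (upd (upd σ r a) s b) c u) (trans (upd-diff (upd σ r a) b q) (upd-diff σ a p))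

  ev-∼ : ∀ {t p q r} → t ∼ tri p q r → ∀ {σ x y z} → σ p ≡ x → σ q ≡ y → σ r ≡ z → ev (plain t) σ ≡ wP x y z
  ev-∼ {t} {p} {q} {r} e {σ} refl refl refl = ev-plain-↭ {t} {tri p q r} e σ

  ladval : ∀ {r₀ s₀ n r s W} (lad : Lad r₀ s₀ n r s W) → (∀ l → occ l W ≤ 2) → ∀ σ y₀ y → σ r₀ ≡ y₀ → σ s₀ ≡ y₀ → σ r ≡ y → σ s ≡ y →
    cl n y₀ y ≤ sumOver (mid lad) (pr (pl W)) σ
  ladval {r₀} {s₀} LAD@(lad1 {t} {t'} {r} {s} {d} i j) tw σ y₀ y e₁ e₂ e₃ e₄ = ≤-trans (≤-reflexive (fin y₀ y))
      (≤-reflexive (sym (cong₂ _+_ (val true) (val false))))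
    where
    out : ∀ {l} b → l ∈ r₀ ∷ s₀ ∷ r ∷ s ∷ [] → upd σ d b l ≡ σ l
    out b m = upd-diff σ b λ { refl → mid-out LAD tw m (here refl) }
    val : ∀ b → pr (pl (t ∷ t' ∷ [])) (upd σ d b) ≡ wP y y₀ b * (wP y y₀ b * 1)
    val b = cong₂ (λ u v → u * (v * 1))
      (ev-∼ i (trans (out b (there (there (here refl)))) e₃) (trans (out b (here refl)) e₁) (upd-same σ d b))
      (ev-∼ j (trans (out b (there (there (there (here refl))))) e₄) (trans (out b (there (here refl))) e₂) (upd-same σ d b))
    fin : ∀ y₀ y → cl 1 y₀ y ≡ wP y y₀ true * (wP y y₀ true * 1) + wP y y₀ false * (wP y y₀ false * 1)
    fin false false = refl
    fin false true = refl
    fin true false = refl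
    fin true true = refl
  ladval {r₀} {s₀} LAD@(lad+ {n} {r} {s} {W} {t} {t'} {r'} {s'} {d} lad i j) tw σ y₀ y e₁ e₂ e₃ e₄ = fin y e₃ e₄
    where
    M = mid lad
    U' : Uq (r ∷ s ∷ d ∷ M)
    U' = mid-uq LAD tw
    T : Bool → Bool → Bool → ℕ
    T a b c = sumOver M (pr (pl (t ∷ t' ∷ W))) (upd (upd (upd σ r a) s b) d c)
    out : ∀ {l} a b c → l ∈ r₀ ∷ s₀ ∷ r' ∷ s' ∷ [] → upd (upd (upd σ r a) s b) d c l ≡ σ l
    out a b c m = upd3-out σ a b c (λ { refl → mid-out LAD tw m (here refl) }) (λ { refl → mid-out LAD tw m (there (here refl)) }) (λ { refl → mid-out LAD tw m (there (there (here refl))) })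
    r≢s : r ≢ s
    r≢s e = uniq-head U' (here e)
    r≢d : r ≢ d
    r≢d e = uniq-head U' (there (here e))
    s≢d : s ≢ d
    s≢d e = uniq-head (uniq-tail U') (here e)
    at-r : ∀ a b c → upd (upd (upd σ r a) s b) d c r ≡ a
    at-r a b c = trans (upd-diff (upd (upd σ r a) s b) c r≢d) (trans (upd-diff (upd σ r a) b r≢s) (upd-same σ r a))
    at-s : ∀ a b c → upd (upd (upd σ r a) s b) d c s ≡ b
    at-s a b c = trans (upd-diff (upd (upd σ r a) s b) c s≢d) (upd-same (upd σ r a) s b)
    H : Asg → ℕ
    H τ = ev (plain t) τ * ev (plain t') τ
    dH : Dep (labs (t ∷ []) ++ labs (t' ∷ [])) H
    dH = dep-* {labs (t ∷ [])} {labs (t' ∷ [])} (dep1 t) (dep1 t')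
      where
      dep1 : ∀ t → Dep (labs (t ∷ [])) (ev (plain t))
      dep1 t σ τ ag = trans (sym (*-identityʳ _)) (trans (pr-dep (plain t ∷ []) σ τ ag) (*-identityʳ _))
    dis : ∀ {l} → l ∈ M → l ∉ labs (t ∷ []) ++ labs (t' ∷ [])
    dis {l} m k = case ≤-trans (+-mono-≤ (∈⇒cnt {l} k) (≤-reflexive (sym (mid-two lad (tail-occ {t} {t'} {W} tw) m))))
        (≤-trans (≤-reflexive (trans (cong (_+ occ l W) (trans (cnt-++ l (labs (t ∷ [])) (labs (t' ∷ []))) (sym (occ-++ l (t ∷ []) (t' ∷ []))))) (sym (occ-++ l (t ∷ t' ∷ []) W)))) (tw l)) of λ { (s≤s (s≤s ())) }
    val : ∀ a b c → T a b c ≡ wP (upd (upd (upd σ r a) s b) d c r') a c * wP (upd (upd (upd σ r a) s b) d c s') b c * sumOver M (pr (pl W)) (upd (upd (upd σ r a) s b) d c)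
    val a b c = trans (sum-cong M (λ τ → sym (*-assoc (ev (plain t) τ) (ev (plain t') τ) (pr (pl W) τ))) σ')
      (trans (sum-mulˡ M {F = pr (pl W)} {H = H} dH dis σ') (cong (_* sumOver M (pr (pl W)) σ') (cong₂ _*_
        (ev-∼ i {σ = σ'} refl (at-r a b c) (upd-same (upd (upd σ r a) s b) d c)) (ev-∼ j {σ = σ'} refl (at-s a b c) (upd-same (upd (upd σ r a) s b) d c)))))
      where
      σ' = upd (upd (upd σ r a) s b) d c
    use : ∀ y a c → σ r' ≡ y → σ s' ≡ y → wP y a c ≡ 1 → cl n y₀ a ≤ T a a c
    use y a c f₁ f₂ w = ≤-trans (ladval lad (tail-occ {t} {t'} {W} tw) _ y₀ a (trans (out a a c (here refl)) e₁) (trans (out a a c (there (here refl))) e₂) (at-r a a c) (at-s a a c))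
      (≤-reflexive (sym (trans (val a a c) (trans (cong (_* sumOver M (pr (pl W)) (upd (upd (upd σ r a) s a) d c)) (cong₂ _*_
        (trans (cong (λ z → wP z a c) (trans (out a a c (there (there (here refl)))) f₁)) w) (trans (cong (λ z → wP z a c) (trans (out a a c (there (there (there (here refl))))) f₂)) w))) (+-identityʳ _)))))
    pick₁ : ∀ a b c d e f g h → h ≤ a + b + (c + d) + (e + f + (g + h))
    pick₁ a b c d e f g h = ≤-trans (m≤n+m h g) (≤-trans (m≤n+m (g + h) (e + f)) (m≤n+m _ (a + b + (c + d))))
    pick₂ : ∀ a b c d e f g h → g + b ≤ a + b + (c + d) + (e + f + (g + h))
    pick₂ a b c d e f g h = ≤-trans (≤-reflexive (+-comm g b)) (+-mono-≤ (≤-trans (m≤n+m b a) (m≤m+n _ (c + d))) (≤-trans (m≤m+n g h) (m≤n+m _ (e + f))))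
    fin : ∀ y → σ r' ≡ y → σ s' ≡ y → cl (suc n) y₀ y ≤ sumOver (mid LAD) (pr (pl (t ∷ t' ∷ W))) σ
    fin true f₁ f₂ = ≤-trans (use true false false f₁ f₂ refl)
      (pick₁ (T true true true) (T true true false) (T true false true) (T true false false) (T false true true) (T false true false) (T false false true) (T false false false))
    fin false f₁ f₂ = ≤-trans (+-mono-≤ (use false false true f₁ f₂ refl) (use false true false f₁ f₂ refl))
      (pick₂ (T true true true) (T true true false) (T true false true) (T true false false) (T false true true) (T false true false) (T false false true) (T false false false))

  sum-ex : ∀ L {F} τ → 1 ≤ sumOver L F τ → ∃[ σ ] 1 ≤ F σ × (∀ l → l ∉ L → σ l ≡ τ l)
  sum-ex [] τ h = τ , h , λ _ _ → refl
  sum-ex (l ∷ L) {F} τ h = go (pos (sumOver L F (upd τ l true)) (sumOver L F (upd τ l false)) h)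
    where
    pos : ∀ a b → 1 ≤ a + b → 1 ≤ a ⊎ 1 ≤ b
    pos (suc a) b _ = inj₁ (s≤s z≤n)
    pos zero b h = inj₂ h
    ext : ∀ b → (∃[ σ ] 1 ≤ F σ × (∀ m → m ∉ L → σ m ≡ upd τ l b m)) → ∃[ σ ] 1 ≤ F σ × (∀ m → m ∉ l ∷ L → σ m ≡ τ m)
    ext b (σ , h , e) = σ , h , λ m n → trans (e m (n ∘ there)) (upd-diff τ b (n ∘ here))
    go : 1 ≤ sumOver L F (upd τ l true) ⊎ 1 ≤ sumOver L F (upd τ l false) → ∃[ σ ] 1 ≤ F σ × (∀ m → m ∉ l ∷ L → σ m ≡ τ m)
    go (inj₁ x) = ext true (sum-ex L (upd τ l true) x)
    go (inj₂ x) = ext false (sum-ex L (upd τ l false) x)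

  sub↭ : ∀ M L → Uq M → (∀ {l} → l ∈ M → l ∈ L) → ∃[ N ] L ↭ N ++ M
  sub↭ [] L u i = L , ↭-sym (++-identityʳ L)
  sub↭ (m ∷ M) L u i with ∈-split (i (here refl))
  ... | L' , p with sub↭ M L' (uniq-tail u) (λ {l} k → drop' k (∈-resp-↭ p (i (there k))))
    where
    drop' : ∀ {l} → l ∈ M → l ∈ m ∷ L' → l ∈ L'
    drop' k (here refl) = ⊥-elim (uniq-head u k)
    drop' k (there x) = x
  ...   | N , q = N , ptrans p (ptrans (prep m q) (↭-sym (shift m N M)))

  sum-part : ∀ {L M A F} → Dep A F → Uq M → (∀ {l} → l ∈ M → l ∈ L) → ∀ σ → (∀ l → l ∉ L → σ l ≡ false) → sumOver M F σ ≤ sumOver L F zeros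
  sum-part {L} {M} {A} {F} d u i σ o = go (sub↭ M L u i)
    where
    σ° : Asg
    σ° l = [ (λ _ → false) , (λ _ → σ l) ]′ (mem? l M)
    agree : ∀ l → l ∉ M → σ l ≡ σ° l
    agree l n with mem? l M
    ... | inj₁ m = ⊥-elim (n m)
    ... | inj₂ _ = refl
    go : ∃[ N ] L ↭ N ++ M → sumOver M F σ ≤ sumOver L F zeros
    go (N , p) = ≤-trans (≤-reflexive (sum-dep M d σ σ° (λ l _ n → agree l n)))
      (≤-trans (sum-ge N (sum-Dep M d) σ° zeros (λ l _ n → off l n)) (≤-reflexive (sym (trans (sum-↭ d p zeros) (sum-++ N M F zeros)))))
      where
      off : ∀ l → l ∉ N → σ° l ≡ false
      off l n with mem? l M
      ... | inj₁ m = refl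
      ... | inj₂ m = o l λ k → [ n , m ]′ (∈-++⁻ N (∈-resp-↭ p k))

  wP-even₂ : ∀ x a b z → 1 ≤ wP x a z → 1 ≤ wP x b z → a ≡ b
  wP-even₂ x false false z _ _ = refl
  wP-even₂ x true true z _ _ = refl
  wP-even₂ false false true false () _
  wP-even₂ false true false false _ ()
  wP-even₂ false false true true _ ()
  wP-even₂ false true false true () _
  wP-even₂ true false true false _ ()
  wP-even₂ true true false false () _
  wP-even₂ true false true true () _
  wP-even₂ true true false true _ ()

  wP-even₁ : ∀ a b y z → 1 ≤ wP a y z → 1 ≤ wP b y z → a ≡ b
  wP-even₁ false false y z _ _ = refl
  wP-even₁ true true y z _ _ = refl
  wP-even₁ false true false false () _
  wP-even₁ true false false false _ ()
  wP-even₁ false true false true _ ()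
  wP-even₁ true false false true () _
  wP-even₁ false true true false _ ()
  wP-even₁ true false true false () _
  wP-even₁ false true true true () _
  wP-even₁ true false true true _ ()

  *-pos-inv : ∀ a b → 1 ≤ a * b → 1 ≤ a × 1 ≤ b
  *-pos-inv (suc a) (suc b) _ = s≤s z≤n , s≤s z≤n
  *-pos-inv (suc a) zero h = case subst (1 ≤_) (*-zeroʳ a) h of λ ()

  pair-at : ∀ {t t' p q r p' q' r' W} → t ∼ tri p q r → t' ∼ tri p' q' r' → ∀ {σ} → 1 ≤ pr (pl (t ∷ t' ∷ W)) σ →
    1 ≤ wP (σ p) (σ q) (σ r) × 1 ≤ wP (σ p') (σ q') (σ r') × 1 ≤ pr (pl W) σ
  pair-at {t} {t'} {W = W} i j {σ} h with *-pos-inv (ev (plain t) σ) _ h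
  ... | a , h' with *-pos-inv (ev (plain t') σ) _ h'
  ...   | b , c = subst (1 ≤_) (ev-∼ i {σ = σ} refl refl refl) a , subst (1 ≤_) (ev-∼ j {σ = σ} refl refl refl) b , c

  even-back : ∀ {r₀ s₀ n r s W} → Lad r₀ s₀ n r s W → ∀ {σ} → 1 ≤ pr (pl W) σ → σ r ≡ σ s → σ r₀ ≡ σ s₀
  even-back {r₀} {s₀} (lad1 {r = r} {s} {d} i j) {σ} h e with pair-at {W = []} i j {σ} h
  ... | a , b , _ = wP-even₂ (σ r) (σ r₀) (σ s₀) (σ d) a (subst (λ z → 1 ≤ wP z (σ s₀) (σ d)) (sym e) b)
  even-back (lad+ {r = r} {s} {W} {r' = r'} {s'} {d} l i j) {σ} h e with pair-at {W = W} i j {σ} h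
  ... | a , b , c = even-back l {σ} c (wP-even₂ (σ r') (σ r) (σ s) (σ d) a (subst (λ z → 1 ≤ wP z (σ s) (σ d)) (sym e) b))

  -- a perfect matching avoiding e and both rails at one rung, modified freely along the ladder
  ladder-Φ : ∀ {L G e r₀ s₀ n r s r' s' d t t' W O} → Prime L G → (lad : Lad r₀ s₀ n r s W) → t ∼ tri r' r d → t' ∼ tri s' s d →
    G ↭ (t ∷ t' ∷ W) ++ O → occ e (t ∷ t' ∷ W) ≡ 0 → ∃[ y₀ ] ∃[ y ] cl (suc n) y₀ y ≤ Φ L G e
  ladder-Φ {L} {G} {e} {r₀} {s₀} {n} {r} {s} {r'} {s'} {d} {t} {t'} {W} {O} P lad i j eG e0 = fin (sum-ex L zeros pm)
    where
    LAD : Lad r₀ s₀ (suc n) r' s' (t ∷ t' ∷ W)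
    LAD = lad+ lad i j
    WW = t ∷ t' ∷ W
    wG : WF L (WW ++ O)
    wG = WF-↭ eG (pwf P)
    tw : ∀ l → occ l WW ≤ 2
    tw l with split3 {X = WW} {O} wG l
    ... | c00 _ x _ rewrite x = z≤n
    ... | c02 _ x _ rewrite x = z≤n
    ... | c11 _ x _ rewrite x = s≤s z≤n
    ... | c20 _ x _ rewrite x = ≤-refl
    u x₁ : Tri
    u = tri r d r'
    x₁ = tri d s s'
    iu : t ∼ u
    iu = ptrans i (ptrans (pswap r' r prefl) (prep r (pswap r' d prefl)))
    jx : t' ∼ x₁
    jx = ptrans j (ptrans (prep s' (pswap s d prefl)) (ptrans (pswap s' d prefl) (prep d (pswap s' s prefl))))
    T : List Tri
    T = W ++ O
    q₀ : pl G ⇝ pl (u ∷ x₁ ∷ T)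
    q₀ = ⇝↭ (pl-↭ eG) ⇝∙ (⇝lb {t} {u} {pl (t' ∷ T)} iu ⇝∙ (⇝↭ (pswap (plain u) (plain t') prefl) ⇝∙ (⇝lb {t'} {x₁} {pl (u ∷ T)} jx ⇝∙ ⇝↭ (pswap (plain x₁) (plain u) prefl))))
    P₀ : Prime L (u ∷ x₁ ∷ T)
    P₀ = prime-⇝ {L} {G} {u ∷ x₁ ∷ T} q₀ P
    e∉ : ∀ {l} → l ∈ labs (t ∷ t' ∷ []) → e ≢ l
    e∉ m refl = cnt⇒∉ e0 (subst (e ∈_) (sym (labs-++ (t ∷ t' ∷ []) W)) (∈-++⁺ˡ m))
    inu : ∀ {l} → l ∈ labs (u ∷ []) → l ∈ labs (t ∷ t' ∷ [])
    inu {l} m = subst (l ∈_) (sym (labs-++ (t ∷ []) (t' ∷ []))) (∈-++⁺ˡ (∈-resp-↭ (↭-sym iu) m))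
    inx : ∀ {l} → l ∈ labs (x₁ ∷ []) → l ∈ labs (t ∷ t' ∷ [])
    inx {l} m = subst (l ∈_) (sym (labs-++ (t ∷ []) (t' ∷ []))) (∈-++⁺ʳ (labs (t ∷ [])) (∈-resp-↭ (↭-sym jx) m))
    h₀ : Loopless u
    h₀ = noloop (pwf P₀) (pbr P₀)
    r'∉ : r' ∉ s ∷ s' ∷ []
    r'∉ = nodigon (pwf P₁) (pbr P₁) (pn3 P₁) (≤-pred (≤-pred (p6 P₁)))
      where
      P₁ : Prime L (tri d r' r ∷ x₁ ∷ T)
      P₁ = prime-⇝ {L} {u ∷ x₁ ∷ T} {tri d r' r ∷ x₁ ∷ T} (⇝sw (s12 (s23 s0))) P₀
    once₁ : occ r' (u ∷ x₁ ∷ []) ≡ 1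
    once₁ = trans (occ-++ r' (u ∷ []) (x₁ ∷ [])) (cong₂ _+_ (≤-antisym (h₀ r') (∈⇒cnt {A = r ∷ d ∷ r' ∷ []} (there (there (here refl)))))
      (∉⇒cnt {r'} (d ∷ s ∷ s' ∷ []) λ { (here z) → proj₂ (proj₂ (dist3 h₀)) (sym z) ; (there m) → r'∉ m }))
    pm : 1 ≤ Z L (pl G) (λ σ → neg r σ * (neg s σ * neg e σ))
    pm = go (pull (plain u ∷ plain x₁ ∷ []) T (other-end {X = u ∷ x₁ ∷ []} {T} {r'} (pwf P₀) once₁))
      where
      go : ∃[ m ] ∃[ k ] ∃[ Y ] (plain u ∷ plain x₁ ∷ pl T ⇝ plain u ∷ plain x₁ ∷ pl (tri r' m k ∷ Y)) → 1 ≤ Z L (pl G) (λ σ → neg r σ * (neg s σ * neg e σ))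
      go (g₃ , g₄ , Y , q) = use (V.voorG (dep-neg e) (λ { (here refl) (here z) → e∉ (inu (there (here refl))) z ; (here refl) (there (here z)) → e∉ (inu (there (there (here refl)))) z
            ; (here refl) (there (there (here z))) → e∉ (inx (there (here refl))) z }))
        where
        K : List Tri
        K = u ∷ x₁ ∷ tri r' g₃ g₄ ∷ Y
        qK : pl G ⇝ pl K
        qK = q₀ ⇝∙ q
        PK : Prime L K
        PK = prime-⇝ {L} {G} {K} qK P
        module V = Voor4 (pwf PK) (pbr PK) (pn3 PK) (≤-pred (≤-pred (≤-pred (p6 PK))))
        use : (∃[ L₁ ] ∃[ V ] ∃[ R₁ ] Good L₁ V R₁ Y r × Z L₁ (pl (V ∷ R₁)) (λ σ → neg r σ * neg e σ) ≤ Z L (pl K) (λ σ → neg r σ * (neg s σ * neg e σ))) →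
          1 ≤ Z L (pl G) (λ σ → neg r σ * (neg s σ * neg e σ))
        use (L₁ , V , R₁ , g , le) = ≤-trans (ples! (gwf g) (gbr g) r e) (≤-trans le (≤-reflexive (sym (⇝Z qK L (λ σ → neg r σ * (neg s σ * neg e σ))))))
    fin : ∃[ σ ] 1 ≤ pr (pl G) σ * (neg r σ * (neg s σ * neg e σ)) × (∀ l → l ∉ L → σ l ≡ false) → ∃[ y₀ ] ∃[ y ] cl (suc n) y₀ y ≤ Φ L G e
    fin (σ , h , off) = σ r₀ , σ r' , ≤-trans (ladval LAD tw σ (σ r₀) (σ r') refl (sym e₀) refl (sym e₁))
        (≤-trans (≤-trans (≤-reflexive (sym (*-identityʳ S₀))) (*-monoʳ-≤ S₀ hH))
        (≤-trans (≤-reflexive (sym (trans (sum-cong M {λ τ → pr (pl G) τ * neg e τ} {λ τ → pr (pl WW) τ * H τ} (λ τ → trans (cong (_* neg e τ) (prG τ)) (*-assoc (pr (pl WW) τ) (pr (pl O) τ) (neg e τ))) σ) (sum-mulʳ M {F = pr (pl WW)} {H = H} dH dis σ))))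
          (sum-part {L} {M} (dep-* (pr-dep (pl G)) (dep-neg e)) (mid-uq LAD tw) inL σ off)))
      where
      M = mid LAD
      S₀ : ℕ
      S₀ = sumOver M (pr (pl WW)) σ
      H : Asg → ℕ
      H τ = pr (pl O) τ * neg e τ
      prG : ∀ τ → pr (pl G) τ ≡ pr (pl WW) τ * pr (pl O) τ
      prG τ = trans (pr-↭ (pl-↭ eG) τ) (trans (cong (λ z → pr z τ) (map-++ plain WW O)) (pr-++ (pl WW) (pl O) τ))
      dH : Dep (labs (tr (pl O)) ++ e ∷ []) H
      dH = dep-* (pr-dep (pl O)) (dep-neg e)
      pos1 = *-pos-inv (pr (pl G) σ) (neg r σ * (neg s σ * neg e σ)) h
      pos2 = *-pos-inv (neg r σ) (neg s σ * neg e σ) (proj₂ pos1)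
      pos3 = *-pos-inv (neg s σ) (neg e σ) (proj₂ pos2)
      pos4 = *-pos-inv (pr (pl WW) σ) (pr (pl O) σ) (subst (1 ≤_) (prG σ) (proj₁ pos1))
      hH : 1 ≤ H σ
      hH = *-mono-≤ (proj₂ pos4) (proj₂ pos3)
      off' : ∀ l → 1 ≤ neg l σ → σ l ≡ false
      off' l h with σ l
      ... | false = refl
      ers : σ r ≡ σ s
      ers = trans (off' r (proj₁ pos2)) (sym (off' s (proj₁ pos3)))
      top = pair-at {W = W} i j {σ} (proj₁ pos4)
      e₁ : σ r' ≡ σ s'
      e₁ = wP-even₁ (σ r') (σ s') (σ r) (σ d) (proj₁ top) (subst (λ z → 1 ≤ wP (σ s') z (σ d)) (sym ers) (proj₁ (proj₂ top)))
      e₀ : σ r₀ ≡ σ s₀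
      e₀ = even-back LAD {σ} (proj₁ pos4) e₁
      inL : ∀ {l} → l ∈ M → l ∈ L
      inL {l} m = cnt⇒∈ L (half-pos (≤-trans (≤-trans (s≤s z≤n) (≤-reflexive (sym (mid-two LAD tw m)))) (≤-trans (m≤m+n _ (occ l O)) (≤-reflexive (trans (sym (occ-++ l WW O)) (twice wG l))))))
      dis : ∀ {l} → l ∈ M → l ∉ labs (tr (pl O)) ++ e ∷ []
      dis {l} m k with ∈-++⁻ (labs (tr (pl O))) k
      ... | inj₂ (here refl) = case trans (sym e0) (mid-two LAD tw m) of λ ()
      ... | inj₁ k' with split3 {X = WW} {O} wG l
      ...   | c00 _ x _ = case trans (sym x) (mid-two LAD tw m) of λ ()
      ...   | c02 _ x _ = case trans (sym x) (mid-two LAD tw m) of λ ()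
      ...   | c11 _ x _ = case trans (sym x) (mid-two LAD tw m) of λ ()
      ...   | c20 _ _ x = cnt⇒∉ x (subst (λ z → l ∈ labs z) (tr-pl O) k')

  -- Graphs without non-trivial 3-edge cuts

  least : ∀ T X → 1 ≤ T → ∃[ b ] X ≤ T * b × (∀ N → X ≤ T * N → b ≤ N)
  least T X h = go X (≤-trans (≤-reflexive (sym (+-identityʳ X))) (*-monoˡ-≤ X h))
    where
    go : ∀ m → X ≤ T * m → ∃[ b ] X ≤ T * b × (∀ N → X ≤ T * N → b ≤ N)
    go zero g = 0 , g , λ _ _ → z≤n
    go (suc m) g with X ≤? T * m
    ... | yes g' = go m g'
    ... | no n = suc m , g , λ N k → ≰⇒> λ N≤m → n (≤-trans k (*-monoʳ-≤ T N≤m))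

  ∉-mem : ∀ {e t} (W : List Tri) → occ e W ≡ 0 → t ∈ W → e ∉ labs (t ∷ [])
  ∉-mem {e} {t} W h m k with ∈-split m
  ... | W' , p = cnt⇒∉ (trans (sym (occ-↭ e p)) h) (subst (e ∈_) (sym (labs-++ (t ∷ []) W')) (∈-++⁺ˡ k))

  module Superlinear (A p q β m : ℕ) (A1 : 1 ≤ A) (q1 : 1 ≤ q) where
    L₀ : ℕ
    L₀ = suc (m * 4 + m * 4)

    1≤K : 1 ≤ A * (L₀ + 3)
    1≤K = *-mono-≤ {1} {A} {1} {L₀ + 3} A1 (s≤s z≤n)

    module Pt (M : ℕ) = Potential A L₀ p q β M

    c B₀ : ℕ
    c = β + 4 * p
    B₀ = Pt.B 0

    core : ∀ {L G e} → (∀ {L' Q f} → length Q < length G → Prime L' Q → 1 ≤ cnt f L' → p * length Q + 2 * q ≤ q * Φ L' Q f + β) →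
      Prime L G → 1 ≤ cnt e L → Φ L G e < 16 ^ m →
      ∃[ M ] length G ≡ 3 + M × 4 * (A * (p * M + 2 * q)) ≤ 3 * ((A * q + c) * Φ L G e) + 4 * (c * B₀ + A * c)
    core {L} {G} {e} hyp P he sm = go (centre (pwf P) (pbr P) (pn3 P) (p6 P) he e)
      where
      go : Centre G e e → ∃[ M ] length G ≡ 3 + M × 4 * (A * (p * M + 2 * q)) ≤ 3 * ((A * q + c) * Φ L G e) + 4 * (c * B₀ + A * c)
      go (s , t , a , b , g₁ , g₂ , g₃ , g₄ , R₀ , _ , qG) = M , lenG , fin (least T (D ∸ E) T1)
        where
        R K : List Tri
        R = tri e s t ∷ R₀
        K = tri e a b ∷ tri a g₁ g₂ ∷ tri b g₃ g₄ ∷ R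
        M = length R
        lenG : length G ≡ 3 + M
        lenG = pllen {G} {K} qG
        PK : Prime L K
        PK = prime-⇝ {L} {G} {K} qG P
        module V = Voor4 (pwf PK) (pbr PK) (pn3 PK) (≤-pred (≤-pred (≤-pred (p6 PK))))
        T D E : ℕ
        T = A * q + c
        D = A * (p * M + 2 * q)
        E = c * B₀ + A * c
        φ : ℕ
        φ = Φ L G e
        ΦK : Φ L K e ≡ φ
        ΦK = sym (⇝Z qG L (neg e))
        module OneGood {L₁ W R₁} (g : Good L₁ W R₁ R e) where
          open Chain A L₀ p q β M 1≤K (λ l → hyp (≤-trans (s≤s l) (≤-trans (n≤1+n (2 + M)) (≤-reflexive (sym lenG))))) e R₁ (glen g) (gin g) hiding (K; B; C; c₁; T; S; x; i1; i2)
          N : ℕ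
          N = Z L₁ (pl (W ∷ R₁)) (neg e)
          st : St e L₁ W R₁
          st = record { sw = gwf g ; sb = gbr g ; sstar = gstar g ; sR = gin g }
          run : Out N
          run = chain M {U = []} (≤-reflexive (glen g)) st prefl (subst (λ k → Num (wt 1 1 1 0) 2 k 0) (sym (glen g)) (num-start 1≤K)) pz
          noLad : ∀ {n r₀ s₀ r s W O} → L₀ < n → Lad r₀ s₀ n r s W → R₁ ↭ W ++ O → occ e W ≡ 0 → ⊥
          noLad l (lad1 _ _) _ _ = case ≤-trans (s≤s (s≤s z≤n)) l of λ { (s≤s ()) }
          noLad {W = W'} {O} l (lad+ {n} lad i j) p' z with gold g W' O p' (λ {t} m' → ∉-mem W' z m')
          ... | Y , eR = bad (ladder-Φ PK lad i j eK z)
            where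
            eK : K ↭ W' ++ (Y ++ (tri e a b ∷ tri a g₁ g₂ ∷ tri b g₃ g₄ ∷ []))
            eK = ptrans (++-comm (tri e a b ∷ tri a g₁ g₂ ∷ tri b g₃ g₄ ∷ []) R) (ptrans (++⁺ʳ _ eR) (++-assoc W' Y _))
            bad : ∃[ y₀ ] ∃[ y ] cl (suc n) y₀ y ≤ Φ L K e → ⊥
            bad (y₀ , y , h) with m≤n⇒∃[o]m+o≡n l
            ... | o , eq = <⇒≱ sm (≤-trans (≤-reflexive (trans (^-*-assoc 2 4 m) (cong (2 ^_) (*-comm 4 m)))) (≤-trans (cl-pow (m * 4) o y₀ y)
                  (≤-trans (≤-reflexive (cong (λ z → cl z y₀ y) eq)) (≤-trans h (≤-reflexive ΦK)))))
          fromOut : Out N → D ≤ T * N + E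
          fromOut (ladder (_ , _ , _ , _ , _ , _ , _ , l , lad , p' , z)) = ⊥-elim (noLad l lad p' z)
          fromOut (bound S h h') = ≤-trans (*-monoʳ-≤ A h') (≤-trans (≤-reflexive (r₁ A q N c S)) (≤-trans (+-monoˡ-≤ (A * c) (+-monoʳ-≤ (A * q * N) (*-monoʳ-≤ c h)))
              (≤-reflexive (r₂ A q N c B₀))))
            where
            r₁ : ∀ A q N c S → A * (q * N + c * suc S) ≡ A * q * N + c * (A * S) + A * c
            r₁ = solve-∀
            r₂ : ∀ A q N c B → A * q * N + c * (N + B) + A * c ≡ (A * q + c) * N + (c * B + A * c)
            r₂ = solve-∀
          good-le : D ∸ E ≤ T * N
          good-le = m≤n+o⇒m∸n≤o D E (≤-trans (fromOut run) (≤-reflexive (+-comm (T * N) E)))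
        fin : ∃[ b ] D ∸ E ≤ T * b × (∀ N → D ∸ E ≤ T * N → b ≤ N) → 4 * D ≤ 3 * (T * φ) + 4 * E
        fin (lb , h , h') = ≤-trans (*-monoʳ-≤ 4 (≤-trans (m≤n+m∸n D E) (+-monoʳ-≤ E h))) (≤-trans (≤-reflexive (r₁ E T lb))
            (≤-trans (+-monoˡ-≤ (4 * E) (*-monoʳ-≤ T v4)) (≤-reflexive (r₂ E T φ))))
          where
          v4 : 4 * lb ≤ 3 * φ
          v4 = ≤-trans (V.voor4 dep-one (λ ()) lb (λ L₁ W R₁ g → ≤-trans (h' _ (OneGood.good-le g)) (≤-reflexive (toone L₁ (pl (W ∷ R₁))))))
            (≤-reflexive (cong (3 *_) (trans (sym (toone L (pl K))) ΦK)))
            where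
            toone : ∀ L G → Z L G (neg e) ≡ Z L G (λ σ → neg e σ * one σ)
            toone L G = sum-cong L (λ σ → cong (pr G σ *_) (sym (*-identityʳ (neg e σ)))) zeros
          r₁ : ∀ E T b → 4 * (E + T * b) ≡ T * (4 * b) + 4 * E
          r₁ = solve-∀
          r₂ : ∀ E T φ → T * (3 * φ) + 4 * E ≡ 3 * (T * φ) + 4 * E
          r₂ = solve-∀
        T1 : 1 ≤ T
        T1 = ≤-trans (*-mono-≤ {1} {A} {1} {q} A1 q1) (m≤m+n (A * q) c)

  Lin : ℕ → ℕ → ℕ → Set
  Lin p q β = ∀ {L G e} → Prime L G → 1 ≤ cnt e L → p * length G + 2 * q ≤ q * Φ L G e + β

  suc≤2^ : ∀ n → suc n ≤ 2 ^ n
  suc≤2^ zero = ≤-refl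
  suc≤2^ (suc n) = ≤-trans (+-mono-≤ (≤-trans (s≤s z≤n) (suc≤2^ n)) (suc≤2^ n)) (≤-reflexive (cong (2 ^ n +_) (sym (+-identityʳ _))))

  log16 : ∀ x → 1 ≤ x → ∃[ m ] x < 16 ^ m × 16 ^ m ≤ 16 * x
  log16 x h = go x (≤-trans (suc≤2^ x) (^-monoˡ-≤ x (s≤s (s≤s z≤n))))
    where
    go : ∀ m → x < 16 ^ m → ∃[ m ] x < 16 ^ m × 16 ^ m ≤ 16 * x
    go zero l = ⊥-elim (<⇒≱ l h)
    go (suc m) l with x <? 16 ^ m
    ... | yes l' = go m l'
    ... | no n = suc m , l , *-monoʳ-≤ 16 (≮⇒≥ n)

  fourth : ∀ m → suc m * suc m * (suc m * suc m) ≤ 16 ^ m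
  fourth m = ≤-trans (*-mono-≤ (*-mono-≤ (suc≤2^ m) (suc≤2^ m)) (*-mono-≤ (suc≤2^ m) (suc≤2^ m))) (≤-reflexive (sq m))
    where
    r : ∀ x → 2 * x * (2 * x) * (2 * x * (2 * x)) ≡ 16 * (x * x * (x * x))
    r = solve-∀
    sq : ∀ m → 2 ^ m * 2 ^ m * (2 ^ m * 2 ^ m) ≡ 16 ^ m
    sq zero = refl
    sq (suc m) = trans (r (2 ^ m)) (cong (16 *_) (sq m))

  abstract
    quartic : ℕ → ℕ
    quartic c = c * (c * c * c)

    cube-le : ∀ c X → c * (X * X * X) ≤ X * X * (X * X) + quartic c
    cube-le c X with ≤-total c X
    ... | inj₁ h = ≤-trans (≤-trans (*-monoˡ-≤ (X * X * X) h) (≤-reflexive (r X))) (m≤m+n _ _)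
      where
      r : ∀ X → X * (X * X * X) ≡ X * X * (X * X)
      r = solve-∀
    ... | inj₂ h = ≤-trans (*-monoʳ-≤ c (*-mono-≤ (*-mono-≤ h h) h)) (m≤n+m _ _)

    Qc : ℕ → ℕ → ℕ
    Qc c A = quartic (4 * (c * (8 * (8 * A * (8 * A) * (8 * A)))))

    quartic-le : ∀ c A X → 4 * (c * (8 * (8 * (A * X) * (8 * (A * X)) * (8 * (A * X))))) ≤ X * X * (X * X) + Qc c A
    quartic-le c A X = ≤-trans (≤-reflexive (r c A X 4 8)) (cube-le (4 * (c * (8 * (8 * A * (8 * A) * (8 * A))))) X)
      where
      r : ∀ c A X k l → k * (c * (l * (l * (A * X) * (l * (A * X)) * (l * (A * X))))) ≡ k * (c * (l * (l * A * (l * A) * (l * A)))) * (X * X * X)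
      r = solve-∀

  module Est (A p q β : ℕ) (A1 : 1 ≤ A) (q1 : 1 ≤ q) where
    c Q : ℕ
    c = β + 4 * p
    Q = Qc c A

    B-le : ∀ m → 4 * (c * Superlinear.B₀ A p q β m A1 q1) ≤ suc m * suc m * (suc m * suc m) + Q
    B-le m = ≤-trans (*-monoʳ-≤ 4 (*-monoʳ-≤ c (≤-trans (poly≤ (Superlinear.1≤K A p q β m A1 q1)) (*-monoʳ-≤ 8 (*-mono-≤ (*-mono-≤ K≤ K≤) K≤))))) (quartic-le c A (suc m))
      where
      poly≤ : ∀ {K} → 1 ≤ K → K * (3 * K) + (K * (3 * K) + K) * K + K ≤ 8 * (K * K * K)
      poly≤ {K} h = ≤-trans (≤-reflexive (r K)) (≤-trans (+-monoʳ-≤ (3 * (K * K * K)) (+-mono-≤ (*-monoʳ-≤ 4 K²) (≤-trans K¹ K²))) (≤-reflexive (r' (K * K * K))))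
        where
        K¹ : K ≤ K * K
        K¹ = ≤-trans (≤-reflexive (sym (*-identityʳ K))) (*-monoʳ-≤ K h)
        K² : K * K ≤ K * K * K
        K² = ≤-trans (≤-reflexive (sym (*-identityʳ (K * K)))) (*-monoʳ-≤ (K * K) h)
        r : ∀ K → K * (3 * K) + (K * (3 * K) + K) * K + K ≡ 3 * (K * K * K) + (4 * (K * K) + K)
        r = solve-∀
        r' : ∀ x → 3 * x + (4 * x + x) ≡ 8 * x
        r' = solve-∀
      K≤ : A * (suc (m * 4 + m * 4) + 3) ≤ 8 * (A * suc m)
      K≤ = ≤-trans (m≤m+n _ (A * 4)) (≤-reflexive (r A m))
        where
        r : ∀ A m → A * (suc (m * 4 + m * 4) + 3) + A * 4 ≡ 8 * (A * suc m)
        r = solve-∀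

    main : ∀ {L G e} → (∀ {L' Q f} → length Q < length G → Prime L' Q → 1 ≤ cnt f L' → p * length Q + 2 * q ≤ q * Φ L' Q f + β) →
      Prime L G → 1 ≤ cnt e L →
      ∃[ M ] length G ≡ 3 + M × 4 * (A * (p * M + 2 * q)) ≤ (3 * (A * q + c) + 16) * Φ L G e + (Q + 4 * (A * c))
    main {L} {G} {e} hyp P he = go (log16 φ (≤-trans (s≤s z≤n) (prime-φ4 P he)))
      where
      φ : ℕ
      φ = Φ L G e
      go : ∃[ m ] φ < 16 ^ m × 16 ^ m ≤ 16 * φ → ∃[ M ] length G ≡ 3 + M × 4 * (A * (p * M + 2 * q)) ≤ (3 * (A * q + c) + 16) * φ + (Q + 4 * (A * c))
      go (m , lo , hi) = fin (Superlinear.core A p q β m A1 q1 hyp P he lo)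
        where
        B₀ : ℕ
        B₀ = Superlinear.B₀ A p q β m A1 q1
        4B : 4 * (c * B₀) ≤ 16 * φ + Q
        4B = ≤-trans (B-le m) (+-monoˡ-≤ Q (≤-trans (fourth m) hi))
        fin : ∃[ M ] length G ≡ 3 + M × 4 * (A * (p * M + 2 * q)) ≤ 3 * ((A * q + c) * φ) + 4 * (c * B₀ + A * c) →
          ∃[ M ] length G ≡ 3 + M × 4 * (A * (p * M + 2 * q)) ≤ (3 * (A * q + c) + 16) * φ + (Q + 4 * (A * c))
        fin (M , l , h) = M , l , ≤-trans h (≤-trans (≤-reflexive (r₁ ((A * q + c) * φ) (c * B₀) (A * c)))
          (≤-trans (+-monoˡ-≤ (4 * (A * c)) (+-monoʳ-≤ (3 * ((A * q + c) * φ)) 4B)) (≤-reflexive (r₂ (A * q + c) φ Q (4 * (A * c))))))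
          where
          r₁ : ∀ x y z → 3 * x + 4 * (y + z) ≡ 3 * x + 4 * y + 4 * z
          r₁ = solve-∀
          r₂ : ∀ t φ Q z → 3 * (t * φ) + (16 * φ + Q) + z ≡ (3 * t + 16) * φ + (Q + z)
          r₂ = solve-∀

  lin-from : ∀ q → 1 ≤ q → Qc 4 1 + 56 ≤ q → Lin 1 q 0
  lin-from q q1 qQ {L} {G} P he = go (length G) ≤-refl P he
    where
    Q₀ : ℕ
    Q₀ = Qc 4 1
    fin : ∀ {φ n} → ∃[ M ] n ≡ 3 + M × 4 * (1 * (1 * M + 2 * q)) ≤ (3 * (1 * q + 4) + 16) * φ + (Q₀ + 16) → 1 ≤ φ → 1 * n + 2 * q ≤ q * φ + 0
    fin {φ} (M , refl , h) φ1 = *-cancelˡ-≤ 4 (≤-trans (≤-reflexive (r₁ M q))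
        (≤-trans (+-monoˡ-≤ 12 h) (≤-trans (≤-reflexive (r₂ q φ Q₀)) (≤-trans (+-monoʳ-≤ (3 * (q * φ) + 28 * φ) (≤-trans (≤-reflexive (sym (*-identityʳ (Q₀ + 28)))) (*-monoʳ-≤ (Q₀ + 28) φ1)))
          (≤-trans (≤-reflexive (r₃ q φ Q₀)) (≤-trans (+-monoʳ-≤ (3 * (q * φ)) (*-monoˡ-≤ φ qQ)) (≤-reflexive (r₄ (q * φ)))))))))
      where
      r₁ : ∀ M q → 4 * (1 * (3 + M) + 2 * q) ≡ 4 * (1 * (1 * M + 2 * q)) + 12
      r₁ = solve-∀
      r₂ : ∀ q φ Q → (3 * (1 * q + 4) + 16) * φ + (Q + 16) + 12 ≡ 3 * (q * φ) + 28 * φ + (Q + 28)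
      r₂ = solve-∀
      r₃ : ∀ q φ Q → 3 * (q * φ) + 28 * φ + (Q + 28) * φ ≡ 3 * (q * φ) + (Q + 56) * φ
      r₃ = solve-∀
      r₄ : ∀ x → 3 * x + x ≡ 4 * (x + 0)
      r₄ = solve-∀
    go : ∀ n {L G e} → length G ≤ n → Prime L G → 1 ≤ cnt e L → 1 * length G + 2 * q ≤ q * Φ L G e + 0
    go zero l P he = ⊥-elim (case ≤-trans (p6 P) l of λ ())
    go (suc n) {L} {G} {e} l P he = fin (Est.main 1 1 q 0 ≤-refl q1 (λ l' P' he' → go n (≤-pred (≤-trans l' l)) P' he') P he) (≤-trans (s≤s z≤n) (prime-φ4 P he))

  abstract
    q₀ : ℕ
    q₀ = suc (Qc 4 1 + 56)

    q₀-pos : 1 ≤ q₀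
    q₀-pos = s≤s z≤n

    lin-base : Lin 1 q₀ 0
    lin-base {L} {G} {e} = lin-from q₀ q₀-pos (n≤1+n _) {L} {G} {e}

  lin-step : ∀ {p q β} A → 1 ≤ A → 15 * (β + 4 * p) + 80 ≤ A → 1 ≤ q → Lin p q β → ∃[ β' ] Lin (5 * p) (4 * q) β'
  lin-step {p} {q} {β} A A1 Ac q1 hyp = β' , λ P he → fin (E.main (λ _ → hyp) P he)
    where
    module E = Est A p q β A1 q1
    open E using (c; Q)
    β' : ℕ
    β' = 5 * (Q + 4 * (A * c)) + 60 * (A * p)
    fin : ∀ {φ n} → ∃[ M ] n ≡ 3 + M × 4 * (A * (p * M + 2 * q)) ≤ (3 * (A * q + c) + 16) * φ + (Q + 4 * (A * c)) → 5 * p * n + 2 * (4 * q) ≤ 4 * q * φ + β'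
    fin {φ} (M , refl , h) = *-cancelˡ-≤ (4 * A) {{>-nonZero (*-mono-≤ {1} {4} {1} {A} (s≤s z≤n) A1)}} (≤-trans (≤-trans (m≤m+n _ (8 * (A * q))) (≤-reflexive (r₁ A p M q)))
        (≤-trans (+-monoˡ-≤ (60 * (A * p)) (*-monoʳ-≤ 5 h)) (≤-trans (≤-reflexive (r₂ A q c φ (Q + 4 * (A * c)) (60 * (A * p))))
        (≤-trans (+-monoˡ-≤ β' (+-monoʳ-≤ (15 * (A * q * φ)) (*-monoˡ-≤ φ (≤-trans Ac (≤-trans (≤-reflexive (sym (*-identityʳ A))) (*-monoʳ-≤ A q1))))))
        (≤-trans (+-monoʳ-≤ (15 * (A * q * φ) + A * q * φ) (≤-trans (≤-reflexive (sym (*-identityˡ β'))) (*-monoˡ-≤ β' (*-mono-≤ {1} {4} {1} {A} (s≤s z≤n) A1)))) (≤-reflexive (r₃ A q φ β')))))))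
      where
      r₁ : ∀ A p M q → 4 * A * (5 * p * (3 + M) + 2 * (4 * q)) + 8 * (A * q) ≡ 5 * (4 * (A * (p * M + 2 * q))) + 60 * (A * p)
      r₁ = solve-∀
      r₂ : ∀ A q c φ z y → 5 * ((3 * (A * q + c) + 16) * φ + z) + y ≡ 15 * (A * q * φ) + (15 * c + 80) * φ + (5 * z + y)
      r₂ = solve-∀
      r₃ : ∀ A q φ b → 15 * (A * q * φ) + A * q * φ + 4 * A * b ≡ 4 * A * (4 * q * φ + b)
      r₃ = solve-∀

  lin-step' : ∀ {p q β} → 1 ≤ q → Lin p q β → ∃[ β' ] Lin (5 * p) (4 * q) β'
  lin-step' {p} {q} {β} q1 l = go (15 * (β + 4 * p) + 80) refl
    where
    go : ∀ a → a ≡ 15 * (β + 4 * p) + 80 → ∃[ β' ] Lin (5 * p) (4 * q) β'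
    go a e = lin-step {p} {q} {β} (suc a) (s≤s z≤n) (≤-trans (≤-reflexive (sym e)) (n≤1+n a)) q1 l

  lin-iter : ∀ j → ∃[ p ] ∃[ q ] ∃[ β ] p ≡ 5 ^ j × q ≡ 4 ^ j * q₀ × Lin p q β
  lin-iter zero = 1 , q₀ , 0 , refl , sym (+-identityʳ q₀) , lin-base
  lin-iter (suc j) = go (lin-iter j)
    where
    go : ∃[ p ] ∃[ q ] ∃[ β ] p ≡ 5 ^ j × q ≡ 4 ^ j * q₀ × Lin p q β → ∃[ p ] ∃[ q ] ∃[ β ] p ≡ 5 ^ suc j × q ≡ 4 ^ suc j * q₀ × Lin p q β
    go (p , q , β , ep , eq , l) = out (lin-step' {p} {q} {β} (≤-trans (*-mono-≤ {1} {4 ^ j} {1} {q₀} (m^n>0 4 j) q₀-pos) (≤-reflexive (sym eq))) l)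
      where
      out : ∃[ β' ] Lin (5 * p) (4 * q) β' → ∃[ p ] ∃[ q ] ∃[ β ] p ≡ 5 ^ suc j × q ≡ 4 ^ suc j * q₀ × Lin p q β
      out (β' , l') = 5 * p , 4 * q , β' , cong (5 *_) ep , trans (cong (4 *_) eq) (sym (*-assoc 4 (4 ^ j) q₀)) , l'

  bernoulli : ∀ j → 4 ^ j * (4 + j) ≤ 4 * 5 ^ j
  bernoulli zero = ≤-refl
  bernoulli (suc j) = ≤-trans (≤-reflexive (r (4 ^ j) j)) (≤-trans (+-mono-≤ (*-monoʳ-≤ 4 (bernoulli j)) (*-monoʳ-≤ 4 (^-monoˡ-≤ j {4} {5} (n≤1+n 4)))) (≤-reflexive (r' (5 ^ j))))
    where
    r : ∀ x j → 4 * x * (4 + suc j) ≡ 4 * (x * (4 + j)) + 4 * x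
    r = solve-∀
    r' : ∀ y → 4 * (4 * y) + 4 * y ≡ 4 * (5 * y)
    r' = solve-∀

  prime-super : ∀ a → ∃[ β ] (∀ {L G e} → Prime L G → 1 ≤ cnt e L → a * length G ≤ Φ L G e + β)
  prime-super a = go (4 * (a * q₀)) refl (lin-iter (4 * (a * q₀)))
    where
    go : ∀ j → j ≡ 4 * (a * q₀) → ∃[ p ] ∃[ q ] ∃[ β ] p ≡ 5 ^ j × q ≡ 4 ^ j * q₀ × Lin p q β → ∃[ β ] (∀ {L G e} → Prime L G → 1 ≤ cnt e L → a * length G ≤ Φ L G e + β)
    go j ej (p , T , β , ep , eT , l) = β , λ {L} {G} {e} P he → fin {length G} {Φ L G e} (l P he)
      where
      T1 : 1 ≤ T
      T1 = ≤-trans (*-mono-≤ {1} {4 ^ j} {1} {q₀} (m^n>0 4 j) q₀-pos) (≤-reflexive (sym eT))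
      big : T * a ≤ p
      big = *-cancelˡ-≤ 4 (≤-trans (≤-trans (m≤m+n _ (4 * 4 ^ j)) (≤-reflexive (trans (cong (λ z → 4 * (z * a) + 4 * 4 ^ j) eT) (trans (r (4 ^ j) q₀ a) (cong (λ z → 4 ^ j * (4 + z)) (sym ej))))))
          (≤-trans (bernoulli j) (≤-reflexive (cong (4 *_) (sym ep)))))
        where
        r : ∀ x q a → 4 * (x * q * a) + 4 * x ≡ x * (4 + 4 * (a * q))
        r = solve-∀
      fin : ∀ {n φ} → p * n + 2 * T ≤ T * φ + β → a * n ≤ φ + β
      fin {n} {φ} h = *-cancelˡ-≤ T {{>-nonZero T1}} (≤-trans (≤-reflexive (sym (*-assoc T a n))) (≤-trans (*-monoˡ-≤ n big) (≤-trans (m≤m+n _ (2 * T)) (≤-trans h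
        (≤-trans (+-monoʳ-≤ (T * φ) (≤-trans (≤-reflexive (sym (+-identityʳ β))) (*-monoˡ-≤ β T1))) (≤-reflexive (sym (*-distribˡ-+ T φ β))))))))

  -- Repeated contraction of three vertices

  -- weights arising from n ordinary vertices by repeatedly contracting three vertices behind a 3-edge cut
  data Pure : ℕ → Wt → Set where
    leaf : Pure 1 (wt 1 1 1 0)
    perm : ∀ {n v u} → WPerm v u → Pure n v → Pure n u
    ptri : ∀ {l m n a b c} → Pure l a → Pure m b → Pure n c → Pure (l + (m + n)) (triW a b c)
    pdbl : ∀ {l m n a b c} → Pure l a → Pure m b → Pure n c → Pure (l + (m + n)) (dblW a b c)
    ptpl : ∀ {l m n a b c} → Pure l a → Pure m b → Pure n c → Pure (l + (m + n)) (tplW a b c)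

  prodW Ψw : Wt → ℕ
  prodW v = a₁ v * a₂ v * a₃ v
  Ψw v = prodW v * prodW v * suc (a₀ v)

  prodW-perm : ∀ {v u} → WPerm v u → prodW v ≡ prodW u
  prodW-perm w0 = refl
  prodW-perm (w12 {a} {b} {c} w) = trans (cong (_* c) (*-comm a b)) (prodW-perm w)
  prodW-perm (w23 {a} {b} {c} w) = trans (lem a b c) (prodW-perm w)
    where
    lem : ∀ a b c → a * b * c ≡ a * c * b
    lem = solve-∀

  a₀-perm : ∀ {v u} → WPerm v u → a₀ v ≡ a₀ u
  a₀-perm w0 = refl
  a₀-perm (w12 w) = a₀-perm w
  a₀-perm (w23 w) = a₀-perm w

  ge-perm : ∀ {v u k} → WPerm v u → AllGe k v → AllGe k u
  ge-perm w0 h = h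
  ge-perm (w12 w) (allge x y z) = ge-perm w (allge y x z)
  ge-perm (w23 w) (allge x y z) = ge-perm w (allge x z y)

  m1 : ∀ {x y} → 1 ≤ x → 1 ≤ y → 1 ≤ x * y
  m1 h k = *-mono-≤ h k

  prodW-pos : ∀ {v} → AllGe 1 v → 1 ≤ prodW v
  prodW-pos (allge x y z) = m1 (m1 x y) z

  ≤*ˡ : ∀ {x} y → 1 ≤ x → y ≤ x * y
  ≤*ˡ y h = ≤-trans (≤-reflexive (sym (*-identityˡ y))) (*-monoˡ-≤ y h)

  ≤*ʳ : ∀ x {y} → 1 ≤ y → x ≤ x * y
  ≤*ʳ x h = ≤-trans (≤-reflexive (sym (*-identityʳ x))) (*-monoʳ-≤ x h)

  tri-super : ∀ a b c → prodW a * prodW b * prodW c ≤ prodW (triW a b c)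
  tri-super (wt a b c d) (wt p q r s) (wt x y z u) = ≤-trans (≤-reflexive (ring a b c p q r x y z))
    (*-mono-≤ (*-mono-≤ (m≤m+n (a * (r * z)) _) (m≤m+n (c * (p * y)) _)) (m≤m+n (b * (q * x)) _))
    where
    ring : ∀ a b c p q r x y z → a * b * c * (p * q * r) * (x * y * z) ≡ a * (r * z) * (c * (p * y)) * (b * (q * x))
    ring = solve-∀

  -- only (q x + r y)² ≥ 2 q x r y is used
  dbl-super : ∀ a b c → AllGe 1 b → AllGe 1 c → 2 * (prodW a * prodW b * prodW c) ≤ prodW (dblW a b c)
  dbl-super (wt a b c d) (wt p q r s) (wt x y z u) _ _ = ≤-trans (≤-reflexive (r₁ a b c p q r x y z))
      (≤-trans (*-monoʳ-≤ (a * b * c) (*-mono-≤ (sq (q * x) (r * y)) (m≤m+n (p * z) (s * u)))) (≤-reflexive (r₂ a b c (q * x + r * y) (p * z + s * u))))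
    where
    sq : ∀ m n → 2 * (m * n) ≤ (m + n) * (m + n)
    sq m n = ≤-trans (m≤m+n _ (m * m + n * n)) (≤-reflexive (r₀ m n))
      where
      r₀ : ∀ m n → 2 * (m * n) + (m * m + n * n) ≡ (m + n) * (m + n)
      r₀ = solve-∀
    r₁ : ∀ a b c p q r x y z → 2 * (a * b * c * (p * q * r) * (x * y * z)) ≡ a * b * c * (2 * (q * x * (r * y)) * (p * z))
    r₁ = solve-∀
    r₂ : ∀ a b c X Y → a * b * c * (X * X * Y) ≡ a * X * (b * X) * (c * Y)
    r₂ = solve-∀

  tpl-super : ∀ a b c → AllGe 1 b → AllGe 1 c → 2 * (prodW a * prodW b * prodW c) ≤ prodW (tplW a b c)
  tpl-super (wt a b c d) (wt p q r s) (wt x y z u) _ _ = ≤-trans (≤-reflexive (r₁ a b c p q r x y z))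
      (≤-trans (*-monoʳ-≤ (a * b * c) (cube (p * x) (q * y) (r * z) (s * u))) (≤-reflexive (r₂ a b c (p * x + q * y + r * z + s * u))))
    where
    cube : ∀ l m n k → 2 * (l * m * n) ≤ (l + m + n + k) * (l + m + n + k) * (l + m + n + k)
    cube l m n k = ≤-trans (≤-trans (≤-reflexive (r₀ l m n)) (≤-trans (m≤m+n _ (l * l * n + m * m * n)) (≤-reflexive (r' l m n))))
        (*-mono-≤ (*-mono-≤ (≤-trans (m≤m+n (l + m) n) (m≤m+n _ k)) (≤-trans (m≤m+n (l + m) n) (m≤m+n _ k))) (≤-trans (m≤n+m n (l + m)) (m≤m+n _ k)))
      where
      r₀ : ∀ l m n → 2 * (l * m * n) ≡ 2 * l * m * n
      r₀ = solve-∀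
      r' : ∀ l m n → 2 * l * m * n + (l * l * n + m * m * n) ≡ (l + m) * (l + m) * n
      r' = solve-∀
    r₁ : ∀ a b c p q r x y z → 2 * (a * b * c * (p * q * r) * (x * y * z)) ≡ a * b * c * (2 * (p * x * (q * y) * (r * z)))
    r₁ = solve-∀
    r₂ : ∀ a b c T → a * b * c * (T * T * T) ≡ a * T * (b * T) * (c * T)
    r₂ = solve-∀

  rail-double : ∀ x s → 2 * (x * x * suc s) ≤ (x + s) * (x + s) * suc x
  rail-double x s with ≤-total s x
  ... | inj₁ le with m≤n⇒∃[o]m+o≡n le
  ...   | k , refl = ≤-cancel {k * k} {k * k * k} (2 * (s * s * s) + 4 * (s * s * k) + 2 * (s * s) + 3 * (s * k * k)) (sq k) (ring s k)
    where
    sq : ∀ k → k * k ≤ k * k * k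
    sq zero = z≤n
    sq (suc k) = ≤*ʳ (suc k * suc k) (s≤s z≤n)
    ring : ∀ s k → 2 * ((s + k) * (s + k) * suc s) + k * k * k + (2 * (s * s * s) + 4 * (s * s * k) + 2 * (s * s) + 3 * (s * k * k))
      ≡ (s + k + s) * (s + k + s) * suc (s + k) + k * k
    ring = solve-∀
  rail-double x s | inj₂ le with m≤n⇒∃[o]m+o≡n le
  ... | k , refl = ≤-trans (m≤m+n _ (2 * (x * x * x) + 2 * (x * x) + 2 * (x * x * k) + 4 * (x * k) + k * k * x + k * k)) (≤-reflexive (ring x k))
    where
    ring : ∀ x k → 2 * (x * x * suc (x + k)) + (2 * (x * x * x) + 2 * (x * x) + 2 * (x * x * k) + 4 * (x * k) + k * k * x + k * k)
      ≡ (x + (x + k)) * (x + (x + k)) * suc x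
    ring = solve-∀

  Ψ-rail : ∀ {x y z s P Q R W} → x + s ≤ P → y ≤ Q → z ≤ R → x ≤ W → 2 * (x * y * z * (x * y * z) * suc s) ≤ P * Q * R * (P * Q * R) * suc W
  Ψ-rail {x} {y} {z} {s} {P} {Q} {R} {W} h i j k = ≤-trans (≤-reflexive (r₁ x y z (suc s))) (≤-trans (*-monoʳ-≤ (y * z * (y * z)) (rail-double x s))
      (≤-trans (≤-reflexive (r₂ (x + s) y z (suc x))) (*-mono-≤ (*-mono-≤ pq pq) (s≤s k))))
    where
    pq : (x + s) * y * z ≤ P * Q * R
    pq = *-mono-≤ (*-mono-≤ h i) j
    r₁ : ∀ x y z s → 2 * (x * y * z * (x * y * z) * s) ≡ y * z * (y * z) * (2 * (x * x * s))
    r₁ = solve-∀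
    r₂ : ∀ u y z w → y * z * (y * z) * (u * u * w) ≡ u * y * z * (u * y * z) * w
    r₂ = solve-∀

  module TriStep {a b c} (A : AllGe 1 a) (B : AllGe 1 b) (C : AllGe 1 c) where
    private
      kx : ∀ x {y z} → 1 ≤ y → 1 ≤ z → x ≤ x * (y * z)
      kx x h k = ≤*ʳ x (m1 h k)
      ky : ∀ {x} y {z} → 1 ≤ x → 1 ≤ z → y ≤ x * (y * z)
      ky y h k = ≤-trans (≤*ʳ y k) (≤*ˡ _ h)
      kz : ∀ {x y} z → 1 ≤ x → 1 ≤ y → z ≤ x * (y * z)
      kz z h k = ≤-trans (≤*ˡ z k) (≤*ˡ _ h)
    U₁a : a₁ a + a₀ a ≤ a₁ (triW a b c)
    U₁a = +-mono-≤ (kx (a₁ a) (g₃ B) (g₃ C)) (kx (a₀ a) (g₂ B) (g₂ C))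
    U₂b : a₁ b + a₀ b ≤ a₂ (triW a b c)
    U₂b = +-mono-≤ (ky (a₁ b) (g₃ A) (g₂ C)) (ky (a₀ b) (g₂ A) (g₃ C))
    U₃c : a₁ c + a₀ c ≤ a₃ (triW a b c)
    U₃c = +-mono-≤ (kz (a₁ c) (g₂ A) (g₂ B)) (kz (a₀ c) (g₃ A) (g₃ B))
    Ψa : 2 * Ψw a ≤ Ψw (triW a b c)
    Ψa = ≤-trans (≤-reflexive (cong (2 *_) (r (a₁ a) (a₂ a) (a₃ a) (suc (a₀ a))))) (Ψ-rail U₁a (≤-trans (kx (a₃ a) (g₁ B) (g₂ C)) (m≤m+n _ _)) (≤-trans (kx (a₂ a) (g₂ B) (g₁ C)) (m≤m+n _ _)) (≤-trans (kx (a₁ a) (g₁ B) (g₁ C)) (m≤m+n _ _)))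
      where
      r : ∀ x y z s → x * y * z * (x * y * z) * s ≡ x * z * y * (x * z * y) * s
      r = solve-∀
    Ψb : 2 * Ψw b ≤ Ψw (triW a b c)
    Ψb = ≤-trans (≤-reflexive (cong (2 *_) (r (a₁ b) (a₂ b) (a₃ b) (suc (a₀ b))))) (≤-trans (Ψ-rail {x = a₁ b} {a₃ b} {a₂ b} U₂b (≤-trans (ky (a₃ b) (g₁ A) (g₃ C)) (m≤m+n _ _)) (≤-trans (ky (a₂ b) (g₂ A) (g₁ C)) (m≤m+n _ _)) (≤-trans (ky (a₁ b) (g₁ A) (g₁ C)) (m≤m+n _ _)))
        (≤-reflexive (r' (a₁ (triW a b c)) (a₂ (triW a b c)) (a₃ (triW a b c)) (suc (a₀ (triW a b c))))))
      where
      r : ∀ x y z s → x * y * z * (x * y * z) * s ≡ x * z * y * (x * z * y) * s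
      r = solve-∀
      r' : ∀ x y z s → y * x * z * (y * x * z) * s ≡ x * y * z * (x * y * z) * s
      r' = solve-∀
    Ψc : 2 * Ψw c ≤ Ψw (triW a b c)
    Ψc = ≤-trans (≤-reflexive (cong (2 *_) (r (a₁ c) (a₂ c) (a₃ c) (suc (a₀ c))))) (≤-trans (Ψ-rail {x = a₁ c} {a₃ c} {a₂ c} U₃c (≤-trans (kz (a₃ c) (g₁ A) (g₃ B)) (m≤m+n _ _)) (≤-trans (kz (a₂ c) (g₃ A) (g₁ B)) (m≤m+n _ _)) (≤-trans (kz (a₁ c) (g₁ A) (g₁ B)) (m≤m+n _ _)))
        (≤-reflexive (r' (a₁ (triW a b c)) (a₂ (triW a b c)) (a₃ (triW a b c)) (suc (a₀ (triW a b c))))))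
      where
      r : ∀ x y z s → x * y * z * (x * y * z) * s ≡ x * z * y * (x * z * y) * s
      r = solve-∀
      r' : ∀ x y z s → z * x * y * (z * x * y) * s ≡ x * y * z * (x * y * z) * s
      r' = solve-∀
    tri-ge : AllGe 1 (triW a b c)
    tri-ge = allge (≤-trans (g₁ A) (≤-trans (m≤m+n _ _) U₁a)) (≤-trans (g₁ B) (≤-trans (m≤m+n _ _) U₂b)) (≤-trans (g₁ C) (≤-trans (m≤m+n _ _) U₃c))
    tri-star : 1 ≤ a₀ (triW a b c)
    tri-star = ≤-trans (g₁ A) (≤-trans (kx (a₁ a) (g₁ B) (g₁ C)) (m≤m+n _ _))
    private
      2≤ : ∀ {x y z} → 2 ≤ x → 1 ≤ y → 1 ≤ z → 2 ≤ x * y * z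
      2≤ h k l = *-mono-≤ (*-mono-≤ h k) l
    big-a : 1 ≤ a₀ a → 2 ≤ prodW (triW a b c)
    big-a h = 2≤ (≤-trans (+-mono-≤ (g₁ A) h) U₁a) (g₂ tri-ge) (g₃ tri-ge)
    big-b : 1 ≤ a₀ b → 2 ≤ prodW (triW a b c)
    big-b h = ≤-trans (2≤ (≤-trans (+-mono-≤ (g₁ B) h) U₂b) (g₁ tri-ge) (g₃ tri-ge)) (≤-reflexive (cong (_* a₃ (triW a b c)) (*-comm (a₂ (triW a b c)) (a₁ (triW a b c)))))
    big-c : 1 ≤ a₀ c → 2 ≤ prodW (triW a b c)
    big-c h = ≤-trans (*-mono-≤ (*-mono-≤ (g₁ tri-ge) (g₂ tri-ge)) (≤-trans (+-mono-≤ (g₁ C) h) U₃c)) ≤-refl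

  tri-a₀ : ∀ a b c → AllGe 1 a → AllGe 1 b → AllGe 1 c → a₀ (triW a b c) ≤ prodW (triW a b c)
  tri-a₀ (wt a b c d) (wt p q r s) (wt x y z u) (allge A₁ A₂ A₃) (allge B₁ B₂ B₃) (allge C₁ C₂ C₃) =
    ≤-trans (+-mono-≤ (≤-trans (≤*ʳ (a * (p * x)) (m1 (m1 (m1 A₂ A₃) (m1 B₂ B₃)) (m1 C₂ C₃))) (≤-reflexive (r₁ a b c p q r x y z)))
                      (≤-trans (≤*ʳ (d * (s * u)) (m1 (m1 (m1 A₂ A₃) (m1 B₂ B₃)) (m1 C₂ C₃))) (≤-reflexive (r₂ d b c s q r u y z))))
      (two (a * (r * z)) (d * (q * y)) (c * (p * y)) (b * (s * z)) (b * (q * x)) (c * (r * u)))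
    where
    r₁ : ∀ a b c p q r x y z → a * (p * x) * (b * c * (q * r) * (y * z)) ≡ a * (r * z) * (c * (p * y)) * (b * (q * x))
    r₁ = solve-∀
    r₂ : ∀ d b c s q r u y z → d * (s * u) * (b * c * (q * r) * (y * z)) ≡ d * (q * y) * (b * (s * z)) * (c * (r * u))
    r₂ = solve-∀
    two : ∀ a b c d e f → a * c * e + b * d * f ≤ (a + b) * (c + d) * (e + f)
    two a b c d e f = ≤-trans (m≤m+n _ (a * c * f + (a * d + b * c) * (e + f) + b * d * e)) (≤-reflexive (r₀ a b c d e f))
      where
      r₀ : ∀ a b c d e f → a * c * e + b * d * f + (a * c * f + (a * d + b * c) * (e + f) + b * d * e) ≡ (a + b) * (c + d) * (e + f)
      r₀ = solve-∀

  pure-inv : ∀ {n v} → Pure n v → AllGe 1 v × a₀ v ≤ prodW v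
  pure-inv leaf = allge ≤-refl ≤-refl ≤-refl , z≤n
  pure-inv (perm w p) with pure-inv p
  ... | g , h = ge-perm w g , ≤-trans (≤-reflexive (sym (a₀-perm w))) (≤-trans h (≤-reflexive (prodW-perm w)))
  pure-inv (ptri {a = a} {b} {c} p q r) with pure-inv p | pure-inv q | pure-inv r
  ... | A , _ | B , _ | C , _ = TriStep.tri-ge {a} {b} {c} A B C , tri-a₀ a b c A B C
  pure-inv (pdbl {a = wt a b c d} {wt p q r s} {wt x y z u} P Q R) with pure-inv P | pure-inv Q | pure-inv R
  ... | allge A₁ A₂ A₃ , h | allge B₁ B₂ B₃ , _ | allge C₁ C₂ C₃ , _ = allge (m1 A₁ X1) (m1 A₂ X1) (m1 A₃ Y1) ,
      ≤-trans (*-monoˡ-≤ (p * z + s * u) h) (≤-trans (≤*ʳ _ (m1 X1 X1)) (≤-reflexive (ring a b c (q * x + r * y) (p * z + s * u))))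
    where
    X1 : 1 ≤ q * x + r * y
    X1 = ≤-trans (m1 B₂ C₁) (m≤m+n _ _)
    Y1 : 1 ≤ p * z + s * u
    Y1 = ≤-trans (m1 B₁ C₃) (m≤m+n _ _)
    ring : ∀ a b c X Y → a * b * c * Y * (X * X) ≡ a * X * (b * X) * (c * Y)
    ring = solve-∀
  pure-inv (ptpl {a = wt a b c d} {wt p q r s} {wt x y z u} P Q R) with pure-inv P | pure-inv Q | pure-inv R
  ... | allge A₁ A₂ A₃ , h | allge B₁ B₂ B₃ , _ | allge C₁ C₂ C₃ , _ = allge (m1 A₁ X1) (m1 A₂ X1) (m1 A₃ X1) ,
      ≤-trans (*-monoˡ-≤ (p * x + q * y + r * z + s * u) h) (≤-trans (≤*ʳ _ (m1 X1 X1)) (≤-reflexive (ring a b c (p * x + q * y + r * z + s * u))))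
    where
    X1 : 1 ≤ p * x + q * y + r * z + s * u
    X1 = ≤-trans (m1 B₁ C₁) (≤-trans (m≤m+n (p * x) (q * y)) (≤-trans (m≤m+n _ (r * z)) (m≤m+n _ (s * u))))
    ring : ∀ a b c X → a * b * c * X * (X * X) ≡ a * X * (b * X) * (c * X)
    ring = solve-∀

  -- n is bounded through ℓ ≤ log Π and d ≤ log Ψ: a step with one large child doubles Ψ, every other step is paid for by Π
  data Cls (E n : ℕ) (v : Wt) : Set where
    zer1 : n ≡ 1 → Cls E n v
    zer3 : n ≤ 3 → 1 ≤ a₀ v → Cls E n v
    pos  : ∀ ℓ d → 1 ≤ ℓ → 2 ^ ℓ ≤ prodW v → 2 ^ d ≤ Ψw v → n + 18 * E ≤ 27 * E * ℓ + 9 * suc d → Cls E n v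

  module Classify (E : ℕ) (E1 : 1 ≤ E) where
    Small³ : Wt → Set
    Small³ v = 2 * (prodW v * prodW v * prodW v) < 2 ^ E

    d<E : ∀ {v d} → AllGe 1 v → a₀ v ≤ prodW v → Small³ v → 2 ^ d ≤ Ψw v → d < E
    d<E {v} {d} A h s p = ≰⇒> λ le → <⇒≱ s (≤-trans (^-monoʳ-≤ 2 le) (≤-trans p (≤-trans (*-monoʳ-≤ (prodW v * prodW v) (+-mono-≤ (prodW-pos A) h)) (≤-reflexive (r (prodW v))))))
      where
      r : ∀ x → x * x * (x + x) ≡ 2 * (x * x * x)
      r = solve-∀

    small-mono : ∀ {v u} → prodW u ≤ prodW v → Small³ v → Small³ u
    small-mono h s = ≤-trans (s≤s (*-monoʳ-≤ 2 (*-mono-≤ (*-mono-≤ h h) h))) s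

    record Sum (n : ℕ) (v : Wt) : Set where
      constructor summ
      field
        ℓ : ℕ
        sℓ : 2 ^ ℓ ≤ prodW v
        sn : n ≤ 27 * E * ℓ + 3

    Few Many : ℕ → Wt → Set
    Few n v = n ≤ 3 × (n ≡ 1 ⊎ 1 ≤ a₀ v)
    Many n v = ∃[ ℓ ] ∃[ d ] 1 ≤ ℓ × 2 ^ ℓ ≤ prodW v × 2 ^ d ≤ Ψw v × n + 18 * E ≤ 27 * E * ℓ + 9 * suc d × n + 9 * E ≤ 27 * E * ℓ

    sort : ∀ {n v} → AllGe 1 v → a₀ v ≤ prodW v → Small³ v → Cls E n v → Few n v ⊎ Many n v
    sort A h s (zer1 refl) = inj₁ (s≤s z≤n , inj₁ refl)
    sort A h s (zer3 e g) = inj₁ (e , inj₂ g)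
    sort {n} {v} A h s (pos ℓ d l p q b) = inj₂ (ℓ , d , l , p , q , b , +-cancelʳ-≤ (9 * E) _ _ (≤-trans (≤-reflexive (r n E)) (≤-trans b (+-monoʳ-≤ (27 * E * ℓ) (*-monoʳ-≤ 9 (d<E {v} A h s q))))))
      where
      r : ∀ n E → n + 9 * E + 9 * E ≡ n + 18 * E
      r = solve-∀

    toSum : ∀ {n v} → AllGe 1 v → Few n v ⊎ Many n v → Sum n v
    toSum A (inj₁ (e , _)) = summ 0 (prodW-pos A) (≤-trans e (m≤n+m 3 _))
    toSum A (inj₂ (ℓ , d , l , p , q , b , c)) = summ ℓ p (≤-trans (≤-trans (m≤m+n _ (9 * E)) c) (m≤m+n _ 3))

    pow3 : ∀ {i j k x y z} → 2 ^ i ≤ x → 2 ^ j ≤ y → 2 ^ k ≤ z → 2 ^ (i + j + k) ≤ x * y * z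
    pow3 {i} {j} {k} p q r = ≤-trans (≤-reflexive (trans (^-distribˡ-+-* 2 (i + j) k) (cong (_* 2 ^ k) (^-distribˡ-+-* 2 i j)))) (*-mono-≤ (*-mono-≤ p q) r)

    Ψ1 : ∀ {v} → AllGe 1 v → 2 ^ 0 ≤ Ψw v
    Ψ1 A = m1 (m1 (prodW-pos A) (prodW-pos A)) (s≤s z≤n)

    doubling : ∀ {l m n a b c v} → Sum l a → Sum m b → Sum n c → AllGe 1 v → 2 * (prodW a * prodW b * prodW c) ≤ prodW v → Cls E (l + (m + n)) v
    doubling {l} {m} {n} (summ i p x) (summ j q y) (summ k r z) V h = pos (suc (i + j + k)) 0 (s≤s z≤n) (≤-trans (*-monoʳ-≤ 2 (pow3 {i} {j} {k} p q r)) h) (Ψ1 V)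
        (≤-trans (+-monoˡ-≤ (18 * E) (+-mono-≤ x (+-mono-≤ y z))) (≤-trans (m≤m+n _ (9 * E)) (≤-reflexive (ring E i j k))))
      where
      ring : ∀ E i j k → 27 * E * i + 3 + (27 * E * j + 3 + (27 * E * k + 3)) + 18 * E + 9 * E ≡ 27 * E * suc (i + j + k) + 9 * 1
      ring = solve-∀

    module TriCls {l m n : ℕ} {a b c : Wt} (A : AllGe 1 a) (B : AllGe 1 b) (C : AllGe 1 c) where
      open TriStep {a} {b} {c} A B C
      v : Wt
      v = triW a b c
      N : ℕ
      N = l + (m + n)
      P3 : ∀ {i j k} → 2 ^ i ≤ prodW a → 2 ^ j ≤ prodW b → 2 ^ k ≤ prodW c → 2 ^ (i + j + k) ≤ prodW v
      P3 {i} {j} {k} p q r = ≤-trans (pow3 {i} {j} {k} p q r) (tri-super a b c)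
      base : 2 ≤ prodW v → N ≤ 9 → Cls E N v
      base h k = pos 1 0 ≤-refl h (Ψ1 tri-ge) (≤-trans (+-monoˡ-≤ (18 * E) k) (≤-trans (m≤m+n _ (9 * E)) (≤-reflexive (r E))))
        where
        r : ∀ E → 9 + 18 * E + 9 * E ≡ 27 * E * 1 + 9 * 1
        r = solve-∀
      many : ∀ {i j k} → 1 ≤ i + j + k → 2 ^ i ≤ prodW a → 2 ^ j ≤ prodW b → 2 ^ k ≤ prodW c → N + 18 * E ≤ 27 * E * (i + j + k) + 9 → Cls E N v
      many {i} {j} {k} h p q r e = pos (i + j + k) 0 h (P3 {i} {j} {k} p q r) (Ψ1 tri-ge) e
      single : ∀ {ℓ d x w} → 1 ≤ ℓ → 2 ^ ℓ ≤ prodW v → 2 ^ d ≤ Ψw w → 2 * Ψw w ≤ Ψw v → x + 18 * E ≤ 27 * E * ℓ + 9 * suc d → N ≤ x + 6 → Cls E N v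
      single {ℓ} {d} {x} h p q t e g = pos ℓ (suc d) h p (≤-trans (*-monoʳ-≤ 2 q) t) (≤-trans (+-monoˡ-≤ (18 * E) g) (≤-trans (≤-reflexive (r₁ x E))
          (≤-trans (+-monoˡ-≤ 6 e) (≤-trans (m≤m+n _ 3) (≤-reflexive (r₂ (27 * E * ℓ) d))))))
        where
        r₁ : ∀ x E → x + 6 + 18 * E ≡ x + 18 * E + 6
        r₁ = solve-∀
        r₂ : ∀ y d → y + 9 * suc d + 6 + 3 ≡ y + 9 * suc (suc d)
        r₂ = solve-∀
      up : ∀ {x y z u w t} → x + 9 * E ≤ u → y + 9 * E ≤ w → z ≤ t + 3 → x + y + z + 18 * E ≤ u + w + t + 9
      up {x} {y} {z} {u} {w} {t} p q r = ≤-trans (≤-reflexive (r₁ x y z E)) (≤-trans (+-mono-≤ (+-mono-≤ p q) r) (≤-trans (m≤m+n _ 6) (≤-reflexive (r₂ u w t))))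
        where
        r₁ : ∀ x y z E → x + y + z + 18 * E ≡ x + 9 * E + (y + 9 * E) + z
        r₁ = solve-∀
        r₂ : ∀ u w t → u + w + (t + 3) + 6 ≡ u + w + t + 9
        r₂ = solve-∀
      private
        L : ℕ → ℕ
        L i = 27 * E * i
        eL : ∀ i j k → L i + L j + L k ≡ L (i + j + k)
        eL i j k = r (27 * E) i j k
          where
          r : ∀ e i j k → e * i + e * j + e * k ≡ e * (i + j + k)
          r = solve-∀
        pa : prodW a ≤ prodW v
        pa = ≤-trans (≤-trans (≤*ʳ _ (prodW-pos B)) (≤*ʳ _ (prodW-pos C))) (tri-super a b c)
        pb : prodW b ≤ prodW v
        pb = ≤-trans (≤-trans (≤*ˡ _ (prodW-pos A)) (≤*ʳ _ (prodW-pos C))) (tri-super a b c)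
        pc : prodW c ≤ prodW v
        pc = ≤-trans (≤*ˡ _ (m1 (prodW-pos A) (prodW-pos B))) (tri-super a b c)

      ab : Many l a → Many m b → Sum n c → Cls E N v
      ab (i , _ , i1 , p , _ , _ , e) (j , _ , _ , q , _ , _ , f) (summ k r g) = many {i} {j} {k} (≤-trans i1 (≤-trans (m≤m+n i j) (m≤m+n _ k))) p q r
        (≤-trans (≤-reflexive (cong (_+ 18 * E) (sym (+-assoc l m n)))) (≤-trans (up {l} {m} {n} e f g) (≤-reflexive (cong (_+ 9) (eL i j k)))))
      ac : Many l a → Sum m b → Many n c → Cls E N v
      ac (i , _ , i1 , p , _ , _ , e) (summ j q g) (k , _ , _ , r , _ , _ , f) = many {i} {j} {k} (≤-trans i1 (≤-trans (m≤m+n i j) (m≤m+n _ k))) p q r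
        (≤-trans (≤-reflexive (cong (_+ 18 * E) (r₁ l m n))) (≤-trans (up {l} {n} {m} e f g) (≤-reflexive (cong (_+ 9) (trans (r₂ (L i) (L j) (L k)) (eL i j k))))))
        where
        r₁ : ∀ l m n → l + (m + n) ≡ l + n + m
        r₁ = solve-∀
        r₂ : ∀ i j k → i + k + j ≡ i + j + k
        r₂ = solve-∀
      bc : Sum l a → Many m b → Many n c → Cls E N v
      bc (summ i p g) (j , _ , j1 , q , _ , _ , e) (k , _ , _ , r , _ , _ , f) = many {i} {j} {k} (≤-trans j1 (≤-trans (m≤n+m j i) (m≤m+n _ k))) p q r
        (≤-trans (≤-reflexive (cong (_+ 18 * E) (r₁ l m n))) (≤-trans (up {m} {n} {l} e f g) (≤-reflexive (cong (_+ 9) (trans (r₂ (L i) (L j) (L k)) (eL i j k))))))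
        where
        r₁ : ∀ l m n → l + (m + n) ≡ m + n + l
        r₁ = solve-∀
        r₂ : ∀ i j k → j + k + i ≡ i + j + k
        r₂ = solve-∀

      few : Few l a → Few m b → Few n c → Cls E N v
      few (x , _) (y , _) (z , inj₂ h) = base (big-c h) (+-mono-≤ x (+-mono-≤ y z))
      few (x , _) (y , inj₂ h) (z , _) = base (big-b h) (+-mono-≤ x (+-mono-≤ y z))
      few (x , inj₂ h) (y , _) (z , _) = base (big-a h) (+-mono-≤ x (+-mono-≤ y z))
      few (x , inj₁ refl) (y , inj₁ refl) (z , inj₁ refl) = zer3 ≤-refl tri-star

      tri-cls : Few l a ⊎ Many l a → Few m b ⊎ Many m b → Few n c ⊎ Many n c → Cls E N v
      tri-cls (inj₁ x) (inj₁ y) (inj₁ z) = few x y z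
      tri-cls (inj₂ x) (inj₂ y) z = ab x y (toSum C z)
      tri-cls (inj₂ x) (inj₁ y) (inj₂ z) = ac x (toSum B (inj₁ y)) z
      tri-cls (inj₁ x) (inj₂ y) (inj₂ z) = bc (toSum A (inj₁ x)) y z
      tri-cls (inj₂ (ℓ , d , h , p , q , e , _)) (inj₁ (y , _)) (inj₁ (z , _)) = single {w = a} h (≤-trans p pa) q Ψa e (+-monoʳ-≤ l (+-mono-≤ y z))
      tri-cls (inj₁ (x , _)) (inj₂ (ℓ , d , h , p , q , e , _)) (inj₁ (z , _)) = single {w = b} h (≤-trans p pb) q Ψb e
        (≤-trans (+-mono-≤ x (+-monoʳ-≤ m z)) (≤-reflexive (r m)))
        where
        r : ∀ m → 3 + (m + 3) ≡ m + 6
        r = solve-∀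
      tri-cls (inj₁ (x , _)) (inj₁ (y , _)) (inj₂ (ℓ , d , h , p , q , e , _)) = single {w = c} h (≤-trans p pc) q Ψc e
        (≤-trans (+-mono-≤ x (+-monoˡ-≤ n y)) (≤-reflexive (r n)))
        where
        r : ∀ n → 3 + (3 + n) ≡ n + 6
        r = solve-∀

    prods : ∀ {a b c v} → AllGe 1 a → AllGe 1 b → AllGe 1 c → prodW a * prodW b * prodW c ≤ prodW v → prodW a ≤ prodW v × prodW b ≤ prodW v × prodW c ≤ prodW v
    prods A B C h = ≤-trans (≤-trans (≤*ʳ _ (prodW-pos B)) (≤*ʳ _ (prodW-pos C))) h , ≤-trans (≤-trans (≤*ˡ _ (prodW-pos A)) (≤*ʳ _ (prodW-pos C))) h ,
      ≤-trans (≤*ˡ _ (m1 (prodW-pos A) (prodW-pos B))) h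

    cls-perm : ∀ {n v u} → WPerm v u → Cls E n v → Cls E n u
    cls-perm w (zer1 e) = zer1 e
    cls-perm w (zer3 e g) = zer3 e (≤-trans g (≤-reflexive (a₀-perm w)))
    cls-perm {v = v} {u} w (pos ℓ d h p q e) = pos ℓ d h (≤-trans p (≤-reflexive (prodW-perm w))) (≤-trans q (≤-reflexive (cong₂ (λ x y → x * x * suc y) (prodW-perm w) (a₀-perm w)))) e

    classify : ∀ {n v} → Pure n v → Small³ v → Cls E n v
    sorted : ∀ {n v} → Pure n v → Small³ v → Few n v ⊎ Many n v
    classify leaf s = zer1 refl
    classify (perm {v = v} {u} w p) s = cls-perm w (classify p (small-mono {u} {v} (≤-reflexive (prodW-perm w)) s))
    classify (ptri {a = a} {b} {c} p q r) s = TriCls.tri-cls A B C (sorted p (small-mono {v} {a} (proj₁ ps) s)) (sorted q (small-mono {v} {b} (proj₁ (proj₂ ps)) s)) (sorted r (small-mono {v} {c} (proj₂ (proj₂ ps)) s))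
      where
      A = proj₁ (pure-inv p)
      B = proj₁ (pure-inv q)
      C = proj₁ (pure-inv r)
      v = triW a b c
      ps = prods {a} {b} {c} {v} A B C (tri-super a b c)
    classify P@(pdbl {a = a} {b} {c} p q r) s = doubling (toSum A (sorted p (small-mono {v} {a} (proj₁ ps) s))) (toSum B (sorted q (small-mono {v} {b} (proj₁ (proj₂ ps)) s))) (toSum C (sorted r (small-mono {v} {c} (proj₂ (proj₂ ps)) s)))
        (proj₁ (pure-inv P)) (dbl-super a b c B C)
      where
      A = proj₁ (pure-inv p)
      B = proj₁ (pure-inv q)
      C = proj₁ (pure-inv r)
      v = dblW a b c
      ps = prods {a} {b} {c} {v} A B C (≤-trans (≤*ˡ {2} _ (s≤s z≤n)) (dbl-super a b c B C))
    classify P@(ptpl {a = a} {b} {c} p q r) s = doubling (toSum A (sorted p (small-mono {v} {a} (proj₁ ps) s))) (toSum B (sorted q (small-mono {v} {b} (proj₁ (proj₂ ps)) s))) (toSum C (sorted r (small-mono {v} {c} (proj₂ (proj₂ ps)) s)))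
        (proj₁ (pure-inv P)) (tpl-super a b c B C)
      where
      A = proj₁ (pure-inv p)
      B = proj₁ (pure-inv q)
      C = proj₁ (pure-inv r)
      v = tplW a b c
      ps = prods {a} {b} {c} {v} A B C (≤-trans (≤*ˡ {2} _ (s≤s z≤n)) (tpl-super a b c B C))
    sorted {v = v} p s = sort (proj₁ (pure-inv p)) (proj₂ (pure-inv p)) s (classify p s)

    count : ∀ {n v} → Pure n v → Small³ v → n ≤ 3 ⊎ (∃[ ℓ ] 2 ^ ℓ ≤ prodW v × n ≤ 27 * E * ℓ)
    count p s with sorted p s
    ... | inj₁ (h , _) = inj₁ h
    ... | inj₂ (ℓ , _ , _ , q , _ , _ , h) = inj₂ (ℓ , q , ≤-trans (m≤m+n _ (9 * E)) h)

  sum-prod : ∀ v → prodW v ≤ sum₃ v * sum₃ v * sum₃ v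
  sum-prod v = *-mono-≤ (*-mono-≤ (≤-trans (m≤m+n (a₁ v) (a₂ v)) (m≤m+n _ (a₃ v))) (≤-trans (m≤n+m (a₂ v) (a₁ v)) (m≤m+n _ (a₃ v)))) (m≤n+m (a₃ v) _)

  -- with s = a₁ + a₂ + a₃ and 16 ^ m ≤ s < 16 ^ (m + 1), n is at most quadratic in m + 1 while s is at least quartic
  pure-quad : ∀ {n v} → Pure n v → ∃[ Y ] 1 ≤ Y × Y * Y * (Y * Y) ≤ sum₃ v × n ≤ 27 * 37 * 12 * (Y * Y)
  pure-quad {n} {v} p = go (log16 s s1)
    where
    s : ℕ
    s = sum₃ v
    A = proj₁ (pure-inv p)
    s1 : 1 ≤ s
    s1 = ≤-trans (g₁ A) (≤-trans (m≤m+n _ _) (m≤m+n _ _))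
    go : ∃[ m ] s < 16 ^ m × 16 ^ m ≤ 16 * s → ∃[ Y ] 1 ≤ Y × Y * Y * (Y * Y) ≤ s × n ≤ 27 * 37 * 12 * (Y * Y)
    go (zero , lo , _) = ⊥-elim (<⇒≱ lo s1)
    go (suc m , lo , hi) = Y , s≤s z≤n , ≤-trans (fourth m) (*-cancelˡ-≤ 16 hi) , bound' (C.count p sm)
      where
      Y : ℕ
      Y = suc m
      E : ℕ
      E = suc (36 * Y)
      module C = Classify E (s≤s z≤n)
      pw : 16 ^ Y * 16 ^ Y * 16 ^ Y ≡ 2 ^ (12 * Y)
      pw = trans (cong (λ z → z * z * z) (^-*-assoc 2 4 Y)) (trans (cong (_* 2 ^ (4 * Y)) (sym (^-distribˡ-+-* 2 (4 * Y) (4 * Y)))) (trans (sym (^-distribˡ-+-* 2 (4 * Y + 4 * Y) (4 * Y))) (cong (2 ^_) (r Y))))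
        where
        r : ∀ y → 4 * y + 4 * y + 4 * y ≡ 12 * y
        r = solve-∀
      Π< : prodW v < 2 ^ (12 * Y)
      Π< = ≤-trans (s≤s (sum-prod v)) (≤-trans (*-mono-< (*-mono-< lo lo) lo) (≤-reflexive pw))
      sm : C.Small³ v
      sm = ≤-trans (*-monoʳ-< 2 (*-mono-< (*-mono-< Π< Π<) Π<)) (≤-reflexive (cong (2 *_) (trans (cong (_* 2 ^ (12 * Y)) (sym (^-distribˡ-+-* 2 (12 * Y) (12 * Y)))) (trans (sym (^-distribˡ-+-* 2 (12 * Y + 12 * Y) (12 * Y))) (cong (2 ^_) (r Y))))))
        where
        r : ∀ y → 12 * y + 12 * y + 12 * y ≡ 36 * y
        r = solve-∀
      bound' : n ≤ 3 ⊎ (∃[ ℓ ] 2 ^ ℓ ≤ prodW v × n ≤ 27 * E * ℓ) → n ≤ 27 * 37 * 12 * (Y * Y)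
      bound' (inj₁ h) = ≤-trans h (*-mono-≤ {3} {27 * 37 * 12} {1} {Y * Y} (s≤s (s≤s (s≤s z≤n))) (s≤s z≤n))
      bound' (inj₂ (ℓ , q , h)) = ≤-trans h (≤-trans (*-mono-≤ (*-monoʳ-≤ 27 E≤) ℓ≤) (≤-reflexive (r 27 37 12 Y)))
        where
        E≤ : E ≤ 37 * Y
        E≤ = +-monoˡ-≤ (36 * Y) (s≤s z≤n)
        ℓ≤ : ℓ ≤ 12 * Y
        ℓ≤ = ≮⇒≥ λ l → <⇒≱ Π< (≤-trans (^-monoʳ-≤ 2 (≤-trans (n≤1+n (12 * Y)) l)) q)
        r : ∀ a b c y → a * (b * y) * (c * y) ≡ a * b * c * (y * y)
        r = solve-∀

  pure-super : ∀ α → ∃[ c ] (∀ {n v} → Pure n v → c ≤ n → α * n + 3 ≤ sum₃ v)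
  pure-super α = go (27 * 37 * 12) refl
    where
    go : ∀ κ → κ ≡ 27 * 37 * 12 → ∃[ c ] (∀ {n v} → Pure n v → c ≤ n → α * n + 3 ≤ sum₃ v)
    go κ eκ = suc (κ * (t * t)) , λ {n} {v} p h → fin {n} {sum₃ v} (pure-quad p) h
      where
      t : ℕ
      t = α * κ + 3
      fin : ∀ {n s} → ∃[ Y ] 1 ≤ Y × Y * Y * (Y * Y) ≤ s × n ≤ 27 * 37 * 12 * (Y * Y) → suc (κ * (t * t)) ≤ n → α * n + 3 ≤ s
      fin {n} {s} (Y , Y1 , a , b) h = ≤-trans (+-mono-≤ (*-monoʳ-≤ α b') (*-monoʳ-≤ 3 (m1 Y1 Y1))) (≤-trans (≤-reflexive (r α κ (Y * Y))) (≤-trans (*-monoˡ-≤ (Y * Y) (≤-trans t≤Y (≤*ʳ Y Y1))) a))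
        where
        b' : n ≤ κ * (Y * Y)
        b' = subst (λ z → n ≤ z * (Y * Y)) (sym eκ) b
        t≤Y : t ≤ Y
        t≤Y = ≮⇒≥ λ l → <⇒≱ h (≤-trans b' (*-monoʳ-≤ κ (*-mono-≤ (≤-trans (n≤1+n Y) l) (≤-trans (n≤1+n Y) l))))
        r : ∀ α κ z → α * (κ * z) + 3 * z ≡ (α * κ + 3) * z
        r = solve-∀

  -- Reduction along 3-edge cuts

  data Deco (P : ℕ → Set) : List Vx → ℕ → Set where
    dnil  : Deco P [] 0
    dcons : ∀ {t v X n N} → P n → Pure n v → Deco P X N → Deco P ((t , v) ∷ X) (n + N)

  deco-map : ∀ {P Q : ℕ → Set} {X N} → (∀ {n} → P n → Q n) → Deco P X N → Deco Q X N
  deco-map f dnil = dnil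
  deco-map f (dcons p a d) = dcons (f p) a (deco-map f d)

  deco-↭ : ∀ {P X Y N} → X ↭ Y → Deco P X N → Deco P Y N
  deco-↭ prefl d = d
  deco-↭ (prep x p) (dcons a b d) = dcons a b (deco-↭ p d)
  deco-↭ {P} (pswap x y p) (dcons {n = n} a b (dcons {n = m} {N} c e d)) = subst (Deco P _) (lem m n N) (dcons c e (dcons a b (deco-↭ p d)))
    where
    lem : ∀ a b c → a + (b + c) ≡ b + (a + c)
    lem = solve-∀
  deco-↭ (ptrans p q) d = deco-↭ q (deco-↭ p d)

  deco-++ : ∀ {P} X {Y N} → Deco P (X ++ Y) N → ∃[ A ] ∃[ B ] N ≡ A + B × Deco P X A × Deco P Y B
  deco-++ [] d = 0 , _ , refl , dnil , d
  deco-++ ((t , v) ∷ X) (dcons {n = n} a b d) with deco-++ X d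
  ... | A , B , refl , x , y = n + A , B , sym (+-assoc n A B) , dcons a b x , y

  deco-≈ : ∀ {P X Y N} → X ≈ Y → Deco P X N → Deco P Y N
  deco-≈ ≈refl d = d
  deco-≈ (≈↭ p e) d = deco-≈ e (deco-↭ p d)
  deco-≈ (≈sw s e) (dcons a b d) = deco-≈ e (dcons a (perm (sw→wperm s) b) d)

  deco-len : ∀ {c X N} → Deco (_≤ c) X N → N ≤ c * length X
  deco-len dnil = z≤n
  deco-len {c} (dcons {X = X} a b d) = ≤-trans (+-mono-≤ a (deco-len d)) (≤-reflexive (sym (*-suc c (length X))))

  pure-pos : ∀ {n v} → Pure n v → 1 ≤ n
  pure-pos leaf = ≤-refl
  pure-pos (perm _ p) = pure-pos p
  pure-pos (ptri p _ _) = ≤-trans (pure-pos p) (m≤m+n _ _)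
  pure-pos (pdbl p _ _) = ≤-trans (pure-pos p) (m≤m+n _ _)
  pure-pos (ptpl p _ _) = ≤-trans (pure-pos p) (m≤m+n _ _)

  deco-pos : ∀ {P X A} → Deco P X A → 1 ≤ length X → 1 ≤ A
  deco-pos (dcons _ p _) _ = ≤-trans (pure-pos p) (m≤m+n _ _)

  All⊤ : ℕ → Set
  All⊤ n = 0 ≤ n

  deco-big : ∀ c {X N} → Deco All⊤ X N →
    (∃[ t ] ∃[ v ] ∃[ n ] ∃[ Y ] ∃[ M ] X ↭ (t , v) ∷ Y × c < n × Pure n v × Deco All⊤ Y M × N ≡ n + M) ⊎ Deco (_≤ c) X N
  deco-big c dnil = inj₂ dnil
  deco-big c (dcons {t} {v} {X} {n} {N} a b d) with n ≤? c | deco-big c d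
  ... | no h | _ = inj₁ (t , v , n , X , N , prefl , ≰⇒> h , b , d , refl)
  ... | yes h | inj₂ e = inj₂ (dcons h b e)
  ... | yes h | inj₁ (t' , v' , n' , Y , M , p , g , pu , e , refl) = inj₁ (t' , v' , n' , (t , v) ∷ Y , n + M , ptrans (prep (t , v) p) (pswap (t , v) (t' , v') prefl) , g , pu , dcons z≤n b e , lem n n' M)
    where
    lem : ∀ a b c → a + (b + c) ≡ b + (a + c)
    lem = solve-∀

  deco-shape : ∀ {P X Y f₁ f₂ f₃ α β γ A B} (s : Shape X f₁ f₂ f₃ α β γ) → Deco P X A → Deco All⊤ Y B →
    Deco All⊤ ((tri f₁ f₂ f₃ , shapeW s) ∷ Y) (A + B)
  deco-shape {Y = Y} {f₁} {f₂} {f₃} {B = B} s dX dY = go s dX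
    where
    plus0 : ∀ {v} l m n → Pure (l + (m + n)) v → Deco All⊤ ((tri f₁ f₂ f₃ , v) ∷ Y) (l + (m + (n + 0)) + B)
    plus0 {v} l m n p = subst (λ z → Deco All⊤ ((tri f₁ f₂ f₃ , v) ∷ Y) (l + (m + z) + B)) (sym (+-identityʳ n)) (dcons z≤n p dY)
    go : ∀ {P X α β γ A} (s : Shape X f₁ f₂ f₃ α β γ) → Deco P X A → Deco All⊤ ((tri f₁ f₂ f₃ , shapeW s) ∷ Y) (A + B)
    go (triangle _ _ _) (dcons {n = l} _ p (dcons {n = m} _ q (dcons {n = n} _ r dnil))) = plus0 l m n (ptri p q r)
    go (double _ _ _) (dcons {n = l} _ p (dcons {n = m} _ q (dcons {n = n} _ r dnil))) = plus0 l m n (pdbl p q r)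
    go (triple _ _ _) (dcons {n = l} _ p (dcons {n = m} _ q (dcons {n = n} _ r dnil))) = plus0 l m n (ptpl p q r)

  ev-ge : ∀ t {v} → AllGe 1 v → ∀ σ → ev (plain t) σ ≤ ev (t , v) σ
  ev-ge (tri p q r) {wt a b c d} (allge x y z) σ = go (σ p) (σ q) (σ r)
    where
    go : ∀ i j k → wP i j k ≤ w3 (wt a b c d) i j k
    go true false false = x
    go false true false = y
    go false false true = z
    go true true true = z≤n
    go true true false = z≤n
    go true false true = z≤n
    go false true true = z≤n
    go false false false = z≤n

  pr-ge : ∀ {P X N} → Deco P X N → ∀ σ → pr (pl (tr X)) σ ≤ pr X σ
  pr-ge dnil σ = ≤-refl
  pr-ge (dcons {t} a b d) σ = *-mono-≤ (ev-ge t (proj₁ (pure-inv b)) σ) (pr-ge d σ)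

  U-ge : ∀ {P L t Y N} → Deco P Y N → ∀ {k} → AllGe k (Uv L t (pl (tr Y)) one) → AllGe k (Uv L t Y one)
  U-ge {L = L} {t} {Y} d (allge x y z) = allge (≤-trans x (mono true false false)) (≤-trans y (mono false true false)) (≤-trans z (mono false false true))
    where
    mono : ∀ i j k → U L t (pl (tr Y)) one i j k ≤ U L t Y one i j k
    mono i j k = sum-mono (rest L t) (λ σ → *-monoˡ-≤ 1 (pr-ge d σ)) (pat t i j k)

  Z1 : List ℕ → List Vx → ℕ
  Z1 L X = Z L X one

  Z1-ge : ∀ {P L X N} → Deco P X N → Z1 L (pl (tr X)) ≤ Z1 L X
  Z1-ge {L = L} {X} d = Z-mono L {pl (tr X)} {X} {one} {one} (pr-ge d) (λ _ → ≤-refl)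

  Z-neg≤ : ∀ {L G e} → Z L (pl G) (neg e) ≤ Z1 L (pl G)
  Z-neg≤ {L} {G} {e} = Z-mono L {pl G} {pl G} {neg e} {one} (λ _ → ≤-refl) le
    where
    le : ∀ σ → neg e σ ≤ 1
    le σ with σ e
    ... | true = z≤n
    ... | false = ≤-refl

  Z1-pos : ∀ {P L X N} → Deco P X N → WF L (tr X) → Br L (tr X) → 1 ≤ Z1 L X
  Z1-pos {L = L} {X} d w b = ≤-trans (ples! w b 0 0) (≤-trans (Z-mono L {pl (tr X)} {pl (tr X)} {λ σ → neg 0 σ * neg 0 σ} {neg 0} (λ _ → ≤-refl) (λ σ → *-pos {0} {0} σ))
    (≤-trans (Z-neg≤ {L} {tr X} {0}) (Z1-ge {L = L} {X} d)))

  all1→ge : ∀ {u} → All1 u → AllGe 1 u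
  all1→ge (all1 x y z) = allge x y z

  u-pos : ∀ {P L t Y N} → Deco P Y N → WF L (t ∷ tr Y) → Br L (t ∷ tr Y) → AllGe 1 (Uv L t Y one)
  u-pos {L = L} {tri p q r} {Y} d w b = U-ge {L = L} {tri p q r} {Y} d (all1→ge (ples-all1 w (noloop w b) (ples! w b)))

  dot-1 : ∀ {v u} → AllGe 1 v → AllGe 1 u → sum₃ u + sum₃ v ≤ dot v u + 3
  dot-1 {wt a b c d} {wt x y z w} (allge g₁ g₂ g₃) (allge h₁ h₂ h₃) = ≤-trans (≤-reflexive (r x y z a b c))
      (≤-trans (+-mono-≤ (+-mono-≤ (m a x g₁ h₁) (m b y g₂ h₂)) (m c z g₃ h₃)) (≤-trans (m≤m+n _ (d * w)) (≤-reflexive (r' (a * x) (b * y) (c * z) (d * w)))))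
    where
    m : ∀ a x → 1 ≤ a → 1 ≤ x → x + a ≤ a * x + 1
    m (suc a) (suc x) _ _ = ≤-trans (m≤m+n _ (a * x)) (≤-reflexive (s a x))
      where
      s : ∀ a x → suc x + suc a + a * x ≡ suc a * suc x + 1
      s = solve-∀
    r : ∀ x y z a b c → x + y + z + (a + b + c) ≡ (x + a) + (y + b) + (z + c)
    r = solve-∀
    r' : ∀ x y z w → x + 1 + (y + 1) + (z + 1) + w ≡ x + y + z + w + 3
    r' = solve-∀

  dot-2 : ∀ {v u} → AllGe 2 v → AllGe 1 u → sum₃ u + sum₃ u + sum₃ v ≤ dot v u + 6
  dot-2 {wt a b c d} {wt x y z w} (allge g₁ g₂ g₃) (allge h₁ h₂ h₃) = ≤-trans (≤-reflexive (r x y z a b c))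
      (≤-trans (+-mono-≤ (+-mono-≤ (m a x g₁ h₁) (m b y g₂ h₂)) (m c z g₃ h₃)) (≤-trans (m≤m+n _ (d * w)) (≤-reflexive (r' (a * x) (b * y) (c * z) (d * w)))))
    where
    m : ∀ a x → 2 ≤ a → 1 ≤ x → x + x + a ≤ a * x + 2
    m (suc (suc a)) (suc x) _ _ = ≤-trans (m≤m+n _ (a * x)) (≤-reflexive (s a x))
      where
      s : ∀ a x → suc x + suc x + suc (suc a) + a * x ≡ suc (suc a) * suc x + 2
      s = solve-∀
    m (suc zero) x (s≤s ()) _
    r : ∀ x y z a b c → x + y + z + (x + y + z) + (a + b + c) ≡ (x + x + a) + (y + y + b) + (z + z + c)
    r = solve-∀
    r' : ∀ x y z w → x + 2 + (y + 2) + (z + 2) + w ≡ x + y + z + w + 6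
    r' = solve-∀

  record Scheme (c : ℕ) : Set₁ where
    field
      G Known : ℕ → ℕ → Set
      mono   : ∀ {N Z Z'} → Z ≤ Z' → G N Z → G N Z'
      reset  : ∀ {n v M Z Z'} → Pure n v → c < n → G (1 + M) Z' → Z' + sum₃ v ≤ Z + 3 → G (n + M) Z
      tiny   : ∀ {N Z} → N ≤ c * 4 → 1 ≤ Z → G N Z
      prime  : ∀ {L H e N Z} → Prime L H → 1 ≤ cnt e L → N ≤ c * length H → Φ L H e ≤ Z → G N Z
      twig   : ∀ {L H e N M Z Z' s} → Prime L H → 1 ≤ cnt e L → N ≤ c * length H → Φ L H e ≤ s → 6 ≤ s →
               Z' + s ≤ Z + 3 → Z' + Z' + s ≤ Z + 6 → Known (1 + M) Z' → G (1 + M) Z' → G (N + M) Z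

  some-label : ∀ {L G} → WF L G → 6 ≤ length G → ∃[ e ] 1 ≤ cnt e L
  some-label {L} {tri p q r ∷ G} w _ = p , half-pos (≤-trans (∈⇒cnt {p} {p ∷ q ∷ r ∷ labs G} (here refl)) (≤-reflexive (twice w p)))
  some-label {G = []} w ()

  module Induct (c : ℕ) (c1 : 1 ≤ c) (S : Scheme c)
    (known : ∀ {L X N} → WF L (tr X) → Br L (tr X) → Deco All⊤ X N → Scheme.Known S N (Z1 L X)) where
    open Scheme S

    Rec : ℕ → Set
    Rec k = ∀ {L X N} → length X + N ≤ k → WF L (tr X) → Br L (tr X) → Deco All⊤ X N → G N (Z1 L X)

    do-reset : ∀ {k L X t v n Y M} → Rec k → length X + (n + M) ≤ suc k → WF L (tr X) → Br L (tr X) → X ↭ (t , v) ∷ Y → c < n → Pure n v → Deco All⊤ Y M → G (n + M) (Z1 L X)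
    do-reset {k} {L} {X} {tri p q r} {v} {n} {Y} {M} rec le w b pX cn pv d = reset pv cn (rec {L} {plain t ∷ Y} {1 + M} le' w' b' (dcons z≤n leaf' d)) (≤-trans (≤-reflexive (cong (_+ sum₃ v) (Zsum w' (noloop w' b') dep-one)))
        (≤-trans (dot-1 (proj₁ (pure-inv pv)) (u-pos d w' b')) (≤-reflexive (cong (_+ 3) (sym (trans (Z-↭ L {X} {(t , v) ∷ Y} one pX) (vertexSum w' (noloop w' b') dep-one)))))))
      where
      t = tri p q r
      leaf' : Pure 1 (wt 1 1 1 0)
      leaf' = leaf
      w' : WF L (t ∷ tr Y)
      w' = WF-↭ (tr-↭ pX) w
      b' : Br L (t ∷ tr Y)
      b' = Br-↭ {L = L} (tr-↭ pX) b
      le' : suc (length Y) + (1 + M) ≤ k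
      le' = ≤-pred (≤-trans (≤-trans (≤-reflexive (lem (length Y) M)) (+-monoʳ-≤ (suc (length Y)) (+-monoˡ-≤ M (≤-trans (s≤s c1) cn)))) (subst (λ z → z + (n + M) ≤ suc k) (↭-length pX) le))
        where
        lem : ∀ y m → suc (suc y + (1 + m)) ≡ suc y + (2 + m)
        lem = solve-∀

    do-cut : ∀ {k L X N} → Rec k → length X + N ≤ suc k → WF L (tr X) → Br L (tr X) → Deco (_≤ c) X N →
      (∃[ W ] ∃[ V ] tr X ↭ W ++ V × 2 ≤ length W × δ L W ≡ 3 × Min3 L W) → G N (Z1 L X)
    do-cut {k} {L} {X} {N} rec le w₀ b₀ d (W , V , pW , lW , dW , mW) with map-split↭ proj₁ X {W} {V} pW
    ... | XW , XY , pX , refl , refl = go (deco-++ XW (deco-↭ pX d)) (bdl3 L (tr XW) dW)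
      where
      w : WF L (tr XW ++ tr XY)
      w = WF-↭ pW w₀
      b : Br L (tr XW ++ tr XY)
      b = Br-↭ {L = L} pW b₀
      lenX : length X ≡ length XW + length XY
      lenX = trans (↭-length pX) (length-++ XW)
      lW' : 2 ≤ length XW
      lW' = subst (2 ≤_) (length-map proj₁ XW) lW
      ZX : Z1 L X ≡ Z1 L (XW ++ XY)
      ZX = Z-↭ L {X} {XW ++ XY} one pX
      go : ∃[ A ] ∃[ B ] N ≡ A + B × Deco (_≤ c) XW A × Deco (_≤ c) XY B → ∃[ x ] ∃[ y ] ∃[ z ] bdl L (tr XW) ↭ x ∷ y ∷ z ∷ [] → G N (Z1 L X)
      go (A , B , refl , dA , dB) (x , y , z , bd) = which (tr XW) refl (small wX)
        where
        open Sides XW XY refl refl w b bd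
        dB⊤ : Deco All⊤ XY B
        dB⊤ = deco-map (λ _ → z≤n) dB
        le' : ∀ {n} → n ≤ A → suc (length XY) + (n + B) ≤ k
        le' {n} h = ≤-pred (≤-trans (≤-trans (≤-reflexive (lem (length XY) (n + B))) (+-mono-≤ (+-monoˡ-≤ (length XY) lW') (+-monoˡ-≤ B h))) (subst (λ z → z + (A + B) ≤ suc k) lenX le))
          where
          lem : ∀ y m → suc (suc y + m) ≡ 2 + y + m
          lem = solve-∀
        A1 : 1 ≤ A
        A1 = deco-pos dA (≤-trans (s≤s z≤n) lW')
        prime-leaf : 6 ≤ length (o ∷ tr XW) → G (A + B) (Z1 L X)
        prime-leaf l6 = lf (some-label wX l6)
          where
          P : Prime LX (o ∷ tr XW)
          P = record { pwf = wX ; pbr = bX ; pn3 = CX.No3' mW ; p6 = l6 }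
          v' u : Wt
          v' = Uv LX o XW one
          u = Uv LY o XY one
          v2 : AllGe 2 v'
          v2 = U-ge {L = LX} {o} {XW} dA (prime-all2 P)
          v1 : AllGe 1 v'
          v1 = allge (≤-trans (s≤s z≤n) (g₁ v2)) (≤-trans (s≤s z≤n) (g₂ v2)) (≤-trans (s≤s z≤n) (g₃ v2))
          u1 : AllGe 1 u
          u1 = u-pos dB wY bY
          Z' : ℕ
          Z' = Z1 LY (plain o ∷ XY)
          Z'≡ : Z' ≡ sum₃ u
          Z'≡ = Zsum wY h dep-one
          sd : dot v' u ≤ Z1 L X
          sd = ≤-trans (split-dot dep-one (λ ()) dep-one (λ ())) (≤-reflexive (sym ZX))
          s6 : 6 ≤ sum₃ v'
          s6 = +-mono-≤ (+-mono-≤ (g₁ v2) (g₂ v2)) (g₃ v2)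
          lf : ∃[ e ] 1 ≤ cnt e LX → G (A + B) (Z1 L X)
          lf (e , he) = twig P he (≤-trans (deco-len dA) (*-monoʳ-≤ c (≤-trans (≤-reflexive (sym (length-map proj₁ XW))) (n≤1+n _))))
            (≤-trans (Z-neg≤ {LX} {o ∷ tr XW} {e}) (≤-trans (Z1-ge {All⊤} {LX} {plain o ∷ XW} (dcons z≤n leaf (deco-map (λ _ → z≤n) dA))) (≤-reflexive (Zsum wX h dep-one)))) s6
            (≤-trans (≤-reflexive (cong (_+ sum₃ v') Z'≡)) (≤-trans (dot-1 v1 u1) (+-monoˡ-≤ 3 sd)))
            (≤-trans (≤-reflexive (cong (λ z → z + z + sum₃ v') Z'≡)) (≤-trans (dot-2 v2 u1) (+-monoˡ-≤ 6 sd)))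
            (known {LY} {plain o ∷ XY} {1 + B} wY bY (dcons z≤n leaf dB⊤))
            (rec {LY} {plain o ∷ XY} {1 + B} (le' A1) wY bY (dcons z≤n leaf dB⊤))
        three-leaf : length XW ≡ 3 → G (A + B) (Z1 L X)
        three-leaf len = nfo (toNF {L} {XW} {tr XY} w b dW len)
          where
          nfo : NF XW → G (A + B) (Z1 L X)
          nfo (nf {X'} {f₁} {f₂} {f₃} s e) = mono zle (rec {SD.LY} {(SD.o , shapeW s) ∷ XY} {A + B} (le' ≤-refl) SD.wY SD.bY (deco-shape s (deco-≈ e dA) dB⊤))
            where
            w' : WF L (tr X' ++ tr XY)
            w' = ≈WF {X = XW} {X'} {XY} e w
            b' : Br L (tr X' ++ tr XY)
            b' = ≈Br {L} {XW} {X'} {XY} e b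
            d' : δ L (tr X') ≡ 3
            d' = trans (≈δ e) dW
            bd' : bdl L (tr X') ↭ f₁ ∷ f₂ ∷ f₃ ∷ []
            bd' = shape-bdl s w' b' d'
            module SD = Sides X' XY refl refl w' b' bd'
            zle : Z1 SD.LY ((SD.o , shapeW s) ∷ XY) ≤ Z1 L X
            zle = ≤-trans (≤-trans (≤-reflexive (cong (λ v → Z1 SD.LY ((SD.o , v) ∷ XY)) (sym (shapeV s (shape-uq s w' b' d') SD.wX SD.h))))
                (glue' X' XY refl refl w' SD.h bd' dep-one (λ ()) dep-one (λ ())))
              (≤-reflexive (trans (sym (⇝Z (≈⇝ e XY) L one)) (sym ZX)))
        which : ∀ T → tr XW ≡ T → Small (o ∷ T) → G (A + B) (Z1 L X)
        which [] e sm = ⊥-elim (case ≤-trans lW' (≤-reflexive (trans (sym (length-map proj₁ XW)) (cong length e))) of λ ())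
        which (_ ∷ []) e sm = ⊥-elim (case ≤-trans lW' (≤-reflexive (trans (sym (length-map proj₁ XW)) (cong length e))) of λ { (s≤s ()) })
        which (_ ∷ _ ∷ _ ∷ []) e sm = three-leaf (trans (sym (length-map proj₁ XW)) (cong length e))
        which T e (sz6 l6) = prime-leaf (subst (λ z → 6 ≤ suc (length z)) (sym e) l6)

    induct : ∀ k → Rec k
    induct k {L} {X} {N} le w b d = go (deco-big c d)
      where
      cut : Deco (_≤ c) X N → (∃[ A ] ∃[ B ] tr X ↭ A ++ B × 2 ≤ length A × 2 ≤ length B × δ L A ≡ 3) ⊎ No3 L (tr X) → G N (Z1 L X)
      cut dB (inj₂ n3) = sz (tr X) refl (small w)
        where
        ti : length (tr X) ≤ 4 → G N (Z1 L X)
        ti h = tiny (≤-trans (deco-len dB) (*-monoʳ-≤ c (≤-trans (≤-reflexive (sym (length-map proj₁ X))) h))) (Z1-pos d w b)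
        sz : ∀ T → tr X ≡ T → Small T → G N (Z1 L X)
        sz _ e sz0 = ti (≤-trans (≤-reflexive (cong length e)) z≤n)
        sz _ e sz2 = ti (≤-trans (≤-reflexive (cong length e)) (s≤s (s≤s z≤n)))
        sz _ e sz4 = ti (≤-reflexive (cong length e))
        sz T e (sz6 l) = pr' (some-label w l6)
          where
          l6 : 6 ≤ length (tr X)
          l6 = subst (λ z → 6 ≤ length z) (sym e) l
          pr' : ∃[ f ] 1 ≤ cnt f L → G N (Z1 L X)
          pr' (f , hf) = prime {L} {tr X} {f} (record { pwf = w ; pbr = b ; pn3 = n3 ; p6 = l6 }) hf (≤-trans (deco-len dB) (*-monoʳ-≤ c (≤-reflexive (sym (length-map proj₁ X)))))
            (≤-trans (Z-neg≤ {L} {tr X} {f}) (Z1-ge {L = L} {X} d))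
      cut dB (inj₁ (A , B , p , lA , lB , dA)) = fuel k le
        where
        fuel : ∀ k → length X + N ≤ k → G N (Z1 L X)
        fuel zero h = tiny (≤-trans (m≤n+m N (length X)) (≤-trans h z≤n)) (Z1-pos d w b)
        fuel (suc k) h = do-cut (induct k) h w b dB (lift₃ (shrink3 L _ A ≤-refl lA dA))
          where
          lift₃ : (∃[ W ] ∃[ E ] A ↭ W ++ E × 2 ≤ length W × δ L W ≡ 3 × Min3 L W) → ∃[ W ] ∃[ V ] tr X ↭ W ++ V × 2 ≤ length W × δ L W ≡ 3 × Min3 L W
          lift₃ (W , E , q , a) = W , E ++ B , ptrans p (ptrans (++⁺ʳ B q) (++-assoc W E B)) , a
      go : (∃[ t ] ∃[ v ] ∃[ n ] ∃[ Y ] ∃[ M ] X ↭ (t , v) ∷ Y × c < n × Pure n v × Deco All⊤ Y M × N ≡ n + M) ⊎ Deco (_≤ c) X N → G N (Z1 L X)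
      go (inj₂ dB) = cut dB (search3 L (tr X))
      go (inj₁ (t , v , n , Y , M , pX , cn , pv , dY , refl)) = fuel k le
        where
        fuel : ∀ k → length X + (n + M) ≤ k → G (n + M) (Z1 L X)
        fuel zero h = tiny (≤-trans (m≤n+m (n + M) (length X)) (≤-trans h z≤n)) (Z1-pos d w b)
        fuel (suc k) h = do-reset (induct k) h w b pX cn pv dY

  linear : ∃[ q ] (∀ {L X N} → WF L (tr X) → Br L (tr X) → Deco All⊤ X N → N ≤ q * Z1 L X)
  linear = go (pure-super 1) (prime-super 1)
    where
    go : ∃[ c ] (∀ {n v} → Pure n v → c ≤ n → 1 * n + 3 ≤ sum₃ v) → ∃[ β ] (∀ {L G e} → Prime L G → 1 ≤ cnt e L → 1 * length G ≤ Φ L G e + β) →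
      ∃[ q ] (∀ {L X N} → WF L (tr X) → Br L (tr X) → Deco All⊤ X N → N ≤ q * Z1 L X)
    go (c₀ , hp) (β , hq) = q , λ {L} {X} {N} w b d → Induct.induct c (s≤s z≤n) S (λ _ _ _ → z≤n) (length X + N) ≤-refl w b d
      where
      c q : ℕ
      c = suc c₀
      q = c * (4 * suc β)
      q1 : 1 ≤ q
      q1 = *-mono-≤ {1} {c} {1} {4 * suc β} (s≤s z≤n) (s≤s z≤n)
      c4 : c * 4 ≤ q
      c4 = *-monoʳ-≤ c (≤*ʳ 4 (s≤s z≤n))
      len : ∀ {L H e} → Prime L H → 1 ≤ cnt e L → length H ≤ suc β * Φ L H e
      len {L} {H} {e} P he = ≤-trans (≤-reflexive (sym (+-identityʳ _))) (≤-trans (hq P he) (+-monoʳ-≤ (Φ L H e) (≤*ʳ β (≤-trans (s≤s z≤n) (prime-φ4 P he)))))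
      S : Scheme c
      S = record
        { G = λ N Z → N ≤ q * Z
        ; Known = λ _ _ → 0 ≤ 0
        ; mono = λ h g → ≤-trans g (*-monoʳ-≤ q h)
        ; reset = λ {n} {v} {M} {Z} {Z'} pv cn g h → rs {n} {M} {Z} {Z'} {sum₃ v} (hp pv (≤-trans (n≤1+n c₀) (≤-trans (n≤1+n c) cn))) g h
        ; tiny = λ {N} {Z} h z → ≤-trans h (≤-trans c4 (≤*ʳ q z))
        ; prime = λ {L} {H} {e} {N} {Z} P he h g → ≤-trans (pl' (≤-trans h (*-monoʳ-≤ c (len P he)))) (*-monoʳ-≤ q g)
        ; twig = λ {L} {H} {e} {N} {M} {Z} {Z'} {s} P he h g s6 a b _ r → tw {N} {M} {Z} {Z'} {s} (≤-trans h (*-monoʳ-≤ c (≤-trans (len P he) (*-monoʳ-≤ (suc β) g)))) s6 a r }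
        where
        pl' : ∀ {N φ} → N ≤ c * (suc β * φ) → N ≤ q * φ
        pl' {N} {φ} h = ≤-trans h (≤-trans (m≤m+n _ (3 * (c * (suc β * φ)))) (≤-reflexive (r c (suc β) φ)))
          where
          r : ∀ c b φ → c * (b * φ) + 3 * (c * (b * φ)) ≡ c * (4 * b) * φ
          r = solve-∀
        rs : ∀ {n M Z Z' s} → 1 * n + 3 ≤ s → 1 + M ≤ q * Z' → Z' + s ≤ Z + 3 → n + M ≤ q * Z
        rs {n} {M} {Z} {Z'} {s} h g k = ≤-trans (+-mono-≤ {n} {q * n} (≤*ˡ n q1) (≤-trans (n≤1+n M) g)) (≤-trans (≤-reflexive (trans (+-comm (q * n) (q * Z')) (sym (*-distribˡ-+ q Z' n)))) (*-monoʳ-≤ q nz))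
          where
          nz : Z' + n ≤ Z
          nz = +-cancelʳ-≤ 3 _ _ (≤-trans (≤-reflexive (+-assoc Z' n 3)) (≤-trans (+-monoʳ-≤ Z' (≤-trans (+-monoˡ-≤ 3 (≤-reflexive (sym (+-identityʳ n)))) h)) k))
        tw : ∀ {N M Z Z' s} → N ≤ c * (suc β * s) → 6 ≤ s → Z' + s ≤ Z + 3 → 1 + M ≤ q * Z' → N + M ≤ q * Z
        tw {N} {M} {Z} {Z'} {s} h s6 k g with m≤n⇒∃[o]m+o≡n s6
        ... | o , refl = ≤-trans (+-mono-≤ (≤-trans h (≤-trans (*-monoʳ-≤ c (*-monoʳ-≤ (suc β) s≤)) (≤-reflexive (r₁ c (suc β) (3 + o))))) (≤-trans (n≤1+n M) g))
            (≤-trans (≤-reflexive (trans (+-comm (q * (3 + o)) (q * Z')) (sym (*-distribˡ-+ q Z' (3 + o))))) (*-monoʳ-≤ q (+-cancelʳ-≤ 3 _ _ (≤-trans (≤-reflexive (r₂ Z' o)) k))))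
          where
          s≤ : 6 + o ≤ 4 * (3 + o)
          s≤ = ≤-trans (m≤m+n (6 + o) (6 + 3 * o)) (≤-reflexive (r o))
            where
            r : ∀ o → 6 + o + (6 + 3 * o) ≡ 4 * (3 + o)
            r = solve-∀
          r₁ : ∀ c b x → c * (b * (4 * x)) ≡ c * (4 * b) * x
          r₁ = solve-∀
          r₂ : ∀ z o → z + (3 + o) + 3 ≡ z + (6 + o)
          r₂ = solve-∀

  superlinear : ∀ a → ∃[ β ] (∀ {L X N} → WF L (tr X) → Br L (tr X) → Deco All⊤ X N → a * N ≤ Z1 L X + β)
  superlinear a = go linear (pure-super a)
    where
    go : ∃[ q ] (∀ {L X N} → WF L (tr X) → Br L (tr X) → Deco All⊤ X N → N ≤ q * Z1 L X) → ∃[ c ] (∀ {n v} → Pure n v → c ≤ n → a * n + 3 ≤ sum₃ v) →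
      ∃[ β ] (∀ {L X N} → WF L (tr X) → Br L (tr X) → Deco All⊤ X N → a * N ≤ Z1 L X + β)
    go (q , hl) (c₀ , hp) = go' (prime-super (a * suc c₀))
      where
      c : ℕ
      c = suc c₀
      go' : ∃[ β ] (∀ {L G e} → Prime L G → 1 ≤ cnt e L → a * c * length G ≤ Φ L G e + β) → ∃[ β ] (∀ {L X N} → WF L (tr X) → Br L (tr X) → Deco All⊤ X N → a * N ≤ Z1 L X + β)
      go' (β₀ , hq) = β , λ {L} {X} {N} w b d → Induct.induct c (s≤s z≤n) S (λ w b d → hl w b d) (length X + N) ≤-refl w b d
        where
        t β : ℕ
        t = β₀ + 6
        β = a * (c * 4) + t + a * (q * t)
        S : Scheme c
        S = record
          { G = λ N Z → a * N ≤ Z + β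
          ; Known = λ N Z → N ≤ q * Z
          ; mono = λ h g → ≤-trans g (+-monoˡ-≤ β h)
          ; reset = λ {n} {v} {M} {Z} {Z'} pv cn g h → rs {n} {M} {Z} {Z'} {sum₃ v} (hp pv (≤-trans (n≤1+n c₀) (≤-trans (n≤1+n c) cn))) g h
          ; tiny = λ {N} {Z} h z → ≤-trans (*-monoʳ-≤ a h) (≤-trans (≤-trans (m≤m+n _ t) (m≤m+n _ (a * (q * t)))) (m≤n+m β Z))
          ; prime = λ {L} {H} {e} {N} {Z} P he h g → ≤-trans (len P he h) (+-mono-≤ g (≤-trans (m≤m+n β₀ 6) (≤-trans (m≤n+m t (a * (c * 4))) (m≤m+n _ _))))
          ; twig = λ {L} {H} {e} {N} {M} {Z} {Z'} {s} P he h g s6 x y k r → tw {N} {M} {Z} {Z'} {s} (≤-trans (len P he h) (+-monoˡ-≤ β₀ g)) y k r }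
          where
          len : ∀ {L H e N} → Prime L H → 1 ≤ cnt e L → N ≤ c * length H → a * N ≤ Φ L H e + β₀
          len {H = H} P he h = ≤-trans (*-monoʳ-≤ a h) (≤-trans (≤-reflexive (sym (*-assoc a c (length H)))) (hq P he))
          rs : ∀ {n M Z Z' s} → a * n + 3 ≤ s → a * (1 + M) ≤ Z' + β → Z' + s ≤ Z + 3 → a * (n + M) ≤ Z + β
          rs {n} {M} {Z} {Z'} {s} h g k = +-cancelʳ-≤ 3 _ _ (≤-trans (m≤m+n _ a) (≤-trans (≤-reflexive (r₁ a n M)) (≤-trans (+-mono-≤ h g)
              (≤-trans (≤-reflexive (r₂ s Z' β)) (≤-trans (+-monoˡ-≤ β k) (≤-reflexive (r₃ Z β)))))))
            where
            r₁ : ∀ a n M → a * (n + M) + 3 + a ≡ a * n + 3 + a * (1 + M)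
            r₁ = solve-∀
            r₂ : ∀ s z b → s + (z + b) ≡ z + s + b
            r₂ = solve-∀
            r₃ : ∀ z b → z + 3 + b ≡ z + b + 3
            r₃ = solve-∀
          tw : ∀ {N M Z Z' s} → a * N ≤ s + β₀ → Z' + Z' + s ≤ Z + 6 → 1 + M ≤ q * Z' → a * (1 + M) ≤ Z' + β → a * (N + M) ≤ Z + β
          tw {N} {M} {Z} {Z'} {s} h k l g with t ≤? Z'
          ... | yes le = +-cancelʳ-≤ 6 _ _ (≤-trans (≤-reflexive (cong (_+ 6) (*-distribˡ-+ a N M))) (≤-trans (+-monoˡ-≤ 6 (+-mono-≤ h (≤-trans (*-monoʳ-≤ a (n≤1+n M)) g)))
              (≤-trans (≤-reflexive (r₁ s β₀ Z' β)) (≤-trans (+-monoʳ-≤ (s + Z' + β) le) (≤-trans (≤-reflexive (r₂ s Z' β)) (≤-trans (+-monoˡ-≤ β k) (≤-reflexive (r₃ Z β))))))))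
            where
            r₁ : ∀ s b z β → s + b + (z + β) + 6 ≡ s + z + β + (b + 6)
            r₁ = solve-∀
            r₂ : ∀ s z β → s + z + β + z ≡ z + z + s + β
            r₂ = solve-∀
            r₃ : ∀ z b → z + 6 + b ≡ z + b + 6
            r₃ = solve-∀
          ... | no n = ≤-trans (≤-reflexive (*-distribˡ-+ a N M)) (≤-trans (+-mono-≤ h (*-monoʳ-≤ a M≤)) (≤-trans (+-monoˡ-≤ (a * (q * t)) (+-monoˡ-≤ β₀ (≤-trans (m≤n+m s (Z' + Z')) k)))
              (≤-trans (≤-reflexive (r₁ Z β₀ (a * (q * t)))) (+-monoʳ-≤ Z (+-monoˡ-≤ (a * (q * t)) (m≤n+m t (a * (c * 4))))))))
            where
            M≤ : M ≤ q * t
            M≤ = ≤-trans (n≤1+n M) (≤-trans l (*-monoʳ-≤ q (≤-trans (n≤1+n Z') (≰⇒> n))))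
            r₁ : ∀ z b x → z + 6 + b + x ≡ z + (b + 6 + x)
            r₁ = solve-∀

  -- From multigraphs to lists of vertices

  open import Defs renaming (ends to endsᴳ)
  open import Data.Fin using (Fin; toℕ) renaming (zero to fzero; suc to fsuc; _≟_ to _≟F_)
  open import Data.Fin.Properties using (toℕ-injective)
  open import Data.Fin.Subset.Properties using (_∈?_)
  open import Data.List using (filter; allFin; tabulate)
  open import Data.List.Properties using (map-tabulate; tabulate-cong)
  open import Data.List.Membership.Propositional.Properties using (∈-allFin)
  open import Data.Vec using (Vec; lookup) renaming ([] to []ᵥ; _∷_ to _∷ᵥ_)
  open import Data.Vec.Properties using ([]=⇒lookup; lookup⇒[]=)

  rng : ℕ → ℕ → List ℕ
  rng k zero = []
  rng k (suc m) = k ∷ rng (suc k) m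

  cnt-rng-below : ∀ {l k} m → l < k → cnt l (rng k m) ≡ 0
  cnt-rng-below zero h = refl
  cnt-rng-below {l} {k} (suc m) h = cong₂ _+_ (δ-diff (<⇒≢ h)) (cnt-rng-below m (≤-trans h (n≤1+n k)))

  cnt-rng : ∀ l k m → cnt l (rng k m) ≤ 1
  cnt-rng l k zero = z≤n
  cnt-rng l k (suc m) with eqL l k
  ... | inj₁ refl = s≤s (≤-reflexive (cnt-rng-below m ≤-refl))
  ... | inj₂ _ = cnt-rng l (suc k) m

  allFin-rng : ∀ m → map toℕ (allFin m) ≡ rng 0 m
  allFin-rng m = trans (map-tabulate id toℕ) (go 0 m)
    where
    go : ∀ k m → tabulate {n = m} (λ i → k + toℕ i) ≡ rng k m
    go k zero = refl
    go k (suc m) = cong₂ _∷_ (+-identityʳ k) (trans (tabulate-cong (λ i → +-suc k (toℕ i))) (go (suc k) m))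

  κ : ∀ {k} → Fin k → List (Fin k) → ℕ
  κ v A = cnt (toℕ v) (map toℕ A)

  κ-all : ∀ {k} (v : Fin k) → κ v (allFin k) ≡ 1
  κ-all {k} v = ≤-antisym (subst (λ L → cnt (toℕ v) L ≤ 1) (sym (allFin-rng k)) (cnt-rng (toℕ v) 0 k)) (∈⇒cnt (∈-map⁺ toℕ (∈-allFin v)))

  toTri : List ℕ → Tri
  toTri (x ∷ y ∷ z ∷ _) = tri x y z
  toTri _ = tri 0 0 0

  labs-toTri : ∀ xs → length xs ≡ 3 → labs (toTri xs ∷ []) ≡ xs
  labs-toTri (x ∷ y ∷ z ∷ []) refl = refl

  updV : ∀ {m} → ℕ → Vec Bool m → Asg → Asg
  updV k []ᵥ σ = σ
  updV k (b ∷ᵥ M) σ = updV (suc k) M (upd σ k b)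

  updV-below : ∀ {m} k (M : Vec Bool m) σ {l} → l < k → updV k M σ l ≡ σ l
  updV-below k []ᵥ σ h = refl
  updV-below k (b ∷ᵥ M) σ h = trans (updV-below (suc k) M (upd σ k b) (≤-trans h (n≤1+n k))) (upd-diff σ b (<⇒≢ h))

  updV-at : ∀ {m} k (M : Vec Bool m) σ e → updV k M σ (k + toℕ e) ≡ lookup M e
  updV-at k (b ∷ᵥ M) σ fzero = trans (cong (updV (suc k) M (upd σ k b)) (+-identityʳ k)) (trans (updV-below (suc k) M (upd σ k b) ≤-refl) (upd-same σ k b))
  updV-at k (b ∷ᵥ M) σ (fsuc e) = trans (cong (updV (suc k) M (upd σ k b)) (+-suc k (toℕ e))) (updV-at (suc k) M (upd σ k b) e)

  sumS : {A : Set} → (A → ℕ) → List A → ℕ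
  sumS f [] = 0
  sumS f (x ∷ xs) = f x + sumS f xs

  sumS-++ : ∀ {A : Set} (f : A → ℕ) xs ys → sumS f (xs ++ ys) ≡ sumS f xs + sumS f ys
  sumS-++ f [] ys = refl
  sumS-++ f (x ∷ xs) ys = trans (cong (f x +_) (sumS-++ f xs ys)) (sym (+-assoc (f x) _ _))

  sumS-map : ∀ {A B : Set} (f : B → ℕ) (g : A → B) xs → sumS f (map g xs) ≡ sumS (f ∘ g) xs
  sumS-map f g [] = refl
  sumS-map f g (x ∷ xs) = cong (f (g x) +_) (sumS-map f g xs)

  sum-subsets : ∀ k m F σ → sumOver (rng k m) F σ ≡ sumS (λ M → F (updV k M σ)) (allSubsets m)
  sum-subsets k zero F σ = sym (+-identityʳ (F σ))
  sum-subsets k (suc m) F σ = trans (cong₂ _+_ (trans (sum-subsets (suc k) m F (upd σ k true)) (sym (sumS-map (λ M → F (updV k M σ)) (true ∷ᵥ_) (allSubsets m))))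
      (trans (sum-subsets (suc k) m F (upd σ k false)) (sym (sumS-map (λ M → F (updV k M σ)) (false ∷ᵥ_) (allSubsets m)))))
    (sym (sumS-++ (λ M → F (updV k M σ)) (map (true ∷ᵥ_) (allSubsets m)) (map (false ∷ᵥ_) (allSubsets m))))

  count-le : ∀ {A : Set} {P : A → Set} (P? : ∀ x → Dec (P x)) (f : A → ℕ) → (∀ x → f x ≤ 1) → (∀ x → 1 ≤ f x → P x) → ∀ xs → sumS f xs ≤ length (filter P? xs)
  count-le P? f h g [] = z≤n
  count-le P? f h g (x ∷ xs) with P? x
  ... | yes p = +-mono-≤ (h x) (count-le P? f h g xs)
  ... | no n = +-mono-≤ {f x} {0} (≮⇒≥ (n ∘ g x)) (count-le P? f h g xs)

  cnt-filter : ∀ {m} {P : Fin m → Set} (P? : ∀ e → Dec (P e)) f xs →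
    cnt (toℕ f) (map toℕ (filter P? xs)) ≡ (if does (P? f) then 1 else 0) * κ f xs
  cnt-filter P? f [] = sym (*-zeroʳ (if does (P? f) then 1 else 0))
  cnt-filter P? f (x ∷ xs) with f ≟F x
  cnt-filter P? f (x ∷ xs) | yes refl with P? f | cnt-filter P? f xs
  ... | yes p | ih = trans (cong (δ= (toℕ f) (toℕ f) +_) (trans ih (+-identityʳ _))) (sym (+-identityʳ _))
  ... | no p | ih = ih
  cnt-filter P? f (x ∷ xs) | no ne with P? x
  ... | yes p = trans (cong₂ _+_ (δ-diff (ne ∘ toℕ-injective)) (cnt-filter P? f xs)) (cong (λ z → (if does (P? f) then 1 else 0) * (z + κ f xs)) (sym (δ-diff (ne ∘ toℕ-injective))))
  ... | no p = trans (cnt-filter P? f xs) (cong (λ z → (if does (P? f) then 1 else 0) * (z + κ f xs)) (sym (δ-diff (ne ∘ toℕ-injective))))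

  length-filter-× : ∀ {m} {P Q : Fin m → Set} (P? : ∀ e → Dec (P e)) (Q? : ∀ e → Dec (Q e)) {g : ℕ → ℕ} →
    (∀ e → (if does (P? e) then 1 else 0) ≡ g (toℕ e)) → ∀ xs → length (filter (λ e → P? e ×-dec Q? e) xs) ≡ sumL g (map toℕ (filter Q? xs))
  length-filter-× P? Q? h [] = refl
  length-filter-× P? Q? h (x ∷ xs) with P? x | Q? x | h x
  ... | yes p | yes q | e = cong₂ _+_ e (length-filter-× P? Q? h xs)
  ... | no p | yes q | e = cong₂ _+_ e (length-filter-× P? Q? h xs)
  ... | yes p | no q | e = length-filter-× P? Q? h xs
  ... | no p | no q | e = length-filter-× P? Q? h xs

  module _ {n m : ℕ} (G : Multigraph n m) where

    inc : Fin n → List (Fin m)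
    inc v = filter (incident? G v) (allFin m)

    vt : Fin n → Tri
    vt v = toTri (map toℕ (inc v))

    fst snd : Fin m → Fin n
    fst f = proj₁ (endsᴳ G f)
    snd f = proj₂ (endsᴳ G f)

    ι : Fin n → Fin m → ℕ
    ι w f = if does (incident? G w f) then 1 else 0

    ι-eq : ∀ w f → ι w f ≡ κ (fst f) (w ∷ []) + κ (snd f) (w ∷ [])
    ι-eq w f with w ≟F fst f | w ≟F snd f
    ... | yes p | yes q = ⊥-elim (loopless G f (trans (sym p) q))
    ... | yes refl | no q rewrite δ-same (toℕ (fst f)) | δ-diff {toℕ (snd f)} {toℕ (fst f)} (λ e → q (sym (toℕ-injective e))) = refl
    ... | no p | yes refl rewrite δ-same (toℕ (snd f)) | δ-diff {toℕ (fst f)} {toℕ (snd f)} (λ e → p (sym (toℕ-injective e))) = refl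
    ... | no p | no q rewrite δ-diff {toℕ (fst f)} {toℕ w} (λ e → p (sym (toℕ-injective e))) | δ-diff {toℕ (snd f)} {toℕ w} (λ e → q (sym (toℕ-injective e))) = refl

    module _ (cub : Cubic G) (bl : Bridgeless G) where
      L : List ℕ
      L = map toℕ (allFin m)
      T : List Tri
      T = map vt (allFin n)

      labs-vt : ∀ v → labs (vt v ∷ []) ≡ map toℕ (inc v)
      labs-vt v = labs-toTri _ (trans (length-map toℕ (inc v)) (cub v))

      occ-verts : ∀ f A → occ (toℕ f) (map vt A) ≡ κ (fst f) A + κ (snd f) A
      occ-verts f [] = refl
      occ-verts f (w ∷ A) = trans (occ-++ (toℕ f) (vt w ∷ []) (map vt A)) (trans (cong₂ _+_ (trans (cong (cnt (toℕ f)) (labs-vt w))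
          (trans (cnt-filter (incident? G w) f (allFin m)) (trans (cong (ι w f *_) (κ-all f)) (trans (*-identityʳ (ι w f)) (ι-eq w f))))) (occ-verts f A))
          (lem (δ= (toℕ (fst f)) (toℕ w)) (δ= (toℕ (snd f)) (toℕ w)) (κ (fst f) A) (κ (snd f) A)))
        where
        lem : ∀ a b c d → a + 0 + (b + 0) + (c + d) ≡ a + c + (b + d)
        lem = solve-∀

      labs-verts : ∀ {l} A → l ∈ labs (map vt A) → l ∈ L
      labs-verts {l} (w ∷ A) i with ∈-++⁻ (labs (vt w ∷ [])) (subst (l ∈_) (labs-++ (vt w ∷ []) (map vt A)) i)
      ... | inj₂ k = labs-verts A k
      ... | inj₁ k with ∈-map⁻ toℕ (subst (l ∈_) (labs-vt w) k)
      ...   | f , _ , refl = ∈-map⁺ toℕ (∈-allFin f)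

      simpleL : ∀ l → cnt l L ≤ 1
      simpleL l = subst (λ M → cnt l M ≤ 1) (sym (allFin-rng m)) (cnt-rng l 0 m)

      wfG : WF L T
      wfG = wf simpleL tw
        where
        tw : ∀ l → occ l T ≡ cnt l L + cnt l L
        tw l with mem? l L
        ... | inj₂ k = trans (∉⇒cnt (labs T) (k ∘ labs-verts (allFin n))) (cong₂ _+_ (sym (∉⇒cnt L k)) (sym (∉⇒cnt L k)))
        ... | inj₁ k with ∈-map⁻ toℕ k
        ...   | f , _ , refl = trans (occ-verts f (allFin n)) (trans (cong₂ _+_ (κ-all (fst f)) (κ-all (snd f))) (sym (cong₂ _+_ (κ-all f) (κ-all f))))

      -- along a path avoiding e the side of the cut does not change
      brG : Br L T
      brG X Y p d with map-split↭ vt (allFin n) {X} {Y} p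
      ... | A , B , q , refl , refl = go (bdl L (map vt A)) refl (trans (sym (δ-len L (map vt A))) d)
        where
        κ≤ : ∀ v → κ v A ≤ 1
        κ≤ v = ≤-trans (m≤m+n _ (κ v B)) (≤-reflexive (trans (sym (trans (cong (cnt (toℕ v)) (map-++ toℕ A B)) (cnt-++ (toℕ v) (map toℕ A) (map toℕ B))))
          (trans (sym (cnt-↭ (toℕ v) (map⁺ toℕ q))) (κ-all v))))
        in-bdl : ∀ f → occ (toℕ f) (map vt A) ≡ 1 → toℕ f ∈ bdl L (map vt A)
        in-bdl f h = cnt⇒∈ _ (≤-reflexive (sym (trans (cnt-sel (λ l → is1 (occ l (map vt A))) (toℕ f) L) (cong₂ (λ x y → bit (is1 x) * y) h (κ-all f)))))
        go : ∀ xs → bdl L (map vt A) ≡ xs → length xs ≡ 1 → ⊥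
        go (l ∷ []) eq refl = edge (∈-map⁻ toℕ l∈L)
          where
          c1 : 1 ≤ bit (is1 (occ l (map vt A))) * cnt l L
          c1 = subst (1 ≤_) (cnt-sel (λ l → is1 (occ l (map vt A))) l L) (∈⇒cnt (subst (l ∈_) (sym eq) (here refl)))
          occ1 : ∀ o {c} → 1 ≤ bit (is1 o) * c → o ≡ 1
          occ1 1 _ = refl
          l∈L : l ∈ L
          l∈L = cnt⇒∈ L (proj₂ (*-pos-inv (bit (is1 (occ l (map vt A)))) (cnt l L) c1))
          edge : ∃[ e ] e ∈ allFin m × l ≡ toℕ e → ⊥
          edge (e , _ , refl) = bl e λ c → odd (trans (sym (occ-verts e A)) (occ1 (occ (toℕ e) (map vt A)) c1)) (path c)
            where
            side : ∀ f → f ≢ e → κ (fst f) A ≡ κ (snd f) A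
            side f ne = two (κ (fst f) A) (κ (snd f) A) (κ≤ (fst f)) (κ≤ (snd f)) λ h → ne (toℕ-injective (one₀ (subst (toℕ f ∈_) eq (in-bdl f (trans (occ-verts f A) h)))))
              where
              one₀ : ∀ {x y : ℕ} → x ∈ y ∷ [] → x ≡ y
              one₀ (here z) = z
              two : ∀ a b → a ≤ 1 → b ≤ 1 → a + b ≢ 1 → a ≡ b
              two 0 0 _ _ _ = refl
              two 0 1 _ _ h = ⊥-elim (h refl)
              two 1 0 _ _ h = ⊥-elim (h refl)
              two 1 1 _ _ _ = refl
              two (suc (suc _)) _ (s≤s ()) _ _
              two 0 (suc (suc _)) _ (s≤s ()) _
              two 1 (suc (suc _)) _ (s≤s ()) _
            path : ∀ {a b} → ConnectedAvoiding G e a b → κ a A ≡ κ b A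
            path here = refl
            path (step f ne (inj₁ (refl , refl)) c) = trans (side f ne) (path c)
            path (step f ne (inj₂ (refl , refl)) c) = trans (sym (side f ne)) (path c)
            odd : ∀ {a b} → a + b ≡ 1 → a ≡ b → ⊥
            odd {0} {.0} () refl
            odd {suc a} {.(suc a)} h refl = case m+n≡0⇒n≡0 a (suc-injective h) of λ ()

      asg : Vec Bool m → Asg
      asg M = updV 0 M zeros

      in-bit : ∀ M e → (if does (e ∈? M) then 1 else 0) ≡ bit (asg M (toℕ e))
      in-bit M e rewrite updV-at 0 M zeros e with e ∈? M
      ... | yes p rewrite []=⇒lookup p = refl
      ... | no n with lookup M e in eq
      ...   | true = ⊥-elim (n (lookup⇒[]= e M eq))
      ...   | false = refl

      ev-deg : ∀ M v → ev (plain (vt v)) (asg M) ≡ bit (is1 (degreeIn G M v))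
      ev-deg M v = trans (go (vt v)) (cong (λ xs → bit (is1 xs)) (trans (cong (sumL (bit ∘ asg M)) (labs-vt v)) (sym (length-filter-× (_∈? M) (incident? G v) (in-bit M) (allFin m)))))
        where
        go : ∀ t → ev (plain t) (asg M) ≡ bit (is1 (sumL (bit ∘ asg M) (labs (t ∷ []))))
        go (tri p q r) = wP-sum (asg M p) (asg M q) (asg M r)

      pr≤1 : ∀ M A → pr (pl (map vt A)) (asg M) ≤ 1
      pr≤1 M [] = ≤-refl
      pr≤1 M (v ∷ A) = *-mono-≤ {_} {1} {_} {1} (≤-trans (≤-reflexive (ev-deg M v)) (b1 (is1 (degreeIn G M v)))) (pr≤1 M A)
        where
        b1 : ∀ b → bit b ≤ 1
        b1 true = ≤-refl
        b1 false = z≤n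

      pr⇒deg : ∀ M A → 1 ≤ pr (pl (map vt A)) (asg M) → ∀ {v} → v ∈ A → degreeIn G M v ≡ 1
      pr⇒deg M (w ∷ A) h (here refl) = one₁ (degreeIn G M w) (subst (1 ≤_) (ev-deg M w) (proj₁ (*-pos-inv (ev (plain (vt w)) (asg M)) _ h)))
        where
        one₁ : ∀ k → 1 ≤ bit (is1 k) → k ≡ 1
        one₁ 1 _ = refl
      pr⇒deg M (w ∷ A) h (there i) = pr⇒deg M A (proj₂ (*-pos-inv (ev (plain (vt w)) (asg M)) _ h)) i

      Z≤PM : Z1 L (pl T) ≤ numPerfectMatchings G
      Z≤PM = ≤-trans (≤-reflexive (trans (cong (λ M → sumOver M (λ σ → pr (pl T) σ * 1) zeros) (allFin-rng m)) (sum-subsets 0 m (λ σ → pr (pl T) σ * 1) zeros)))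
        (count-le (isPerfectMatching? G) (λ M → pr (pl T) (asg M) * 1) (λ M → ≤-trans (≤-reflexive (*-identityʳ _)) (pr≤1 M (allFin n)))
          (λ M h v → pr⇒deg M (allFin n) (≤-trans h (≤-reflexive (*-identityʳ _))) (∈-allFin v)) (allSubsets m))

  deco-pl : ∀ T → Deco All⊤ (pl T) (length T)
  deco-pl [] = dnil
  deco-pl (t ∷ T) = dcons z≤n leaf (deco-pl T)

  matchings : ∀ a → ∃[ β ] (∀ {n m} (G : Multigraph n m) → Cubic G → Bridgeless G → a * n ≤ numPerfectMatchings G + β)
  matchings a = go (superlinear a)
    where
    len-rng : ∀ k n → length (rng k n) ≡ n
    len-rng k zero = refl
    len-rng k (suc n) = cong suc (len-rng (suc k) n)
    go : ∃[ β ] (∀ {L X N} → WF L (tr X) → Br L (tr X) → Deco All⊤ X N → a * N ≤ Z1 L X + β) →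
      ∃[ β ] (∀ {n m} (G : Multigraph n m) → Cubic G → Bridgeless G → a * n ≤ numPerfectMatchings G + β)
    go (β , h) = β , bound'
      where
      bound' : ∀ {n m} (G : Multigraph n m) → Cubic G → Bridgeless G → a * n ≤ numPerfectMatchings G + β
      bound' {n} {m} G cub bl = ≤-trans (*-monoʳ-≤ a (≤-reflexive (sym lenT)))
          (≤-trans (h {L G cub bl} {pl (T G cub bl)} (subst (WF (L G cub bl)) (sym (tr-pl (T G cub bl))) (wfG G cub bl)) (subst (Br (L G cub bl)) (sym (tr-pl (T G cub bl))) (brG G cub bl)) (deco-pl (T G cub bl)))
            (+-monoˡ-≤ β (Z≤PM G cub bl)))
        where
        lenT : length (T G cub bl) ≡ n
        lenT = trans (length-map (vt G) (allFin n)) (trans (sym (length-map toℕ (allFin n))) (trans (cong length (allFin-rng n)) (len-rng 0 n)))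

  import Data.Integer as ℤ
  import Data.Integer.Properties as ℤP
  import Data.Rational as ℚ
  import Data.Rational.Properties as ℚP
  import Data.Rational.Unnormalised as ℚᵘ
  import Data.Rational.Unnormalised.Properties as ℚᵘP
  open import Data.Nat.Coprimality using (Coprime)

  ℕ/1 : ℕ → ℚ.ℚ
  ℕ/1 n = ℤ.+ n ℚ./ 1

  ℕ/1-ᵘ : ∀ n → ℚ.toℚᵘ (ℕ/1 n) ℚᵘ.≃ ℚᵘ.mkℚᵘ (ℤ.+ n) 0
  ℕ/1-ᵘ n = ℚP.toℚᵘ-fromℚᵘ (ℚᵘ.mkℚᵘ (ℤ.+ n) 0)

  suc/1-pos : ∀ b → ℚ.0ℚ ℚ.< ℕ/1 (suc b)
  suc/1-pos b = ℚP.toℚᵘ-cancel-< (ℚᵘP.<-respʳ-≃ (ℚᵘP.≃-sym {ℚ.toℚᵘ (ℕ/1 (suc b))} (ℕ/1-ᵘ (suc b))) (ℚᵘ.*<* (ℤ.+<+ (s≤s z≤n))))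

  frac-≤ : ∀ p d n M b → p * n ≤ M + b → ℚᵘ.mkℚᵘ (ℤ.+ p) d ℚᵘ.* ℚᵘ.mkℚᵘ (ℤ.+ n) 0 ℚᵘ.≤ ℚᵘ.mkℚᵘ (ℤ.+ M) 0 ℚᵘ.+ ℚᵘ.mkℚᵘ (ℤ.+ suc b) 0
  frac-≤ p d n M b h = ℚᵘ.*≤* (subst₂ ℤ._≤_ (sym l) (sym r) (ℤ.+≤+ (≤-trans h (≤-trans (+-monoʳ-≤ M (n≤1+n b)) (≤*ʳ (M + suc b) (s≤s z≤n))))))
    where
    l : (ℤ.+ p ℤ.* ℤ.+ n) ℤ.* ℤ.+ 1 ≡ ℤ.+ (p * n)
    l = trans (ℤP.*-identityʳ _) (sym (ℤP.pos-* p n))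
    r : (ℤ.+ M ℤ.* ℤ.+ 1 ℤ.+ ℤ.+ suc b ℤ.* ℤ.+ 1) ℤ.* ℤ.+ suc (d * 1) ≡ ℤ.+ ((M + suc b) * suc (d * 1))
    r = trans (cong₂ (λ x y → (x ℤ.+ y) ℤ.* ℤ.+ suc (d * 1)) (ℤP.*-identityʳ (ℤ.+ M)) (ℤP.*-identityʳ (ℤ.+ suc b))) (sym (ℤP.pos-* (M + suc b) (suc (d * 1))))

  scaled-≤ : ∀ p d .(c : Coprime p (suc d)) n M b → p * n ≤ M + b → ℚ.mkℚ (ℤ.+ p) d c ℚ.* ℕ/1 n ℚ.- ℕ/1 (suc b) ℚ.≤ ℕ/1 M
  scaled-≤ p d c n M b h = subst (α ℚ.* ℕ/1 n ℚ.- β ℚ.≤_) cancel (ℚP.+-monoˡ-≤ (ℚ.- β) main)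
    where
    α β : ℚ.ℚ
    α = ℚ.mkℚ (ℤ.+ p) d c
    β = ℕ/1 (suc b)
    cancel : (ℕ/1 M ℚ.+ β) ℚ.- β ≡ ℕ/1 M
    cancel = trans (ℚP.+-assoc (ℕ/1 M) β (ℚ.- β)) (trans (cong (ℕ/1 M ℚ.+_) (ℚP.+-inverseʳ β)) (ℚP.+-identityʳ (ℕ/1 M)))
    left : ℚ.toℚᵘ (α ℚ.* ℕ/1 n) ℚᵘ.≃ ℚᵘ.mkℚᵘ (ℤ.+ p) d ℚᵘ.* ℚᵘ.mkℚᵘ (ℤ.+ n) 0
    left = ℚᵘP.≃-trans {ℚ.toℚᵘ (α ℚ.* ℕ/1 n)} (ℚP.toℚᵘ-homo-* α (ℕ/1 n)) (ℚᵘP.*-congˡ {ℚᵘ.mkℚᵘ (ℤ.+ p) d} (ℕ/1-ᵘ n))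
    right : ℚ.toℚᵘ (ℕ/1 M ℚ.+ β) ℚᵘ.≃ ℚᵘ.mkℚᵘ (ℤ.+ M) 0 ℚᵘ.+ ℚᵘ.mkℚᵘ (ℤ.+ suc b) 0
    right = ℚᵘP.≃-trans {ℚ.toℚᵘ (ℕ/1 M ℚ.+ β)} (ℚP.toℚᵘ-homo-+ (ℕ/1 M) β) (ℚᵘP.+-cong (ℕ/1-ᵘ M) (ℕ/1-ᵘ (suc b)))
    main : α ℚ.* ℕ/1 n ℚ.≤ ℕ/1 M ℚ.+ β
    main = ℚP.toℚᵘ-cancel-≤ (ℚᵘP.≤-respˡ-≃ (ℚᵘP.≃-sym {ℚ.toℚᵘ (α ℚ.* ℕ/1 n)} left) (ℚᵘP.≤-respʳ-≃ (ℚᵘP.≃-sym {ℚ.toℚᵘ (ℕ/1 M ℚ.+ β)} right) (frac-≤ p d n M b h)))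

  rational-bound : (α : ℚ.ℚ) → ℚ.0ℚ ℚ.< α →
    Σ ℚ.ℚ λ β → ℚ.0ℚ ℚ.< β × ((n m : ℕ) (G : Multigraph n m) → Cubic G → Bridgeless G → α ℚ.* ℕ/1 n ℚ.- β ℚ.≤ ℕ/1 (numPerfectMatchings G))
  rational-bound (ℚ.mkℚ (ℤ.+ p) d c) _ = go (matchings p)
    where
    go : ∃[ β ] (∀ {n m} (G : Multigraph n m) → Cubic G → Bridgeless G → p * n ≤ numPerfectMatchings G + β) →
      Σ ℚ.ℚ λ β → ℚ.0ℚ ℚ.< β × ((n m : ℕ) (G : Multigraph n m) → Cubic G → Bridgeless G → ℚ.mkℚ (ℤ.+ p) d c ℚ.* ℕ/1 n ℚ.- β ℚ.≤ ℕ/1 (numPerfectMatchings G))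
    go (b , h) = ℕ/1 (suc b) , suc/1-pos b , λ n m G cub bl → scaled-≤ p d c n (numPerfectMatchings G) b (h G cub bl)
  rational-bound (ℚ.mkℚ (ℤ.-[1+ p ]) d c) (ℚ.*<* h) = ⊥-elim (bad h)
    where
    bad : ∀ {x} → ℤ.+ 0 ℤ.< ℤ.-[1+ x ] → ⊥
    bad ()

open import Defs
open import Data.Nat using (ℕ)
open import Data.Integer using (+_)
open import Data.Rational using (ℚ; _/_; _*_; _-_; _≤_; _<_; 0ℚ)
open import Data.Product using (Σ; _×_)

theorem1 : (α : ℚ) → 0ℚ < α →
    Σ ℚ (λ β → 0ℚ < β ×
    ((n m : ℕ) (G : Multigraph n m) → Cubic G → Bridgeless G →
    α * (+ n / 1) - β ≤ (+ numPerfectMatchings G / 1)))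
theorem1 = Development.rational-bound
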